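{- Let $G$ be the distance graph on $\mathbb{F}_q^t$ and let $U\subset \mathbb{F}_q^t$ be a set of vertices. There is a constant $C$ such that: (1) if $|U|\ge Cq^{\frac{t+1}{2}}$, then the VC-dimension of $\mathcal{H}(U)$ is at least $2$; (2) if $|U|\ge C\max\{q^{\frac{7t+19}{14}}, q^{t-1}\}$, then the VC-dimension of $\mathcal{H}(U)$ is at least $3$.
   Context: $\mathbb{F}_q$ is the finite field with $q$ elements. The distance graph in $\mathbb{F}_q^t$ has vertex set $\mathbb{F}_q^t$, with $x$ and $y$ adjacent ($x\sim y$) if $(x_1-y_1)^2+\cdots+(x_t-y_t)^2=1$. For $U$ a set of vertices and $v\in U$, let $h_v\colon U\to\{0,1\}$ be given by $h_v(u)=1$ if $u\sim v$ and $0$ otherwise, and $\mathcal{H}(U)=\{h_v:v\in U\}$. A collection $\mathcal{H}$ of functions $V\to\{0,1\}$ shatters a finite set $X\subset V$ if its restrictions to $X$ give every function $X\to\{0,1\}$; the VC-dimension of $\mathcal{H}$ is the largest size of a set shattered by $\mathcal{H}$.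
   Formalization: The theorem is stated for q odd: in characteristic 2 adjacency depends only on the sum of the coordinates, so no 2-element set is shattered and the claim fails, e.g. for U equal to the whole space. The constant C depends only on t. -}

module Defs where

open import Level using (0ℓ)
open import Data.Nat using (ℕ)
open import Data.Fin using (Fin)
open import Data.Bool using (Bool; true)
open import Data.Vec using (Vec; foldr; zipWith)
open import Data.List using (List; length)
open import Data.List.Membership.Propositional using (_∈_)
open import Data.List.Relation.Unary.Unique.Propositional using (Unique)
open import Data.Product using (Σ; ∃; _×_)
open import Relation.Nullary using (¬_)
open import Relation.Binary.PropositionalEquality using (_≡_; _≢_)
open import Algebra.Structures using (IsCommutativeRing)
open import Function.Bundles using (_↔_; _⇔_)

record FiniteField : Set₁ where
  field
    Carrier : Set
    _+_ _*_ : Carrier → Carrier → Carrier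
    -_ : Carrier → Carrier
    0# 1# : Carrier
    isCommutativeRing : IsCommutativeRing _≡_ _+_ _*_ -_ 0# 1#
    1≢0 : 1# ≢ 0#
    inverse : ∀ x → x ≢ 0# → ∃ λ y → x * y ≡ 1#
    q : ℕ
    enumeration : Fin q ↔ Carrier

  OddCharacteristic : Set
  OddCharacteristic = (1# + 1#) ≢ 0#

module _ (F : FiniteField) where
  open FiniteField F

  Point : ℕ → Set
  Point t = Vec Carrier t

  sqDist : ∀ {t} → Point t → Point t → Carrier
  sqDist x y = foldr _ _+_ 0# (zipWith (λ a b → (a + (- b)) * (a + (- b))) x y)

  _∼_ : ∀ {t} → Point t → Point t → Set
  x ∼ y = sqDist x y ≡ 1#

  -- h_v : U → {0,1},  h_v(u) = 1 iff u ∼ v  (stated as: h_v u ≡ true ⇔ u ∼ v)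
  -- A set of vertices U ⊆ F_q^t is a duplicate-free list; |U| = length U.
  -- ℋ(U) = { h_v : v ∈ U } shatters the d distinct points X ⊆ U when every
  -- pattern f : X → {0,1} is realised by some h_v with v ∈ U.
  ShatteredBy : ∀ {t d} → List (Point t) → Vec (Point t) d → Set
  ShatteredBy {d = d} U X =
    (f : Fin d → Bool) →
      Σ _ λ v → v ∈ U × ((i : Fin d) → (f i ≡ true ⇔ (Data.Vec.lookup X i ∼ v)))

  VCdim≥ : ∀ {t} → List (Point t) → ℕ → Set
  VCdim≥ {t} U d =
    Σ (Vec (Point t) d) λ X →
      Unique (Data.Vec.toList X) ×
      ((i : Fin d) → Data.Vec.lookup X i ∈ U) ×
      ShatteredBy U X

{-# OPTIONS --safe #-}
module Submission where

-- Let N(x) be the number of neighbours of x in U. The mixing estimate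
--   Σ_x (q N(x) - |U|)² ≤ 20 q^(t+1) |U|
-- holds for every set U, so few points x are adjacent to a positive proportion of a given set.
-- Choose a tuple X in U^d with a common neighbour in U. If X is not shattered, then some x_j is
-- adjacent to a 1/d proportion of the common neighbourhood of some of the other points; summing
-- over the common neighbour first, at most O(q^(t-1) |U|^(d-1)) configurations are spoilt in this
-- way, out of about |U|^(d+1)/q^d. Thus |U|² ≥ C q^(t+d-1) suffices for VC-dimension ≥ d.
--
-- For the mixing estimate, the Radon transform reduces the convolution with the sphere to
-- convolutions on F. Completing squares coordinate by coordinate shows that these are, up to sign
-- and a power of q, the sum over the square roots of a field element (t odd) or a Kloosterman
-- operator (t even), so that Weil's bound is needed.
--
-- The latter is proved without characters for K f(ξ) = Σ_s f(ξ + Tr(s + b/s)), s in an extension E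
-- of F. Passing to a quadratic extension E′ of E one has K_E² + K_E′ = 2|E| on functions of mean
-- zero, so a bound ‖K_E‖ ≤ c √|E| for large E with c independent of E descends to ‖K_F‖ ≤ 3 √q.
-- Such a bound follows from Stepanov's method: with |E| = Q₀² and T(s) the first half of the trace
-- of s + b/s, the points with trace c satisfy T^Q₀ = c - T. Hence a relation among the conjugated
-- monomials s^(k Q₀ + i) (c - T)^j gives a nonzero combination of the s^(k + i Q₀) T^j that vanishes
-- at all these points; the latter are independent because their degrees are distinct.

-- All operators are studied on functions of mean zero, where a constant added to a kernel acts as
-- zero. This is the substitute for characters: the quadratic character becomes the number of square
-- roots, a Gauss sum becomes a convolution `R` with R² = ±q, and equidistribution becomes the
-- vanishing of a sum. Operators are compared through squared ℓ² norms, so that every inequality is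
-- one between integers.
--
-- Stepanov's count yields only the constant 5q, worthless over F itself but the same for all
-- extensions of the tower. If ‖K_E′‖ ≤ (M + 1) |E|, then ‖K_E‖² ≤ (2 + M + 1) |E| ≤ M² |E| as soon
-- as M ≥ 3; hence every quadratic step down lowers the constant by one, and a tower of 5q steps is
-- high enough to arrive at 3.
--
-- Half of the trace is used because its degree in s is q^(h - 1) = Q₀/q, where |E| = q^(2h). The
-- powers T^j with j < q then fill the gaps between consecutive powers of s^Q₀, which is why degrees
-- can be made distinct.

open import Defs
open import Level using (0ℓ)
open import Algebra.Bundles using (CommutativeRing)
open import Algebra.Structures using (IsCommutativeRing)
import Algebra.Properties.CommutativeMonoid.Sum
import Algebra.Properties.CommutativeSemiring.Exp
import Algebra.Properties.Ring
import Algebra.Properties.Semiring.Mult.TCOptimised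
import Algebra.Properties.Semiring.Sum
import Algebra.Solver.CommutativeMonoid
import Algebra.Solver.Ring
import Algebra.Solver.Ring.AlmostCommutativeRing as ACR
open import Data.Bool using (Bool; true; false)
import Data.Bool.Properties as BoolP
open import Data.Empty using (⊥; ⊥-elim)
open import Data.Fin using (Fin; zero; suc; toℕ; punchIn)
open import Data.Fin.Permutation using (Permutation; permutation; _⟨$⟩ʳ_)
open import Data.Fin.Properties as FinP using (any?; all?; ¬∀⟶∃¬; toℕ<n)
open import Data.Integer as ℤ using (ℤ; -[1+_]; 0ℤ; 1ℤ) renaming (+_ to pos)
import Data.Integer.Properties as ℤP
open import Data.Integer.Tactic.RingSolver using (solve-∀)
open import Data.List as List using (List; []; _∷_; length; cartesianProductWith; map; _++_; allFin)
open import Data.List.Membership.Propositional using (_∈_)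
open import Data.List.Membership.Propositional.Properties using (∈-allFin)
open import Data.List.Properties using (length-tabulate)
open import Data.List.Relation.Unary.All using (All; []; _∷_)
open import Data.List.Relation.Unary.AllPairs using ([]; _∷_)
open import Data.List.Relation.Unary.Any using (here; there)
open import Data.List.Relation.Unary.Unique.Propositional using (Unique)
open import Data.List.Relation.Unary.Unique.Propositional.Properties using (tabulate⁺)
open import Data.Maybe using (Maybe; just; nothing)
open import Data.Nat as ℕ using (ℕ; zero; suc; z≤n; s≤s)
open import Data.Nat.DivMod using (_/_; _%_; m≡m%n+[m/n]*n; m%n<n; m<n*o⇒m/o<n)
import Data.Nat.Properties as ℕP
import Data.Nat.Tactic.RingSolver as ℕSolver
open import Data.Product using (Σ; ∃; _×_; _,_; proj₁; proj₂)
open import Data.Product.Properties using () renaming (≡-dec to ×-≡-dec)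
open import Data.Sum using (_⊎_; inj₁; inj₂)
open import Data.Vec as Vec using (Vec; []; _∷_; lookup; insertAt; replicate; tabulate; toList)
import Data.Vec.Functional as VecF
import Data.Vec.Functional.Properties as VecFP
open import Data.Vec.Properties using (≡-dec; ∷-injective; insertAt-lookup; lookup∘tabulate)
open import Function using (_∘_)
open import Function.Bundles using (Inverse; _↔_; mk⇔)
open import Relation.Binary using (DecidableEquality)
open import Relation.Binary.PropositionalEquality using (_≡_; _≢_; refl; sym; trans; cong; cong₂; subst; subst₂; isEquivalence; module ≡-Reasoning)
open import Relation.Nullary using (¬_; Dec; yes; no; contradiction)
open import Relation.Nullary.Decidable using (¬?; _→-dec_; decidable-stable; map′; isYes)

-- Sums over lists and finite types

*-nonneg : ∀ {x y} → 0ℤ ℤ.≤ x → 0ℤ ℤ.≤ y → 0ℤ ℤ.≤ x ℤ.* y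
*-nonneg {x} {y} p q = subst (ℤ._≤ x ℤ.* y) (ℤP.*-zeroʳ x) (ℤP.*-monoˡ-≤-nonNeg x ⦃ ℤ.nonNegative p ⦄ q)

sq-nonneg : ∀ x → 0ℤ ℤ.≤ x ℤ.* x
sq-nonneg x with ℤP.≤-total 0ℤ x
... | inj₁ p = *-nonneg p p
... | inj₂ p = subst (0ℤ ℤ.≤_) (lemma x) (*-nonneg {(ℤ.- x)} {(ℤ.- x)} (ℤP.neg-mono-≤ p) (ℤP.neg-mono-≤ p))
  where
  lemma : ∀ x → (ℤ.- x) ℤ.* (ℤ.- x) ≡ x ℤ.* x
  lemma = solve-∀

*-monoˡ : ∀ {c x y} → 0ℤ ℤ.≤ c → x ℤ.≤ y → c ℤ.* x ℤ.≤ c ℤ.* y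
*-monoˡ {c} p q = ℤP.*-monoˡ-≤-nonNeg c ⦃ ℤ.nonNegative p ⦄ q

*-mono : ∀ {a b c d} → 0ℤ ℤ.≤ a → 0ℤ ℤ.≤ d → a ℤ.≤ b → c ℤ.≤ d → a ℤ.* c ℤ.≤ b ℤ.* d
*-mono {a} {b} {c} {d} pa pd p q = ℤP.≤-trans (*-monoˡ pa q)
  (subst₂′ (ℤP.*-comm d a) (ℤP.*-comm d b) (*-monoˡ pd p))
  where
  subst₂′ : ∀ {x y x′ y′} → x ≡ x′ → y ≡ y′ → x ℤ.≤ y → x′ ℤ.≤ y′
  subst₂′ refl refl z = z

≤-from-diff : ∀ {x y} → 0ℤ ℤ.≤ y ℤ.- x → x ℤ.≤ y
≤-from-diff = ℤP.0≤i-j⇒j≤i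

diff-nonneg : ∀ {x y} → x ℤ.≤ y → 0ℤ ℤ.≤ y ℤ.- x
diff-nonneg = ℤP.i≤j⇒0≤j-i

square-cancel-≤ : ∀ {x y} → 0ℤ ℤ.≤ y → x ℤ.* x ℤ.≤ y ℤ.* y → x ℤ.≤ y
square-cancel-≤ {x} {y} 0≤y le with x ℤP.≤? y
... | yes p = p
... | no ¬p = contradiction le (ℤP.<⇒≱ (ℤP.≤-<-trans (*-monoˡ 0≤y (ℤP.<⇒≤ y<x))
        (ℤP.*-monoʳ-<-pos x ⦃ ℤ.positive (ℤP.≤-<-trans 0≤y y<x) ⦄ y<x)))
  where
  y<x : y ℤ.< x
  y<x = ℤP.≰⇒> ¬p

-- Iverson bracket. Cardinalities are integer sums of brackets, so that counting and weighted
-- estimates obey the same lemmas.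
⟦_⟧ : {P : Set} → Dec P → ℤ
⟦ yes _ ⟧ = 1ℤ
⟦ no _ ⟧ = 0ℤ

⟦⟧-yes : {P : Set} (d : Dec P) → P → ⟦ d ⟧ ≡ 1ℤ
⟦⟧-yes (yes _) _ = refl
⟦⟧-yes (no ¬p) p = contradiction p ¬p

⟦⟧-no : {P : Set} (d : Dec P) → ¬ P → ⟦ d ⟧ ≡ 0ℤ
⟦⟧-no (yes p) ¬p = contradiction p ¬p
⟦⟧-no (no _) _ = refl

⟦⟧-cong : {P Q : Set} (d : Dec P) (e : Dec Q) → (P → Q) → (Q → P) → ⟦ d ⟧ ≡ ⟦ e ⟧
⟦⟧-cong (yes p) e f g = sym (⟦⟧-yes e (f p))
⟦⟧-cong (no ¬p) e f g = sym (⟦⟧-no e (λ q → ¬p (g q)))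

⟦⟧-nonneg : {P : Set} (d : Dec P) → 0ℤ ℤ.≤ ⟦ d ⟧
⟦⟧-nonneg (yes _) = ℤ.+≤+ z≤n
⟦⟧-nonneg (no _) = ℤ.+≤+ z≤n

⟦⟧-*-cong : {P : Set} (d : Dec P) {x y : ℤ} → (P → x ≡ y) → ⟦ d ⟧ ℤ.* x ≡ ⟦ d ⟧ ℤ.* y
⟦⟧-*-cong (yes p) e = cong (1ℤ ℤ.*_) (e p)
⟦⟧-*-cong (no _) e = refl

⟦⟧-× : {P Q R : Set} (d : Dec P) (e : Dec Q) (f : Dec R) → (P → Q × R) → (Q → R → P) → ⟦ d ⟧ ≡ ⟦ e ⟧ ℤ.* ⟦ f ⟧
⟦⟧-× d (yes q) (yes r) to from = ⟦⟧-yes d (from q r)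
⟦⟧-× d (yes q) (no ¬r) to from = ⟦⟧-no d (λ p → ¬r (proj₂ (to p)))
⟦⟧-× d (no ¬q) f to from = trans (⟦⟧-no d (λ p → ¬q (proj₁ (to p)))) (sym (ℤP.*-zeroˡ ⟦ f ⟧))

∑ : {A : Set} → List A → (A → ℤ) → ℤ
∑ [] f = 0ℤ
∑ (x ∷ xs) f = f x ℤ.+ ∑ xs f

module _ {A : Set} where

  ∑-cong : (xs : List A) {f g : A → ℤ} → (∀ x → f x ≡ g x) → ∑ xs f ≡ ∑ xs g
  ∑-cong [] h = refl
  ∑-cong (x ∷ xs) h = cong₂ ℤ._+_ (h x) (∑-cong xs h)

  ∑-zero : (xs : List A) → ∑ xs (λ _ → 0ℤ) ≡ 0ℤ
  ∑-zero [] = refl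
  ∑-zero (x ∷ xs) = trans (ℤP.+-identityˡ _) (∑-zero xs)

  ∑-+ : (xs : List A) (f g : A → ℤ) → ∑ xs (λ x → f x ℤ.+ g x) ≡ ∑ xs f ℤ.+ ∑ xs g
  ∑-+ [] f g = refl
  ∑-+ (x ∷ xs) f g = trans (cong (ℤ._+_ (f x ℤ.+ g x)) (∑-+ xs f g)) (lemma (f x) (g x) (∑ xs f) (∑ xs g))
    where
    lemma : ∀ a b c d → a ℤ.+ b ℤ.+ (c ℤ.+ d) ≡ a ℤ.+ c ℤ.+ (b ℤ.+ d)
    lemma = solve-∀

  ∑-*ˡ : (xs : List A) (c : ℤ) (f : A → ℤ) → ∑ xs (λ x → c ℤ.* f x) ≡ c ℤ.* ∑ xs f
  ∑-*ˡ [] c f = sym (ℤP.*-zeroʳ c)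
  ∑-*ˡ (x ∷ xs) c f = trans (cong (ℤ._+_ (c ℤ.* f x)) (∑-*ˡ xs c f)) (sym (ℤP.*-distribˡ-+ c (f x) (∑ xs f)))

  ∑-*ʳ : (xs : List A) (c : ℤ) (f : A → ℤ) → ∑ xs (λ x → f x ℤ.* c) ≡ ∑ xs f ℤ.* c
  ∑-*ʳ xs c f = trans (∑-cong xs (λ x → ℤP.*-comm (f x) c)) (trans (∑-*ˡ xs c f) (ℤP.*-comm c _))

  ∑-neg : (xs : List A) (f : A → ℤ) → ∑ xs (λ x → ℤ.- f x) ≡ ℤ.- ∑ xs f
  ∑-neg xs f = trans (∑-cong xs (λ x → lemma (f x))) (trans (∑-*ˡ xs (ℤ.- 1ℤ) f) (sym (lemma (∑ xs f))))
    where
    lemma : ∀ a → ℤ.- a ≡ (ℤ.- 1ℤ) ℤ.* a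
    lemma = solve-∀

  ∑-sub : (xs : List A) (f g : A → ℤ) → ∑ xs (λ x → f x ℤ.- g x) ≡ ∑ xs f ℤ.- ∑ xs g
  ∑-sub xs f g = trans (∑-+ xs f (λ x → ℤ.- g x)) (cong (ℤ._+_ (∑ xs f)) (∑-neg xs g))

  ∑-mono : (xs : List A) {f g : A → ℤ} → (∀ x → f x ℤ.≤ g x) → ∑ xs f ℤ.≤ ∑ xs g
  ∑-mono [] h = ℤP.≤-refl
  ∑-mono (x ∷ xs) h = ℤP.+-mono-≤ (h x) (∑-mono xs h)

  ∑-nonneg : (xs : List A) {f : A → ℤ} → (∀ x → 0ℤ ℤ.≤ f x) → 0ℤ ℤ.≤ ∑ xs f
  ∑-nonneg xs {f} h = subst (ℤ._≤ ∑ xs f) (∑-zero xs) (∑-mono xs h)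

  ∑-const : (xs : List A) (c : ℤ) → ∑ xs (λ _ → c) ≡ pos (length xs) ℤ.* c
  ∑-const [] c = sym (ℤP.*-zeroˡ c)
  ∑-const (x ∷ xs) c = trans (cong (ℤ._+_ c) (∑-const xs c)) (sym (ℤP.suc-* (pos (length xs)) c))

  ∑-++ : (xs ys : List A) (f : A → ℤ) → ∑ (xs ++ ys) f ≡ ∑ xs f ℤ.+ ∑ ys f
  ∑-++ [] ys f = sym (ℤP.+-identityˡ _)
  ∑-++ (x ∷ xs) ys f = trans (cong (ℤ._+_ (f x)) (∑-++ xs ys f)) (sym (ℤP.+-assoc (f x) _ _))

  ∑-swap : {B : Set} (xs : List A) (ys : List B) (f : A → B → ℤ) →
           ∑ xs (λ x → ∑ ys (λ y → f x y)) ≡ ∑ ys (λ y → ∑ xs (λ x → f x y))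
  ∑-swap [] ys f = sym (lemma ys)
    where
    lemma : {B : Set} (ys : List B) → ∑ ys (λ _ → 0ℤ) ≡ 0ℤ
    lemma [] = refl
    lemma (y ∷ ys) = trans (ℤP.+-identityˡ _) (lemma ys)
  ∑-swap {B} (x ∷ xs) ys f = trans (cong (ℤ._+_ (∑ ys (f x))) (∑-swap xs ys f)) (sym (lemma ys))
    where
    open ≡-Reasoning
    swap4 : ∀ a b c d → a ℤ.+ b ℤ.+ (c ℤ.+ d) ≡ a ℤ.+ c ℤ.+ (b ℤ.+ d)
    swap4 = solve-∀
    lemma : (ys : List B) → ∑ ys (λ y → f x y ℤ.+ ∑ xs (λ x → f x y)) ≡ ∑ ys (f x) ℤ.+ ∑ ys (λ y → ∑ xs (λ x → f x y))
    lemma [] = refl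
    lemma (y ∷ ys) = trans (cong (ℤ._+_ (f x y ℤ.+ ∑ xs (λ x → f x y))) (lemma ys))
      (swap4 (f x y) (∑ xs (λ x → f x y)) (∑ ys (f x)) _)

  ∑-map : {B : Set} (h : B → A) (ys : List B) (f : A → ℤ) → ∑ (map h ys) f ≡ ∑ ys (λ y → f (h y))
  ∑-map h [] f = refl
  ∑-map h (y ∷ ys) f = cong (ℤ._+_ (f (h y))) (∑-map h ys f)

  ∈⇒∑-pos : (xs : List A) {f : A → ℤ} → (∀ x → 0ℤ ℤ.≤ f x) → ∀ {x} → x ∈ xs → f x ℤ.≤ ∑ xs f
  ∈⇒∑-pos (y ∷ xs) {f} h (here refl) = subst (ℤ._≤ f y ℤ.+ ∑ xs f) (ℤP.+-identityʳ (f y)) (ℤP.+-monoʳ-≤ (f y) (∑-nonneg xs h))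
  ∈⇒∑-pos (y ∷ xs) {f} h {x} (there p) = ℤP.≤-trans (∈⇒∑-pos xs h p) (subst (ℤ._≤ f y ℤ.+ ∑ xs f) (ℤP.+-identityˡ _) (ℤP.+-monoˡ-≤ _ (h y)))

  ∑-witness : (xs : List A) (f : A → ℤ) → 0ℤ ℤ.< ∑ xs f → ∃ λ x → x ∈ xs × 0ℤ ℤ.< f x
  ∑-witness [] f p = ⊥-elim (ℤP.<-irrefl refl p)
  ∑-witness (x ∷ xs) f p with 0ℤ ℤP.<? f x
  ... | yes q = x , here refl , q
  ... | no ¬q with ∑-witness xs f (ℤP.<-≤-trans p (subst (f x ℤ.+ ∑ xs f ℤ.≤_) (ℤP.+-identityˡ _) (ℤP.+-monoˡ-≤ _ (ℤP.≮⇒≥ ¬q))))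
  ... | y , y∈ , q = y , there y∈ , q

  ∑-product : (xs ys : List A) (f g : A → ℤ) → ∑ xs f ℤ.* ∑ ys g ≡ ∑ xs (λ x → ∑ ys (λ y → f x ℤ.* g y))
  ∑-product xs ys f g = trans (sym (∑-*ʳ xs (∑ ys g) f)) (∑-cong xs (λ x → sym (∑-*ˡ ys (f x) g)))

∑-cartesian : {A B C : Set} (h : A → B → C) (xs : List A) (ys : List B) (f : C → ℤ) →
              ∑ (cartesianProductWith h xs ys) f ≡ ∑ xs (λ x → ∑ ys (λ y → f (h x y)))
∑-cartesian h [] ys f = refl
∑-cartesian h (x ∷ xs) ys f = trans (∑-++ (map (h x) ys) _ f)
  (cong₂ ℤ._+_ (∑-map (h x) ys f) (∑-cartesian h xs ys f))

-- Twice the difference of the two sides is Σ_{x,y} w x w y (f x g y - f y g x)².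
weighted-cauchy-schwarz : {A : Set} (xs : List A) (w f g : A → ℤ) → (∀ x → 0ℤ ℤ.≤ w x) →
  ∑ xs (λ x → w x ℤ.* (f x ℤ.* g x)) ℤ.* ∑ xs (λ x → w x ℤ.* (f x ℤ.* g x)) ℤ.≤
  ∑ xs (λ x → w x ℤ.* (f x ℤ.* f x)) ℤ.* ∑ xs (λ x → w x ℤ.* (g x ℤ.* g x))
weighted-cauchy-schwarz {A} xs w f g w≥0 = ≤-from-diff (ℤP.*-cancelˡ-≤-pos 0ℤ _ (pos 2) (subst (0ℤ ℤ.≤_) eq nonneg))
  where
  open ≡-Reasoning
  FG FF GG : ℤ
  FG = ∑ xs (λ x → w x ℤ.* (f x ℤ.* g x))
  FF = ∑ xs (λ x → w x ℤ.* (f x ℤ.* f x))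
  GG = ∑ xs (λ x → w x ℤ.* (g x ℤ.* g x))
  D : A → A → ℤ
  D x y = f x ℤ.* g y ℤ.- f y ℤ.* g x
  nonneg : 0ℤ ℤ.≤ ∑ xs (λ x → ∑ xs (λ y → (w x ℤ.* w y) ℤ.* (D x y ℤ.* D x y)))
  nonneg = ∑-nonneg xs (λ x → ∑-nonneg xs (λ y → *-nonneg (*-nonneg (w≥0 x) (w≥0 y)) (sq-nonneg (D x y))))
  expand : ∀ a b c d u v → (u ℤ.* v) ℤ.* ((a ℤ.* d ℤ.- c ℤ.* b) ℤ.* (a ℤ.* d ℤ.- c ℤ.* b)) ≡
           (u ℤ.* (a ℤ.* a)) ℤ.* (v ℤ.* (d ℤ.* d)) ℤ.+ ((u ℤ.* (b ℤ.* b)) ℤ.* (v ℤ.* (c ℤ.* c)) ℤ.+ (ℤ.- (pos 2)) ℤ.* ((u ℤ.* (a ℤ.* b)) ℤ.* (v ℤ.* (c ℤ.* d))))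
  expand = solve-∀
  total : ∀ F G H → F ℤ.* G ℤ.+ (G ℤ.* F ℤ.+ (ℤ.- (pos 2)) ℤ.* (H ℤ.* H)) ≡ pos 2 ℤ.* (F ℤ.* G ℤ.- H ℤ.* H)
  total = solve-∀
  ff gg fg : A → ℤ
  ff x = w x ℤ.* (f x ℤ.* f x)
  gg x = w x ℤ.* (g x ℤ.* g x)
  fg x = w x ℤ.* (f x ℤ.* g x)
  inner : ∀ x → ∑ xs (λ y → (w x ℤ.* w y) ℤ.* (D x y ℤ.* D x y)) ≡ ff x ℤ.* GG ℤ.+ (gg x ℤ.* FF ℤ.+ (ℤ.- (pos 2)) ℤ.* (fg x ℤ.* FG))
  inner x = begin
    ∑ xs (λ y → (w x ℤ.* w y) ℤ.* (D x y ℤ.* D x y))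
      ≡⟨ ∑-cong xs (λ y → expand (f x) (g x) (f y) (g y) (w x) (w y)) ⟩
    ∑ xs (λ y → ff x ℤ.* gg y ℤ.+ (gg x ℤ.* ff y ℤ.+ (ℤ.- (pos 2)) ℤ.* (fg x ℤ.* fg y)))
      ≡⟨ ∑-+ xs (λ y → ff x ℤ.* gg y) (λ y → gg x ℤ.* ff y ℤ.+ (ℤ.- (pos 2)) ℤ.* (fg x ℤ.* fg y)) ⟩
    ∑ xs (λ y → ff x ℤ.* gg y) ℤ.+ ∑ xs (λ y → gg x ℤ.* ff y ℤ.+ (ℤ.- (pos 2)) ℤ.* (fg x ℤ.* fg y))
      ≡⟨ cong₂ ℤ._+_ (∑-*ˡ xs (ff x) gg) (trans (∑-+ xs (λ y → gg x ℤ.* ff y) (λ y → (ℤ.- (pos 2)) ℤ.* (fg x ℤ.* fg y)))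
           (cong₂ ℤ._+_ (∑-*ˡ xs (gg x) ff) (trans (∑-*ˡ xs (ℤ.- (pos 2)) (λ y → fg x ℤ.* fg y)) (cong ((ℤ.- (pos 2)) ℤ.*_) (∑-*ˡ xs (fg x) fg))))) ⟩
    ff x ℤ.* GG ℤ.+ (gg x ℤ.* FF ℤ.+ (ℤ.- (pos 2)) ℤ.* (fg x ℤ.* FG)) ∎
  eq : ∑ xs (λ x → ∑ xs (λ y → (w x ℤ.* w y) ℤ.* (D x y ℤ.* D x y))) ≡ pos 2 ℤ.* (FF ℤ.* GG ℤ.- FG ℤ.* FG)
  eq = begin
    ∑ xs (λ x → ∑ xs (λ y → (w x ℤ.* w y) ℤ.* (D x y ℤ.* D x y))) ≡⟨ ∑-cong xs inner ⟩
    ∑ xs (λ x → ff x ℤ.* GG ℤ.+ (gg x ℤ.* FF ℤ.+ (ℤ.- (pos 2)) ℤ.* (fg x ℤ.* FG)))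
      ≡⟨ ∑-+ xs (λ x → ff x ℤ.* GG) (λ x → gg x ℤ.* FF ℤ.+ (ℤ.- (pos 2)) ℤ.* (fg x ℤ.* FG)) ⟩
    ∑ xs (λ x → ff x ℤ.* GG) ℤ.+ ∑ xs (λ x → gg x ℤ.* FF ℤ.+ (ℤ.- (pos 2)) ℤ.* (fg x ℤ.* FG))
      ≡⟨ cong₂ ℤ._+_ (∑-*ʳ xs GG ff) (trans (∑-+ xs (λ x → gg x ℤ.* FF) (λ x → (ℤ.- (pos 2)) ℤ.* (fg x ℤ.* FG)))
           (cong₂ ℤ._+_ (∑-*ʳ xs FF gg) (trans (∑-*ˡ xs (ℤ.- (pos 2)) (λ x → fg x ℤ.* FG)) (cong ((ℤ.- (pos 2)) ℤ.*_) (∑-*ʳ xs FG fg))))) ⟩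
    FF ℤ.* GG ℤ.+ (GG ℤ.* FF ℤ.+ (ℤ.- (pos 2)) ℤ.* (FG ℤ.* FG)) ≡⟨ total FF GG FG ⟩
    pos 2 ℤ.* (FF ℤ.* GG ℤ.- FG ℤ.* FG) ∎

cauchy-schwarz : {A : Set} (xs : List A) (f g : A → ℤ) →
  ∑ xs (λ x → f x ℤ.* g x) ℤ.* ∑ xs (λ x → f x ℤ.* g x) ℤ.≤ ∑ xs (λ x → f x ℤ.* f x) ℤ.* ∑ xs (λ x → g x ℤ.* g x)
cauchy-schwarz xs f g = subst₂ ℤ._≤_
  (cong₂ ℤ._*_ (drop (λ x → f x ℤ.* g x)) (drop (λ x → f x ℤ.* g x))) (cong₂ ℤ._*_ (drop (λ x → f x ℤ.* f x)) (drop (λ x → g x ℤ.* g x)))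
  (weighted-cauchy-schwarz xs (λ _ → 1ℤ) f g (λ _ → ℤ.+≤+ z≤n))
  where
  drop : ∀ h → ∑ xs (λ x → 1ℤ ℤ.* h x) ≡ ∑ xs h
  drop h = ∑-cong xs (λ x → ℤP.*-identityˡ (h x))

-- `once` says in a single equation that `els` is complete and free of repetitions, and it has the
-- form in which sums against a delta function are evaluated.
record Finite (A : Set) : Set where
  infix 4 _≟_
  field
    els : List A
    _≟_ : DecidableEquality A
    once : ∀ a → ∑ els (λ x → ⟦ x ≟ a ⟧) ≡ 1ℤ

  size : ℕ
  size = length els

  ∑-δ : ∀ a (f : A → ℤ) → ∑ els (λ x → ⟦ x ≟ a ⟧ ℤ.* f x) ≡ f a
  ∑-δ a f = trans (∑-cong els (λ x → ⟦⟧-*-cong (x ≟ a) (λ p → cong f p)))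
    (trans (∑-*ʳ els (f a) _) (trans (cong (ℤ._* f a) (once a)) (ℤP.*-identityˡ _)))

  ∑-δ′ : ∀ a (f : A → ℤ) → ∑ els (λ x → ⟦ a ≟ x ⟧ ℤ.* f x) ≡ f a
  ∑-δ′ a f = trans (∑-cong els (λ x → cong (ℤ._* f x) (⟦⟧-cong (a ≟ x) (x ≟ a) sym sym))) (∑-δ a f)

  ∈-els : ∀ a → a ∈ els
  ∈-els a with ∑-witness els (λ x → ⟦ x ≟ a ⟧) (subst (0ℤ ℤ.<_) (sym (once a)) (ℤ.+<+ (ℕ.s≤s z≤n)))
  ... | x , x∈ , p with x ≟ a
  ... | yes refl = x∈
  ... | no _ = ⊥-elim (ℤP.<-irrefl refl p)

  size-positive : A → 0 ℕ.< size
  size-positive a = go (∈-els a)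
    where
    go : ∀ {x} {xs : List A} → x ∈ xs → 0 ℕ.< length xs
    go (here _) = ℕ.s≤s z≤n
    go (there _) = ℕ.s≤s z≤n

  search : {P : A → Set} → (∀ x → Dec (P x)) → (∃ P) ⊎ (∀ x → ¬ P x)
  search {P} P? with go els
    where
    go : (xs : List A) → (∃ P) ⊎ (∀ {x} → x ∈ xs → ¬ P x)
    go [] = inj₂ (λ ())
    go (x ∷ xs) with P? x
    ... | yes p = inj₁ (x , p)
    ... | no ¬p with go xs
    ... | inj₁ e = inj₁ e
    ... | inj₂ n = inj₂ (λ { (here refl) → ¬p ; (there i) → n i })
  ... | inj₁ e = inj₁ e
  ... | inj₂ n = inj₂ (λ x → n (∈-els x))

module _ {A B : Set} (FA : Finite A) (FB : Finite B) where
  private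
    module A = Finite FA
    module B = Finite FB

  -- Each term is spread over all b by a delta function and the sums are interchanged. For a
  -- bijection the fibres have size one; for squaring their sizes are `roots`.
  ∑-fibres : (φ : A → B) (f : B → ℤ) →
    ∑ A.els (λ a → f (φ a)) ≡ ∑ B.els (λ b → ∑ A.els (λ a → ⟦ φ a B.≟ b ⟧) ℤ.* f b)
  ∑-fibres φ f = trans (∑-cong A.els (λ a → sym (B.∑-δ′ (φ a) f)))
    (trans (∑-swap A.els B.els _) (∑-cong B.els (λ b → ∑-*ʳ A.els (f b) _)))

  ∑-reindex : (φ : A → B) (ψ : B → A) → (∀ a → ψ (φ a) ≡ a) → (∀ b → φ (ψ b) ≡ b) →
    (f : B → ℤ) → ∑ A.els (λ a → f (φ a)) ≡ ∑ B.els f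
  ∑-reindex φ ψ l r f = trans (∑-fibres φ f) (∑-cong B.els (λ b → trans (cong (ℤ._* f b) (fibre b)) (ℤP.*-identityˡ _)))
    where
    fibre : ∀ b → ∑ A.els (λ a → ⟦ φ a B.≟ b ⟧) ≡ 1ℤ
    fibre b = trans (∑-cong A.els (λ a → ⟦⟧-cong (φ a B.≟ b) (a A.≟ ψ b)
      (λ p → trans (sym (l a)) (cong ψ p)) (λ p → trans (cong φ p) (r b)))) (A.once (ψ b))

  finite-× : Finite (A × B)
  finite-× = record
    { els = cartesianProductWith _,_ A.els B.els
    ; _≟_ = ×-≡-dec A._≟_ B._≟_
    ; once = λ { (a , b) → trans (∑-cartesian _,_ A.els B.els _)
        (trans (∑-cong A.els (λ x → trans (∑-cong B.els (λ y → split a b x y))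
          (trans (∑-*ˡ B.els ⟦ x A.≟ a ⟧ _) (cong (⟦ x A.≟ a ⟧ ℤ.*_) (B.once b)))))
          (trans (∑-cong A.els (λ x → ℤP.*-identityʳ _)) (A.once a))) }
    }
    where
    split : ∀ a b x y → ⟦ ×-≡-dec A._≟_ B._≟_ (x , y) (a , b) ⟧ ≡ ⟦ x A.≟ a ⟧ ℤ.* ⟦ y B.≟ b ⟧
    split a b x y = ⟦⟧-× (×-≡-dec A._≟_ B._≟_ (x , y) (a , b)) (x A.≟ a) (y B.≟ b)
      (λ e → cong proj₁ e , cong proj₂ e) (λ p q → cong₂ _,_ p q)

module _ {A : Set} (FA : Finite A) where
  private
    module A = Finite FA

  vecs : (n : ℕ) → List (Vec A n)
  vecs zero = [] ∷ []
  vecs (suc n) = cartesianProductWith _∷_ A.els (vecs n)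

  ∑-vecs : ∀ n (f : Vec A (suc n) → ℤ) →
    ∑ (vecs (suc n)) f ≡ ∑ A.els (λ x → ∑ (vecs n) (λ xs → f (x ∷ xs)))
  ∑-vecs n f = ∑-cartesian _∷_ A.els (vecs n) f

  finite-vec : (n : ℕ) → Finite (Vec A n)
  finite-vec n = record { els = vecs n ; _≟_ = ≡-dec A._≟_ ; once = once n }
    where
    split : ∀ {n} a (as : Vec A n) x xs →
      ⟦ ≡-dec A._≟_ (x ∷ xs) (a ∷ as) ⟧ ≡ ⟦ x A.≟ a ⟧ ℤ.* ⟦ ≡-dec A._≟_ xs as ⟧
    split a as x xs = ⟦⟧-× (≡-dec A._≟_ (x ∷ xs) (a ∷ as)) (x A.≟ a) (≡-dec A._≟_ xs as)
      ∷-injective (λ p q → cong₂ _∷_ p q)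
    once : ∀ n (as : Vec A n) → ∑ (vecs n) (λ xs → ⟦ ≡-dec A._≟_ xs as ⟧) ≡ 1ℤ
    once zero [] = refl
    once (suc n) (a ∷ as) = trans (∑-vecs n _)
      (trans (∑-cong A.els (λ x → trans (∑-cong (vecs n) (λ xs → split a as x xs))
          (trans (∑-*ˡ (vecs n) ⟦ x A.≟ a ⟧ _) (cong (⟦ x A.≟ a ⟧ ℤ.*_) (once n as)))))
          (trans (∑-cong A.els (λ x → ℤP.*-identityʳ _)) (A.once a)))

-- Finite fields of odd characteristic

-- The canonical map from ℤ gives a ring solver that collects integer coefficients, so that
-- identities involving 2 or -1 are decided as well.
module IntegerCoefficients (R : CommutativeRing 0ℓ 0ℓ) where
  open CommutativeRing R renaming (zero to *-zero; refl to ≈-refl; sym to ≈-sym; trans to ≈-trans)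
  open Algebra.Properties.Semiring.Mult.TCOptimised semiring using (1+×; ×-homo-+; ×1-homo-*) renaming (_×_ to _·_)
  open Algebra.Properties.Ring ring using (-0#≈0#; -‿distribˡ-*; -‿distribʳ-*; -‿involutive; -‿+-comm)
  open import Relation.Binary.Reasoning.Setoid setoid

  fromℤ : ℤ → Carrier
  fromℤ (pos n) = n · 1#
  fromℤ -[1+ n ] = - (suc n · 1#)

  fromℤ-neg : ∀ i → fromℤ (ℤ.- i) ≈ - fromℤ i
  fromℤ-neg (pos zero) = ≈-sym -0#≈0#
  fromℤ-neg (pos (suc n)) = ≈-refl
  fromℤ-neg -[1+ n ] = ≈-sym (-‿involutive _)

  fromℤ-⊖ : ∀ m n → fromℤ (m ℤ.⊖ n) ≈ m · 1# + - (n · 1#)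
  fromℤ-⊖ zero zero = ≈-sym (-‿inverseʳ 0#)
  fromℤ-⊖ zero (suc n) = ≈-sym (+-identityˡ _)
  fromℤ-⊖ (suc m) zero = ≈-sym (≈-trans (+-congˡ -0#≈0#) (+-identityʳ _))
  fromℤ-⊖ (suc m) (suc n) = begin
    fromℤ (suc m ℤ.⊖ suc n) ≡⟨ cong fromℤ (ℤP.[1+m]⊖[1+n]≡m⊖n m n) ⟩
    fromℤ (m ℤ.⊖ n) ≈⟨ fromℤ-⊖ m n ⟩
    m · 1# + - (n · 1#) ≈⟨ +-congˡ (+-identityˡ _) ⟨
    m · 1# + (0# + - (n · 1#)) ≈⟨ +-congˡ (+-congʳ (-‿inverseʳ 1#)) ⟨
    m · 1# + (1# + - 1# + - (n · 1#)) ≈⟨ +-congˡ (+-assoc _ _ _) ⟩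
    m · 1# + (1# + (- 1# + - (n · 1#))) ≈⟨ +-assoc _ _ _ ⟨
    m · 1# + 1# + (- 1# + - (n · 1#)) ≈⟨ +-cong (+-comm _ _) (-‿+-comm _ _) ⟩
    1# + m · 1# + - (1# + n · 1#) ≈⟨ +-cong (1+× m 1#) (-‿cong (1+× n 1#)) ⟨
    suc m · 1# + - (suc n · 1#) ∎

  fromℤ-+ : ∀ i j → fromℤ (i ℤ.+ j) ≈ fromℤ i + fromℤ j
  fromℤ-+ (pos m) (pos n) = ×-homo-+ 1# m n
  fromℤ-+ (pos m) -[1+ n ] = fromℤ-⊖ m (suc n)
  fromℤ-+ -[1+ m ] (pos n) = ≈-trans (fromℤ-⊖ n (suc m)) (+-comm _ _)
  fromℤ-+ -[1+ m ] -[1+ n ] = begin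
    - (suc (suc (m ℕ.+ n)) · 1#) ≡⟨ cong (λ k → - (suc k · 1#)) (ℕP.+-suc m n) ⟨
    - ((suc m ℕ.+ suc n) · 1#) ≈⟨ -‿cong (×-homo-+ 1# (suc m) (suc n)) ⟩
    - (suc m · 1# + suc n · 1#) ≈⟨ -‿+-comm _ _ ⟨
    - (suc m · 1#) + - (suc n · 1#) ∎

  fromℤ-* : ∀ i j → fromℤ (i ℤ.* j) ≈ fromℤ i * fromℤ j
  fromℤ-* (pos m) (pos n) = ≈-trans (reflexive (cong fromℤ (sym (ℤP.pos-* m n)))) (×1-homo-* m n)
  fromℤ-* (pos m) -[1+ n ] = begin
    fromℤ (pos m ℤ.* -[1+ n ]) ≡⟨ cong fromℤ (ℤP.neg-distribʳ-* (pos m) (pos (suc n))) ⟨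
    fromℤ (ℤ.- (pos m ℤ.* pos (suc n))) ≈⟨ fromℤ-neg (pos m ℤ.* pos (suc n)) ⟩
    - fromℤ (pos m ℤ.* pos (suc n)) ≈⟨ -‿cong (fromℤ-* (pos m) (pos (suc n))) ⟩
    - (m · 1# * (suc n · 1#)) ≈⟨ -‿distribʳ-* _ _ ⟩
    m · 1# * - (suc n · 1#) ∎
  fromℤ-* -[1+ m ] (pos n) = begin
    fromℤ (-[1+ m ] ℤ.* pos n) ≡⟨ cong fromℤ (ℤP.neg-distribˡ-* (pos (suc m)) (pos n)) ⟨
    fromℤ (ℤ.- (pos (suc m) ℤ.* pos n)) ≈⟨ fromℤ-neg (pos (suc m) ℤ.* pos n) ⟩
    - fromℤ (pos (suc m) ℤ.* pos n) ≈⟨ -‿cong (fromℤ-* (pos (suc m)) (pos n)) ⟩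
    - (suc m · 1# * (n · 1#)) ≈⟨ -‿distribˡ-* _ _ ⟩
    - (suc m · 1#) * (n · 1#) ∎
  fromℤ-* -[1+ m ] -[1+ n ] = begin
    (suc m ℕ.* suc n) · 1# ≈⟨ ×1-homo-* (suc m) (suc n) ⟩
    suc m · 1# * (suc n · 1#) ≈⟨ -‿involutive _ ⟨
    - - (suc m · 1# * (suc n · 1#)) ≈⟨ -‿cong (-‿distribʳ-* _ _) ⟩
    - (suc m · 1# * - (suc n · 1#)) ≈⟨ -‿distribˡ-* _ _ ⟩
    - (suc m · 1#) * - (suc n · 1#) ∎

  almost = ACR.fromCommutativeRing R

  morphism : ℤ.+-*-rawRing ACR.-Raw-AlmostCommutative⟶ almost
  morphism = record
    { ⟦_⟧ = fromℤ ; +-homo = fromℤ-+ ; *-homo = fromℤ-* ; -‿homo = fromℤ-neg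
    ; 0-homo = ≈-refl ; 1-homo = ≈-refl }

  decide : ∀ i j → Maybe (fromℤ i ≈ fromℤ j)
  decide i j with i ℤP.≟ j
  ... | yes p = just (reflexive (cong fromℤ p))
  -- Different integers may agree in positive characteristic, so this case is left undecided.
  ... | no _ = nothing

  open Algebra.Solver.Ring ℤ.+-*-rawRing almost morphism decide public
    using (solve; _:=_; _:+_; _:*_; _:-_; :-_; con)

record OddField : Set₁ where
  field
    Carrier : Set
    _+_ _*_ : Carrier → Carrier → Carrier
    -_ : Carrier → Carrier
    0# 1# : Carrier
    isCommutativeRing : IsCommutativeRing _≡_ _+_ _*_ -_ 0# 1#
    1≢0 : 1# ≢ 0#
    inverse : ∀ x → x ≢ 0# → ∃ λ y → x * y ≡ 1#
    2≢0 : 1# + 1# ≢ 0#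
    finite : Finite Carrier

  infixl 6 _+_ _-_
  infixl 7 _*_
  infix 8 -_

  commutativeRing : CommutativeRing 0ℓ 0ℓ
  commutativeRing = record { isCommutativeRing = isCommutativeRing }

  open CommutativeRing commutativeRing public
    using (+-assoc; +-comm; +-identityˡ; +-identityʳ; *-assoc; *-comm; *-identityˡ; *-identityʳ;
           -‿inverseˡ; -‿inverseʳ; zeroˡ; zeroʳ; distribˡ; distribʳ; commutativeSemiring; *-commutativeMonoid; *-monoid)
  open Algebra.Properties.CommutativeSemiring.Exp commutativeSemiring public
    using (_^_; ^-homo-*; ^-assocʳ; ^-distrib-*)
  open Algebra.Properties.Ring (CommutativeRing.ring commutativeRing) public
    using (-‿involutive; -0#≈0#)
  open Finite finite public
  open IntegerCoefficients commutativeRing public using (solve; _:=_; _:+_; _:*_; _:-_; :-_; con)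

  _-_ : Carrier → Carrier → Carrier
  x - y = x + - y

  sum : (Carrier → ℤ) → ℤ
  sum f = ∑ els f

  -- The value at 0 is a convention: the lemmas about `inv` exclude 0, and the Kloosterman sums give
  -- s = 0 the weight zero.
  inv : Carrier → Carrier
  inv x with x ≟ 0#
  ... | yes _ = 0#
  ... | no x≢0 = proj₁ (inverse x x≢0)

  *-inv : ∀ {x} → x ≢ 0# → x * inv x ≡ 1#
  *-inv {x} x≢0 with x ≟ 0#
  ... | yes p = contradiction p x≢0
  ... | no p = proj₂ (inverse x p)

  inv-* : ∀ {x} → x ≢ 0# → inv x * x ≡ 1#
  inv-* {x} p = trans (*-comm (inv x) x) (*-inv p)

  cancel-*-zero : ∀ {x y} → x ≢ 0# → x * y ≡ 0# → y ≡ 0#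
  cancel-*-zero {x} {y} p e = begin
    y ≡⟨ *-identityˡ y ⟨
    1# * y ≡⟨ cong (_* y) (inv-* p) ⟨
    inv x * x * y ≡⟨ *-assoc _ _ _ ⟩
    inv x * (x * y) ≡⟨ cong (inv x *_) e ⟩
    inv x * 0# ≡⟨ zeroʳ _ ⟩
    0# ∎
    where open ≡-Reasoning

  *-≢0 : ∀ {x y} → x ≢ 0# → y ≢ 0# → x * y ≢ 0#
  *-≢0 p r e = r (cancel-*-zero p e)

  inv-≢0 : ∀ {x} → x ≢ 0# → inv x ≢ 0#
  inv-≢0 {x} p e = 1≢0 (trans (sym (*-inv p)) (trans (cong (x *_) e) (zeroʳ x)))

  *-cancelˡ : ∀ {x y z} → x ≢ 0# → x * y ≡ x * z → y ≡ z
  *-cancelˡ {x} {y} {z} p e = begin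
    y ≡⟨ *-identityˡ y ⟨
    1# * y ≡⟨ cong (_* y) (inv-* p) ⟨
    inv x * x * y ≡⟨ *-assoc _ _ _ ⟩
    inv x * (x * y) ≡⟨ cong (inv x *_) e ⟩
    inv x * (x * z) ≡⟨ *-assoc _ _ _ ⟨
    inv x * x * z ≡⟨ cong (_* z) (inv-* p) ⟩
    1# * z ≡⟨ *-identityˡ z ⟩
    z ∎
    where open ≡-Reasoning

  zero-product : ∀ x y → x * y ≡ 0# → x ≡ 0# ⊎ y ≡ 0#
  zero-product x y e with x ≟ 0#
  ... | yes p = inj₁ p
  ... | no p = inj₂ (cancel-*-zero p e)

  +-cancelˡ : ∀ x {y z} → x + y ≡ x + z → y ≡ z
  +-cancelˡ x {y} {z} e = begin
    y ≡⟨ solve 2 (λ x y → y := :- x :+ (x :+ y)) refl x y ⟩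
    - x + (x + y) ≡⟨ cong (_+_ (- x)) e ⟩
    - x + (x + z) ≡⟨ solve 2 (λ x y → y := :- x :+ (x :+ y)) refl x z ⟨
    z ∎
    where open ≡-Reasoning

  x-y≡0⇒x≡y : ∀ {x y} → x - y ≡ 0# → x ≡ y
  x-y≡0⇒x≡y {x} {y} e = begin
    x ≡⟨ solve 2 (λ x y → x := x :- y :+ y) refl x y ⟩
    x - y + y ≡⟨ cong (_+ y) e ⟩
    0# + y ≡⟨ +-identityˡ y ⟩
    y ∎
    where open ≡-Reasoning

  ^-≢0 : ∀ {x} n → x ≢ 0# → x ^ n ≢ 0#
  ^-≢0 zero p = 1≢0
  ^-≢0 (suc n) p = *-≢0 p (^-≢0 n p)

  ^≡0 : ∀ x n → x ^ n ≡ 0# → x ≡ 0#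
  ^≡0 x n e with x ≟ 0#
  ... | yes p = p
  ... | no p = contradiction e (^-≢0 n p)

  one^ : ∀ n → 1# ^ n ≡ 1#
  one^ zero = refl
  one^ (suc n) = trans (*-identityˡ _) (one^ n)

  2# : Carrier
  2# = 1# + 1#

  half : Carrier
  half = inv 2#

  sum-shift : ∀ c f → sum (λ x → f (c + x)) ≡ sum f
  sum-shift c = ∑-reindex finite finite (c +_) (_+_ (- c))
    (λ x → sym (solve 2 (λ c x → x := :- c :+ (c :+ x)) refl c x))
    (λ x → sym (solve 2 (λ c x → x := c :+ (:- c :+ x)) refl c x))

  sum-scale : ∀ {c} → c ≢ 0# → ∀ f → sum (λ x → f (c * x)) ≡ sum f
  sum-scale {c} p = ∑-reindex finite finite (c *_) (inv c *_)
    (λ x → trans (sym (*-assoc _ _ _)) (trans (cong (_* x) (inv-* p)) (*-identityˡ x)))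
    (λ x → trans (sym (*-assoc _ _ _)) (trans (cong (_* x) (*-inv p)) (*-identityˡ x)))

  sum-neg : ∀ f → sum (λ x → f (- x)) ≡ sum f
  sum-neg = ∑-reindex finite finite -_ -_ -‿involutive -‿involutive

  MeanZero : (Carrier → ℤ) → Set
  MeanZero f = sum f ≡ 0ℤ

  -- One plus the quadratic character of x.
  roots : Carrier → ℤ
  roots x = sum (λ y → ⟦ y * y ≟ x ⟧)

  Nonsquare : Carrier → Set
  Nonsquare d = ∀ y → y * y ≢ d

  square-roots : ∀ y z → y * y ≡ z * z → y ≡ z ⊎ y ≡ - z
  square-roots y z e with zero-product (y - z) (y + z)
    (trans (solve 2 (λ y z → (y :- z) :* (y :+ z) := y :* y :- z :* z) refl y z)
      (trans (cong (_- (z * z)) e) (-‿inverseʳ _)))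
  ... | inj₁ p = inj₁ (x-y≡0⇒x≡y p)
  ... | inj₂ p = inj₂ (x-y≡0⇒x≡y (trans (cong (y +_) (-‿involutive z)) p))

  roots≤2 : ∀ x → roots x ℤ.≤ pos 2
  roots≤2 x with search (λ y → y * y ≟ x)
  ... | inj₂ none = subst (ℤ._≤ pos 2) (sym (trans (∑-cong els (λ y → ⟦⟧-no (y * y ≟ x) (none y))) (∑-zero els))) (ℤ.+≤+ z≤n)
  ... | inj₁ (z , e) = ℤP.≤-trans (∑-mono els bound) (ℤP.≤-reflexive
          (trans (∑-+ els (λ y → ⟦ y ≟ z ⟧) (λ y → ⟦ y ≟ - z ⟧)) (cong₂ ℤ._+_ (once z) (once (- z)))))
    where
    bound : ∀ y → ⟦ y * y ≟ x ⟧ ℤ.≤ ⟦ y ≟ z ⟧ ℤ.+ ⟦ y ≟ - z ⟧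
    bound y with y * y ≟ x
    ... | no _ = ℤP.+-mono-≤ (⟦⟧-nonneg (y ≟ z)) (⟦⟧-nonneg (y ≟ - z))
    ... | yes p with square-roots y z (trans p (sym e))
    ... | inj₁ q = subst (λ w → 1ℤ ℤ.≤ w ℤ.+ ⟦ y ≟ - z ⟧) (sym (⟦⟧-yes (y ≟ z) q)) (ℤP.+-mono-≤ (ℤP.≤-refl {1ℤ}) (⟦⟧-nonneg (y ≟ - z)))
    ... | inj₂ q = subst (λ w → 1ℤ ℤ.≤ ⟦ y ≟ z ⟧ ℤ.+ w) (sym (⟦⟧-yes (y ≟ - z) q)) (ℤP.+-mono-≤ (⟦⟧-nonneg (y ≟ z)) (ℤP.≤-refl {1ℤ}))

  roots-sum : sum roots ≡ pos size
  roots-sum = trans (∑-swap els els (λ x y → ⟦ y * y ≟ x ⟧))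
    (trans (∑-cong els (λ y → trans (∑-cong els (λ x → ⟦⟧-cong (y * y ≟ x) (x ≟ y * y) sym sym)) (once (y * y))))
      (trans (∑-const els 1ℤ) (ℤP.*-identityʳ _)))

  -1≢1 : - 1# ≢ 1#
  -1≢1 e = 2≢0 (trans (cong (1# +_) (sym e)) (-‿inverseʳ 1#))

  1<size : 1 ℕ.< size
  1<size = ℤP.drop‿+<+ (ℤP.<-≤-trans (ℤ.+<+ (ℕ.s≤s (ℕ.s≤s z≤n))) (subst (pos 2 ℤ.≤_) (trans (∑-const els 1ℤ) (ℤP.*-identityʳ _))
    (subst (ℤ._≤ sum (λ _ → 1ℤ)) (trans (∑-+ els (λ x → ⟦ x ≟ 0# ⟧) (λ x → ⟦ x ≟ 1# ⟧)) (cong₂ ℤ._+_ (once 0#) (once 1#))) (∑-mono els distinct))))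
    where
    distinct : ∀ x → ⟦ x ≟ 0# ⟧ ℤ.+ ⟦ x ≟ 1# ⟧ ℤ.≤ 1ℤ
    distinct x with x ≟ 0# | x ≟ 1#
    ... | yes p | yes r = ⊥-elim (1≢0 (trans (sym r) p))
    ... | yes _ | no _ = ℤP.≤-refl
    ... | no _ | yes _ = ℤP.≤-refl
    ... | no _ | no _ = ℤ.+≤+ z≤n

  -- A bound attained on average is attained everywhere. With the known total of `roots`, this turns
  -- inequalities for square roots into exact counts.
  sum-squeeze : ∀ (f : Carrier → ℤ) c → (∀ x → f x ℤ.≤ c) → sum f ≡ pos size ℤ.* c → ∀ x → f x ≡ c
  sum-squeeze f c le eq x = ℤP.≤-antisym (le x) (≤-from-diff (subst (0ℤ ℤ.≤_) (lem c (f x)) (ℤP.neg-mono-≤ slack)))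
    where
    lem : ∀ a b → ℤ.- (a ℤ.- b) ≡ b ℤ.- a
    lem = solve-∀
    total : sum (λ x → c ℤ.- f x) ≡ 0ℤ
    total = trans (∑-sub els (λ _ → c) f) (trans (cong₂ ℤ._-_ (∑-const els c) eq) (ℤP.+-inverseʳ (pos size ℤ.* c)))
    slack : c ℤ.- f x ℤ.≤ 0ℤ
    slack = subst (c ℤ.- f x ℤ.≤_) total (∈⇒∑-pos els (λ y → diff-nonneg (le y)) (∈-els x))

  -- If every element had a root, then `roots`, whose average is 1, would be 1 everywhere; but 1 has
  -- the two roots 1 and -1.
  exists-nonsquare : ∃ Nonsquare
  exists-nonsquare with search (λ x → all-no x)
    where
    all-no : ∀ x → Dec (Nonsquare x)
    all-no x with search (λ y → y * y ≟ x)
    ... | inj₁ (y , e) = no (λ n → n y e)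
    ... | inj₂ n = yes n
  ... | inj₁ e = e
  ... | inj₂ all = ⊥-elim (two≢one (trans (sym two) (sum-squeeze′ 1#)))
    where
    one≤ : ∀ x → 1ℤ ℤ.≤ roots x
    one≤ x with search (λ y → y * y ≟ x)
    ... | inj₂ n = ⊥-elim (all x n)
    ... | inj₁ (y , e) = subst (ℤ._≤ roots x) (⟦⟧-yes (y * y ≟ x) e) (∈⇒∑-pos els (λ z → ⟦⟧-nonneg (z * z ≟ x)) (∈-els y))
    neg-roots : ∀ x → ℤ.- roots x ≡ ℤ.- 1ℤ
    neg-roots = sum-squeeze (λ x → ℤ.- roots x) (ℤ.- 1ℤ) (λ x → ℤP.neg-mono-≤ (one≤ x))
      (trans (∑-neg els roots) (trans (cong ℤ.-_ roots-sum) (lem (pos size))))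
      where
      lem : ∀ a → ℤ.- a ≡ a ℤ.* (ℤ.- 1ℤ)
      lem = solve-∀
    sum-squeeze′ : ∀ x → roots x ≡ 1ℤ
    sum-squeeze′ x = ℤP.neg-injective (neg-roots x)
    two≢one : ¬ (pos 2 ≡ 1ℤ)
    two≢one ()
    two : roots 1# ≡ pos 2
    two = trans (∑-cong els split) (trans (∑-+ els (λ y → ⟦ y ≟ 1# ⟧) (λ y → ⟦ y ≟ - 1# ⟧)) (cong₂ ℤ._+_ (once 1#) (once (- 1#))))
      where
      split : ∀ y → ⟦ y * y ≟ 1# ⟧ ≡ ⟦ y ≟ 1# ⟧ ℤ.+ ⟦ y ≟ - 1# ⟧
      split y with y ≟ 1# | y ≟ - 1#
      ... | yes p | yes r = ⊥-elim (-1≢1 (trans (sym r) p))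
      ... | yes refl | no _ = ⟦⟧-yes (1# * 1# ≟ 1#) (*-identityˡ 1#)
      ... | no _ | yes refl = ⟦⟧-yes (- 1# * - 1# ≟ 1#) (solve 0 (:- con 1ℤ :* :- con 1ℤ := con 1ℤ) refl)
      ... | no p | no r = ⟦⟧-no (y * y ≟ 1#) λ e → contra (square-roots y 1# (trans e (sym (*-identityˡ 1#))))
        where
        contra : y ≡ 1# ⊎ y ≡ - 1# → ⊥
        contra (inj₁ e) = p e
        contra (inj₂ e) = r e

  scaled-roots : Carrier → Carrier → ℤ
  scaled-roots d x = sum (λ y → ⟦ d * (y * y) ≟ x ⟧)

  private
    scaled-roots≡ : ∀ {d} → d ≢ 0# → ∀ x → scaled-roots d x ≡ roots (inv d * x)
    scaled-roots≡ {d} d≢0 x = ∑-cong els (λ y → ⟦⟧-cong (d * (y * y) ≟ x) (y * y ≟ inv d * x)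
      (λ e → *-cancelˡ d≢0 (trans e (sym (fold x))))
      (λ e → trans (cong (d *_) e) (fold x)))
      where
      fold : ∀ x → d * (inv d * x) ≡ x
      fold x = trans (sym (*-assoc _ _ _)) (trans (cong (_* x) (*-inv d≢0)) (*-identityˡ x))

  nonsquare≢0 : ∀ {d} → Nonsquare d → d ≢ 0#
  nonsquare≢0 n e = n 0# (trans (zeroˡ 0#) (sym e))

  roots-zero : roots 0# ≡ 1ℤ
  roots-zero = trans (∑-cong els (λ y → ⟦⟧-cong (y * y ≟ 0#) (y ≟ 0#)
    (λ e → either y (zero-product y y e)) (λ e → trans (cong (_* y) e) (zeroˡ y)))) (once 0#)
    where
    either : ∀ y → y ≡ 0# ⊎ y ≡ 0# → y ≡ 0#
    either y (inj₁ e) = e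
    either y (inj₂ e) = e

  roots-nonsquare : ∀ {x} → Nonsquare x → roots x ≡ 0ℤ
  roots-nonsquare {x} n = trans (∑-cong els (λ y → ⟦⟧-no (y * y ≟ x) (n y))) (∑-zero els)

  -- Two nonzero elements with nonsquare ratio are not both squares, so the sum is at most 2; at 0
  -- it is 1 + 1. As its average is 2, `sum-squeeze` gives equality.
  roots-complement : ∀ {d} → Nonsquare d → ∀ x → roots x ℤ.+ scaled-roots d x ≡ pos 2
  roots-complement {d} nd = sum-squeeze _ (pos 2) bound total
    where
    d≢0 = nonsquare≢0 nd
    bound : ∀ x → roots x ℤ.+ scaled-roots d x ℤ.≤ pos 2
    bound x with x ≟ 0#
    ... | yes refl = ℤP.≤-reflexive (cong₂ ℤ._+_ roots-zero
            (trans (scaled-roots≡ d≢0 0#) (trans (cong roots (zeroʳ (inv d))) roots-zero)))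
    ... | no x≢0 with search (λ y → y * y ≟ x)
    ... | inj₂ n = subst (ℤ._≤ pos 2) (sym (trans (cong (ℤ._+ scaled-roots d x) (roots-nonsquare n)) (ℤP.+-identityˡ _)))
                     (subst (ℤ._≤ pos 2) (sym (scaled-roots≡ d≢0 x)) (roots≤2 (inv d * x)))
    ... | inj₁ (z , e) = subst (ℤ._≤ pos 2) (sym (trans (cong (λ w → roots x ℤ.+ w) none) (ℤP.+-identityʳ _))) (roots≤2 x)
      where
      z≢0 : z ≢ 0#
      z≢0 p = x≢0 (trans (sym e) (trans (cong (_* z) p) (zeroˡ z)))
      none : scaled-roots d x ≡ 0ℤ
      none = trans (∑-cong els (λ y → ⟦⟧-no (d * (y * y) ≟ x) λ f →
        let y≢0 : y ≢ 0#
            y≢0 p = x≢0 (trans (sym f) (trans (cong (λ y → d * (y * y)) p) (trans (cong (d *_) (zeroˡ 0#)) (zeroʳ d))))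
            open ≡-Reasoning
        in nd (z * inv y) (begin
             z * inv y * (z * inv y) ≡⟨ solve 2 (λ z v → z :* v :* (z :* v) := z :* z :* (v :* v)) refl z (inv y) ⟩
             z * z * (inv y * inv y) ≡⟨ cong (_* (inv y * inv y)) (trans e (sym f)) ⟩
             d * (y * y) * (inv y * inv y) ≡⟨ solve 3 (λ d y v → d :* (y :* y) :* (v :* v) := d :* ((y :* v) :* (y :* v))) refl d y (inv y) ⟩
             d * ((y * inv y) * (y * inv y)) ≡⟨ cong (λ w → d * (w * w)) (*-inv y≢0) ⟩
             d * (1# * 1#) ≡⟨ solve 1 (λ d → d :* (con 1ℤ :* con 1ℤ) := d) refl d ⟩
             d ∎))) (∑-zero els)
    total : sum (λ x → roots x ℤ.+ scaled-roots d x) ≡ pos size ℤ.* pos 2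
    total = trans (∑-+ els roots (scaled-roots d)) (trans (cong₂ ℤ._+_ roots-sum
      (trans (∑-cong els (scaled-roots≡ d≢0)) (trans (sum-scale (inv-≢0 d≢0) roots) roots-sum))) (lem (pos size)))
      where
      lem : ∀ a → a ℤ.+ a ≡ a ℤ.* pos 2
      lem = solve-∀

  sum-squares : ∀ (h : Carrier → ℤ) → sum (λ y → h (y * y)) ≡ sum (λ x → roots x ℤ.* h x)
  sum-squares h = ∑-fibres finite finite (λ y → y * y) h

  -- As y varies, y² and d y² together cover the field twice. This compares a sum over one square
  -- class with the sum over the other, for the square of a Kloosterman operator as well as for the
  -- sign in `R-class`.
  sum-square-classes : ∀ {d} → Nonsquare d → ∀ (h : Carrier → ℤ) →
    sum (λ y → h (y * y)) ℤ.+ sum (λ y → h (d * (y * y))) ≡ pos 2 ℤ.* sum h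
  sum-square-classes {d} nd h = trans
    (cong₂ ℤ._+_ (sum-squares h) (∑-fibres finite finite (λ y → d * (y * y)) h))
    (trans (sym (∑-+ els (λ x → roots x ℤ.* h x) (λ x → scaled-roots d x ℤ.* h x)))
      (trans (∑-cong els (λ x → trans (sym (ℤP.*-distribʳ-+ (h x) (roots x) (scaled-roots d x)))
        (cong (ℤ._* h x) (roots-complement nd x)))) (∑-*ˡ els (pos 2) h)))

-- Polynomial functions

module PolynomialFunctions (E : OddField) where
  open OddField E
  open Algebra.Properties.CommutativeMonoid.Sum (CommutativeRing.+-commutativeMonoid commutativeRing) public
    using (sum-cong-≗; sum-remove; ∑-distrib-+; sum-replicate-zero) renaming (sum to sumF)
  open Algebra.Properties.Semiring.Sum (CommutativeRing.semiring commutativeRing) public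
    using (*-distribˡ-sum; *-distribʳ-sum)

  -- Poly d means degree < d, whereas Monic d means degree exactly d.
  Poly : ℕ → (Carrier → Carrier) → Set
  Poly zero p = ∀ x → p x ≡ 0#
  Poly (suc d) p = Σ Carrier λ c → Σ (Carrier → Carrier) λ p′ → (∀ x → p x ≡ c + x * p′ x) × Poly d p′

  Monic : ℕ → (Carrier → Carrier) → Set
  Monic zero p = ∀ x → p x ≡ 1#
  Monic (suc d) p = Σ Carrier λ c → Σ (Carrier → Carrier) λ p′ → (∀ x → p x ≡ c + x * p′ x) × Monic d p′

  poly-cong : ∀ d {p r} → (∀ x → r x ≡ p x) → Poly d p → Poly d r
  poly-cong zero e h x = trans (e x) (h x)
  poly-cong (suc d) e (c , p′ , h , k) = c , p′ , (λ x → trans (e x) (h x)) , k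

  monic-cong : ∀ d {p r} → (∀ x → r x ≡ p x) → Monic d p → Monic d r
  monic-cong zero e h x = trans (e x) (h x)
  monic-cong (suc d) e (c , p′ , h , k) = c , p′ , (λ x → trans (e x) (h x)) , k

  poly-zero : ∀ d → Poly d (λ _ → 0#)
  poly-zero zero x = refl
  poly-zero (suc d) = 0# , (λ _ → 0#) , (λ x → sym (trans (+-identityˡ _) (zeroʳ x))) , poly-zero d

  poly-+ : ∀ d {p r} → Poly d p → Poly d r → Poly d (λ x → p x + r x)
  poly-+ zero h k x = trans (cong₂ _+_ (h x) (k x)) (+-identityˡ 0#)
  poly-+ (suc d) (c , p , h , h′) (e , r , k , k′) = c + e , (λ x → p x + r x) ,
    (λ x → trans (cong₂ _+_ (h x) (k x)) (solve 5 (λ c e x p r → c :+ x :* p :+ (e :+ x :* r) := c :+ e :+ x :* (p :+ r)) refl c e x (p x) (r x))) ,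
    poly-+ d h′ k′

  monic-+ : ∀ d {p r} → Monic d p → Poly d r → Monic d (λ x → p x + r x)
  monic-+ zero h k x = trans (cong₂ _+_ (h x) (k x)) (+-identityʳ 1#)
  monic-+ (suc d) (c , p , h , h′) (e , r , k , k′) = c + e , (λ x → p x + r x) ,
    (λ x → trans (cong₂ _+_ (h x) (k x)) (solve 5 (λ c e x p r → c :+ x :* p :+ (e :+ x :* r) := c :+ e :+ x :* (p :+ r)) refl c e x (p x) (r x))) ,
    monic-+ d h′ k′

  poly-scale : ∀ d a {p} → Poly d p → Poly d (λ x → a * p x)
  poly-scale zero a h x = trans (cong (a *_) (h x)) (zeroʳ a)
  poly-scale (suc d) a (c , p , h , h′) = a * c , (λ x → a * p x) ,
    (λ x → trans (cong (a *_) (h x)) (solve 4 (λ a c x p → a :* (c :+ x :* p) := a :* c :+ x :* (a :* p)) refl a c x (p x))) ,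
    poly-scale d a h′

  poly-≤ : ∀ {d e p} → d ℕ.≤ e → Poly d p → Poly e p
  poly-≤ {zero} {e} z≤n h = poly-cong e h (poly-zero e)
  poly-≤ (s≤s le) (c , p , h , h′) = c , p , h , poly-≤ le h′

  poly-x* : ∀ d {p} → Poly d p → Poly (suc d) (λ x → x * p x)
  poly-x* d {p} h = 0# , p , (λ x → sym (+-identityˡ _)) , h

  monic-x* : ∀ d {p} → Monic d p → Monic (suc d) (λ x → x * p x)
  monic-x* d {p} h = 0# , p , (λ x → sym (+-identityˡ _)) , h

  monic⇒poly : ∀ d {p} → Monic d p → Poly (suc d) p
  monic⇒poly zero h = 1# , (λ _ → 0#) , (λ x → trans (h x) (sym (trans (cong (1# +_) (zeroʳ x)) (+-identityʳ 1#)))) , λ x → refl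
  monic⇒poly (suc d) (c , p , h , h′) = c , p , h , monic⇒poly d h′

  monic-* : ∀ d e {p r} → Monic d p → Monic e r → Monic (d ℕ.+ e) (λ x → p x * r x)
  monic-* zero e {p} {r} h k = monic-cong e (λ x → trans (cong (_* r x) (h x)) (*-identityˡ _)) k
  monic-* (suc d) e {p} {r} (c , p′ , h , h′) k = monic-cong (suc d ℕ.+ e)
    (λ x → trans (cong (_* r x) (h x)) (solve 4 (λ c x p r → (c :+ x :* p) :* r := x :* (p :* r) :+ c :* r) refl c x (p′ x) (r x)))
    (monic-+ (suc d ℕ.+ e) (monic-x* (d ℕ.+ e) (monic-* d e h′ k))
      (poly-scale (suc d ℕ.+ e) c (poly-≤ (s≤s (ℕP.m≤n+m e d)) (monic⇒poly e k))))

  poly-* : ∀ d e {p r} → Poly (suc d) p → Poly (suc e) r → Poly (suc (d ℕ.+ e)) (λ x → p x * r x)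
  poly-* zero e {p} {r} (c , p′ , h , h′) k = poly-cong (suc e)
    (λ x → trans (cong (_* r x) (trans (h x) (trans (cong (λ w → c + x * w) (h′ x)) (trans (cong (c +_) (zeroʳ x)) (+-identityʳ c))))) refl)
    (poly-scale (suc e) c k)
  poly-* (suc d) e {p} {r} (c , p′ , h , h′) k = poly-cong (suc (suc d ℕ.+ e))
    (λ x → trans (cong (_* r x) (h x)) (solve 4 (λ c x p r → (c :+ x :* p) :* r := x :* (p :* r) :+ c :* r) refl c x (p′ x) (r x)))
    (poly-+ (suc (suc d ℕ.+ e)) (poly-x* (suc (d ℕ.+ e)) (poly-* d e h′ k))
      (poly-scale (suc (suc d ℕ.+ e)) c (poly-≤ (s≤s (ℕP.m≤n+m e (suc d))) k)))

  monic-^ : ∀ d {p} → Monic d p → ∀ n → Monic (n ℕ.* d) (λ x → p x ^ n)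
  monic-^ d h zero x = refl
  monic-^ d h (suc n) = monic-* d (n ℕ.* d) h (monic-^ d h n)

  poly-^ : ∀ d {p} → Poly (suc d) p → ∀ n → Poly (suc (n ℕ.* d)) (λ x → p x ^ n)
  poly-^ d h zero = monic⇒poly 0 (λ x → refl)
  poly-^ d h (suc n) = poly-* d (n ℕ.* d) h (poly-^ d h n)

  monic-x^ : ∀ n → Monic n (λ x → x ^ n)
  monic-x^ zero x = refl
  monic-x^ (suc n) = monic-x* n (monic-x^ n)

  monic-x^-x : ∀ n → 1 ℕ.< n → Monic n (λ x → x ^ n - x)
  monic-x^-x n lt = monic-+ n (monic-x^ n) (poly-≤ lt (0# , (λ _ → - 1#) ,
    (λ x → solve 1 (λ x → :- x := con 0ℤ :+ x :* (:- con 1ℤ)) refl x) ,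
    (- 1# , (λ _ → 0#) , (λ x → solve 1 (λ x → :- con 1ℤ := :- con 1ℤ :+ x :* con 0ℤ) refl x) , λ _ → refl)))

  -- Horner's scheme: division by X - r leaves the remainder p r.
  divide : ∀ d {p} → Monic (suc d) p → ∀ r → ∃ λ p′ → Monic d p′ × (∀ x → p x ≡ (x - r) * p′ x + p r)
  divide zero {p} (c , u , h , k) r = (λ _ → 1#) , (λ _ → refl) , λ x → begin
    p x ≡⟨ trans (h x) (cong (λ w → c + x * w) (k x)) ⟩
    c + x * 1# ≡⟨ solve 3 (λ c x r → c :+ x :* con 1ℤ := (x :- r) :* con 1ℤ :+ (c :+ r :* con 1ℤ)) refl c x r ⟩
    (x - r) * 1# + (c + r * 1#) ≡⟨ cong ((x - r) * 1# +_) (trans (h r) (cong (λ w → c + r * w) (k r))) ⟨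
    (x - r) * 1# + p r ∎
    where open ≡-Reasoning
  divide (suc d) {p} (c , u , h , k) r with divide d k r
  ... | v , mv , e = (λ x → x * v x + u r) , monic-+ (suc d) (monic-x* d mv) (u r , (λ _ → 0#) ,
      (λ x → solve 2 (λ a x → a := a :+ x :* con 0ℤ) refl (u r) x) , poly-zero d) , λ x → begin
    p x ≡⟨ trans (h x) (cong (λ w → c + x * w) (e x)) ⟩
    c + x * ((x - r) * v x + u r) ≡⟨ solve 5 (λ c x r v a → c :+ x :* ((x :- r) :* v :+ a) := (x :- r) :* (x :* v :+ a) :+ (c :+ r :* a)) refl c x r (v x) (u r) ⟩
    (x - r) * (x * v x + u r) + (c + r * u r) ≡⟨ cong ((x - r) * (x * v x + u r) +_) (h r) ⟨
    (x - r) * (x * v x + u r) + p r ∎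
    where open ≡-Reasoning

  -- Induction on the degree, splitting off X - r for a root r. Roots are counted along an injection
  -- so that the points of a subfield can be counted alone.
  root-count : {A : Set} (FA : Finite A) (ι : A → Carrier) → (∀ {a b} → ι a ≡ ι b → a ≡ b) →
    ∀ d {p} → Monic d p → ∑ (Finite.els FA) (λ a → ⟦ p (ι a) ≟ 0# ⟧) ℤ.≤ pos d
  root-count FA ι inj zero {p} h = ℤP.≤-reflexive (trans (∑-cong (Finite.els FA) (λ a → ⟦⟧-no (p (ι a) ≟ 0#) (λ e → 1≢0 (trans (sym (h (ι a))) e))))
    (∑-zero (Finite.els FA)))
  root-count FA ι inj (suc d) {p} h with Finite.search FA (λ a → p (ι a) ≟ 0#)
  ... | inj₂ none = subst (ℤ._≤ pos (suc d)) (sym (trans (∑-cong (Finite.els FA) (λ a → ⟦⟧-no (p (ι a) ≟ 0#) (none a))) (∑-zero (Finite.els FA)))) (ℤ.+≤+ z≤n)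
  ... | inj₁ (r , pr) with divide d h (ι r)
  ... | u , mu , e = ℤP.≤-trans (∑-mono A.els bound) (ℤP.≤-trans
        (ℤP.≤-reflexive (∑-+ A.els (λ a → ⟦ a A.≟ r ⟧) (λ a → ⟦ u (ι a) ≟ 0# ⟧)))
        (ℤP.+-mono-≤ (ℤP.≤-reflexive (A.once r)) (root-count FA ι inj d mu)))
    where
    module A = Finite FA
    bound : ∀ a → ⟦ p (ι a) ≟ 0# ⟧ ℤ.≤ ⟦ a A.≟ r ⟧ ℤ.+ ⟦ u (ι a) ≟ 0# ⟧
    bound a with p (ι a) ≟ 0#
    ... | no _ = ℤP.+-mono-≤ (⟦⟧-nonneg (a A.≟ r)) (⟦⟧-nonneg (u (ι a) ≟ 0#))
    ... | yes z with zero-product (ι a - ι r) (u (ι a)) (trans (sym (trans (e (ι a)) (trans (cong ((ι a - ι r) * u (ι a) +_) pr) (+-identityʳ _)))) z)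
    ... | inj₁ q = subst (λ w → 1ℤ ℤ.≤ w ℤ.+ ⟦ u (ι a) ≟ 0# ⟧) (sym (⟦⟧-yes (a A.≟ r) (inj (x-y≡0⇒x≡y q))))
                    (ℤP.+-mono-≤ (ℤP.≤-refl {1ℤ}) (⟦⟧-nonneg (u (ι a) ≟ 0#)))
    ... | inj₂ q = subst (λ w → 1ℤ ℤ.≤ ⟦ a A.≟ r ⟧ ℤ.+ w) (sym (⟦⟧-yes (u (ι a) ≟ 0#) q))
                    (ℤP.+-mono-≤ (⟦⟧-nonneg (a A.≟ r)) (ℤP.≤-refl {1ℤ}))

  -- `Poly` only bounds the degree. Discarding zero coefficients from the top leaves a constant
  -- times a monic polynomial, to which `root-count` applies.
  leading-term : ∀ d {p} → Poly d p → (∀ x → p x ≡ 0#) ⊎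
    (∃ λ e → e ℕ.< d × (∃ λ c → c ≢ 0# × (∃ λ m → Monic e m × (∀ x → p x ≡ c * m x))))
  leading-term zero h = inj₁ h
  leading-term (suc d) {p} (c , u , h , k) with leading-term d k
  ... | inj₂ (e , e<d , a , a≢0 , m , mm , f) = inj₂ (suc e , s≤s e<d , a , a≢0 , (λ x → c * inv a + x * m x) ,
          (c * inv a , m , (λ x → refl) , mm) , λ x → begin
            p x ≡⟨ trans (h x) (cong (λ w → c + x * w) (f x)) ⟩
            c + x * (a * m x) ≡⟨ cong (_+ x * (a * m x)) (trans (sym (*-identityʳ c)) (cong (c *_) (sym (*-inv a≢0)))) ⟩
            c * (a * inv a) + x * (a * m x) ≡⟨ solve 5 (λ c a v x m → c :* (a :* v) :+ x :* (a :* m) := a :* (c :* v :+ x :* m)) refl c a (inv a) x (m x) ⟩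
            a * (c * inv a + x * m x) ∎)
    where open ≡-Reasoning
  ... | inj₁ z with c ≟ 0#
  ... | yes refl = inj₁ (λ x → trans (h x) (trans (cong (λ w → 0# + x * w) (z x)) (trans (+-identityˡ _) (zeroʳ x))))
  ... | no c≢0 = inj₂ (0 , s≤s z≤n , c , c≢0 , (λ _ → 1#) , (λ _ → refl) , λ x →
      trans (h x) (trans (cong (λ w → c + x * w) (z x)) (solve 2 (λ c x → c :+ x :* con 0ℤ := c :* con 1ℤ) refl c x)))

  -- The vanishing is tested on the image of ι only, typically a subfield, but the conclusion holds
  -- on the whole field.
  many-roots⇒zero : {A : Set} (FA : Finite A) (ι : A → Carrier) → (∀ {a b} → ι a ≡ ι b → a ≡ b) →
    ∀ {p} → Poly (Finite.size FA) p → (∀ a → p (ι a) ≡ 0#) → ∀ x → p x ≡ 0#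
  many-roots⇒zero FA ι inj {p} h z with leading-term (Finite.size FA) h
  ... | inj₁ e = e
  ... | inj₂ (e , e< , c , c≢0 , m , mm , f) = ⊥-elim (ℤP.<⇒≱ (ℤ.+<+ e<) (subst (ℤ._≤ pos e) count (root-count FA ι inj e mm)))
    where
    module A = Finite FA
    count : ∑ A.els (λ a → ⟦ m (ι a) ≟ 0# ⟧) ≡ pos A.size
    count = trans (∑-cong A.els (λ a → ⟦⟧-yes (m (ι a) ≟ 0#) (cancel-*-zero c≢0 (trans (sym (f (ι a))) (z a)))))
      (trans (∑-const A.els 1ℤ) (ℤP.*-identityʳ _))

  sumF-*ˡ : ∀ {n} c (f : Fin n → Carrier) → sumF (λ i → c * f i) ≡ c * sumF f
  sumF-*ˡ c f = sym (*-distribˡ-sum c f)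

  sumF-*ʳ : ∀ {n} c (f : Fin n → Carrier) → sumF (λ i → f i * c) ≡ sumF f * c
  sumF-*ʳ c f = sym (*-distribʳ-sum c f)

  -- Gaussian elimination on constant terms. If all of them vanish, a factor x is divided out;
  -- otherwise some p j serves as pivot, and the other polynomials minus multiples of p j are
  -- divisible by x. Either way D drops by one.
  dependence : ∀ D n (p : Fin n → Carrier → Carrier) → (∀ i → Poly D (p i)) → D ℕ.< n →
    ∃ λ (α : Fin n → Carrier) → (∃ λ i → α i ≢ 0#) × (∀ x → sumF (λ i → α i * p i x) ≡ 0#)
  dependence zero (suc n) p h lt = (λ _ → 1#) , (zero , 1≢0) ,
    λ x → trans (sum-cong-≗ (λ i → trans (cong (1# *_) (h i x)) (zeroʳ 1#))) (sum-replicate-zero (suc n))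
  dependence (suc D) (suc n) p h (s≤s lt) with any? (λ j → ¬? (proj₁ (h j) ≟ 0#))
  ... | no none with dependence D (suc n) (λ i → proj₁ (proj₂ (h i))) (λ i → proj₂ (proj₂ (proj₂ (h i)))) (ℕP.m≤n⇒m≤1+n lt)
  ... | α , nz , z = α , nz , λ x → begin
        sumF (λ i → α i * p i x) ≡⟨ sum-cong-≗ (λ i → trans (cong (α i *_) (trans (proj₁ (proj₂ (proj₂ (h i))) x)
            (trans (cong (_+ x * p′ i x) (c≡0 i)) (+-identityˡ _)))) (solve 3 (λ a x p → a :* (x :* p) := x :* (a :* p)) refl (α i) x (p′ i x))) ⟩
        sumF (λ i → x * (α i * p′ i x)) ≡⟨ sumF-*ˡ x (λ i → α i * p′ i x) ⟩
        x * sumF (λ i → α i * p′ i x) ≡⟨ trans (cong (x *_) (z x)) (zeroʳ x) ⟩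
        0# ∎
    where
    open ≡-Reasoning
    p′ : Fin (suc n) → Carrier → Carrier
    p′ i = proj₁ (proj₂ (h i))
    c≡0 : ∀ i → proj₁ (h i) ≡ 0#
    c≡0 i = decidable-stable (proj₁ (h i) ≟ 0#) (λ ne → none (i , ne))
  dependence (suc D) (suc n) p h (s≤s lt) | yes (j , cj≢0) with dependence D n
      (λ i x → proj₁ (proj₂ (h (punchIn j i))) x + (- (proj₁ (h (punchIn j i)) * inv (proj₁ (h j)))) * proj₁ (proj₂ (h j)) x)
      (λ i → poly-+ D (proj₂ (proj₂ (proj₂ (h (punchIn j i))))) (poly-scale D _ (proj₂ (proj₂ (proj₂ (h j)))))) lt
  ... | β , (i₀ , nz) , z = α , (punchIn j i₀ , λ e → nz (trans (sym (VecFP.insertAt-punchIn β j s i₀)) e)) , rel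
    where
    open ≡-Reasoning
    c : Fin (suc n) → Carrier
    c i = proj₁ (h i)
    p′ : Fin (suc n) → Carrier → Carrier
    p′ i = proj₁ (proj₂ (h i))
    ratio : Fin n → Carrier
    ratio i = c (punchIn j i) * inv (c j)
    q : Fin n → Carrier → Carrier
    q i x = p′ (punchIn j i) x + (- ratio i) * p′ j x
    -- The coefficient of the pivot, chosen to cancel the multiples of p j that were subtracted from
    -- the others.
    s : Carrier
    s = - sumF (λ i → β i * ratio i)
    α : Fin (suc n) → Carrier
    α = VecF.insertAt β j s
    split : ∀ i x → p (punchIn j i) x ≡ ratio i * p j x + x * q i x
    split i x = begin
      p (punchIn j i) x ≡⟨ proj₁ (proj₂ (proj₂ (h (punchIn j i)))) x ⟩
      c (punchIn j i) + x * p′ (punchIn j i) x ≡⟨ cong (_+ x * p′ (punchIn j i) x) (sym (trans (*-assoc _ _ _) (trans (cong (c (punchIn j i) *_) (inv-* cj≢0)) (*-identityʳ _)))) ⟩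
      ratio i * c j + x * p′ (punchIn j i) x
        ≡⟨ solve 5 (λ r c x a b → r :* c :+ x :* a := r :* (c :+ x :* b) :+ x :* (a :+ (:- r) :* b)) refl (ratio i) (c j) x (p′ (punchIn j i) x) (p′ j x) ⟩
      ratio i * (c j + x * p′ j x) + x * q i x ≡⟨ cong (λ w → ratio i * w + x * q i x) (proj₁ (proj₂ (proj₂ (h j))) x) ⟨
      ratio i * p j x + x * q i x ∎
    rel : ∀ x → sumF (λ i → α i * p i x) ≡ 0#
    rel x = begin
      sumF (λ i → α i * p i x) ≡⟨ sum-remove {i = j} (λ i → α i * p i x) ⟩
      α j * p j x + sumF (λ i → α (punchIn j i) * p (punchIn j i) x)
        ≡⟨ cong₂ _+_ (cong (_* p j x) (VecFP.insertAt-lookup β j s)) (sum-cong-≗ (λ i → trans (cong₂ _*_ (VecFP.insertAt-punchIn β j s i) (split i x))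
             (solve 5 (λ b r p x q → b :* (r :* p :+ x :* q) := b :* r :* p :+ x :* (b :* q)) refl (β i) (ratio i) (p j x) x (q i x)))) ⟩
      s * p j x + sumF (λ i → β i * ratio i * p j x + x * (β i * q i x))
        ≡⟨ cong (s * p j x +_) (trans (∑-distrib-+ (λ i → β i * ratio i * p j x) (λ i → x * (β i * q i x)))
             (cong₂ _+_ (sumF-*ʳ (p j x) (λ i → β i * ratio i)) (trans (sumF-*ˡ x (λ i → β i * q i x)) (cong (x *_) (z x))))) ⟩
      s * p j x + (sumF (λ i → β i * ratio i) * p j x + x * 0#)
        ≡⟨ solve 3 (λ s p x → (:- s) :* p :+ (s :* p :+ x :* con 0ℤ) := con 0ℤ) refl (sumF (λ i → β i * ratio i)) (p j x) x ⟩
      0# ∎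

  -- Distinct degrees prevent cancellation of leading terms.
  triangular : ∀ n d (a : Fin n → Carrier) (e : Fin n → Carrier → Carrier) → (∀ i → Monic (d ℕ.+ toℕ i) (e i)) →
    (∀ i → a i ≡ 0#) ⊎ (∃ λ k → d ℕ.≤ k × k ℕ.< d ℕ.+ n × (∃ λ c → c ≢ 0# × (∃ λ m → Monic k m × (∀ x → sumF (λ i → a i * e i x) ≡ c * m x))))
  triangular zero d a e h = inj₁ (λ ())
  triangular (suc n) d a e h with triangular n (suc d) (λ i → a (suc i)) (λ i → e (suc i)) (λ i → subst (λ k → Monic k (e (suc i))) (ℕP.+-suc d (toℕ i)) (h (suc i)))
  ... | inj₂ (k , dk , kn , c , c≢0 , m , mm , f) = inj₂ (k , ℕP.<⇒≤ dk , subst (k ℕ.<_) (sym (ℕP.+-suc d n)) kn , c , c≢0 ,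
        (λ x → m x + inv c * a zero * e zero x) ,
        monic-+ k mm (poly-scale k (inv c * a zero) (poly-≤ dk (subst (λ k → Poly k (e zero)) (cong suc (ℕP.+-identityʳ d)) (monic⇒poly (d ℕ.+ 0) (h zero))))) ,
        λ x → begin
          a zero * e zero x + sumF (λ i → a (suc i) * e (suc i) x) ≡⟨ cong₂ _+_ (sym (trans (cong (_* (a zero * e zero x)) (*-inv c≢0)) (*-identityˡ _))) (f x) ⟩
          c * inv c * (a zero * e zero x) + c * m x ≡⟨ solve 5 (λ c v a e m → c :* v :* (a :* e) :+ c :* m := c :* (m :+ v :* a :* e)) refl c (inv c) (a zero) (e zero x) (m x) ⟩
          c * (m x + inv c * a zero * e zero x) ∎)
    where open ≡-Reasoning
  ... | inj₁ z with a zero ≟ 0#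
  ... | yes p = inj₁ (λ { zero → p ; (suc i) → z i })
  ... | no p = inj₂ (d , ℕP.≤-refl , ℕP.m<m+n d (s≤s z≤n) , a zero , p , e zero , subst (λ k → Monic k (e zero)) (ℕP.+-identityʳ d) (h zero) ,
      λ x → trans (cong (a zero * e zero x +_) (trans (sum-cong-≗ (λ i → trans (cong (_* e (suc i) x) (z i)) (zeroˡ _))) (sum-replicate-zero n))) (+-identityʳ _))

-- Frobenius and quadratic extensions

record Embedding (F E : OddField) : Set where
  private
    module F = OddField F
    module E = OddField E
  field
    emb : F.Carrier → E.Carrier
    emb-+ : ∀ x y → emb (x F.+ y) ≡ emb x E.+ emb y
    emb-* : ∀ x y → emb (x F.* y) ≡ emb x E.* emb y
    emb-1 : emb F.1# ≡ E.1#
    emb-injective : ∀ {x y} → emb x ≡ emb y → x ≡ y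

  emb-0 : emb F.0# ≡ E.0#
  emb-0 = E.+-cancelˡ (emb F.0#) (trans (sym (emb-+ F.0# F.0#)) (trans (cong emb (F.+-identityˡ F.0#)) (sym (E.+-identityʳ _))))

  emb-^ : ∀ x n → emb (x F.^ n) ≡ emb x E.^ n
  emb-^ x zero = emb-1
  emb-^ x (suc n) = trans (emb-* x (x F.^ n)) (cong (emb x E.*_) (emb-^ x n))

  emb-≢0 : ∀ {x} → x ≢ F.0# → emb x ≢ E.0#
  emb-≢0 p e = p (emb-injective (trans e (sym emb-0)))

-- Additivity of the q-th power is derived from Fermat's identity on F alone, with no appeal to a
-- prime characteristic or to binomial coefficients.
module Frobenius (F E : OddField) (ι : Embedding F E) (fermat : ∀ x → OddField._^_ F x (OddField.size F) ≡ x) where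
  private
    module F = OddField F
  open OddField E
  open Embedding ι
  open PolynomialFunctions E

  q : ℕ
  q = F.size

  emb-fixed : ∀ c → emb c ^ q ≡ emb c
  emb-fixed c = trans (sym (emb-^ c q)) (cong emb (fermat c))

  -- The leading terms cancel. The drop to degree below n is decisive: with n = q, the q elements of
  -- F are then enough roots to force a polynomial to vanish.
  ^-shift-poly : ∀ n y → Poly n (λ x → (x + y) ^ n - x ^ n)
  ^-shift-poly zero y x = -‿inverseʳ 1#
  ^-shift-poly (suc n) y = poly-cong (suc n)
    (λ x → solve 4 (λ x y a b → (x :+ y) :* a :- x :* b := x :* (a :- b) :+ y :* a) refl x y ((x + y) ^ n) (x ^ n))
    (poly-+ (suc n) (poly-x* n (^-shift-poly n y)) (poly-scale (suc n) y (monic⇒poly n (shifted n))))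
    where
    linear : Monic 1 (λ x → x + y)
    linear = y , (λ _ → 1#) , (λ x → solve 2 (λ x y → x :+ y := y :+ x :* con 1ℤ) refl x y) , (λ _ → refl)
    shifted : ∀ n → Monic n (λ x → (x + y) ^ n)
    shifted n = subst (λ k → Monic k (λ x → (x + y) ^ n)) (ℕP.*-identityʳ n) (monic-^ 1 linear n)

  private
    nonempty : 0 ℕ.< q
    nonempty = F.size-positive F.0#

    defect : Carrier → Carrier → Carrier
    defect y x = ((x + y) ^ q - x ^ q) - y ^ q

    const-poly : ∀ c → Poly q (λ _ → c)
    const-poly c = poly-≤ nonempty (c , (λ _ → 0#) , (λ x → solve 2 (λ c x → c := c :+ x :* con 0ℤ) refl c x) , (λ _ → refl))

    defect-poly : ∀ y → Poly q (defect y)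
    defect-poly y = poly-+ q (^-shift-poly q y) (const-poly (- (y ^ q)))

    defect-const : ∀ c x → defect (emb c) x ≡ 0#
    defect-const c = many-roots⇒zero F.finite emb emb-injective (defect-poly (emb c)) λ a → begin
      (emb a + emb c) ^ q - emb a ^ q - emb c ^ q ≡⟨ cong₂ (λ u v → u - v - emb c ^ q) (trans (cong (_^ q) (sym (emb-+ a c))) (emb-fixed (a F.+ c))) (emb-fixed a) ⟩
      emb (a F.+ c) - emb a - emb c ^ q ≡⟨ cong₂ (λ u v → u - emb a - v) (emb-+ a c) (emb-fixed c) ⟩
      emb a + emb c - emb a - emb c ≡⟨ solve 2 (λ a c → a :+ c :- a :- c := con 0ℤ) refl (emb a) (emb c) ⟩
      0# ∎
      where open ≡-Reasoning

    defect-zero : ∀ y x → defect y x ≡ 0#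
    defect-zero y = many-roots⇒zero F.finite emb emb-injective (defect-poly y) λ c →
      trans (solve 3 (λ s a b → s :- a :- b := s :- b :- a) refl ((emb c + y) ^ q) (emb c ^ q) (y ^ q))
        (trans (cong (λ w → w ^ q - y ^ q - emb c ^ q) (+-comm (emb c) y)) (defect-const c y))

  -- (X + y)^q - X^q - y^q has degree < q and vanishes on F, first for y in F and then for all y.
  frobenius-+ : ∀ x y → (x + y) ^ q ≡ x ^ q + y ^ q
  frobenius-+ x y = begin
    (x + y) ^ q ≡⟨ solve 3 (λ s a b → s := (s :- a :- b) :+ (a :+ b)) refl ((x + y) ^ q) (x ^ q) (y ^ q) ⟩
    defect y x + (x ^ q + y ^ q) ≡⟨ cong (_+ (x ^ q + y ^ q)) (defect-zero y x) ⟩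
    0# + (x ^ q + y ^ q) ≡⟨ +-identityˡ _ ⟩
    x ^ q + y ^ q ∎
    where open ≡-Reasoning

  frobenius^-+ : ∀ i x y → (x + y) ^ (q ℕ.^ i) ≡ x ^ (q ℕ.^ i) + y ^ (q ℕ.^ i)
  frobenius^-+ zero x y = solve 2 (λ x y → (x :+ y) :* con 1ℤ := x :* con 1ℤ :+ y :* con 1ℤ) refl x y
  frobenius^-+ (suc i) x y = begin
    (x + y) ^ (q ℕ.* q ℕ.^ i) ≡⟨ ^-assocʳ (x + y) q (q ℕ.^ i) ⟨
    ((x + y) ^ q) ^ (q ℕ.^ i) ≡⟨ cong (_^ (q ℕ.^ i)) (frobenius-+ x y) ⟩
    (x ^ q + y ^ q) ^ (q ℕ.^ i) ≡⟨ frobenius^-+ i (x ^ q) (y ^ q) ⟩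
    (x ^ q) ^ (q ℕ.^ i) + (y ^ q) ^ (q ℕ.^ i) ≡⟨ cong₂ _+_ (^-assocʳ x q (q ℕ.^ i)) (^-assocʳ y q (q ℕ.^ i)) ⟩
    x ^ (q ℕ.* q ℕ.^ i) + y ^ (q ℕ.* q ℕ.^ i) ∎
    where open ≡-Reasoning

  emb-fixed^ : ∀ i c → emb c ^ (q ℕ.^ i) ≡ emb c
  emb-fixed^ zero c = *-identityʳ _
  emb-fixed^ (suc i) c = trans (sym (^-assocʳ (emb c) q (q ℕ.^ i))) (trans (cong (_^ (q ℕ.^ i)) (emb-fixed c)) (emb-fixed^ i c))

  -- The field trace to F when n is the degree of E; for half that degree it is the low-degree
  -- function of Stepanov's method.
  powerTrace : ℕ → Carrier → Carrier
  powerTrace zero x = 0#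
  powerTrace (suc n) x = x ^ (q ℕ.^ n) + powerTrace n x

  powerTrace-+ : ∀ n x y → powerTrace n (x + y) ≡ powerTrace n x + powerTrace n y
  powerTrace-+ zero x y = sym (+-identityˡ 0#)
  powerTrace-+ (suc n) x y = trans (cong₂ _+_ (frobenius^-+ n x y) (powerTrace-+ n x y))
    (solve 4 (λ a b c d → a :+ b :+ (c :+ d) := a :+ c :+ (b :+ d)) refl (x ^ (q ℕ.^ n)) (y ^ (q ℕ.^ n)) (powerTrace n x) (powerTrace n y))

  powerTrace-add : ∀ m n x → powerTrace (m ℕ.+ n) x ≡ powerTrace m (x ^ (q ℕ.^ n)) + powerTrace n x
  powerTrace-add zero n x = sym (+-identityˡ _)
  powerTrace-add (suc m) n x = trans (cong₂ _+_
    (trans (cong (x ^_) (trans (cong (q ℕ.^_) (ℕP.+-comm m n)) (ℕP.^-distribˡ-+-* q n m))) (sym (^-assocʳ x (q ℕ.^ n) (q ℕ.^ m))))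
    (powerTrace-add m n x)) (sym (+-assoc _ _ _))

  powerTrace-^ : ∀ n i x → powerTrace n x ^ (q ℕ.^ i) ≡ powerTrace n (x ^ (q ℕ.^ i))
  powerTrace-^ zero i x = zero^ (q ℕ.^ i) (ℕP.m^n>0 q ⦃ ℕ.>-nonZero nonempty ⦄ i)
    where
    zero^ : ∀ n → 0 ℕ.< n → 0# ^ n ≡ 0#
    zero^ (suc n) _ = zeroˡ _
  powerTrace-^ (suc n) i x = trans (frobenius^-+ i (x ^ (q ℕ.^ n)) (powerTrace n x)) (cong₂ _+_
    (trans (^-assocʳ x (q ℕ.^ n) (q ℕ.^ i)) (trans (cong (x ^_) (ℕP.*-comm (q ℕ.^ n) (q ℕ.^ i))) (sym (^-assocʳ x (q ℕ.^ i) (q ℕ.^ n)))))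
    (powerTrace-^ n i x))

module Conjugation (E E′ : OddField) (ι : Embedding E E′) (fix : ∀ x → OddField._^_ E x (OddField.size E) ≡ x)
  (√d : OddField.Carrier E′) (d : OddField.Carrier E) (√d² : OddField._*_ E′ √d √d ≡ Embedding.emb ι d)
  (size-square : OddField.size E′ ≡ OddField.size E ℕ.* OddField.size E) where
  private
    module E = OddField E
  open OddField E′
  open Embedding ι
  open Frobenius E E′ ι fix
  open PolynomialFunctions E′

  element : E.Carrier → E.Carrier → Carrier
  element x y = emb x + emb y * √d

  private
    power : ∀ x y → element x y ^ q ≡ emb x + emb y * √d ^ q
    power x y = trans (frobenius-+ (emb x) (emb y * √d))
      (cong₂ _+_ (emb-fixed x) (trans (^-distrib-* (emb y) √d q) (cong (_* √d ^ q) (emb-fixed y))))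

    √d^-square : √d ^ q * √d ^ q ≡ √d * √d
    √d^-square = trans (sym (^-distrib-* √d √d q)) (trans (cong (_^ q) √d²) (trans (emb-fixed d) (sym √d²)))

  module _ (spans : ∀ z → ∃ λ x → ∃ λ y → z ≡ element x y) where

    private
      -- Otherwise X^q - X would vanish on all q² elements of E′.
      √d^≢√d : √d ^ q ≢ √d
      √d^≢√d e = ℤP.<⇒≱ (ℤ.+<+ lt) (subst (ℤ._≤ pos q) count (root-count finite (λ x → x) (λ e → e) q (monic-x^-x q E.1<size)))
        where
        all-fixed : ∀ z → z ^ q ≡ z
        all-fixed z with spans z
        ... | x , y , refl = trans (power x y) (cong (λ w → emb x + emb y * w) e)
        count : sum (λ z → ⟦ z ^ q - z ≟ 0# ⟧) ≡ pos size
        count = trans (∑-cong els (λ z → ⟦⟧-yes (z ^ q - z ≟ 0#) (trans (cong (_- z) (all-fixed z)) (-‿inverseʳ z))))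
          (trans (∑-const els 1ℤ) (ℤP.*-identityʳ _))
        lt : q ℕ.< size
        lt = subst (q ℕ.<_) (sym size-square) (ℕP.m<m*n q q ⦃ ℕ.>-nonZero (ℕP.<-trans (s≤s z≤n) E.1<size) ⦄ E.1<size)

    -- The q-th power fixes E and sends √d to another root of d, hence to √d or to -√d; the first is
    -- excluded.
    conjugate : ∀ x y → element x y ^ q ≡ emb x - emb y * √d
    conjugate x y with square-roots (√d ^ q) √d √d^-square
    ... | inj₁ p = ⊥-elim (√d^≢√d p)
    ... | inj₂ p = trans (power x y) (trans (cong (λ w → emb x + emb y * w) p)
        (solve 3 (λ x y r → x :+ y :* (:- r) := x :- y :* r) refl (emb x) (emb y) √d))

    conjugate-+ : ∀ x y → element x y + element x y ^ q ≡ emb (x E.+ x)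
    conjugate-+ x y = trans (cong (element x y +_) (conjugate x y))
      (trans (solve 2 (λ x z → x :+ z :+ (x :- z) := x :+ x) refl (emb x) (emb y * √d)) (sym (emb-+ x x)))

    -- Two conjugations cancel. Thus Fermat's identity passes from E to E′ and the construction can
    -- be iterated.
    all-fixed² : ∀ z → z ^ size ≡ z
    all-fixed² z with spans z
    ... | x , y , refl = begin
      element x y ^ size ≡⟨ cong (element x y ^_) size-square ⟩
      element x y ^ (q ℕ.* q) ≡⟨ ^-assocʳ (element x y) q q ⟨
      (element x y ^ q) ^ q ≡⟨ cong (_^ q) flip ⟩
      element x (E.- y) ^ q ≡⟨ conjugate x (E.- y) ⟩
      emb x - emb (E.- y) * √d ≡⟨ cong (λ w → emb x - w * √d) emb-neg ⟩
      emb x - (- emb y) * √d ≡⟨ solve 3 (λ x y r → x :- (:- y) :* r := x :+ y :* r) refl (emb x) (emb y) √d ⟩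
      element x y ∎
      where
      open ≡-Reasoning
      emb-neg : emb (E.- y) ≡ - emb y
      emb-neg = +-cancelˡ (emb y) (trans (sym (emb-+ y (E.- y))) (trans (cong emb (E.-‿inverseʳ y)) (trans emb-0 (sym (-‿inverseʳ (emb y))))))
      flip : element x y ^ q ≡ element x (E.- y)
      flip = trans (conjugate x y) (trans (solve 3 (λ x y r → x :- y :* r := x :+ (:- y) :* r) refl (emb x) (emb y) √d)
        (cong (λ w → emb x + w * √d) (sym emb-neg)))

module Quadratic (E : OddField) (d : OddField.Carrier E) (nd : OddField.Nonsquare E d) where
  open OddField E

  infixl 6 _⊕_
  infixl 7 _⊗_

  Pair : Set
  Pair = Carrier × Carrier

  _⊕_ _⊗_ : Pair → Pair → Pair
  (a , b) ⊕ (c , e) = a + c , b + e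
  (a , b) ⊗ (c , e) = a * c + d * (b * e) , a * e + b * c

  ⊖_ : Pair → Pair
  ⊖ (a , b) = - a , - b

  norm : Carrier → Carrier → Carrier
  norm a b = a * a - d * (b * b)

  isCommutativeRing′ : IsCommutativeRing _≡_ _⊕_ _⊗_ ⊖_ (0# , 0#) (1# , 0#)
  isCommutativeRing′ = record
    { isRing = record
      { +-isAbelianGroup = record
        { isGroup = record
          { isMonoid = record
            { isSemigroup = record
              { isMagma = record { isEquivalence = isEquivalence ; ∙-cong = cong₂ _⊕_ }
              ; assoc = λ { (a , b) (c , e) (f , g) → cong₂ _,_ (+-assoc a c f) (+-assoc b e g) } }
            ; identity = (λ { (a , b) → cong₂ _,_ (+-identityˡ a) (+-identityˡ b) }) , (λ { (a , b) → cong₂ _,_ (+-identityʳ a) (+-identityʳ b) }) }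
          ; inverse = (λ { (a , b) → cong₂ _,_ (-‿inverseˡ a) (-‿inverseˡ b) }) , (λ { (a , b) → cong₂ _,_ (-‿inverseʳ a) (-‿inverseʳ b) })
          ; ⁻¹-cong = cong ⊖_ }
        ; comm = λ { (a , b) (c , e) → cong₂ _,_ (+-comm a c) (+-comm b e) } }
      ; *-cong = cong₂ _⊗_
      ; *-assoc = λ { (a , b) (c , e) (f , g) → cong₂ _,_
          (solve 7 (λ d a b c e f g → (a :* c :+ d :* (b :* e)) :* f :+ d :* ((a :* e :+ b :* c) :* g) := a :* (c :* f :+ d :* (e :* g)) :+ d :* (b :* (c :* g :+ e :* f))) refl d a b c e f g)
          (solve 7 (λ d a b c e f g → (a :* c :+ d :* (b :* e)) :* g :+ (a :* e :+ b :* c) :* f := a :* (c :* g :+ e :* f) :+ b :* (c :* f :+ d :* (e :* g))) refl d a b c e f g) }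
      ; *-identity = (λ { (a , b) → cong₂ _,_
            (solve 3 (λ d a b → con 1ℤ :* a :+ d :* (con 0ℤ :* b) := a) refl d a b) (solve 2 (λ a b → con 1ℤ :* b :+ con 0ℤ :* a := b) refl a b) })
          , (λ { (a , b) → cong₂ _,_
            (solve 3 (λ d a b → a :* con 1ℤ :+ d :* (b :* con 0ℤ) := a) refl d a b) (solve 2 (λ a b → a :* con 0ℤ :+ b :* con 1ℤ := b) refl a b) })
      ; distrib = (λ { (a , b) (c , e) (f , g) → cong₂ _,_
            (solve 7 (λ d a b c e f g → a :* (c :+ f) :+ d :* (b :* (e :+ g)) := (a :* c :+ d :* (b :* e)) :+ (a :* f :+ d :* (b :* g))) refl d a b c e f g)
            (solve 6 (λ a b c e f g → a :* (e :+ g) :+ b :* (c :+ f) := (a :* e :+ b :* c) :+ (a :* g :+ b :* f)) refl a b c e f g) })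
          , (λ { (a , b) (c , e) (f , g) → cong₂ _,_
            (solve 7 (λ d a b c e f g → (c :+ f) :* a :+ d :* ((e :+ g) :* b) := (c :* a :+ d :* (e :* b)) :+ (f :* a :+ d :* (g :* b))) refl d a b c e f g)
            (solve 6 (λ a b c e f g → (c :+ f) :* b :+ (e :+ g) :* a := (c :* b :+ e :* a) :+ (f :* b :+ g :* a)) refl a b c e f g) }) }
    ; *-comm = λ { (a , b) (c , e) → cong₂ _,_
        (solve 5 (λ d a b c e → a :* c :+ d :* (b :* e) := c :* a :+ d :* (e :* b)) refl d a b c e)
        (solve 4 (λ a b c e → a :* e :+ b :* c := c :* b :+ e :* a) refl a b c e) } }

  -- For b ≠ 0 the equation would make d the square of a/b.
  norm≡0 : ∀ a b → norm a b ≡ 0# → (a , b) ≡ (0# , 0#)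
  norm≡0 a b e with b ≟ 0#
  ... | no b≢0 = ⊥-elim (nd (a * inv b) (begin
          a * inv b * (a * inv b) ≡⟨ solve 2 (λ a v → a :* v :* (a :* v) := a :* a :* (v :* v)) refl a (inv b) ⟩
          a * a * (inv b * inv b) ≡⟨ cong (_* (inv b * inv b)) (x-y≡0⇒x≡y e) ⟩
          d * (b * b) * (inv b * inv b) ≡⟨ solve 3 (λ d b v → d :* (b :* b) :* (v :* v) := d :* ((b :* v) :* (b :* v))) refl d b (inv b) ⟩
          d * (b * inv b * (b * inv b)) ≡⟨ cong (λ w → d * (w * w)) (*-inv b≢0) ⟩
          d * (1# * 1#) ≡⟨ solve 1 (λ d → d :* (con 1ℤ :* con 1ℤ) := d) refl d ⟩
          d ∎))
    where open ≡-Reasoning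
  ... | yes refl with zero-product a a (trans (solve 2 (λ a d → a :* a := a :* a :- d :* (con 0ℤ :* con 0ℤ)) refl a d) e)
  ... | inj₁ p = cong (_, 0#) p
  ... | inj₂ p = cong (_, 0#) p

  pair-inv : Carrier → Carrier → Pair
  pair-inv a b = a * inv (norm a b) , (- b) * inv (norm a b)

  pair-*-inv : ∀ a b → norm a b ≢ 0# → (a , b) ⊗ pair-inv a b ≡ (1# , 0#)
  pair-*-inv a b ne = cong₂ _,_
    (trans (solve 4 (λ d a b v → a :* (a :* v) :+ d :* (b :* (:- b :* v)) := (a :* a :- d :* (b :* b)) :* v) refl d a b (inv (norm a b))) (*-inv ne))
    (solve 3 (λ a b v → a :* (:- b :* v) :+ b :* (a :* v) := con 0ℤ) refl a b (inv (norm a b)))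

  extension : OddField
  extension = record
    { Carrier = Pair ; _+_ = _⊕_ ; _*_ = _⊗_ ; -_ = ⊖_ ; 0# = 0# , 0# ; 1# = 1# , 0#
    ; isCommutativeRing = isCommutativeRing′
    ; 1≢0 = λ e → 1≢0 (cong proj₁ e)
    ; inverse = λ { (a , b) ne → pair-inv a b , pair-*-inv a b (λ e → ne (norm≡0 a b e)) }
    ; 2≢0 = λ e → 2≢0 (cong proj₁ e)
    ; finite = finite-× finite finite
    }

  private module E′ = OddField extension

  extension-size : E′.size ≡ size ℕ.* size
  extension-size = ℤP.+-injective (begin
    pos E′.size ≡⟨ ℤP.*-identityʳ (pos E′.size) ⟨
    pos E′.size ℤ.* 1ℤ ≡⟨ ∑-const E′.els 1ℤ ⟨
    E′.sum (λ _ → 1ℤ) ≡⟨ ∑-cartesian _,_ els els (λ _ → 1ℤ) ⟩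
    sum (λ _ → sum (λ _ → 1ℤ)) ≡⟨ ∑-const els (sum (λ _ → 1ℤ)) ⟩
    pos size ℤ.* sum (λ _ → 1ℤ) ≡⟨ cong (pos size ℤ.*_) (trans (∑-const els 1ℤ) (ℤP.*-identityʳ (pos size))) ⟩
    pos size ℤ.* pos size ≡⟨ ℤP.pos-* size size ⟨
    pos (size ℕ.* size) ∎)
    where open ≡-Reasoning

  extension-sum : ∀ f → E′.sum f ≡ sum (λ x → sum (λ y → f (x , y)))
  extension-sum f = ∑-cartesian _,_ els els f

  inclusion : Embedding E extension
  inclusion = record
    { emb = λ x → x , 0#
    ; emb-+ = λ x y → cong (x + y ,_) (sym (+-identityˡ 0#))
    ; emb-* = λ x y → cong₂ _,_ (solve 3 (λ d x y → x :* y := x :* y :+ d :* (con 0ℤ :* con 0ℤ)) refl d x y)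
        (solve 2 (λ x y → con 0ℤ := x :* con 0ℤ :+ con 0ℤ :* y) refl x y)
    ; emb-1 = refl
    ; emb-injective = cong proj₁ }

  norm-zero : norm 0# 0# ≡ 0#
  norm-zero = solve 1 (λ d → con 0ℤ :* con 0ℤ :- d :* (con 0ℤ :* con 0ℤ) := con 0ℤ) refl d

  inv≡pair-inv : ∀ a b → norm a b ≢ 0# → E′.inv (a , b) ≡ pair-inv a b
  inv≡pair-inv a b ne = E′.*-cancelˡ {a , b} z≢0 (trans (E′.*-inv {a , b} z≢0) (sym (pair-*-inv a b ne)))
    where
    z≢0 : (a , b) ≢ (0# , 0#)
    z≢0 refl = ne norm-zero

  √d : Pair
  √d = 0# , 1#

  √d² : √d ⊗ √d ≡ (d , 0#)
  √d² = cong₂ _,_ (solve 1 (λ d → con 0ℤ :* con 0ℤ :+ d :* (con 1ℤ :* con 1ℤ) := d) refl d) (solve 0 (con 0ℤ :* con 1ℤ :+ con 1ℤ :* con 0ℤ := con 0ℤ) refl)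

  decompose : ∀ x y → (x , y) ≡ (x , 0#) ⊕ (y , 0#) ⊗ √d
  decompose x y = cong₂ _,_
    (solve 3 (λ d x y → x := x :+ (y :* con 0ℤ :+ d :* (con 0ℤ :* con 1ℤ))) refl d x y)
    (solve 1 (λ y → y := con 0ℤ :+ (y :* con 1ℤ :+ con 0ℤ :* con 0ℤ)) refl y)

embedding-∘ : {F E E′ : OddField} → Embedding F E → Embedding E E′ → Embedding F E′
embedding-∘ ι κ = record
  { emb = λ x → κ.emb (ι.emb x)
  ; emb-+ = λ x y → trans (cong κ.emb (ι.emb-+ x y)) (κ.emb-+ _ _)
  ; emb-* = λ x y → trans (cong κ.emb (ι.emb-* x y)) (κ.emb-* _ _)
  ; emb-1 = trans (cong κ.emb ι.emb-1) κ.emb-1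
  ; emb-injective = λ e → ι.emb-injective (κ.emb-injective e) }
  where
  module ι = Embedding ι
  module κ = Embedding κ

module _ (F : OddField) (fermat : ∀ x → OddField._^_ F x (OddField.size F) ≡ x) where
  private
    module F = OddField F

  -- The trace is carried as F-valued data. `emb-Tr` identifies it with the sum of conjugates, and
  -- `sum-Tr` is its equidistribution, tested on functions of mean zero.
  record Extension (n : ℕ) : Set₁ where
    field
      E : OddField
      ι : Embedding F E
      size-E : OddField.size E ≡ F.size ℕ.^ n
      fixed : ∀ x → OddField._^_ E x (OddField.size E) ≡ x
      Tr : OddField.Carrier E → F.Carrier
      emb-Tr : ∀ x → Embedding.emb ι (Tr x) ≡ Frobenius.powerTrace F E ι fermat n x
      sum-Tr : ∀ f → F.MeanZero f → OddField.sum E (λ x → f (Tr x)) ≡ 0ℤ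

    open Embedding ι public
    open Frobenius F E ι fermat public

    private module E = OddField E

    Tr-+ : ∀ x y → Tr (x E.+ y) ≡ Tr x F.+ Tr y
    Tr-+ x y = emb-injective (trans (emb-Tr (x E.+ y)) (trans (powerTrace-+ n x y)
      (trans (sym (cong₂ E._+_ (emb-Tr x) (emb-Tr y))) (sym (emb-+ (Tr x) (Tr y))))))

    Tr-0 : Tr E.0# ≡ F.0#
    Tr-0 = F.+-cancelˡ (Tr E.0#) (trans (sym (Tr-+ E.0# E.0#)) (trans (cong Tr (E.+-identityˡ E.0#)) (sym (F.+-identityʳ _))))

    Tr-neg : ∀ x → Tr (E.- x) ≡ F.- Tr x
    Tr-neg x = F.+-cancelˡ (Tr x) (trans (sym (Tr-+ x (E.- x))) (trans (cong Tr (E.-‿inverseʳ x)) (trans Tr-0 (sym (F.-‿inverseʳ (Tr x))))))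

  base : Extension 1
  base = record
    { E = F
    ; ι = record { emb = λ x → x ; emb-+ = λ _ _ → refl ; emb-* = λ _ _ → refl ; emb-1 = refl ; emb-injective = λ e → e }
    ; size-E = sym (ℕP.*-identityʳ F.size)
    ; fixed = fermat
    ; Tr = λ x → x
    ; emb-Tr = λ x → F.solve 1 (λ x → x F.:= x F.:* F.con 1ℤ F.:+ F.con 0ℤ) refl x
    ; sum-Tr = λ f m → m }

  module Step {n : ℕ} (L : Extension n) where
    open Extension L
    private
      module E = OddField E

    d : E.Carrier
    d = proj₁ E.exists-nonsquare

    nd : E.Nonsquare d
    nd = proj₂ E.exists-nonsquare

    module Q = Quadratic E d nd

    private
      module Abstract (E′ : OddField) (κ : Embedding E E′) (√d : OddField.Carrier E′)
        (√d² : OddField._*_ E′ √d √d ≡ Embedding.emb κ d)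
        (size-square : OddField.size E′ ≡ E.size ℕ.* E.size)
        (re im : OddField.Carrier E′ → E.Carrier)
        (coordinates : ∀ z → z ≡ Conjugation.element E E′ κ fixed √d d √d² size-square (re z) (im z))
        (sum-Tr′ : ∀ f → F.MeanZero f → OddField.sum E′ (λ z → f (Tr (re z E.+ re z))) ≡ 0ℤ) where
        module E′ = OddField E′
        module κ = Embedding κ
        open Conjugation E E′ κ fixed √d d √d² size-square
        module Fr = Frobenius F E′ (embedding-∘ ι κ) fermat

        spans : ∀ z → ∃ λ x → ∃ λ y → z ≡ element x y
        spans z = re z , im z , coordinates z

        size′ : E′.size ≡ F.size ℕ.^ (n ℕ.+ n)
        size′ = trans size-square (trans (cong₂ ℕ._*_ size-E size-E) (sym (ℕP.^-distribˡ-+-* F.size n n)))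

        fixed′ : ∀ z → z E′.^ E′.size ≡ z
        fixed′ = all-fixed² spans

        emb-powerTrace : ∀ m x → κ.emb (powerTrace m x) ≡ Fr.powerTrace m (κ.emb x)
        emb-powerTrace zero x = κ.emb-0
        emb-powerTrace (suc m) x = trans (κ.emb-+ _ _) (cong₂ E′._+_ (κ.emb-^ x (F.size ℕ.^ m)) (emb-powerTrace m x))

        -- Transitivity of the trace: the trace of x + y√d down to E is 2x, and it is the element
        -- plus its |E|-th power. Its n conjugates are therefore the 2n conjugates over F.
        emb-Tr′ : ∀ x y → κ.emb (emb (Tr (x E.+ x))) ≡ Fr.powerTrace (n ℕ.+ n) (element x y)
        emb-Tr′ x y = begin
          κ.emb (emb (Tr (x E.+ x))) ≡⟨ cong κ.emb (emb-Tr (x E.+ x)) ⟩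
          κ.emb (powerTrace n (x E.+ x)) ≡⟨ emb-powerTrace n (x E.+ x) ⟩
          Fr.powerTrace n (κ.emb (x E.+ x)) ≡⟨ cong (Fr.powerTrace n) (conjugate-+ spans x y) ⟨
          Fr.powerTrace n (element x y E′.+ element x y E′.^ E.size) ≡⟨ Fr.powerTrace-+ n (element x y) (element x y E′.^ E.size) ⟩
          Fr.powerTrace n (element x y) E′.+ Fr.powerTrace n (element x y E′.^ E.size) ≡⟨ E′.+-comm _ _ ⟩
          Fr.powerTrace n (element x y E′.^ E.size) E′.+ Fr.powerTrace n (element x y)
            ≡⟨ cong (λ k → Fr.powerTrace n (element x y E′.^ k) E′.+ Fr.powerTrace n (element x y)) size-E ⟩
          Fr.powerTrace n (element x y E′.^ (F.size ℕ.^ n)) E′.+ Fr.powerTrace n (element x y) ≡⟨ Fr.powerTrace-add n n (element x y) ⟨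
          Fr.powerTrace (n ℕ.+ n) (element x y) ∎
          where open ≡-Reasoning

        level : Extension (n ℕ.+ n)
        level = record
          { E = E′ ; ι = embedding-∘ ι κ ; size-E = size′ ; fixed = fixed′
          ; Tr = λ z → Tr (re z E.+ re z)
          ; emb-Tr = λ z → trans (emb-Tr′ (re z) (im z)) (cong (Fr.powerTrace (n ℕ.+ n)) (sym (coordinates z)))
          ; sum-Tr = sum-Tr′ }

      double : ∀ x → x E.+ x ≡ E.2# E.* x
      double x = E.solve 1 (λ x → x E.:+ x E.:= (E.con 1ℤ E.:+ E.con 1ℤ) E.:* x) refl x

      -- The first coordinate is uniform on E, and doubling is a bijection in odd characteristic.
      sum-double : ∀ f → F.MeanZero f → OddField.sum Q.extension (λ z → f (Tr (proj₁ z E.+ proj₁ z))) ≡ 0ℤ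
      sum-double f m = trans (Q.extension-sum (λ z → f (Tr (proj₁ z E.+ proj₁ z))))
          (trans (∑-cong E.els (λ x → ∑-const E.els (f (Tr (x E.+ x)))))
            (trans (∑-*ˡ E.els (pos E.size) (λ x → f (Tr (x E.+ x))))
              (trans (cong (pos E.size ℤ.*_) (trans (∑-cong E.els (λ x → cong (λ z → f (Tr z)) (double x)))
                (trans (E.sum-scale E.2≢0 (λ x → f (Tr x))) (sum-Tr f m)))) (ℤP.*-zeroʳ (pos E.size)))))

    next : Extension (n ℕ.+ n)
    next = Abstract.level Q.extension Q.inclusion Q.√d Q.√d² Q.extension-size proj₁ proj₂ (λ z → Q.decompose (proj₁ z) (proj₂ z)) sum-double

  -- degree⁻ k + 1 = 2^k
  degree⁻ : ℕ → ℕ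
  degree⁻ zero = zero
  degree⁻ (suc k) = degree⁻ k ℕ.+ suc (degree⁻ k)

  -- By the form of `degree⁻`, the degree at level suc k is by definition a sum of two equal
  -- successors, the even degree on which Stepanov's method is set up.
  tower : ∀ k → Extension (suc (degree⁻ k))
  tower zero = base
  tower (suc k) = Step.next (tower k)

-- Kloosterman operators

module Nonzero (E : OddField) where
  open OddField E

  nz : Carrier → ℤ
  nz s = ⟦ ¬? (s ≟ 0#) ⟧

  nz-zero : nz 0# ≡ 0ℤ
  nz-zero = ⟦⟧-no (¬? (0# ≟ 0#)) (λ p → p refl)

  nz-one : ∀ {s} → s ≢ 0# → nz s ≡ 1ℤ
  nz-one {s} p = ⟦⟧-yes (¬? (s ≟ 0#)) p

  nz-* : ∀ s t → nz (s * t) ≡ nz s ℤ.* nz t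
  nz-* s t = ⟦⟧-× (¬? (s * t ≟ 0#)) (¬? (s ≟ 0#)) (¬? (t ≟ 0#))
    (λ p → (λ e → p (trans (cong (_* t) e) (zeroˡ t))) , (λ e → p (trans (cong (s *_) e) (zeroʳ s)))) *-≢0

  inv-product : ∀ {s t} → s ≢ 0# → t ≢ 0# → inv (s * t) ≡ inv s * inv t
  inv-product {s} {t} p r = *-cancelˡ (*-≢0 p r) (trans (*-inv (*-≢0 p r)) (sym (begin
    s * t * (inv s * inv t) ≡⟨ solve 4 (λ s t u v → s :* t :* (u :* v) := s :* u :* (t :* v)) refl s t (inv s) (inv t) ⟩
    s * inv s * (t * inv t) ≡⟨ cong₂ _*_ (*-inv p) (*-inv r) ⟩
    1# * 1# ≡⟨ *-identityˡ 1# ⟩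
    1# ∎)))
    where open ≡-Reasoning

  neg-≢0 : ∀ {s} → s ≢ 0# → - s ≢ 0#
  neg-≢0 {s} p e = p (trans (sym (-‿involutive s)) (trans (cong -_ e) -0#≈0#))

  inv-neg : ∀ {s} → s ≢ 0# → inv (- s) ≡ - inv s
  inv-neg {s} p = *-cancelˡ (neg-≢0 p) (trans (*-inv (neg-≢0 p))
    (sym (trans (solve 2 (λ s u → (:- s) :* (:- u) := s :* u) refl s (inv s)) (*-inv p))))

  -- For s = x + y√d with inverse norm v, the left side is twice the rational part of s + β/s as
  -- multiplication of pairs produces it.
  twice-real-part : ∀ x d β v u → (x + (β * (x * v) + d * (0# * u))) + (x + (β * (x * v) + d * (0# * u))) ≡ x + x + β * ((x + x) * v)
  twice-real-part x d β v u = trans (cong (λ w → w + w) (solve 4 (λ x z d u → x :+ (z :+ d :* (con 0ℤ :* u)) := x :+ z) refl x (β * (x * v)) d u))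
    (solve 3 (λ x β v → x :+ β :* (x :* v) :+ (x :+ β :* (x :* v)) := x :+ x :+ β :* ((x :+ x) :* v)) refl x β v)

  -- The substitution s = x + y, t = x - y is invertible as 2 is; it trades the product s t for the
  -- difference of squares x² - y².
  sum-rotate : ∀ (Φ : Carrier → Carrier → ℤ) →
    sum (λ s → sum (λ t → Φ s t)) ≡ sum (λ x → sum (λ y → Φ (x + y) (x - y)))
  sum-rotate Φ = trans (sym (∑-cartesian _,_ els els (λ p → Φ (proj₁ p) (proj₂ p))))
    (trans (sym (∑-reindex (finite-× finite finite) (finite-× finite finite)
        (λ p → proj₁ p + proj₂ p , proj₁ p - proj₂ p)
        (λ p → half * (proj₁ p + proj₂ p) , half * (proj₁ p - proj₂ p))
        (λ { (x , y) → cong₂ _,_ (trans (cong (half *_) (solve 2 (λ x y → x :+ y :+ (x :- y) := (con 1ℤ :+ con 1ℤ) :* x) refl x y)) (halve x))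
                                (trans (cong (half *_) (solve 2 (λ x y → x :+ y :- (x :- y) := (con 1ℤ :+ con 1ℤ) :* y) refl x y)) (halve y)) })
        (λ { (s , t) → cong₂ _,_ (trans (solve 3 (λ h s t → h :* (s :+ t) :+ h :* (s :- t) := h :* ((con 1ℤ :+ con 1ℤ) :* s)) refl half s t) (halve s))
                                (trans (solve 3 (λ h s t → h :* (s :+ t) :- h :* (s :- t) := h :* ((con 1ℤ :+ con 1ℤ) :* t)) refl half s t) (halve t)) })
        (λ p → Φ (proj₁ p) (proj₂ p))))
      (∑-cartesian _,_ els els (λ p → Φ (proj₁ p + proj₂ p) (proj₁ p - proj₂ p))))
    where
    halve : ∀ x → half * (2# * x) ≡ x
    halve x = trans (sym (*-assoc half 2# x)) (trans (cong (_* x) (inv-* 2≢0)) (*-identityˡ x))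

module Kloosterman (F : OddField) (fermat : ∀ x → OddField._^_ F x (OddField.size F) ≡ x)
  (b : OddField.Carrier F) (b≢0 : b ≢ OddField.0# F) where
  private
    module F = OddField F

  module Operator {n : ℕ} (L : Extension F fermat n) where
    open Extension L
    open OddField E
    open Nonzero E

    β : Carrier
    β = emb b

    phase : Carrier → F.Carrier
    phase s = Tr (s + β * inv s)

    -- On an additive character ψ of F it acts as multiplication by the Kloosterman sum of ψ(Tr(s +
    -- β/s)) over E, so its norm on mean zero functions controls all nontrivial ones at once.
    K : (F.Carrier → ℤ) → F.Carrier → ℤ
    K f ξ = sum (λ s → nz s ℤ.* f (ξ F.+ phase s))

    private
      phase-neg : ∀ s → s ≢ 0# → phase (- s) ≡ F.- phase s
      phase-neg s p = trans (cong Tr (trans (cong (λ w → - s + β * w) (inv-neg p))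
        (solve 3 (λ s β u → :- s :+ β :* (:- u) := :- (s :+ β :* u)) refl s β (inv s)))) (Tr-neg _)

      term-neg : ∀ s (g : F.Carrier → ℤ) ξ → nz (- s) ℤ.* g (ξ F.+ phase (- s)) ≡ nz s ℤ.* g (ξ F.- phase s)
      term-neg s g ξ = cases (s ≟ 0#)
        where
        cases : Dec (s ≡ 0#) → nz (- s) ℤ.* g (ξ F.+ phase (- s)) ≡ nz s ℤ.* g (ξ F.- phase s)
        cases (yes refl) = trans (cong (ℤ._* g (ξ F.+ phase (- 0#))) (trans (cong nz -0#≈0#) nz-zero))
          (sym (cong (ℤ._* g (ξ F.- phase 0#)) nz-zero))
        cases (no p) = cong₂ ℤ._*_ (trans (nz-one (neg-≢0 p)) (sym (nz-one p))) (cong (λ w → g (ξ F.+ w)) (phase-neg s p))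

    -- The phase is odd in s, so the substitution s ↦ -s turns the adjoint of `K` into `K`.
    K-symmetric : ∀ f g → F.sum (λ ξ → f ξ ℤ.* K g ξ) ≡ F.sum (λ ξ → K f ξ ℤ.* g ξ)
    K-symmetric f g = begin
      F.sum (λ ξ → f ξ ℤ.* K g ξ) ≡⟨ ∑-cong F.els (λ ξ → sym (∑-*ˡ els (f ξ) (λ s → nz s ℤ.* g (ξ F.+ phase s)))) ⟩
      F.sum (λ ξ → sum (λ s → f ξ ℤ.* (nz s ℤ.* g (ξ F.+ phase s)))) ≡⟨ ∑-swap F.els els (λ ξ s → f ξ ℤ.* (nz s ℤ.* g (ξ F.+ phase s))) ⟩
      sum (λ s → F.sum (λ ξ → f ξ ℤ.* (nz s ℤ.* g (ξ F.+ phase s)))) ≡⟨ ∑-cong els shift ⟩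
      sum (λ s → F.sum (λ ξ → (nz (- s) ℤ.* f (ξ F.+ phase (- s))) ℤ.* g ξ))
        ≡⟨ sum-neg (λ s → F.sum (λ ξ → (nz s ℤ.* f (ξ F.+ phase s)) ℤ.* g ξ)) ⟩
      sum (λ s → F.sum (λ ξ → (nz s ℤ.* f (ξ F.+ phase s)) ℤ.* g ξ)) ≡⟨ ∑-swap els F.els (λ s ξ → (nz s ℤ.* f (ξ F.+ phase s)) ℤ.* g ξ) ⟩
      F.sum (λ ξ → sum (λ s → (nz s ℤ.* f (ξ F.+ phase s)) ℤ.* g ξ)) ≡⟨ ∑-cong F.els (λ ξ → ∑-*ʳ els (g ξ) (λ s → nz s ℤ.* f (ξ F.+ phase s))) ⟩
      F.sum (λ ξ → K f ξ ℤ.* g ξ) ∎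
      where
      open ≡-Reasoning
      comm : ∀ a c e → a ℤ.* (c ℤ.* e) ≡ (c ℤ.* a) ℤ.* e
      comm = solve-∀
      shift : ∀ s → F.sum (λ ξ → f ξ ℤ.* (nz s ℤ.* g (ξ F.+ phase s))) ≡ F.sum (λ ξ → (nz (- s) ℤ.* f (ξ F.+ phase (- s))) ℤ.* g ξ)
      shift s = begin
        F.sum (λ ξ → f ξ ℤ.* (nz s ℤ.* g (ξ F.+ phase s)))
          ≡⟨ F.sum-shift (F.- phase s) (λ ξ → f ξ ℤ.* (nz s ℤ.* g (ξ F.+ phase s))) ⟨
        F.sum (λ ξ → f (F.- phase s F.+ ξ) ℤ.* (nz s ℤ.* g (F.- phase s F.+ ξ F.+ phase s)))
          ≡⟨ ∑-cong F.els (λ ξ → trans (cong₂ (λ u v → f u ℤ.* (nz s ℤ.* g v)) (F.+-comm _ ξ)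
               (F.solve 2 (λ p x → F.:- p F.:+ x F.:+ p F.:= x) refl (phase s) ξ)) (comm (f (ξ F.- phase s)) (nz s) (g ξ))) ⟩
        F.sum (λ ξ → (nz s ℤ.* f (ξ F.- phase s)) ℤ.* g ξ) ≡⟨ ∑-cong F.els (λ ξ → cong (ℤ._* g ξ) (term-neg s f ξ)) ⟨
        F.sum (λ ξ → (nz (- s) ℤ.* f (ξ F.+ phase (- s))) ℤ.* g ξ) ∎

    -- The summand of K (K f), as a function of the sum σ and the product π of the two variables.
    Ψ : (F.Carrier → ℤ) → F.Carrier → Carrier → Carrier → ℤ
    Ψ f ξ σ π = nz π ℤ.* f (ξ F.+ Tr (σ + β * (σ * inv π)))

    -- The sum s + t + β (1/s + 1/t) depends only on σ = s + t and π = s t. After rotation these are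
    -- 2x and x² - y².
    K² : ∀ f ξ → K (K f) ξ ≡ sum (λ x → sum (λ y → Ψ f ξ (x + x) (x * x - y * y)))
    K² f ξ = begin
      K (K f) ξ ≡⟨ ∑-cong els (λ s → sym (∑-*ˡ els (nz s) (λ t → nz t ℤ.* f (ξ F.+ phase s F.+ phase t)))) ⟩
      sum (λ s → sum (λ t → nz s ℤ.* (nz t ℤ.* f (ξ F.+ phase s F.+ phase t)))) ≡⟨ ∑-cong els (λ s → ∑-cong els (λ t → term s t)) ⟩
      sum (λ s → sum (λ t → Ψ f ξ (s + t) (s * t))) ≡⟨ sum-rotate (λ s t → Ψ f ξ (s + t) (s * t)) ⟩
      sum (λ x → sum (λ y → Ψ f ξ (x + y + (x - y)) ((x + y) * (x - y))))
        ≡⟨ ∑-cong els (λ x → ∑-cong els (λ y → cong₂ (Ψ f ξ) (solve 2 (λ x y → x :+ y :+ (x :- y) := x :+ x) refl x y)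
             (solve 2 (λ x y → (x :+ y) :* (x :- y) := x :* x :- y :* y) refl x y))) ⟩
      sum (λ x → sum (λ y → Ψ f ξ (x + x) (x * x - y * y))) ∎
      where
      open ≡-Reasoning
      term : ∀ s t → nz s ℤ.* (nz t ℤ.* f (ξ F.+ phase s F.+ phase t)) ≡ Ψ f ξ (s + t) (s * t)
      term s t = cases (s ≟ 0#) (t ≟ 0#)
        where
        value : ℤ
        value = f (ξ F.+ Tr (s + t + β * ((s + t) * inv (s * t))))
        vanish : nz s ≡ 0ℤ ⊎ nz t ≡ 0ℤ → nz s ℤ.* (nz t ℤ.* f (ξ F.+ phase s F.+ phase t)) ≡ nz (s * t) ℤ.* value
        vanish (inj₁ e) = trans (cong (ℤ._* (nz t ℤ.* f (ξ F.+ phase s F.+ phase t))) e)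
          (sym (cong (ℤ._* value) (trans (nz-* s t) (cong (ℤ._* nz t) e))))
        vanish (inj₂ e) = trans (trans (cong (λ w → nz s ℤ.* (w ℤ.* f (ξ F.+ phase s F.+ phase t))) e) (ℤP.*-zeroʳ (nz s)))
          (sym (cong (ℤ._* value) (trans (nz-* s t) (trans (cong (nz s ℤ.*_) e) (ℤP.*-zeroʳ (nz s))))))
        cases : Dec (s ≡ 0#) → Dec (t ≡ 0#) → nz s ℤ.* (nz t ℤ.* f (ξ F.+ phase s F.+ phase t)) ≡ Ψ f ξ (s + t) (s * t)
        cases (yes p) _ = vanish (inj₁ (trans (cong nz p) nz-zero))
        cases (no _) (yes r) = vanish (inj₂ (trans (cong nz r) nz-zero))
        cases (no p) (no r) = trans (trans (sym (ℤP.*-assoc (nz s) (nz t) (f (ξ F.+ phase s F.+ phase t)))) (cong (ℤ._* f (ξ F.+ phase s F.+ phase t)) (sym (nz-* s t))))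
            (cong (λ w → nz (s * t) ℤ.* f w) (sym (trans (cong (ξ F.+_) (trans (cong Tr arg) (Tr-+ _ _))) (sym (F.+-assoc _ _ _)))))
          where
          arg : s + t + β * ((s + t) * inv (s * t)) ≡ (s + β * inv s) + (t + β * inv t)
          arg = begin
            s + t + β * ((s + t) * inv (s * t)) ≡⟨ cong (λ w → s + t + β * ((s + t) * w)) (inv-product p r) ⟩
            s + t + β * ((s + t) * (inv s * inv t))
              ≡⟨ solve 5 (λ s t β u v → s :+ t :+ β :* ((s :+ t) :* (u :* v)) := s :+ t :+ β :* ((s :* u) :* v :+ (t :* v) :* u)) refl s t β (inv s) (inv t) ⟩
            s + t + β * ((s * inv s) * inv t + (t * inv t) * inv s) ≡⟨ cong₂ (λ u v → s + t + β * (u * inv t + v * inv s)) (*-inv p) (*-inv r) ⟩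
            s + t + β * (1# * inv t + 1# * inv s)
              ≡⟨ solve 5 (λ s t β u v → s :+ t :+ β :* (con 1ℤ :* v :+ con 1ℤ :* u) := s :+ β :* u :+ (t :+ β :* v)) refl s t β (inv s) (inv t) ⟩
            (s + β * inv s) + (t + β * inv t) ∎

    -- For fixed π the argument is (1 + β/π) σ. Its trace is equidistributed in σ and the inner sum
    -- vanishes, except for π = -β, where the argument is constantly zero.
    sum-Ψ : ∀ f → F.MeanZero f → ∀ ξ → sum (λ σ → sum (λ π → Ψ f ξ σ π)) ≡ pos size ℤ.* f ξ
    sum-Ψ f m ξ = begin
      sum (λ σ → sum (λ π → Ψ f ξ σ π)) ≡⟨ ∑-swap els els (Ψ f ξ) ⟩
      sum (λ π → sum (λ σ → Ψ f ξ σ π)) ≡⟨ ∑-cong els inner ⟩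
      sum (λ π → ⟦ π ≟ - β ⟧ ℤ.* (pos size ℤ.* f ξ)) ≡⟨ ∑-δ (- β) (λ _ → pos size ℤ.* f ξ) ⟩
      pos size ℤ.* f ξ ∎
      where
      open ≡-Reasoning
      slope : Carrier → Carrier
      slope π = 1# + β * inv π
      factor : ∀ σ π → σ + β * (σ * inv π) ≡ slope π * σ
      factor σ π = solve 3 (λ σ β u → σ :+ β :* (σ :* u) := (con 1ℤ :+ β :* u) :* σ) refl σ β (inv π)
      inner : ∀ π → sum (λ σ → Ψ f ξ σ π) ≡ ⟦ π ≟ - β ⟧ ℤ.* (pos size ℤ.* f ξ)
      inner π = trans (∑-*ˡ els (nz π) (λ σ → f (ξ F.+ Tr (σ + β * (σ * inv π))))) (cases (π ≟ 0#))
        where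
        cases : Dec (π ≡ 0#) → nz π ℤ.* sum (λ σ → f (ξ F.+ Tr (σ + β * (σ * inv π)))) ≡ ⟦ π ≟ - β ⟧ ℤ.* (pos size ℤ.* f ξ)
        cases (yes refl) = trans (cong (ℤ._* sum (λ σ → f (ξ F.+ Tr (σ + β * (σ * inv 0#))))) nz-zero)
          (sym (cong (ℤ._* (pos size ℤ.* f ξ)) (⟦⟧-no (0# ≟ - β) (λ e → neg-≢0 (emb-≢0 b≢0) (sym e)))))
        cases (no p) = trans (trans (cong (ℤ._* sum (λ σ → f (ξ F.+ Tr (σ + β * (σ * inv π))))) (nz-one p)) (ℤP.*-identityˡ _)) (cases′ (π ≟ - β))
          where
          cases′ : (dec : Dec (π ≡ - β)) → sum (λ σ → f (ξ F.+ Tr (σ + β * (σ * inv π)))) ≡ ⟦ dec ⟧ ℤ.* (pos size ℤ.* f ξ)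
          cases′ (yes e) = trans (∑-cong els (λ σ → cong f (trans (cong (ξ F.+_) (trans (cong Tr (trans (factor σ π) (trans (cong (_* σ) slope≡0) (zeroˡ σ)))) Tr-0)) (F.+-identityʳ ξ))))
              (trans (∑-const els (f ξ)) (sym (ℤP.*-identityˡ _)))
            where
            slope≡0 : slope π ≡ 0#
            slope≡0 = trans (cong (λ w → 1# + w * inv π) (trans (sym (-‿involutive β)) (cong -_ (sym e))))
              (trans (solve 2 (λ p u → con 1ℤ :+ (:- p) :* u := con 1ℤ :- p :* u) refl π (inv π)) (trans (cong (λ w → 1# - w) (*-inv p)) (-‿inverseʳ 1#)))
          cases′ (no ne) = trans (∑-cong els (λ σ → cong (λ z → f (ξ F.+ Tr z)) (factor σ π)))
              (trans (sum-scale slope≢0 (λ σ → f (ξ F.+ Tr σ))) (sum-Tr (λ c → f (ξ F.+ c)) (trans (F.sum-shift ξ f) m)))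
            where
            slope≢0 : slope π ≢ 0#
            slope≢0 e = ne (begin
              π ≡⟨ *-identityʳ π ⟨
              π * 1# ≡⟨ solve 3 (λ p β u → p :* con 1ℤ := p :* (con 1ℤ :+ β :* u) :- β :* (p :* u)) refl π β (inv π) ⟩
              π * slope π - β * (π * inv π) ≡⟨ cong₂ (λ u v → π * u - β * v) e (*-inv p) ⟩
              π * 0# - β * 1# ≡⟨ solve 2 (λ p β → p :* con 0ℤ :- β :* con 1ℤ := :- β) refl π β ⟩
              - β ∎)

    -- The norm of `K` on mean zero functions is at most M √|E|, squared so as to stay in ℤ.
    P : ℤ → Set
    P M = ∀ f → F.MeanZero f → F.sum (λ ξ → K f ξ ℤ.* K f ξ) ℤ.≤ (M ℤ.* M ℤ.* pos size) ℤ.* F.sum (λ ξ → f ξ ℤ.* f ξ)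

  module Doubling {n : ℕ} (L : Extension F fermat n) where
    open Extension L
    open OddField E
    open Nonzero E
    open Operator L
    open Step F fermat L using (d; nd; next; module Q)
    private
      module K′ = Operator next
      module E′ = OddField Q.extension

    private
      trace-shift : ∀ x → E′.Carrier → F.Carrier
      trace-shift x w = Tr ((x + (β * proj₁ w + d * (0# * proj₂ w))) + (x + (β * proj₁ w + d * (0# * proj₂ w))))

      phase-next : ∀ x y → Q.norm x y ≢ 0# → K′.phase (x , y) ≡ Tr (x + x + β * ((x + x) * inv (Q.norm x y)))
      phase-next x y ne = trans (cong (trace-shift x) {E′.inv (x , y)} {Q.pair-inv x y} inverse-formula) real-part
        where
        inverse-formula : E′.inv (x , y) ≡ Q.pair-inv x y
        inverse-formula = Q.inv≡pair-inv x y ne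
        real-part : trace-shift x (Q.pair-inv x y) ≡ Tr (x + x + β * ((x + x) * inv (Q.norm x y)))
        real-part = cong Tr (twice-real-part x d β (inv (Q.norm x y)) ((- y) * inv (Q.norm x y)))

    -- An element x + y√d has trace 2x and norm x² - d y², and s + β/s has trace 2x (1 + β/norm). So
    -- the expression for `K²` reappears with d y² in place of y².
    K-next : ∀ f ξ → K′.K f ξ ≡ sum (λ x → sum (λ y → Ψ f ξ (x + x) (x * x - d * (y * y))))
    K-next f ξ = trans (Q.extension-sum (λ s → Nonzero.nz Q.extension s ℤ.* f (ξ F.+ K′.phase s)))
      (∑-cong els (λ x → ∑-cong els (λ y → term x y (Q.norm x y ≟ 0#))))
      where
      open ≡-Reasoning
      term : ∀ x y → Dec (Q.norm x y ≡ 0#) → Nonzero.nz Q.extension (x , y) ℤ.* f (ξ F.+ K′.phase (x , y)) ≡ Ψ f ξ (x + x) (x * x - d * (y * y))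
      term x y (yes e) = trans (cong (ℤ._* f (ξ F.+ K′.phase (x , y))) (⟦⟧-no (¬? ((x , y) E′.≟ E′.0#)) (λ ne → ne (Q.norm≡0 x y e))))
        (sym (cong (ℤ._* f (ξ F.+ Tr (x + x + β * ((x + x) * inv (Q.norm x y))))) (trans (cong nz e) nz-zero)))
      term x y (no ne) = cong₂ ℤ._*_
        (trans (⟦⟧-yes (¬? ((x , y) E′.≟ E′.0#)) (λ e → ne (trans (cong (λ z → Q.norm (proj₁ z) (proj₂ z)) e) Q.norm-zero))) (sym (nz-one ne)))
        (cong (λ z → f (ξ F.+ z)) (phase-next x y ne))

    -- In the sum of the two expressions y² and d y² cover E twice, so π becomes a free variable and
    -- `sum-Ψ` applies. On a character this is the relation between α + ᾱ and α² + ᾱ² for Frobenius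
    -- eigenvalues with α ᾱ = |E|.
    doubling : ∀ f → F.MeanZero f → ∀ ξ → K (K f) ξ ℤ.+ K′.K f ξ ≡ pos 2 ℤ.* (pos size ℤ.* f ξ)
    doubling f m ξ = begin
      K (K f) ξ ℤ.+ K′.K f ξ ≡⟨ cong₂ ℤ._+_ (K² f ξ) (K-next f ξ) ⟩
      sum (λ x → sum (λ y → h x (y * y))) ℤ.+ sum (λ x → sum (λ y → h x (d * (y * y))))
        ≡⟨ ∑-+ els (λ x → sum (λ y → h x (y * y))) (λ x → sum (λ y → h x (d * (y * y)))) ⟨
      sum (λ x → sum (λ y → h x (y * y)) ℤ.+ sum (λ y → h x (d * (y * y)))) ≡⟨ ∑-cong els (λ x → sum-square-classes nd (h x)) ⟩
      sum (λ x → pos 2 ℤ.* sum (h x)) ≡⟨ ∑-*ˡ els (pos 2) (λ x → sum (h x)) ⟩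
      pos 2 ℤ.* sum (λ x → sum (h x)) ≡⟨ cong (pos 2 ℤ.*_) (trans (∑-cong els reflect) (trans (∑-cong els (λ x → cong (λ z → sum (Ψ f ξ z)) (double x)))
          (trans (sum-scale 2≢0 (λ σ → sum (Ψ f ξ σ))) (sum-Ψ f m ξ)))) ⟩
      pos 2 ℤ.* (pos size ℤ.* f ξ) ∎
      where
      open ≡-Reasoning
      h : Carrier → Carrier → ℤ
      h x ρ = Ψ f ξ (x + x) (x * x - ρ)
      double : ∀ x → x + x ≡ 2# * x
      double x = solve 1 (λ x → x :+ x := (con 1ℤ :+ con 1ℤ) :* x) refl x
      reflect : ∀ x → sum (h x) ≡ sum (Ψ f ξ (x + x))
      reflect x = trans (sum-neg (λ ρ → Ψ f ξ (x + x) (x * x + ρ))) (sum-shift (x * x) (Ψ f ξ (x + x)))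

    -- By symmetry ‖K f‖² is the inner product of f with K² f = 2 |E| f - K′ f. As |E′| = |E|², the
    -- assumption bounds the last term by (M + 1) |E| ‖f‖², and M² - 2 - (M + 1) = (M - 3) (M + 2) +
    -- 3 is positive.
    descent : ∀ M → pos 3 ℤ.≤ M → K′.P (M ℤ.+ 1ℤ) → P M
    descent M 3≤M bound f m = ℤP.≤-trans (ℤP.≤-reflexive energy) (ℤP.≤-trans
        (ℤP.+-monoʳ-≤ (pos 2 ℤ.* (Q ℤ.* N)) inner-bound) final)
      where
      open ≡-Reasoning
      N Q I : ℤ
      N = F.sum (λ ξ → f ξ ℤ.* f ξ)
      Q = pos size
      I = F.sum (λ ξ → f ξ ℤ.* K′.K f ξ)
      N≥0 : 0ℤ ℤ.≤ N
      N≥0 = ∑-nonneg F.els (λ ξ → sq-nonneg (f ξ))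
      Q≥0 : 0ℤ ℤ.≤ Q
      Q≥0 = ℤ.+≤+ z≤n
      M+1≥0 : 0ℤ ℤ.≤ M ℤ.+ 1ℤ
      M+1≥0 = ℤP.≤-trans (ℤ.+≤+ z≤n) (ℤP.+-monoˡ-≤ 1ℤ 3≤M)
      rearrange : ∀ a k l → k ℤ.+ l ≡ a → k ≡ a ℤ.- l
      rearrange a k l e = trans (lem k l) (cong (ℤ._- l) e)
        where
        lem : ∀ k l → k ≡ k ℤ.+ l ℤ.- l
        lem = solve-∀
      spread : ∀ a q k → a ℤ.* (pos 2 ℤ.* (q ℤ.* a) ℤ.- k) ≡ (pos 2 ℤ.* q) ℤ.* (a ℤ.* a) ℤ.- a ℤ.* k
      spread = solve-∀
      energy : F.sum (λ ξ → K f ξ ℤ.* K f ξ) ≡ pos 2 ℤ.* (Q ℤ.* N) ℤ.+ ℤ.- I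
      energy = begin
        F.sum (λ ξ → K f ξ ℤ.* K f ξ) ≡⟨ K-symmetric f (K f) ⟨
        F.sum (λ ξ → f ξ ℤ.* K (K f) ξ) ≡⟨ ∑-cong F.els (λ ξ → trans (cong (f ξ ℤ.*_) (rearrange _ (K (K f) ξ) (K′.K f ξ) (doubling f m ξ))) (spread (f ξ) Q (K′.K f ξ))) ⟩
        F.sum (λ ξ → (pos 2 ℤ.* Q) ℤ.* (f ξ ℤ.* f ξ) ℤ.- f ξ ℤ.* K′.K f ξ)
          ≡⟨ ∑-sub F.els (λ ξ → (pos 2 ℤ.* Q) ℤ.* (f ξ ℤ.* f ξ)) (λ ξ → f ξ ℤ.* K′.K f ξ) ⟩
        F.sum (λ ξ → (pos 2 ℤ.* Q) ℤ.* (f ξ ℤ.* f ξ)) ℤ.- I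
          ≡⟨ cong (ℤ._- I) (trans (∑-*ˡ F.els (pos 2 ℤ.* Q) (λ ξ → f ξ ℤ.* f ξ)) (ℤP.*-assoc (pos 2) Q N)) ⟩
        pos 2 ℤ.* (Q ℤ.* N) ℤ.+ ℤ.- I ∎
      neg-sq : ∀ a → (ℤ.- a) ℤ.* (ℤ.- a) ≡ a ℤ.* a
      neg-sq = solve-∀
      collect : ∀ N M Q → N ℤ.* (M ℤ.* M ℤ.* (Q ℤ.* Q) ℤ.* N) ≡ (M ℤ.* (Q ℤ.* N)) ℤ.* (M ℤ.* (Q ℤ.* N))
      collect = solve-∀
      inner-bound : ℤ.- I ℤ.≤ (M ℤ.+ 1ℤ) ℤ.* (Q ℤ.* N)
      inner-bound = square-cancel-≤ (*-nonneg M+1≥0 (*-nonneg Q≥0 N≥0))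
        (ℤP.≤-trans (ℤP.≤-reflexive (neg-sq I)) (ℤP.≤-trans (cauchy-schwarz F.els f (K′.K f))
          (ℤP.≤-trans (*-monoˡ N≥0 (bound f m)) (ℤP.≤-reflexive (trans
            (cong (λ s → N ℤ.* ((M ℤ.+ 1ℤ) ℤ.* (M ℤ.+ 1ℤ) ℤ.* s ℤ.* N)) (trans (cong pos Q.extension-size) (ℤP.pos-* size size)))
            (collect N (M ℤ.+ 1ℤ) Q))))))
      gap : ∀ M Q N → (M ℤ.* M ℤ.* Q) ℤ.* N ℤ.- (pos 2 ℤ.* (Q ℤ.* N) ℤ.+ (M ℤ.+ 1ℤ) ℤ.* (Q ℤ.* N))
        ≡ ((M ℤ.- pos 3) ℤ.* (M ℤ.+ pos 2) ℤ.+ pos 3) ℤ.* (Q ℤ.* N)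
      gap = solve-∀
      final : pos 2 ℤ.* (Q ℤ.* N) ℤ.+ (M ℤ.+ 1ℤ) ℤ.* (Q ℤ.* N) ℤ.≤ (M ℤ.* M ℤ.* Q) ℤ.* N
      final = ≤-from-diff (subst (0ℤ ℤ.≤_) (sym (gap M Q N)) (*-nonneg
        (ℤP.+-mono-≤ (*-nonneg (diff-nonneg 3≤M) (ℤP.≤-trans (ℤ.+≤+ z≤n) (ℤP.+-monoˡ-≤ (pos 2) 3≤M))) (ℤ.+≤+ z≤n)) (*-nonneg Q≥0 N≥0)))

  -- An upper bound on all fibre counts bounds them from below as well, as their total is known.
  module Fibres {n : ℕ} (L : Extension F fermat n) where
    open Extension L
    open OddField E
    open Nonzero E
    open Operator L

    count : F.Carrier → ℤ
    count c = sum (λ s → nz s ℤ.* ⟦ phase s F.≟ c ⟧)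

    K-fibres : ∀ f ξ → K f ξ ≡ F.sum (λ c → count c ℤ.* f (ξ F.+ c))
    K-fibres f ξ = begin
      sum (λ s → nz s ℤ.* f (ξ F.+ phase s)) ≡⟨ ∑-cong els (λ s → cong (nz s ℤ.*_) (sym (F.∑-δ′ (phase s) (λ c → f (ξ F.+ c))))) ⟩
      sum (λ s → nz s ℤ.* F.sum (λ c → ⟦ phase s F.≟ c ⟧ ℤ.* f (ξ F.+ c)))
        ≡⟨ ∑-cong els (λ s → trans (sym (∑-*ˡ F.els (nz s) (λ c → ⟦ phase s F.≟ c ⟧ ℤ.* f (ξ F.+ c))))
             (∑-cong F.els (λ c → sym (ℤP.*-assoc (nz s) ⟦ phase s F.≟ c ⟧ (f (ξ F.+ c)))))) ⟩
      sum (λ s → F.sum (λ c → nz s ℤ.* ⟦ phase s F.≟ c ⟧ ℤ.* f (ξ F.+ c))) ≡⟨ ∑-swap els F.els (λ s c → nz s ℤ.* ⟦ phase s F.≟ c ⟧ ℤ.* f (ξ F.+ c)) ⟩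
      F.sum (λ c → sum (λ s → nz s ℤ.* ⟦ phase s F.≟ c ⟧ ℤ.* f (ξ F.+ c))) ≡⟨ ∑-cong F.els (λ c → ∑-*ʳ els (f (ξ F.+ c)) (λ s → nz s ℤ.* ⟦ phase s F.≟ c ⟧)) ⟩
      F.sum (λ c → count c ℤ.* f (ξ F.+ c)) ∎
      where open ≡-Reasoning

    sum-nz : sum nz ≡ pos size ℤ.- 1ℤ
    sum-nz = trans (∑-cong els complement) (trans (∑-sub els (λ _ → 1ℤ) (λ s → ⟦ s ≟ 0# ⟧))
      (cong₂ ℤ._-_ (trans (∑-const els 1ℤ) (ℤP.*-identityʳ (pos size))) (once 0#)))
      where
      complement : ∀ s → nz s ≡ 1ℤ ℤ.- ⟦ s ≟ 0# ⟧
      complement s with s ≟ 0#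
      ... | yes _ = refl
      ... | no _ = refl

    sum-count : F.sum count ≡ pos size ℤ.- 1ℤ
    sum-count = trans (∑-swap F.els els (λ c s → nz s ℤ.* ⟦ phase s F.≟ c ⟧))
      (trans (∑-cong els (λ s → trans (∑-*ˡ F.els (nz s) (λ c → ⟦ phase s F.≟ c ⟧))
        (trans (cong (nz s ℤ.*_) (trans (∑-cong F.els (λ c → ⟦⟧-cong (phase s F.≟ c) (c F.≟ phase s) sym sym)) (F.once (phase s)))) (ℤP.*-identityʳ (nz s)))))
        sum-nz)

    -- On mean zero functions the weights `count c` may be replaced by `count c` - A. Up to sign
    -- these are nonnegative with total D, and convolution with such weights has norm at most D.
    fibre-bound : ∀ A → (∀ c → count c ℤ.≤ A) → ∀ f → F.MeanZero f →
      let D = pos F.size ℤ.* A ℤ.- (pos size ℤ.- 1ℤ) in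
      F.sum (λ ξ → K f ξ ℤ.* K f ξ) ℤ.≤ (D ℤ.* D) ℤ.* F.sum (λ ξ → f ξ ℤ.* f ξ)
    fibre-bound A le f m = ℤP.≤-trans (∑-mono F.els pointwise) (ℤP.≤-reflexive total)
      where
      open ≡-Reasoning
      D : ℤ
      D = pos F.size ℤ.* A ℤ.- (pos size ℤ.- 1ℤ)
      δ : F.Carrier → ℤ
      δ c = A ℤ.- count c
      δ≥0 : ∀ c → 0ℤ ℤ.≤ δ c
      δ≥0 c = diff-nonneg (le c)
      sum-δ : F.sum δ ≡ D
      sum-δ = trans (∑-sub F.els (λ _ → A) count) (cong₂ ℤ._-_ (∑-const F.els A) sum-count)
      expand : ∀ a c x → c ℤ.* x ≡ a ℤ.* x ℤ.- (a ℤ.- c) ℤ.* x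
      expand = solve-∀
      K-δ : ∀ ξ → K f ξ ≡ ℤ.- F.sum (λ c → δ c ℤ.* f (ξ F.+ c))
      K-δ ξ = begin
        K f ξ ≡⟨ K-fibres f ξ ⟩
        F.sum (λ c → count c ℤ.* f (ξ F.+ c)) ≡⟨ ∑-cong F.els (λ c → expand A (count c) (f (ξ F.+ c))) ⟩
        F.sum (λ c → A ℤ.* f (ξ F.+ c) ℤ.- δ c ℤ.* f (ξ F.+ c)) ≡⟨ ∑-sub F.els (λ c → A ℤ.* f (ξ F.+ c)) (λ c → δ c ℤ.* f (ξ F.+ c)) ⟩
        F.sum (λ c → A ℤ.* f (ξ F.+ c)) ℤ.- F.sum (λ c → δ c ℤ.* f (ξ F.+ c))
          ≡⟨ cong (ℤ._- F.sum (λ c → δ c ℤ.* f (ξ F.+ c))) (trans (∑-*ˡ F.els A (λ c → f (ξ F.+ c))) (trans (cong (A ℤ.*_) (trans (F.sum-shift ξ f) m)) (ℤP.*-zeroʳ A))) ⟩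
        0ℤ ℤ.- F.sum (λ c → δ c ℤ.* f (ξ F.+ c)) ≡⟨ ℤP.+-identityˡ _ ⟩
        ℤ.- F.sum (λ c → δ c ℤ.* f (ξ F.+ c)) ∎
      neg-sq : ∀ a → (ℤ.- a) ℤ.* (ℤ.- a) ≡ a ℤ.* a
      neg-sq = solve-∀
      pointwise : ∀ ξ → K f ξ ℤ.* K f ξ ℤ.≤ D ℤ.* F.sum (λ c → δ c ℤ.* (f (ξ F.+ c) ℤ.* f (ξ F.+ c)))
      pointwise ξ = subst₂ ℤ._≤_
        (trans (cong (λ w → w ℤ.* w) (∑-cong F.els (λ c → cong (δ c ℤ.*_) (ℤP.*-identityˡ (f (ξ F.+ c))))))
          (sym (trans (cong (λ w → w ℤ.* w) (K-δ ξ)) (neg-sq (F.sum (λ c → δ c ℤ.* f (ξ F.+ c)))))))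
        (cong (ℤ._* F.sum (λ c → δ c ℤ.* (f (ξ F.+ c) ℤ.* f (ξ F.+ c)))) (trans (∑-cong F.els (λ c → ℤP.*-identityʳ (δ c))) sum-δ))
        (weighted-cauchy-schwarz F.els δ (λ _ → 1ℤ) (λ c → f (ξ F.+ c)) δ≥0)
      N : ℤ
      N = F.sum (λ ξ → f ξ ℤ.* f ξ)
      total : F.sum (λ ξ → D ℤ.* F.sum (λ c → δ c ℤ.* (f (ξ F.+ c) ℤ.* f (ξ F.+ c)))) ≡ (D ℤ.* D) ℤ.* N
      total = begin
        F.sum (λ ξ → D ℤ.* F.sum (λ c → δ c ℤ.* (f (ξ F.+ c) ℤ.* f (ξ F.+ c)))) ≡⟨ ∑-*ˡ F.els D (λ ξ → F.sum (λ c → δ c ℤ.* (f (ξ F.+ c) ℤ.* f (ξ F.+ c)))) ⟩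
        D ℤ.* F.sum (λ ξ → F.sum (λ c → δ c ℤ.* (f (ξ F.+ c) ℤ.* f (ξ F.+ c)))) ≡⟨ cong (D ℤ.*_) (∑-swap F.els F.els (λ ξ c → δ c ℤ.* (f (ξ F.+ c) ℤ.* f (ξ F.+ c)))) ⟩
        D ℤ.* F.sum (λ c → F.sum (λ ξ → δ c ℤ.* (f (ξ F.+ c) ℤ.* f (ξ F.+ c)))) ≡⟨ cong (D ℤ.*_) (∑-cong F.els (λ c → trans
            (∑-*ˡ F.els (δ c) (λ ξ → f (ξ F.+ c) ℤ.* f (ξ F.+ c))) (cong (δ c ℤ.*_) (trans (∑-cong F.els (λ ξ → cong (λ z → f z ℤ.* f z) (F.+-comm ξ c))) (F.sum-shift c (λ z → f z ℤ.* f z)))))) ⟩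
        D ℤ.* F.sum (λ c → δ c ℤ.* N) ≡⟨ cong (D ℤ.*_) (trans (∑-*ʳ F.els N δ) (cong (ℤ._* N) sum-δ)) ⟩
        D ℤ.* (D ℤ.* N) ≡⟨ ℤP.*-assoc D D N ⟨
        (D ℤ.* D) ℤ.* N ∎

-- Stepanov's method

module Stepanov (F : OddField) (fermat : ∀ x → OddField._^_ F x (OddField.size F) ≡ x)
  (b : OddField.Carrier F) (b≢0 : b ≢ OddField.0# F)
  (h′ : ℕ) (L : Extension F fermat (suc h′ ℕ.+ suc h′)) where
  private
    module F = OddField F
  open Kloosterman F fermat b b≢0
  open Extension L
  open OddField E
  open Nonzero E
  open Operator L
  open PolynomialFunctions E
  open Fibres L
  private module Mon = Algebra.Solver.CommutativeMonoid *-commutativeMonoid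

  -- Here |E| = Q₀², and l = Q₀/q is both the degree of `T` in s and the order of its pole at 0.
  h l Q₀ : ℕ
  h = suc h′
  l = q ℕ.^ h′
  Q₀ = q ℕ.^ h

  private
    1<q : 1 ℕ.< q
    1<q = F.1<size

    instance
      q-nonZero : ℕ.NonZero q
      q-nonZero = ℕ.>-nonZero (ℕP.<-trans (s≤s z≤n) 1<q)
      l-nonZero : ℕ.NonZero l
      l-nonZero = ℕP.m^n≢0 q h′

  size≡ : size ≡ Q₀ ℕ.* Q₀
  size≡ = trans size-E (ℕP.^-distribˡ-+-* q h h)

  φ : Carrier → Carrier
  φ x = x ^ Q₀

  φ-+ : ∀ x y → φ (x + y) ≡ φ x + φ y
  φ-+ = frobenius^-+ h

  φφ : ∀ x → φ (φ x) ≡ x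
  φφ x = trans (^-assocʳ x Q₀ Q₀) (trans (cong (x ^_) (sym size≡)) (fixed x))

  φ-0 : φ 0# ≡ 0#
  φ-0 = +-cancelˡ (φ 0#) (trans (sym (φ-+ 0# 0#)) (trans (cong φ (+-identityˡ 0#)) (sym (+-identityʳ _))))

  φ-sum : ∀ {n} (f : Fin n → Carrier) → φ (sumF f) ≡ sumF (λ i → φ (f i))
  φ-sum {zero} f = φ-0
  φ-sum {suc n} f = trans (φ-+ (f zero) (sumF (λ i → f (suc i)))) (cong (φ (f zero) +_) (φ-sum (λ i → f (suc i))))

  φ-^ : ∀ x n → φ (x ^ n) ≡ φ x ^ n
  φ-^ x n = trans (^-assocʳ x n Q₀) (trans (cong (x ^_) (ℕP.*-comm n Q₀)) (sym (^-assocʳ x Q₀ n)))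

  g : Carrier → Carrier
  g s = s + β * inv s

  T : Carrier → Carrier
  T s = powerTrace h (g s)

  -- The Q₀-th power of the first half of the trace is the second half.
  φ-T : ∀ s → φ (T s) ≡ emb (phase s) - T s
  φ-T s = begin
    φ (T s) ≡⟨ solve 2 (λ a t → a := (a :+ t) :- t) refl (φ (T s)) (T s) ⟩
    φ (T s) + T s - T s ≡⟨ cong (λ w → w + T s - T s) (powerTrace-^ h h (g s)) ⟩
    powerTrace h (g s ^ Q₀) + T s - T s ≡⟨ cong (_- T s) (powerTrace-add h h (g s)) ⟨
    powerTrace (h ℕ.+ h) (g s) - T s ≡⟨ cong (_- T s) (emb-Tr (g s)) ⟨
    emb (phase s) - T s ∎
    where open ≡-Reasoning

  -- s^l · powerTrace m (s + β/s), without denominators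
  tau : ℕ → Carrier → Carrier
  tau zero s = 0#
  tau (suc m) s = s ^ (l ℕ.+ q ℕ.^ m) + (β * s ^ (l ℕ.∸ q ℕ.^ m) + tau m s)

  q^≤l : ∀ {m} → m ℕ.< h → q ℕ.^ m ℕ.≤ l
  q^≤l (s≤s le) = ℕP.^-monoʳ-≤ q le

  tau≡ : ∀ m → m ℕ.≤ h → ∀ {s} → s ≢ 0# → tau m s ≡ s ^ l * powerTrace m (g s)
  tau≡ zero le {s} ne = sym (zeroʳ _)
  tau≡ (suc m) le {s} ne = sym (begin
    s ^ l * (g s ^ (q ℕ.^ m) + powerTrace m (g s)) ≡⟨ distribˡ _ _ _ ⟩
    s ^ l * g s ^ (q ℕ.^ m) + s ^ l * powerTrace m (g s) ≡⟨ cong₂ _+_ top (sym (tau≡ m (ℕP.<⇒≤ le) ne)) ⟩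
    s ^ (l ℕ.+ q ℕ.^ m) + β * s ^ (l ℕ.∸ q ℕ.^ m) + tau m s ≡⟨ +-assoc _ _ _ ⟩
    tau (suc m) s ∎)
    where
    open ≡-Reasoning
    k : ℕ
    k = q ℕ.^ m
    unit : s ^ k * inv s ^ k ≡ 1#
    unit = trans (sym (^-distrib-* s (inv s) k)) (trans (cong (_^ k) (*-inv ne)) (one^ k))
    top : s ^ l * g s ^ k ≡ s ^ (l ℕ.+ k) + β * s ^ (l ℕ.∸ k)
    top = begin
      s ^ l * g s ^ k ≡⟨ cong (s ^ l *_) (trans (frobenius^-+ m s (β * inv s)) (cong (s ^ k +_) (trans (^-distrib-* β (inv s) k) (cong (_* inv s ^ k) (emb-fixed^ m b))))) ⟩
      s ^ l * (s ^ k + β * inv s ^ k) ≡⟨ distribˡ _ _ _ ⟩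
      s ^ l * s ^ k + s ^ l * (β * inv s ^ k) ≡⟨ cong₂ _+_ (sym (^-homo-* s l k)) (begin
          s ^ l * (β * inv s ^ k) ≡⟨ cong (λ e → s ^ e * (β * inv s ^ k)) (sym (ℕP.m∸n+n≡m (q^≤l le))) ⟩
          s ^ (l ℕ.∸ k ℕ.+ k) * (β * inv s ^ k) ≡⟨ cong (_* (β * inv s ^ k)) (^-homo-* s (l ℕ.∸ k) k) ⟩
          s ^ (l ℕ.∸ k) * s ^ k * (β * inv s ^ k) ≡⟨ solve 4 (λ x y β u → x :* y :* (β :* u) := β :* x :* (y :* u)) refl (s ^ (l ℕ.∸ k)) (s ^ k) β (inv s ^ k) ⟩
          β * s ^ (l ℕ.∸ k) * (s ^ k * inv s ^ k) ≡⟨ trans (cong (β * s ^ (l ℕ.∸ k) *_) unit) (*-identityʳ _) ⟩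
          β * s ^ (l ℕ.∸ k) ∎) ⟩
      s ^ (l ℕ.+ k) + β * s ^ (l ℕ.∸ k) ∎

  private
    1≤l : 1 ℕ.≤ l
    1≤l = ℕ.>-nonZero⁻¹ l

    low-poly : ∀ m → Poly (l ℕ.+ l) (λ s → β * s ^ (l ℕ.∸ q ℕ.^ m))
    low-poly m = poly-scale (l ℕ.+ l) β (poly-≤ (ℕP.+-mono-≤ 1≤l (ℕP.m∸n≤m l (q ℕ.^ m))) (monic⇒poly (l ℕ.∸ q ℕ.^ m) (monic-x^ (l ℕ.∸ q ℕ.^ m))))

    tau-poly : ∀ m → m ℕ.≤ h′ → Poly (l ℕ.+ l) (tau m)
    tau-poly zero le = poly-zero (l ℕ.+ l)
    tau-poly (suc m) le = poly-+ (l ℕ.+ l)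
      (poly-≤ (subst (ℕ._≤ l ℕ.+ l) (ℕP.+-suc l (q ℕ.^ m)) (ℕP.+-monoʳ-≤ l (ℕP.^-monoʳ-< q 1<q le))) (monic⇒poly (l ℕ.+ q ℕ.^ m) (monic-x^ (l ℕ.+ q ℕ.^ m))))
      (poly-+ (l ℕ.+ l) (low-poly m) (tau-poly m (ℕP.<⇒≤ le)))

  -- The leading term is that of m = h′, where q^m = l; all other exponents are smaller.
  tau-monic : Monic (l ℕ.+ l) (tau h)
  tau-monic = monic-+ (l ℕ.+ l) (monic-x^ (l ℕ.+ l)) (poly-+ (l ℕ.+ l) (low-poly h′) (tau-poly h′ ℕP.≤-refl))

  q⁻ : ℕ
  q⁻ = q ℕ.∸ 1

  -- The digits k < l, j < q and i < M give M Q₀ monomials. M must be large enough for their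
  -- conjugates to be dependent, and yet M Q₀ must exceed |E|/q = l Q₀, the expected number of
  -- points, by O(Q₀) only.
  M total : ℕ
  M = l ℕ.+ 3
  total = (M ℕ.* q) ℕ.* l

  -- digits of N = k + l (j + q i)
  kᵢ jᵢ iᵢ rᵢ : ℕ → ℕ
  kᵢ N = N % l
  jᵢ N = (N / l) % q
  iᵢ N = (N / l) / q
  rᵢ N = q⁻ ℕ.∸ jᵢ N

  -- Away from s = 0 this is s^(l q⁻) · s^(k + i Q₀) T^j: since j + r = q⁻, the same power of s
  -- clears the pole of T^j for every j.
  basis : ℕ → Carrier → Carrier
  basis N s = s ^ kᵢ N * (tau h s ^ jᵢ N * (s ^ (l ℕ.* rᵢ N) * s ^ (iᵢ N ℕ.* Q₀)))

  -- Away from s = 0 this is s^(l q⁻) · s^(k Q₀ + i) (c - T)^j. Raising to the power Q₀ exchanges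
  -- the roles of k and i because s^(Q₀²) = s, so the exponent stays small.
  conjugateBasis : F.Carrier → ℕ → Carrier → Carrier
  conjugateBasis c N s = s ^ (kᵢ N ℕ.* Q₀ ℕ.+ iᵢ N) * ((emb c * s ^ l - tau h s) ^ jᵢ N * s ^ (l ℕ.* rᵢ N))

  private
    j≤q⁻ : ∀ N → jᵢ N ℕ.≤ q⁻
    j≤q⁻ N = ℕP.<⇒≤pred (m%n<n (N / l) q)

    q⁻≡ : ∀ N → q⁻ ≡ jᵢ N ℕ.+ rᵢ N
    q⁻≡ N = sym (ℕP.m+[n∸m]≡n (j≤q⁻ N))

    digits : ∀ N → N ≡ kᵢ N ℕ.+ (jᵢ N ℕ.+ iᵢ N ℕ.* q) ℕ.* l
    digits N = trans (m≡m%n+[m/n]*n N l) (cong (λ w → kᵢ N ℕ.+ w ℕ.* l) (m≡m%n+[m/n]*n (N / l) q))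

    degree-eq : ∀ N → kᵢ N ℕ.+ (jᵢ N ℕ.* (l ℕ.+ l) ℕ.+ (l ℕ.* rᵢ N ℕ.+ iᵢ N ℕ.* Q₀)) ≡ l ℕ.* q⁻ ℕ.+ N
    degree-eq N = trans (lem (kᵢ N) (jᵢ N) (rᵢ N) (iᵢ N) l q) (sym (cong₂ (λ a c → l ℕ.* a ℕ.+ c) (q⁻≡ N) (digits N)))
      where
      lem : ∀ k j r i l q → k ℕ.+ (j ℕ.* (l ℕ.+ l) ℕ.+ (l ℕ.* r ℕ.+ i ℕ.* (q ℕ.* l))) ≡ l ℕ.* (j ℕ.+ r) ℕ.+ (k ℕ.+ (j ℕ.+ i ℕ.* q) ℕ.* l)
      lem = ℕSolver.solve-∀

    -- As `T` has degree l and Q₀ = q l, the degree of s^(k + i Q₀) T^j is k + l (j + q i). The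
    -- mixed-radix digits are chosen so that this is N.
    basis-monic : ∀ N → Monic (l ℕ.* q⁻ ℕ.+ N) (basis N)
    basis-monic N = subst (λ d → Monic d (basis N)) (degree-eq N)
      (monic-* (kᵢ N) _ (monic-x^ (kᵢ N)) (monic-* (jᵢ N ℕ.* (l ℕ.+ l)) _ (monic-^ (l ℕ.+ l) tau-monic (jᵢ N))
        (monic-* (l ℕ.* rᵢ N) (iᵢ N ℕ.* Q₀) (monic-x^ (l ℕ.* rᵢ N)) (monic-x^ (iᵢ N ℕ.* Q₀)))))

    -- From k ≤ l - 1, i ≤ l + 2 and j + r = q⁻; the factor built from `tau` has degree at most 2 l
    -- j + l r ≤ 2 l q⁻.
    D : ℕ
    D = suc ((l ℕ.∸ 1) ℕ.* Q₀ ℕ.+ (l ℕ.+ 2) ℕ.+ q⁻ ℕ.* (l ℕ.+ l))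

    conj-poly : ∀ c N → N ℕ.< total → Poly D (conjugateBasis c N)
    conj-poly c N N< = poly-≤ (s≤s bound) (poly-* (kᵢ N ℕ.* Q₀ ℕ.+ iᵢ N) _ (monic⇒poly _ (monic-x^ (kᵢ N ℕ.* Q₀ ℕ.+ iᵢ N)))
        (poly-* (jᵢ N ℕ.* (l ℕ.+ l)) (l ℕ.* rᵢ N) (poly-^ (l ℕ.+ l) linear (jᵢ N)) (monic⇒poly (l ℕ.* rᵢ N) (monic-x^ (l ℕ.* rᵢ N)))))
      where
      linear : Poly (suc (l ℕ.+ l)) (λ s → emb c * s ^ l - tau h s)
      linear = poly-+ (suc (l ℕ.+ l)) (poly-scale (suc (l ℕ.+ l)) (emb c) (poly-≤ (s≤s (ℕP.m≤m+n l l)) (monic⇒poly l (monic-x^ l))))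
        (poly-cong (suc (l ℕ.+ l)) (λ s → solve 1 (λ t → :- t := (:- con 1ℤ) :* t) refl (tau h s)) (poly-scale (suc (l ℕ.+ l)) (- 1#) (monic⇒poly (l ℕ.+ l) tau-monic)))
      i≤ : iᵢ N ℕ.≤ l ℕ.+ 2
      i≤ = ℕP.≤-pred (subst (iᵢ N ℕ.<_) (ℕP.+-suc l 2) (m<n*o⇒m/o<n (m<n*o⇒m/o<n N<)))
      bound : kᵢ N ℕ.* Q₀ ℕ.+ iᵢ N ℕ.+ (jᵢ N ℕ.* (l ℕ.+ l) ℕ.+ l ℕ.* rᵢ N) ℕ.≤ (l ℕ.∸ 1) ℕ.* Q₀ ℕ.+ (l ℕ.+ 2) ℕ.+ q⁻ ℕ.* (l ℕ.+ l)
      bound = ℕP.+-mono-≤ (ℕP.+-mono-≤ (ℕP.*-monoˡ-≤ Q₀ (ℕP.<⇒≤pred (m%n<n N l))) i≤)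
        (subst (jᵢ N ℕ.* (l ℕ.+ l) ℕ.+ l ℕ.* rᵢ N ℕ.≤_) (cong (ℕ._* (l ℕ.+ l)) (sym (q⁻≡ N)))
          (ℕP.≤-trans (ℕP.m≤m+n _ (l ℕ.* rᵢ N)) (ℕP.≤-reflexive (lem (jᵢ N) (rᵢ N) l))))
        where
        lem : ∀ j r l → j ℕ.* (l ℕ.+ l) ℕ.+ l ℕ.* r ℕ.+ l ℕ.* r ≡ (j ℕ.+ r) ℕ.* (l ℕ.+ l)
        lem = ℕSolver.solve-∀

    -- With Q₀ = q l one has D = (l + 1) Q₀ - l + 3, against (l + 3) Q₀ for `total`.
    D<total : D ℕ.< total
    D<total = go l (q ℕ.∸ 1) 1≤l (ℕP.<⇒≤pred 1<q) (cong (ℕ._* l) (sym (ℕP.suc-pred q))) (cong (λ w → (l ℕ.+ 3) ℕ.* w ℕ.* l) (sym (ℕP.suc-pred q)))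
      where
      go : ∀ l p → 1 ℕ.≤ l → 1 ℕ.≤ p → ∀ {Q t} → Q ≡ suc p ℕ.* l → t ≡ (l ℕ.+ 3) ℕ.* suc p ℕ.* l →
           suc ((l ℕ.∸ 1) ℕ.* Q ℕ.+ (l ℕ.+ 2) ℕ.+ p ℕ.* (l ℕ.+ l)) ℕ.< t
      go (suc l) (suc p) _ _ refl refl = ℕP.≤-trans (ℕP.m≤m+n _ _) (ℕP.≤-reflexive (lem l p))
        where
        lem : ∀ l p → suc (suc (l ℕ.* (suc (suc p) ℕ.* suc l) ℕ.+ (suc l ℕ.+ 2) ℕ.+ suc p ℕ.* (suc l ℕ.+ suc l))) ℕ.+ (1 ℕ.+ 5 ℕ.* l ℕ.+ 2 ℕ.* (p ℕ.* suc l))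
          ≡ (suc l ℕ.+ 3) ℕ.* suc (suc p) ℕ.* suc l
        lem = ℕSolver.solve-∀

  private
    -- Q₀-th powers turn `basis` into `conjugateBasis` at the points counted.
    frobenius-basis : ∀ N {s} → s ≢ 0# → φ (basis N s) * s ^ (l ℕ.* q⁻) ≡ φ s ^ (l ℕ.* q⁻) * conjugateBasis (phase s) N s
    frobenius-basis N {s} ne = begin
      φ (basis N s) * s ^ (l ℕ.* q⁻) ≡⟨ cong₂ _*_ φ-basis (split s) ⟩
      s ^ (k ℕ.* Q₀) * ((φ s ^ l) ^ j * u ^ j * (φ s ^ (l ℕ.* r) * s ^ i)) * ((s ^ l) ^ j * s ^ (l ℕ.* r))
        ≡⟨ Mon.solve 7 (λ a b u c d e f → (a Mon.⊕ ((b Mon.⊕ u) Mon.⊕ (c Mon.⊕ d))) Mon.⊕ (e Mon.⊕ f) Mon.⊜ (b Mon.⊕ c) Mon.⊕ ((a Mon.⊕ d) Mon.⊕ ((e Mon.⊕ u) Mon.⊕ f))) refl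
             (s ^ (k ℕ.* Q₀)) ((φ s ^ l) ^ j) (u ^ j) (φ s ^ (l ℕ.* r)) (s ^ i) ((s ^ l) ^ j) (s ^ (l ℕ.* r)) ⟩
      (φ s ^ l) ^ j * φ s ^ (l ℕ.* r) * (s ^ (k ℕ.* Q₀) * s ^ i * ((s ^ l) ^ j * u ^ j * s ^ (l ℕ.* r)))
        ≡⟨ cong₂ _*_ (sym (split (φ s))) (cong₂ _*_ (sym (^-homo-* s (k ℕ.* Q₀) i)) (cong (_* s ^ (l ℕ.* r)) (trans (sym (^-distrib-* (s ^ l) u j)) (cong (_^ j) linear)))) ⟩
      φ s ^ (l ℕ.* q⁻) * conjugateBasis (phase s) N s ∎
      where
      open ≡-Reasoning
      k j i r : ℕ
      k = kᵢ N
      j = jᵢ N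
      i = iᵢ N
      r = rᵢ N
      u : Carrier
      u = emb (phase s) - T s
      split : ∀ x → x ^ (l ℕ.* q⁻) ≡ (x ^ l) ^ j * x ^ (l ℕ.* r)
      split x = trans (cong (λ w → x ^ (l ℕ.* w)) (q⁻≡ N)) (trans (cong (x ^_) (ℕP.*-distribˡ-+ l j r))
        (trans (^-homo-* x (l ℕ.* j) (l ℕ.* r)) (cong (_* x ^ (l ℕ.* r)) (sym (^-assocʳ x l j)))))
      linear : s ^ l * u ≡ emb (phase s) * s ^ l - tau h s
      linear = trans (solve 3 (λ x c t → x :* (c :- t) := c :* x :- x :* t) refl (s ^ l) (emb (phase s)) (T s))
        (cong (λ w → emb (phase s) * s ^ l - w) (sym (tau≡ h ℕP.≤-refl ne)))
      φ-* : ∀ x y → φ (x * y) ≡ φ x * φ y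
      φ-* x y = ^-distrib-* x y Q₀
      φ-basis : φ (basis N s) ≡ s ^ (k ℕ.* Q₀) * ((φ s ^ l) ^ j * u ^ j * (φ s ^ (l ℕ.* r) * s ^ i))
      φ-basis = begin
        φ (basis N s) ≡⟨ trans (φ-* _ _) (cong (φ (s ^ k) *_) (trans (φ-* _ _) (cong (φ (tau h s ^ j) *_) (φ-* _ _)))) ⟩
        φ (s ^ k) * (φ (tau h s ^ j) * (φ (s ^ (l ℕ.* r)) * φ (s ^ (i ℕ.* Q₀))))
          ≡⟨ cong₂ _*_ (^-assocʳ s k Q₀) (cong₂ _*_ φ-tau (cong₂ _*_ (φ-^ s (l ℕ.* r))
               (trans (cong φ (sym (^-assocʳ s i Q₀))) (φφ (s ^ i))))) ⟩
        s ^ (k ℕ.* Q₀) * ((φ s ^ l) ^ j * u ^ j * (φ s ^ (l ℕ.* r) * s ^ i)) ∎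
        where
        φ-tau : φ (tau h s ^ j) ≡ (φ s ^ l) ^ j * u ^ j
        φ-tau = begin
          φ (tau h s ^ j) ≡⟨ φ-^ (tau h s) j ⟩
          φ (tau h s) ^ j ≡⟨ cong (_^ j) (trans (cong φ (tau≡ h ℕP.≤-refl ne)) (trans (φ-* (s ^ l) (T s)) (cong₂ _*_ (φ-^ s l) (φ-T s)))) ⟩
          (φ s ^ l * u) ^ j ≡⟨ ^-distrib-* (φ s ^ l) u j ⟩
          (φ s ^ l) ^ j * u ^ j ∎

  private
    combination : (Fin total → Carrier) → Carrier → Carrier
    combination α s = sumF (λ N → φ (α N) * basis (toℕ N) s)

    Relation : F.Carrier → (Fin total → Carrier) → Set
    Relation c α = ∀ s → sumF (λ N → α N * conjugateBasis c (toℕ N) s) ≡ 0#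

    -- The coefficients of `combination` are φ (α N) because φ is an involution: applying φ restores
    -- α N and turns the combination, up to powers of s and φ s, into the given relation. Only the
    -- zero element has Q₀-th power zero.
    combination-vanishes : ∀ c α → Relation c α → ∀ s → s ≢ 0# → phase s ≡ c → combination α s ≡ 0#
    combination-vanishes c α relation s ne refl = ^≡0 (combination α s) Q₀ (cancel-*-zero (^-≢0 (l ℕ.* q⁻) ne) (begin
      s ^ (l ℕ.* q⁻) * φ (combination α s) ≡⟨ cong (s ^ (l ℕ.* q⁻) *_) (φ-sum (λ N → φ (α N) * basis (toℕ N) s)) ⟩
      s ^ (l ℕ.* q⁻) * sumF (λ N → φ (φ (α N) * basis (toℕ N) s)) ≡⟨ sumF-*ˡ (s ^ (l ℕ.* q⁻)) (λ N → φ (φ (α N) * basis (toℕ N) s)) ⟨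
      sumF (λ N → s ^ (l ℕ.* q⁻) * φ (φ (α N) * basis (toℕ N) s)) ≡⟨ sum-cong-≗ term ⟩
      sumF (λ N → φ s ^ (l ℕ.* q⁻) * (α N * conjugateBasis (phase s) (toℕ N) s)) ≡⟨ sumF-*ˡ (φ s ^ (l ℕ.* q⁻)) (λ N → α N * conjugateBasis (phase s) (toℕ N) s) ⟩
      φ s ^ (l ℕ.* q⁻) * sumF (λ N → α N * conjugateBasis (phase s) (toℕ N) s) ≡⟨ trans (cong (φ s ^ (l ℕ.* q⁻) *_) (relation s)) (zeroʳ _) ⟩
      0# ∎))
      where
      open ≡-Reasoning
      term : ∀ N → s ^ (l ℕ.* q⁻) * φ (φ (α N) * basis (toℕ N) s) ≡ φ s ^ (l ℕ.* q⁻) * (α N * conjugateBasis (phase s) (toℕ N) s)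
      term N = begin
        s ^ (l ℕ.* q⁻) * φ (φ (α N) * basis (toℕ N) s) ≡⟨ cong (s ^ (l ℕ.* q⁻) *_) (trans (^-distrib-* (φ (α N)) (basis (toℕ N) s) Q₀) (cong (_* φ (basis (toℕ N) s)) (φφ (α N)))) ⟩
        s ^ (l ℕ.* q⁻) * (α N * φ (basis (toℕ N) s)) ≡⟨ solve 3 (λ x a y → x :* (a :* y) := a :* (y :* x)) refl (s ^ (l ℕ.* q⁻)) (α N) (φ (basis (toℕ N) s)) ⟩
        α N * (φ (basis (toℕ N) s) * s ^ (l ℕ.* q⁻)) ≡⟨ cong (α N *_) (frobenius-basis (toℕ N) ne) ⟩
        α N * (φ s ^ (l ℕ.* q⁻) * conjugateBasis (phase s) (toℕ N) s)
          ≡⟨ solve 3 (λ a x y → a :* (x :* y) := x :* (a :* y)) refl (α N) (φ s ^ (l ℕ.* q⁻)) (conjugateBasis (phase s) (toℕ N) s) ⟩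
        φ s ^ (l ℕ.* q⁻) * (α N * conjugateBasis (phase s) (toℕ N) s) ∎
    root-bound : ∀ c α → Relation c α → ∀ d → d ℕ.< l ℕ.* q⁻ ℕ.+ total → ∀ e → e ≢ 0# → ∀ m → Monic d m →
      (∀ s → combination α s ≡ e * m s) → count c ℤ.≤ pos (l ℕ.* q⁻ ℕ.+ total)
    root-bound c α relation d d< e e≢0 m mm G≡ = ℤP.≤-trans (∑-mono els pointwise)
        (ℤP.≤-trans (root-count finite (λ x → x) (λ p → p) d mm) (ℤ.+≤+ (ℕP.<⇒≤ d<)))
      where
      pointwise : ∀ s → nz s ℤ.* ⟦ phase s F.≟ c ⟧ ℤ.≤ ⟦ m s ≟ 0# ⟧
      pointwise s = cases (s ≟ 0#) (phase s F.≟ c)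
        where
        cases : Dec (s ≡ 0#) → (p : Dec (phase s ≡ c)) → nz s ℤ.* ⟦ p ⟧ ℤ.≤ ⟦ m s ≟ 0# ⟧
        cases (yes e) p = subst (ℤ._≤ ⟦ m s ≟ 0# ⟧) (sym (trans (cong (λ w → w ℤ.* ⟦ p ⟧) (trans (cong nz e) nz-zero)) (ℤP.*-zeroˡ ⟦ p ⟧))) (⟦⟧-nonneg (m s ≟ 0#))
        cases (no _) (no _) = subst (ℤ._≤ ⟦ m s ≟ 0# ⟧) (sym (ℤP.*-zeroʳ (nz s))) (⟦⟧-nonneg (m s ≟ 0#))
        cases (no ne) (yes p) = ℤP.≤-reflexive (trans (ℤP.*-identityʳ (nz s)) (trans (nz-one ne)
          (sym (⟦⟧-yes (m s ≟ 0#) (cancel-*-zero e≢0 (trans (sym (G≡ s)) (combination-vanishes c α relation s ne p)))))))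

    -- φ is injective, so the coefficients do not all vanish, and distinct degrees make the
    -- combination a nonzero multiple of a monic polynomial.
    apply-triangular : ∀ c α → (∃ λ N → α N ≢ 0#) → Relation c α → count c ℤ.≤ pos (l ℕ.* q⁻ ℕ.+ total)
    apply-triangular c α (N₀ , α≢0) relation = cases (triangular total (l ℕ.* q⁻) (λ N → φ (α N)) (λ N → basis (toℕ N)) (λ N → basis-monic (toℕ N)))
      where
      cases : (∀ N → φ (α N) ≡ 0#) ⊎ (∃ λ k → l ℕ.* q⁻ ℕ.≤ k × k ℕ.< l ℕ.* q⁻ ℕ.+ total × (∃ λ c → c ≢ 0# × (∃ λ m → Monic k m × (∀ x → combination α x ≡ c * m x))))
        → count c ℤ.≤ pos (l ℕ.* q⁻ ℕ.+ total)
      cases (inj₁ all-zero) = ⊥-elim (α≢0 (trans (sym (φφ (α N₀))) (trans (cong φ (all-zero N₀)) φ-0)))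
      cases (inj₂ (d , _ , d< , e , e≢0 , m , mm , G≡)) = root-bound c α relation d d< e e≢0 m mm G≡

  count-bound : ∀ c → count c ℤ.≤ pos (l ℕ.* q⁻ ℕ.+ total)
  count-bound c = finish (dependence D total (λ N → conjugateBasis c (toℕ N)) (λ N → conj-poly c (toℕ N) (toℕ<n N)) D<total)
    where
    finish : (∃ λ α → (∃ λ N → α N ≢ 0#) × Relation c α) → count c ℤ.≤ pos (l ℕ.* q⁻ ℕ.+ total)
    finish (α , nonzero , relation) = apply-triangular c α nonzero relation

  -- The count is at most A = (l + 3) Q₀ + l (q - 1), and q A = Q₀² + 4 q Q₀ - Q₀. Hence the excess
  -- in `fibre-bound` is at most 5 q √|E|, with a factor that depends on F but not on the degree of
  -- E.
  weil : P (pos (5 ℕ.* q))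
  weil f mean = ℤP.≤-trans (fibre-bound (pos (l ℕ.* q⁻ ℕ.+ total)) count-bound f mean)
    (ℤP.≤-trans (*-mono {D′ ℤ.* D′} (sq-nonneg D′) N≥0 D′²≤ ℤP.≤-refl) ℤP.≤-refl)
    where
    open ≡-Reasoning
    D′ N : ℤ
    D′ = pos F.size ℤ.* pos (l ℕ.* q⁻ ℕ.+ total) ℤ.- (pos size ℤ.- 1ℤ)
    N = F.sum (λ ξ → f ξ ℤ.* f ξ)
    N≥0 : 0ℤ ℤ.≤ N
    N≥0 = ∑-nonneg F.els (λ ξ → sq-nonneg (f ξ))
    -- q (l (q - 1) + (l + 3) q l) + 1 + slack = Q₀² + 5 q Q₀
    nat-bound : q ℕ.* (l ℕ.* q⁻ ℕ.+ total) ℕ.+ 1 ℕ.≤ Q₀ ℕ.* Q₀ ℕ.+ 5 ℕ.* q ℕ.* Q₀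
    nat-bound = go l (q ℕ.∸ 1) 1≤l (sym (ℕP.suc-pred q))
      where
      go : ∀ l p → 1 ℕ.≤ l → ∀ {q} → q ≡ suc p → q ℕ.* (l ℕ.* p ℕ.+ (l ℕ.+ 3) ℕ.* q ℕ.* l) ℕ.+ 1 ℕ.≤ (q ℕ.* l) ℕ.* (q ℕ.* l) ℕ.+ 5 ℕ.* q ℕ.* (q ℕ.* l)
      go (suc l) p _ refl = ℕP.≤-trans (ℕP.m≤m+n _ _) (ℕP.≤-reflexive (lem l p))
        where
        lem : ∀ l p → suc p ℕ.* (suc l ℕ.* p ℕ.+ (suc l ℕ.+ 3) ℕ.* suc p ℕ.* suc l) ℕ.+ 1 ℕ.+ (suc p ℕ.* suc p ℕ.* suc l ℕ.+ suc p ℕ.* suc l ℕ.∸ 1)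
          ≡ (suc p ℕ.* suc l) ℕ.* (suc p ℕ.* suc l) ℕ.+ 5 ℕ.* suc p ℕ.* (suc p ℕ.* suc l)
        lem l p = trans (cong (suc p ℕ.* (suc l ℕ.* p ℕ.+ (suc l ℕ.+ 3) ℕ.* suc p ℕ.* suc l) ℕ.+ 1 ℕ.+_) (cong (ℕ._∸ 1) (lem₁ l p))) (lem₂ l p)
          where
          lem₁ : ∀ l p → suc p ℕ.* suc p ℕ.* suc l ℕ.+ suc p ℕ.* suc l ≡ suc (1 ℕ.+ 2 ℕ.* l ℕ.+ (3 ℕ.+ p) ℕ.* p ℕ.* suc l)
          lem₁ = ℕSolver.solve-∀
          lem₂ : ∀ l p → suc p ℕ.* (suc l ℕ.* p ℕ.+ (suc l ℕ.+ 3) ℕ.* suc p ℕ.* suc l) ℕ.+ 1 ℕ.+ (1 ℕ.+ 2 ℕ.* l ℕ.+ (3 ℕ.+ p) ℕ.* p ℕ.* suc l)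
            ≡ (suc p ℕ.* suc l) ℕ.* (suc p ℕ.* suc l) ℕ.+ 5 ℕ.* suc p ℕ.* (suc p ℕ.* suc l)
          lem₂ = ℕSolver.solve-∀
    X : ℤ
    X = pos (5 ℕ.* q) ℤ.* pos Q₀
    D′≤ : D′ ℤ.≤ X
    D′≤ = ≤-from-diff (subst (0ℤ ℤ.≤_) eq (diff-nonneg (ℤ.+≤+ nat-bound)))
      where
      rearr : ∀ a c s → (s ℤ.+ c) ℤ.- (a ℤ.+ 1ℤ) ≡ c ℤ.- (a ℤ.- (s ℤ.- 1ℤ))
      rearr = solve-∀
      eq : pos (Q₀ ℕ.* Q₀ ℕ.+ 5 ℕ.* q ℕ.* Q₀) ℤ.- pos (q ℕ.* (l ℕ.* q⁻ ℕ.+ total) ℕ.+ 1) ≡ X ℤ.- D′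
      eq = trans (rearr (pos (q ℕ.* (l ℕ.* q⁻ ℕ.+ total))) (pos (5 ℕ.* q ℕ.* Q₀)) (pos (Q₀ ℕ.* Q₀)))
        (cong₂ (λ u v → u ℤ.- v) (ℤP.pos-* (5 ℕ.* q) Q₀) (cong₂ (λ u v → u ℤ.- (pos v ℤ.- 1ℤ)) (ℤP.pos-* q (l ℕ.* q⁻ ℕ.+ total)) (sym size≡)))
    D′≥0 : 0ℤ ℤ.≤ D′
    D′≥0 = subst (0ℤ ℤ.≤_) (trans (∑-sub F.els (λ _ → pos (l ℕ.* q⁻ ℕ.+ total)) count) (cong₂ ℤ._-_ (∑-const F.els (pos (l ℕ.* q⁻ ℕ.+ total))) sum-count))
      (∑-nonneg F.els (λ c → diff-nonneg (count-bound c)))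
    D′²≤ : D′ ℤ.* D′ ℤ.≤ pos (5 ℕ.* q) ℤ.* pos (5 ℕ.* q) ℤ.* pos size
    D′²≤ = ℤP.≤-trans (*-mono D′≥0 (ℤP.≤-trans D′≥0 D′≤) D′≤ D′≤) (ℤP.≤-reflexive (trans (lem (pos (5 ℕ.* q)) (pos Q₀))
        (cong (pos (5 ℕ.* q) ℤ.* pos (5 ℕ.* q) ℤ.*_) (trans (sym (ℤP.pos-* Q₀ Q₀)) (cong pos (sym size≡))))))
      where
      lem : ∀ a c → (a ℤ.* c) ℤ.* (a ℤ.* c) ≡ a ℤ.* a ℤ.* (c ℤ.* c)
      lem = solve-∀

-- Descent to the Kloosterman bound over the base field

module KloostermanBound (F : OddField) (fermat : ∀ x → OddField._^_ F x (OddField.size F) ≡ x) where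
  open OddField F
  open Nonzero F

  module _ (b : Carrier) (b≢0 : b ≢ 0#) where
    open Kloosterman F fermat b b≢0

    P-mono : ∀ {n} (L : Extension F fermat n) {M M′} → 0ℤ ℤ.≤ M → M ℤ.≤ M′ → Operator.P L M → Operator.P L M′
    P-mono L {M} {M′} 0≤M le p f mean = ℤP.≤-trans (p f mean)
      (*-mono (*-nonneg (sq-nonneg M) (ℤ.+≤+ z≤n)) (∑-nonneg els (λ ξ → sq-nonneg (f ξ)))
        (*-mono (sq-nonneg M) (ℤ.+≤+ z≤n) (*-mono 0≤M (ℤP.≤-trans 0≤M le) le le) ℤP.≤-refl) ℤP.≤-refl)

    descend : ∀ k → Operator.P (tower F fermat k) (pos (3 ℕ.+ k)) → Operator.P (base F fermat) (pos 3)
    descend zero p = p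
    descend (suc k) p = descend k (Doubling.descent (tower F fermat k) (pos (3 ℕ.+ k)) (ℤ.+≤+ (ℕP.m≤m+n 3 k))
      (subst (Operator.P (Step.next F fermat (tower F fermat k))) (cong pos (ℕP.+-comm 1 (3 ℕ.+ k))) p))

    top : ∀ k → Operator.P (tower F fermat (suc k)) (pos (5 ℕ.* size))
    top k = Stepanov.weil F fermat b b≢0 (degree⁻ F fermat k) (tower F fermat (suc k))

    -- At level 5q the descent starts from the constant 3 + 5q, which the 5q of Stepanov's method
    -- satisfies; each level down takes off one.
    base-bound : Operator.P (base F fermat) (pos 3)
    base-bound = descend (suc k) (P-mono (tower F fermat (suc k)) (ℤ.+≤+ z≤n) (ℤ.+≤+ (ℕP.≤-trans (ℕP.≤-reflexive (sym eq)) (ℕP.m≤n+m (suc k) 3))) (top k))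
      where
      k : ℕ
      k = ℕ.pred (5 ℕ.* size)
      eq : suc k ≡ 5 ℕ.* size
      eq = ℕP.suc-pred (5 ℕ.* size) ⦃ ℕP.m*n≢0 5 size ⦃ _ ⦄ ⦃ ℕ.>-nonZero (ℕP.<-trans (s≤s z≤n) 1<size) ⦄ ⦄

    private
      open Fibres (base F fermat)

      -- s + b/s = c means (2s - c)² = c² - 4b.
      count≡roots : ∀ c → count c ≡ roots (c * c - 2# * 2# * b)
      count≡roots c = trans (∑-cong els term) (trans (∑-reindex finite finite (λ s → - c + 2# * s) (λ y → half * (c + y)) left right (λ y → ⟦ y * y ≟ c * c - 2# * 2# * b ⟧)) refl)
        where
        halve : ∀ x → half * (2# * x) ≡ x
        halve x = trans (sym (*-assoc half 2# x)) (trans (cong (_* x) (inv-* 2≢0)) (*-identityˡ x))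
        left : ∀ s → half * (c + (- c + 2# * s)) ≡ s
        left s = trans (cong (half *_) (solve 2 (λ c x → c :+ (:- c :+ x) := x) refl c (2# * s))) (halve s)
        right : ∀ y → - c + 2# * (half * (c + y)) ≡ y
        right y = trans (cong (- c +_) (trans (sym (*-assoc 2# half (c + y))) (trans (cong (_* (c + y)) (*-inv 2≢0)) (*-identityˡ (c + y)))))
          (solve 2 (λ c y → :- c :+ (c :+ y) := y) refl c y)
        4≢0 : 2# * 2# ≢ 0#
        4≢0 = *-≢0 2≢0 2≢0
        square : ∀ s → (- c + 2# * s) * (- c + 2# * s) ≡ c * c - 2# * 2# * b + 2# * 2# * (s * s - s * c + b)
        square s = solve 3 (λ c s b → (:- c :+ (con 1ℤ :+ con 1ℤ) :* s) :* (:- c :+ (con 1ℤ :+ con 1ℤ) :* s) :=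
          c :* c :- (con 1ℤ :+ con 1ℤ) :* (con 1ℤ :+ con 1ℤ) :* b :+ (con 1ℤ :+ con 1ℤ) :* (con 1ℤ :+ con 1ℤ) :* (s :* s :- s :* c :+ b)) refl c s b
        quadratic : ∀ {s} → s ≢ 0# → s * s - s * c + b ≡ s * (s + b * inv s - c)
        quadratic {s} ne = trans (cong (s * s - s * c +_) (trans (sym (*-identityʳ b)) (cong (b *_) (sym (*-inv ne)))))
          (solve 4 (λ s c b v → s :* s :- s :* c :+ b :* (s :* v) := s :* (s :+ b :* v :- c)) refl s c b (inv s))
        to : ∀ {s} → s ≢ 0# → s + b * inv s ≡ c → (- c + 2# * s) * (- c + 2# * s) ≡ c * c - 2# * 2# * b
        to {s} ne e = trans (square s) (trans (cong (λ w → c * c - 2# * 2# * b + 2# * 2# * w)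
          (trans (quadratic ne) (trans (cong (s *_) (trans (cong (_- c) e) (-‿inverseʳ c))) (zeroʳ s))))
          (trans (cong (c * c - 2# * 2# * b +_) (zeroʳ _)) (+-identityʳ _)))
        from : ∀ s → (- c + 2# * s) * (- c + 2# * s) ≡ c * c - 2# * 2# * b → s * s - s * c + b ≡ 0#
        from s e = cancel-*-zero 4≢0 (+-cancelˡ (c * c - 2# * 2# * b) (trans (sym (square s)) (trans e (sym (+-identityʳ _)))))
        s≢0 : ∀ s → s * s - s * c + b ≡ 0# → s ≢ 0#
        s≢0 s e refl = b≢0 (trans (solve 2 (λ c b → b := con 0ℤ :* con 0ℤ :- con 0ℤ :* c :+ b) refl c b) e)
        term : ∀ s → nz s ℤ.* ⟦ s + b * inv s ≟ c ⟧ ≡ ⟦ (- c + 2# * s) * (- c + 2# * s) ≟ c * c - 2# * 2# * b ⟧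
        term s = sym (⟦⟧-× ((- c + 2# * s) * (- c + 2# * s) ≟ c * c - 2# * 2# * b) (¬? (s ≟ 0#)) (s + b * inv s ≟ c)
          (λ e → s≢0 s (from s e) , x-y≡0⇒x≡y (cancel-*-zero (s≢0 s (from s e)) (trans (sym (quadratic (s≢0 s (from s e)))) (from s e))))
          to)

    shifted-bound : ∀ f → MeanZero f →
      sum (λ ξ → sum (λ u → roots (u * u - 2# * 2# * b) ℤ.* f (ξ + u)) ℤ.* sum (λ u → roots (u * u - 2# * 2# * b) ℤ.* f (ξ + u)))
        ℤ.≤ (pos 9 ℤ.* pos size) ℤ.* sum (λ ξ → f ξ ℤ.* f ξ)
    shifted-bound f mean = subst (ℤ._≤ (pos 9 ℤ.* pos size) ℤ.* sum (λ ξ → f ξ ℤ.* f ξ))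
      (∑-cong els (λ ξ → cong (λ w → w ℤ.* w) (trans (K-fibres f ξ) (∑-cong els (λ c → cong (ℤ._* f (ξ + c)) (count≡roots c))))))
      (base-bound f mean)

  -- Weil's bound for Kloosterman sums, for convolution operators instead of characters.
  kloosterman-bound : ∀ n → n ≢ 0# → ∀ f → MeanZero f →
    sum (λ ξ → sum (λ u → roots (u * u - n) ℤ.* f (ξ + u)) ℤ.* sum (λ u → roots (u * u - n) ℤ.* f (ξ + u)))
      ℤ.≤ (pos 9 ℤ.* pos size) ℤ.* sum (λ ξ → f ξ ℤ.* f ξ)
  kloosterman-bound n n≢0 f mean = subst
    (λ m → sum (λ ξ → sum (λ u → roots (u * u - m) ℤ.* f (ξ + u)) ℤ.* sum (λ u → roots (u * u - m) ℤ.* f (ξ + u)))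
      ℤ.≤ (pos 9 ℤ.* pos size) ℤ.* sum (λ ξ → f ξ ℤ.* f ξ)) quarter
    -- b = n/4 turns u² - 4b into u² - n.
    (shifted-bound (half * half * n) (*-≢0 (*-≢0 (inv-≢0 2≢0) (inv-≢0 2≢0)) n≢0) f mean)
    where
    quarter : 2# * 2# * (half * half * n) ≡ n
    quarter = trans (solve 3 (λ t h n → t :* t :* (h :* h :* n) := (t :* h) :* (t :* h) :* n) refl 2# half n)
      (trans (cong (λ w → w * w * n) (*-inv 2≢0)) (solve 1 (λ n → con 1ℤ :* con 1ℤ :* n := n) refl n))

-- Gaussian operators and spheres

-- The signs that occur are values of the quadratic character. They disappear from energies, for
-- which ε² = 1 is all that matters.
Sign : Set
Sign = Σ ℤ λ ε → ε ℤ.* ε ≡ 1ℤ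

+1ₛ : Sign
+1ₛ = 1ℤ , refl

-1ₛ : Sign
-1ₛ = ℤ.- 1ℤ , refl

_·ₛ_ : Sign → Sign → Sign
(ε , p) ·ₛ (δ , r) = ε ℤ.* δ , trans (lem ε δ) (trans (cong₂ ℤ._*_ p r) refl)
  where
  lem : ∀ ε δ → ε ℤ.* δ ℤ.* (ε ℤ.* δ) ≡ ε ℤ.* ε ℤ.* (δ ℤ.* δ)
  lem = solve-∀

sign-flip : ∀ (s : Sign) {x y} → x ≡ proj₁ s ℤ.* y → y ≡ proj₁ s ℤ.* x
sign-flip (ε , p) {x} {y} e = sym (trans (cong (ε ℤ.*_) e) (trans (sym (ℤP.*-assoc ε ε y)) (trans (cong (ℤ._* y) p) (ℤP.*-identityˡ y))))

sign-square : ∀ (s : Sign) x → (proj₁ s ℤ.* x) ℤ.* (proj₁ s ℤ.* x) ≡ x ℤ.* x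
sign-square (ε , p) x = trans (lem ε x) (trans (cong (ℤ._* (x ℤ.* x)) p) (ℤP.*-identityˡ _))
  where
  lem : ∀ ε x → (ε ℤ.* x) ℤ.* (ε ℤ.* x) ≡ ε ℤ.* ε ℤ.* (x ℤ.* x)
  lem = solve-∀

module Heat (F : OddField) where
  open OddField F
  open Nonzero F using (sum-rotate; neg-≢0)

  -- The variable τ records a squared distance and ξ the value of a linear form. `TauZero` is mean
  -- zero in τ for each ξ.
  Fun : Set
  Fun = Carrier → Carrier → ℤ

  TauZero : Fun → Set
  TauZero h = ∀ ξ → sum (λ τ → h τ ξ) ≡ 0ℤ

  -- On characters in τ this is multiplication by a quadratic Gauss sum.
  R : Fun → Fun
  R h τ ξ = sum (λ a → h (τ + a * a) ξ)

  -- Convolution along the parabola u ↦ (u²/n, u), a Gaussian of variance n. The curve a ↦ (a², m₀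
  -- a) is this parabola for n = m₀², and at m₀ = 0 it degenerates to the curve of `R`.
  O-dec : ∀ n → Dec (n ≡ 0#) → Fun → Fun
  O-dec n (yes _) h = R h
  O-dec n (no _) h τ ξ = sum (λ u → h (τ + u * u * inv n) (ξ + u))

  O : Carrier → Fun → Fun
  O n = O-dec n (n ≟ 0#)

  O-zero : ∀ {n} → n ≡ 0# → ∀ h τ ξ → O n h τ ξ ≡ R h τ ξ
  O-zero {n} e h τ ξ = go (n ≟ 0#)
    where
    go : (d : Dec (n ≡ 0#)) → O-dec n d h τ ξ ≡ R h τ ξ
    go (yes _) = refl
    go (no p) = contradiction e p

  O-nonzero : ∀ {n} → n ≢ 0# → ∀ h τ ξ → O n h τ ξ ≡ sum (λ u → h (τ + u * u * inv n) (ξ + u))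
  O-nonzero {n} p h τ ξ = go (n ≟ 0#)
    where
    go : (d : Dec (n ≡ 0#)) → O-dec n d h τ ξ ≡ sum (λ u → h (τ + u * u * inv n) (ξ + u))
    go (yes e) = contradiction e p
    go (no _) = refl

  R-cong : ∀ {h k} → (∀ τ ξ → h τ ξ ≡ k τ ξ) → ∀ τ ξ → R h τ ξ ≡ R k τ ξ
  R-cong e τ ξ = ∑-cong els (λ a → e (τ + a * a) ξ)

  O-cong : ∀ n {h k} → (∀ τ ξ → h τ ξ ≡ k τ ξ) → ∀ τ ξ → O n h τ ξ ≡ O n k τ ξ
  O-cong n {h} {k} e τ ξ = go (n ≟ 0#)
    where
    go : (d : Dec (n ≡ 0#)) → O-dec n d h τ ξ ≡ O-dec n d k τ ξ
    go (yes _) = R-cong e τ ξ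
    go (no _) = ∑-cong els (λ u → e (τ + u * u * inv n) (ξ + u))

  R-scale : ∀ c h τ ξ → R (λ τ ξ → c ℤ.* h τ ξ) τ ξ ≡ c ℤ.* R h τ ξ
  R-scale c h τ ξ = ∑-*ˡ els c (λ a → h (τ + a * a) ξ)

  τ-shift : ∀ {h} → TauZero h → ∀ c ξ → sum (λ τ → h (τ + c) ξ) ≡ 0ℤ
  τ-shift {h} z c ξ = trans (∑-cong els (λ τ → cong (λ w → h w ξ) (+-comm τ c))) (trans (sum-shift c (λ τ → h τ ξ)) (z ξ))

  R-zero : ∀ {h} → TauZero h → TauZero (R h)
  R-zero {h} z ξ = trans (∑-swap els els (λ τ a → h (τ + a * a) ξ)) (trans (∑-cong els (λ a → τ-shift z (a * a) ξ)) (∑-zero els))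

  O-tauzero : ∀ n {h} → TauZero h → TauZero (O n h)
  O-tauzero n {h} z ξ = go (n ≟ 0#)
    where
    go : (d : Dec (n ≡ 0#)) → sum (λ τ → O-dec n d h τ ξ) ≡ 0ℤ
    go (yes _) = R-zero z ξ
    go (no _) = trans (∑-swap els els (λ τ u → h (τ + u * u * inv n) (ξ + u))) (trans (∑-cong els (λ u → τ-shift z (u * u * inv n) (ξ + u))) (∑-zero els))

  O-R-comm : ∀ n h τ ξ → O n (R h) τ ξ ≡ R (O n h) τ ξ
  O-R-comm n h τ ξ = go (n ≟ 0#)
    where
    go : (d : Dec (n ≡ 0#)) → O-dec n d (R h) τ ξ ≡ R (O-dec n d h) τ ξ
    go (yes _) = refl
    go (no _) = trans (∑-swap els els (λ u a → h (τ + u * u * inv n + a * a) (ξ + u)))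
      (∑-cong els (λ a → ∑-cong els (λ u → cong (λ w → h w (ξ + u)) (solve 3 (λ t u a → t :+ u :+ a := t :+ a :+ u) refl τ (u * u * inv n) (a * a)))))

  -- A square c is absorbed into a. For a nonsquare the sums over the two square classes add up to
  -- twice a full sum over τ, which is zero.
  R-class : ∀ c → c ≢ 0# → Σ Sign λ ε → ∀ {h} → TauZero h → ∀ τ ξ → sum (λ a → h (τ + c * (a * a)) ξ) ≡ proj₁ ε ℤ.* R h τ ξ
  R-class c c≢0 with search (λ y → y * y ≟ c)
  ... | inj₁ (y , refl) = +1ₛ , λ {h} z τ ξ → trans (∑-cong els (λ a → cong (λ w → h (τ + w) ξ) (solve 2 (λ y a → y :* y :* (a :* a) := y :* a :* (y :* a)) refl y a)))
        (trans (sum-scale (λ e → c≢0 (trans (cong (_* y) e) (zeroˡ y))) (λ a → h (τ + a * a) ξ)) (sym (ℤP.*-identityˡ _)))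
  ... | inj₂ n = -1ₛ , λ {h} z τ ξ → neg (R h τ ξ) (sum (λ a → h (τ + c * (a * a)) ξ))
        (trans (sum-square-classes n (λ x → h (τ + x) ξ)) (trans (cong (pos 2 ℤ.*_) (trans (sum-shift τ (λ x → h x ξ)) (z ξ))) refl))
    where
    neg : ∀ a x → a ℤ.+ x ≡ 0ℤ → x ≡ (ℤ.- 1ℤ) ℤ.* a
    neg a x e = trans (lem a x) (trans (cong (ℤ._+ (ℤ.- 1ℤ) ℤ.* a) e) (ℤP.+-identityˡ _))
      where
      lem : ∀ a x → x ≡ a ℤ.+ x ℤ.+ (ℤ.- 1ℤ) ℤ.* a
      lem = solve-∀

  -- For s ≠ 0 the product c s t runs through the field with t, and the inner sum vanishes; only s =
  -- 0 survives.
  hyperbola : ∀ {c} → c ≢ 0# → ∀ κ {h} → TauZero h → ∀ τ ξ →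
    sum (λ s → sum (λ t → h (τ + c * (s * t)) (ξ + κ * s))) ≡ pos size ℤ.* h τ ξ
  hyperbola {c} c≢0 κ {h} z τ ξ = trans (∑-cong els inner) (∑-δ 0# (λ _ → pos size ℤ.* h τ ξ))
    where
    inner : ∀ s → sum (λ t → h (τ + c * (s * t)) (ξ + κ * s)) ≡ ⟦ s ≟ 0# ⟧ ℤ.* (pos size ℤ.* h τ ξ)
    inner s with s ≟ 0#
    ... | yes refl = trans (∑-cong els (λ t → cong₂ h (solve 3 (λ τ c t → τ :+ c :* (con 0ℤ :* t) := τ) refl τ c t) (solve 2 (λ ξ κ → ξ :+ κ :* con 0ℤ := ξ) refl ξ κ)))
          (trans (∑-const els (h τ ξ)) (sym (ℤP.*-identityˡ _)))
    ... | no p = trans (∑-cong els (λ t → cong (λ w → h (τ + w) (ξ + κ * s)) (sym (*-assoc c s t))))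
          (trans (sum-scale (*-≢0 c≢0 p) (λ t → h (τ + t) (ξ + κ * s))) (trans (sum-shift τ (λ t → h t (ξ + κ * s))) (z (ξ + κ * s))))

  -- At the price of the square class of -1, the double sum runs over a² - b² = (a + b) (a - b), a
  -- hyperbola. This is the evaluation of the square of a Gauss sum.
  R² : Σ Sign λ ε → ∀ {h} → TauZero h → ∀ τ ξ → R (R h) τ ξ ≡ proj₁ ε ℤ.* (pos size ℤ.* h τ ξ)
  R² with R-class (- 1#) (neg-≢0 1≢0)
  ... | ε , class = ε , λ {h} z τ ξ → begin
      R (R h) τ ξ ≡⟨ sign-flip ε {sum (λ b → R h (τ + (- 1#) * (b * b)) ξ)} {R (R h) τ ξ} (class (R-zero z) τ ξ) ⟩
      proj₁ ε ℤ.* sum (λ b → R h (τ + (- 1#) * (b * b)) ξ) ≡⟨ cong (proj₁ ε ℤ.*_) (begin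
        sum (λ b → sum (λ a → h (τ + (- 1#) * (b * b) + a * a) ξ)) ≡⟨ ∑-swap els els (λ b a → h (τ + (- 1#) * (b * b) + a * a) ξ) ⟩
        sum (λ a → sum (λ b → h (τ + (- 1#) * (b * b) + a * a) ξ)) ≡⟨ ∑-cong els (λ a → ∑-cong els (λ b → cong₂ h
            (solve 3 (λ τ a b → τ :+ (:- con 1ℤ) :* (b :* b) :+ a :* a := τ :+ con 1ℤ :* ((a :+ b) :* (a :- b))) refl τ a b)
            (solve 3 (λ ξ a b → ξ := ξ :+ con 0ℤ :* (a :+ b)) refl ξ a b))) ⟩
        sum (λ a → sum (λ b → h (τ + 1# * ((a + b) * (a - b))) (ξ + 0# * (a + b)))) ≡⟨ sum-rotate (λ s t → h (τ + 1# * (s * t)) (ξ + 0# * s)) ⟨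
        sum (λ s → sum (λ t → h (τ + 1# * (s * t)) (ξ + 0# * s))) ≡⟨ hyperbola 1≢0 0# z τ ξ ⟩
        pos size ℤ.* h τ ξ ∎) ⟩
      proj₁ ε ℤ.* (pos size ℤ.* h τ ξ) ∎
    where open ≡-Reasoning

  -- Completing the square: the kernels u²/n compose like Gaussians of variance n.
  O-compose : ∀ n₁ n₂ → Σ Sign λ ε → ∀ {h} → TauZero h → ∀ τ ξ → O n₁ (O n₂ h) τ ξ ≡ proj₁ ε ℤ.* R (O (n₁ + n₂) h) τ ξ
  O-compose n₁ n₂ = cases (n₁ ≟ 0#) (n₂ ≟ 0#) (n₁ + n₂ ≟ 0#)
    where
    open ≡-Reasoning
    Result : Set
    Result = Σ Sign λ ε → ∀ {h} → TauZero h → ∀ τ ξ → O n₁ (O n₂ h) τ ξ ≡ proj₁ ε ℤ.* R (O (n₁ + n₂) h) τ ξ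
    -- For opposite variances u²/n₁ + w²/n₂ = (u + w) (u - w)/n₁ is a hyperbola, giving q h; this is
    -- rewritten as ±R (R h) to fit the general form, as O 0 = R.
    opposite : n₁ ≢ 0# → n₂ ≢ 0# → n₁ + n₂ ≡ 0# → Result
    opposite p₁ p₂ e = proj₁ R² , λ {h} z τ ξ → begin
      O n₁ (O n₂ h) τ ξ ≡⟨ O-nonzero p₁ (O n₂ h) τ ξ ⟩
      sum (λ u → O n₂ h (τ + u * u * v) (ξ + u)) ≡⟨ ∑-cong els (λ u → O-nonzero p₂ h (τ + u * u * v) (ξ + u)) ⟩
      sum (λ u → sum (λ w → h (τ + u * u * v + w * w * inv n₂) (ξ + u + w)))
        ≡⟨ ∑-cong els (λ u → ∑-cong els (λ w → cong₂ h (trans (cong (λ i → τ + u * u * v + w * w * i) inv₂)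
             (solve 4 (λ τ u v w → τ :+ u :* u :* v :+ w :* w :* (:- v) := τ :+ v :* ((u :+ w) :* (u :- w))) refl τ u v w))
             (solve 3 (λ ξ u w → ξ :+ u :+ w := ξ :+ con 1ℤ :* (u :+ w)) refl ξ u w))) ⟩
      sum (λ u → sum (λ w → h (τ + v * ((u + w) * (u - w))) (ξ + 1# * (u + w)))) ≡⟨ sum-rotate (λ s t → h (τ + v * (s * t)) (ξ + 1# * s)) ⟨
      sum (λ s → sum (λ t → h (τ + v * (s * t)) (ξ + 1# * s))) ≡⟨ hyperbola (inv-≢0 p₁) 1# z τ ξ ⟩
      pos size ℤ.* h τ ξ ≡⟨ sign-flip (proj₁ R²) {R (R h) τ ξ} {pos size ℤ.* h τ ξ} (proj₂ R² z τ ξ) ⟩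
      proj₁ (proj₁ R²) ℤ.* R (R h) τ ξ ≡⟨ cong (proj₁ (proj₁ R²) ℤ.*_) (R-cong (λ τ ξ → sym (O-zero e h τ ξ)) τ ξ) ⟩
      proj₁ (proj₁ R²) ℤ.* R (O (n₁ + n₂) h) τ ξ ∎
      where
      v : Carrier
      v = inv n₁
      inv₂ : inv n₂ ≡ - v
      inv₂ = trans (cong inv (x-y≡0⇒x≡y (trans (cong (n₂ +_) (-‿involutive n₁)) (trans (+-comm n₂ n₁) e)))) (Nonzero.inv-neg F p₁)
    -- With x = u + w the exponent is x²/(n₁ + n₂) + (1/n₁ + 1/n₂) y²; the y-sum is ±R by `R-class`.
    generic : n₁ ≢ 0# → n₂ ≢ 0# → n₁ + n₂ ≢ 0# → Result
    generic p₁ p₂ p = proj₁ class , λ {h} z τ ξ → begin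
      O n₁ (O n₂ h) τ ξ ≡⟨ O-nonzero p₁ (O n₂ h) τ ξ ⟩
      sum (λ u → O n₂ h (τ + u * u * v₁) (ξ + u)) ≡⟨ ∑-cong els (λ u → O-nonzero p₂ h (τ + u * u * v₁) (ξ + u)) ⟩
      sum (λ u → sum (λ w → h (τ + u * u * v₁ + w * w * v₂) (ξ + u + w)))
        ≡⟨ ∑-cong els (λ u → sym (sum-shift (- u) (λ w → h (τ + u * u * v₁ + w * w * v₂) (ξ + u + w)))) ⟩
      sum (λ u → sum (λ x → h (τ + u * u * v₁ + (- u + x) * (- u + x) * v₂) (ξ + u + (- u + x))))
        ≡⟨ ∑-swap els els (λ u x → h (τ + u * u * v₁ + (- u + x) * (- u + x) * v₂) (ξ + u + (- u + x))) ⟩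
      sum (λ x → sum (λ u → h (τ + u * u * v₁ + (- u + x) * (- u + x) * v₂) (ξ + u + (- u + x))))
        ≡⟨ ∑-cong els (λ x → sym (sum-shift (n₁ * v * x) (λ u → h (τ + u * u * v₁ + (- u + x) * (- u + x) * v₂) (ξ + u + (- u + x))))) ⟩
      sum (λ x → sum (λ y → h (τ + (n₁ * v * x + y) * (n₁ * v * x + y) * v₁ + (- (n₁ * v * x + y) + x) * (- (n₁ * v * x + y) + x) * v₂) (ξ + (n₁ * v * x + y) + (- (n₁ * v * x + y) + x))))
        ≡⟨ ∑-cong els (λ x → ∑-cong els (λ y → cong₂ h (complete τ x y) (solve 3 (λ ξ a x → ξ :+ a :+ (:- a :+ x) := ξ :+ x) refl ξ (n₁ * v * x + y) x))) ⟩
      sum (λ x → sum (λ y → h (τ + x * x * v + c * (y * y)) (ξ + x))) ≡⟨ ∑-cong els (λ x → proj₂ class z (τ + x * x * v) (ξ + x)) ⟩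
      sum (λ x → proj₁ (proj₁ class) ℤ.* R h (τ + x * x * v) (ξ + x)) ≡⟨ ∑-*ˡ els (proj₁ (proj₁ class)) (λ x → R h (τ + x * x * v) (ξ + x)) ⟩
      proj₁ (proj₁ class) ℤ.* sum (λ x → R h (τ + x * x * v) (ξ + x)) ≡⟨ cong (proj₁ (proj₁ class) ℤ.*_) (trans (sym (O-nonzero p (R h) τ ξ)) (O-R-comm (n₁ + n₂) h τ ξ)) ⟩
      proj₁ (proj₁ class) ℤ.* R (O (n₁ + n₂) h) τ ξ ∎
      where
      v₁ v₂ v c : Carrier
      v₁ = inv n₁
      v₂ = inv n₂
      v = inv (n₁ + n₂)
      c = v₁ + v₂
      c≡ : c ≡ (n₁ + n₂) * (v₁ * v₂)
      c≡ = sym (trans (solve 4 (λ a b u w → (a :+ b) :* (u :* w) := (b :* w) :* u :+ (a :* u) :* w) refl n₁ n₂ v₁ v₂)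
        (trans (cong₂ (λ s t → s * v₁ + t * v₂) (*-inv p₂) (*-inv p₁)) (cong₂ _+_ (*-identityˡ v₁) (*-identityˡ v₂))))
      c≢0 : c ≢ 0#
      c≢0 e = *-≢0 p (*-≢0 (inv-≢0 p₁) (inv-≢0 p₂)) (trans (sym c≡) e)
      class = R-class c c≢0
      -- The substitution is u = n₁ v x + y, x - u = n₂ v x - y.
      second : ∀ x y → - (n₁ * v * x + y) + x ≡ n₂ * v * x - y
      second x y = trans (cong (- (n₁ * v * x + y) +_) (trans (sym (*-identityˡ x)) (cong (_* x) (sym (*-inv p)))))
        (solve 5 (λ a b v x y → :- (a :* v :* x :+ y) :+ (a :+ b) :* v :* x := b :* v :* x :- y) refl n₁ n₂ v x y)
      square : ∀ n i z y → n * i ≡ 1# → (n * z + y) * (n * z + y) * i ≡ n * (z * z) + 2# * (z * y) + i * (y * y)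
      square n i z y e = begin
        (n * z + y) * (n * z + y) * i
          ≡⟨ solve 4 (λ n i z y → (n :* z :+ y) :* (n :* z :+ y) :* i := (n :* i) :* (n :* (z :* z) :+ (con 1ℤ :+ con 1ℤ) :* (z :* y)) :+ i :* (y :* y)) refl n i z y ⟩
        (n * i) * (n * (z * z) + 2# * (z * y)) + i * (y * y) ≡⟨ cong (_+ i * (y * y)) (trans (cong (_* (n * (z * z) + 2# * (z * y))) e) (*-identityˡ _)) ⟩
        n * (z * z) + 2# * (z * y) + i * (y * y) ∎
      complete : ∀ τ x y → τ + (n₁ * v * x + y) * (n₁ * v * x + y) * v₁ + (- (n₁ * v * x + y) + x) * (- (n₁ * v * x + y) + x) * v₂ ≡ τ + x * x * v + c * (y * y)
      complete τ x y = begin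
        τ + (n₁ * v * x + y) * (n₁ * v * x + y) * v₁ + (- (n₁ * v * x + y) + x) * (- (n₁ * v * x + y) + x) * v₂
          ≡⟨ cong₂ (λ a b → τ + (a + y) * (a + y) * v₁ + b * b * v₂) (*-assoc n₁ v x) (trans (second x y) (cong (_- y) (*-assoc n₂ v x))) ⟩
        τ + (n₁ * z + y) * (n₁ * z + y) * v₁ + (n₂ * z + - y) * (n₂ * z + - y) * v₂
          ≡⟨ cong₂ (λ a b → τ + a + b) (square n₁ v₁ z y (*-inv p₁)) (square n₂ v₂ z (- y) (*-inv p₂)) ⟩
        τ + (n₁ * (z * z) + 2# * (z * y) + v₁ * (y * y)) + (n₂ * (z * z) + 2# * (z * - y) + v₂ * (- y * - y))
          ≡⟨ cong₂ (λ a b → τ + (n₁ * (z * z) + a + v₁ * (y * y)) + (n₂ * (z * z) + b + v₂ * (- y * - y))) refl (solve 2 (λ z y → (con 1ℤ :+ con 1ℤ) :* (z :* (:- y)) := :- ((con 1ℤ :+ con 1ℤ) :* (z :* y))) refl z y) ⟩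
        τ + (n₁ * (z * z) + 2# * (z * y) + v₁ * (y * y)) + (n₂ * (z * z) + - (2# * (z * y)) + v₂ * (- y * - y))
          ≡⟨ cong (λ w → τ + (n₁ * (z * z) + 2# * (z * y) + v₁ * (y * y)) + (n₂ * (z * z) + - (2# * (z * y)) + v₂ * w)) (solve 1 (λ y → (:- y) :* (:- y) := y :* y) refl y) ⟩
        τ + (n₁ * (z * z) + 2# * (z * y) + v₁ * (y * y)) + (n₂ * (z * z) + - (2# * (z * y)) + v₂ * (y * y))
          ≡⟨ regroup τ (z * z) (2# * (z * y)) (y * y) ⟩
        τ + (n₁ + n₂) * (z * z) + c * (y * y)
          ≡⟨ cong (λ w → τ + w + c * (y * y)) (trans (solve 3 (λ n v x → n :* (v :* x :* (v :* x)) := (n :* v) :* (x :* x :* v)) refl (n₁ + n₂) v x)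
               (trans (cong (_* (x * x * v)) (*-inv p)) (*-identityˡ _))) ⟩
        τ + x * x * v + c * (y * y) ∎
        where
        z : Carrier
        z = v * x
        regroup : ∀ τ s w t → τ + (n₁ * s + w + v₁ * t) + (n₂ * s + - w + v₂ * t) ≡ τ + (n₁ + n₂) * s + (v₁ + v₂) * t
        regroup τ s w t = begin
          τ + (n₁ * s + w + v₁ * t) + (n₂ * s + - w + v₂ * t)
            ≡⟨ Mon6 (n₁ * s) (n₂ * s) (v₁ * t) (v₂ * t) ⟩
          τ + (n₁ * s + n₂ * s) + (v₁ * t + v₂ * t) ≡⟨ cong₂ (λ a b → τ + a + b) (sym (distribʳ s n₁ n₂)) (sym (distribʳ t v₁ v₂)) ⟩
          τ + (n₁ + n₂) * s + (v₁ + v₂) * t ∎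
          where
          Mon6 : ∀ a b c d → τ + (a + w + c) + (b + - w + d) ≡ τ + (a + b) + (c + d)
          Mon6 a b c d = solve 6 (λ τ w a b c d → τ :+ (a :+ w :+ c) :+ (b :+ (:- w) :+ d) := τ :+ (a :+ b) :+ (c :+ d)) refl τ w a b c d
    cases : Dec (n₁ ≡ 0#) → Dec (n₂ ≡ 0#) → Dec (n₁ + n₂ ≡ 0#) → Result
    cases (yes refl) _ _ = +1ₛ , λ {h} z τ ξ → trans (O-zero refl (O n₂ h) τ ξ)
      (trans (cong (λ m → R (O m h) τ ξ) (sym (+-identityˡ n₂))) (sym (ℤP.*-identityˡ _)))
    cases (no _) (yes refl) _ = +1ₛ , λ {h} z τ ξ → trans (O-cong n₁ (λ τ ξ → O-zero refl h τ ξ) τ ξ)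
      (trans (O-R-comm n₁ h τ ξ) (trans (cong (λ m → R (O m h) τ ξ) (sym (+-identityʳ n₁))) (sym (ℤP.*-identityˡ _))))
    cases (no p₁) (no p₂) (yes e) = opposite p₁ p₂ e
    cases (no p₁) (no p₂) (no p) = generic p₁ p₂ p

module SphereSums (F : OddField) where
  open OddField F
  open Heat F

  sqd : ∀ {t} → Vec Carrier t → Vec Carrier t → Carrier
  sqd [] [] = 0#
  sqd (x ∷ xs) (y ∷ ys) = (x - y) * (x - y) + sqd xs ys

  dot : ∀ {t} → Vec Carrier t → Vec Carrier t → Carrier
  dot [] [] = 0#
  dot (x ∷ xs) (y ∷ ys) = x * y + dot xs ys

  norm² : ∀ {t} → Vec Carrier t → Carrier
  norm² [] = 0#
  norm² (x ∷ xs) = x * x + norm² xs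

  sqd-sym : ∀ {t} (x y : Vec Carrier t) → sqd x y ≡ sqd y x
  sqd-sym [] [] = refl
  sqd-sym (x ∷ xs) (y ∷ ys) = cong₂ _+_ (solve 2 (λ x y → (x :- y) :* (x :- y) := (y :- x) :* (y :- x)) refl x y) (sqd-sym xs ys)

  Rpow : ℕ → Fun → Fun
  Rpow zero h = h
  Rpow (suc k) h = R (Rpow k h)

  Rpow-cong : ∀ k {h g} → (∀ τ ξ → h τ ξ ≡ g τ ξ) → ∀ τ ξ → Rpow k h τ ξ ≡ Rpow k g τ ξ
  Rpow-cong zero e = e
  Rpow-cong (suc k) e = R-cong (Rpow-cong k e)

  Rpow-scale : ∀ k c h τ ξ → Rpow k (λ τ ξ → c ℤ.* h τ ξ) τ ξ ≡ c ℤ.* Rpow k h τ ξ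
  Rpow-scale zero c h τ ξ = refl
  Rpow-scale (suc k) c h τ ξ = trans (R-cong (Rpow-scale k c h) τ ξ) (R-scale c (Rpow k h) τ ξ)

  Rpow-R : ∀ k h τ ξ → Rpow k (R h) τ ξ ≡ R (Rpow k h) τ ξ
  Rpow-R zero h τ ξ = refl
  Rpow-R (suc k) h τ ξ = R-cong (Rpow-R k h) τ ξ

  O-Rpow : ∀ n k h τ ξ → O n (Rpow k h) τ ξ ≡ Rpow k (O n h) τ ξ
  O-Rpow n zero h τ ξ = refl
  O-Rpow n (suc k) h τ ξ = trans (O-R-comm n (Rpow k h) τ ξ) (R-cong (O-Rpow n k h) τ ξ)

  Rpow-zero : ∀ k {h} → TauZero h → TauZero (Rpow k h)
  Rpow-zero zero z = z
  Rpow-zero (suc k) z = R-zero (Rpow-zero k z)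

  -- The contribution of one coordinate: centred at y₀ and parametrised by u = m₀ a, it is the
  -- parabola of `O` with n = m₀².
  line : ∀ m₀ y₀ h τ ξ → sum (λ a → h (τ + (a - y₀) * (a - y₀)) (ξ + m₀ * a)) ≡ O (m₀ * m₀) h τ (ξ + m₀ * y₀)
  line m₀ y₀ h τ ξ = trans (sym (sum-shift y₀ (λ a → h (τ + (a - y₀) * (a - y₀)) (ξ + m₀ * a))))
    (trans (∑-cong els (λ a → cong₂ h (cong (τ +_) (solve 2 (λ y a → (y :+ a :- y) :* (y :+ a :- y) := a :* a) refl y₀ a))
      (solve 4 (λ ξ m y a → ξ :+ m :* (y :+ a) := ξ :+ m :* y :+ m :* a) refl ξ m₀ y₀ a))) (cases (m₀ ≟ 0#)))
    where
    open ≡-Reasoning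
    cases : Dec (m₀ ≡ 0#) → sum (λ a → h (τ + a * a) (ξ + m₀ * y₀ + m₀ * a)) ≡ O (m₀ * m₀) h τ (ξ + m₀ * y₀)
    cases (yes refl) = trans (∑-cong els (λ a → cong (h (τ + a * a)) (trans (cong (ξ + 0# * y₀ +_) (zeroˡ a)) (+-identityʳ _))))
      (sym (O-zero (zeroˡ 0#) h τ (ξ + 0# * y₀)))
    cases (no p) = sym (begin
      O (m₀ * m₀) h τ ξ′ ≡⟨ O-nonzero (*-≢0 p p) h τ ξ′ ⟩
      sum (λ u → h (τ + u * u * i) (ξ′ + u)) ≡⟨ sum-scale p (λ u → h (τ + u * u * i) (ξ′ + u)) ⟨
      sum (λ a → h (τ + m₀ * a * (m₀ * a) * i) (ξ′ + m₀ * a)) ≡⟨ ∑-cong els (λ a → cong (λ w → h (τ + w) (ξ′ + m₀ * a)) (begin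
          m₀ * a * (m₀ * a) * i ≡⟨ solve 3 (λ m a i → m :* a :* (m :* a) :* i := (m :* m :* i) :* (a :* a)) refl m₀ a i ⟩
          m₀ * m₀ * i * (a * a) ≡⟨ cong (_* (a * a)) (*-inv (*-≢0 p p)) ⟩
          1# * (a * a) ≡⟨ *-identityˡ _ ⟩
          a * a ∎)) ⟩
      sum (λ a → h (τ + a * a) (ξ′ + m₀ * a)) ∎)
      where
      i ξ′ : Carrier
      i = inv (m₀ * m₀)
      ξ′ = ξ + m₀ * y₀

  -- The coordinates contribute commuting operators, which compose by completing squares.
  sphere-identity : ∀ t (m : Vec Carrier (suc t)) → Σ Sign λ ε → ∀ {h} → TauZero h → ∀ y τ ξ →
    ∑ (vecs finite (suc t)) (λ x → h (τ + sqd x y) (ξ + dot m x)) ≡ proj₁ ε ℤ.* Rpow t (O (norm² m) h) τ (ξ + dot m y)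
  sphere-identity zero (m₀ ∷ []) = +1ₛ , λ { {h} z (y₀ ∷ []) τ ξ → begin
      ∑ (vecs finite 1) (λ x → h (τ + sqd x (y₀ ∷ [])) (ξ + dot (m₀ ∷ []) x)) ≡⟨ ∑-vecs finite 0 (λ x → h (τ + sqd x (y₀ ∷ [])) (ξ + dot (m₀ ∷ []) x)) ⟩
      sum (λ a → h (τ + ((a - y₀) * (a - y₀) + 0#)) (ξ + (m₀ * a + 0#)) ℤ.+ 0ℤ)
        ≡⟨ ∑-cong els (λ a → trans (ℤP.+-identityʳ _) (cong₂ h (cong (τ +_) (+-identityʳ _)) (cong (ξ +_) (+-identityʳ _)))) ⟩
      sum (λ a → h (τ + (a - y₀) * (a - y₀)) (ξ + m₀ * a)) ≡⟨ line m₀ y₀ h τ ξ ⟩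
      O (m₀ * m₀) h τ (ξ + m₀ * y₀) ≡⟨ cong₂ (λ n e → O n h τ (ξ + e)) (+-identityʳ _) (+-identityʳ _) ⟨
      O (m₀ * m₀ + 0#) h τ (ξ + (m₀ * y₀ + 0#)) ≡⟨ ℤP.*-identityˡ _ ⟨
      1ℤ ℤ.* O (m₀ * m₀ + 0#) h τ (ξ + (m₀ * y₀ + 0#)) ∎ }
    where open ≡-Reasoning
  sphere-identity (suc t) (m₀ ∷ m) = ε ·ₛ δ , λ { {h} z (y₀ ∷ y) τ ξ → let G = Rpow t (O (norm² m) h) in begin
      ∑ (vecs finite (suc (suc t))) (λ x → h (τ + sqd x (y₀ ∷ y)) (ξ + dot (m₀ ∷ m) x))
        ≡⟨ ∑-vecs finite (suc t) (λ x → h (τ + sqd x (y₀ ∷ y)) (ξ + dot (m₀ ∷ m) x)) ⟩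
      sum (λ a → ∑ (vecs finite (suc t)) (λ x → h (τ + ((a - y₀) * (a - y₀) + sqd x y)) (ξ + (m₀ * a + dot m x))))
        ≡⟨ ∑-cong els (λ a → trans (∑-cong (vecs finite (suc t)) (λ x → cong₂ h (sym (+-assoc _ _ _)) (sym (+-assoc _ _ _)))) (ih z y (τ + (a - y₀) * (a - y₀)) (ξ + m₀ * a))) ⟩
      sum (λ a → proj₁ ε ℤ.* G (τ + (a - y₀) * (a - y₀)) (ξ + m₀ * a + dot m y)) ≡⟨ ∑-*ˡ els (proj₁ ε) (λ a → G (τ + (a - y₀) * (a - y₀)) (ξ + m₀ * a + dot m y)) ⟩
      proj₁ ε ℤ.* sum (λ a → G (τ + (a - y₀) * (a - y₀)) (ξ + m₀ * a + dot m y))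
        ≡⟨ cong (proj₁ ε ℤ.*_) (∑-cong els (λ a → cong (G (τ + (a - y₀) * (a - y₀))) (solve 3 (λ ξ b d → ξ :+ b :+ d := ξ :+ d :+ b) refl ξ (m₀ * a) (dot m y)))) ⟩
      proj₁ ε ℤ.* sum (λ a → G (τ + (a - y₀) * (a - y₀)) (ξ + dot m y + m₀ * a)) ≡⟨ cong (proj₁ ε ℤ.*_) (line m₀ y₀ G τ (ξ + dot m y)) ⟩
      proj₁ ε ℤ.* O (m₀ * m₀) G τ (ξ + dot m y + m₀ * y₀) ≡⟨ cong (proj₁ ε ℤ.*_) (cong (O (m₀ * m₀) G τ) (solve 3 (λ ξ b d → ξ :+ d :+ b := ξ :+ (b :+ d)) refl ξ (m₀ * y₀) (dot m y))) ⟩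
      proj₁ ε ℤ.* O (m₀ * m₀) G τ (ξ + (m₀ * y₀ + dot m y)) ≡⟨ cong (proj₁ ε ℤ.*_) (compose h z τ (ξ + (m₀ * y₀ + dot m y))) ⟩
      proj₁ ε ℤ.* (proj₁ δ ℤ.* Rpow (suc t) (O (m₀ * m₀ + norm² m) h) τ (ξ + (m₀ * y₀ + dot m y))) ≡⟨ ℤP.*-assoc (proj₁ ε) (proj₁ δ) _ ⟨
      proj₁ ε ℤ.* proj₁ δ ℤ.* Rpow (suc t) (O (m₀ * m₀ + norm² m) h) τ (ξ + (m₀ * y₀ + dot m y)) ∎ }
    where
    open ≡-Reasoning
    ε δ : Sign
    ε = proj₁ (sphere-identity t m)
    ih = λ {h} → proj₂ (sphere-identity t m) {h}
    δ = proj₁ (O-compose (m₀ * m₀) (norm² m))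
    compose : ∀ h → TauZero h → ∀ τ ξ → O (m₀ * m₀) (Rpow t (O (norm² m) h)) τ ξ ≡ proj₁ δ ℤ.* Rpow (suc t) (O (m₀ * m₀ + norm² m) h) τ ξ
    compose h z τ ξ = begin
      O (m₀ * m₀) (Rpow t (O (norm² m) h)) τ ξ ≡⟨ O-Rpow (m₀ * m₀) t (O (norm² m) h) τ ξ ⟩
      Rpow t (O (m₀ * m₀) (O (norm² m) h)) τ ξ ≡⟨ Rpow-cong t (proj₂ (O-compose (m₀ * m₀) (norm² m)) z) τ ξ ⟩
      Rpow t (λ τ ξ → proj₁ δ ℤ.* R (O (m₀ * m₀ + norm² m) h) τ ξ) τ ξ ≡⟨ Rpow-scale t (proj₁ δ) (R (O (m₀ * m₀ + norm² m) h)) τ ξ ⟩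
      proj₁ δ ℤ.* Rpow t (R (O (m₀ * m₀ + norm² m) h)) τ ξ ≡⟨ cong (proj₁ δ ℤ.*_) (Rpow-R t (O (m₀ * m₀ + norm² m) h) τ ξ) ⟩
      proj₁ δ ℤ.* Rpow (suc t) (O (m₀ * m₀ + norm² m) h) τ ξ ∎

  qℤ : ℤ
  qℤ = pos size

  pw : ℕ → ℤ
  pw zero = 1ℤ
  pw (suc j) = qℤ ℤ.* pw j

  1≤qℤ : 1ℤ ℤ.≤ qℤ
  1≤qℤ = ℤ.+≤+ (ℕP.<⇒≤ 1<size)

  qℤ≥0 : 0ℤ ℤ.≤ qℤ
  qℤ≥0 = ℤ.+≤+ z≤n

  pw≥0 : ∀ j → 0ℤ ℤ.≤ pw j
  pw≥0 zero = ℤ.+≤+ z≤n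
  pw≥0 (suc j) = *-nonneg qℤ≥0 (pw≥0 j)

  double : ℕ → ℕ
  double zero = zero
  double (suc j) = suc (suc (double j))

  parity : ∀ t → (∃ λ j → t ≡ double j) ⊎ (∃ λ j → t ≡ suc (double j))
  parity zero = inj₁ (0 , refl)
  parity (suc t) with parity t
  ... | inj₁ (j , e) = inj₂ (j , cong suc e)
  ... | inj₂ (j , e) = inj₁ (suc j , cong suc e)

  pw-double : ∀ j → pw (double j) ≡ pw j ℤ.* pw j
  pw-double zero = refl
  pw-double (suc j) = trans (cong (λ w → qℤ ℤ.* (qℤ ℤ.* w)) (pw-double j)) (lem qℤ (pw j))
    where
    lem : ∀ q p → q ℤ.* (q ℤ.* (p ℤ.* p)) ≡ q ℤ.* p ℤ.* (q ℤ.* p)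
    lem = solve-∀

  Rpow-double : ∀ j → Σ Sign λ ε → ∀ {h} → TauZero h → ∀ τ ξ → Rpow (double j) h τ ξ ≡ proj₁ ε ℤ.* (pw j ℤ.* h τ ξ)
  Rpow-double zero = +1ₛ , λ {h} z τ ξ → sym (trans (ℤP.*-identityˡ _) (ℤP.*-identityˡ (h τ ξ)))
  Rpow-double (suc j) = proj₁ R² ·ₛ proj₁ (Rpow-double j) , λ {h} z τ ξ →
    trans (proj₂ R² (Rpow-zero (double j) z) τ ξ) (trans (cong (λ w → proj₁ (proj₁ R²) ℤ.* (qℤ ℤ.* w)) (proj₂ (Rpow-double j) z τ ξ))
      (lem (proj₁ (proj₁ R²)) qℤ (proj₁ (proj₁ (Rpow-double j))) (pw j) (h τ ξ)))
    where
    lem : ∀ a q e p x → a ℤ.* (q ℤ.* (e ℤ.* (p ℤ.* x))) ≡ a ℤ.* e ℤ.* (q ℤ.* p ℤ.* x)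
    lem = solve-∀

  -- The indicator of distance one, multiplied by q and corrected to have mean zero.
  κ : Carrier → ℤ
  κ τ = qℤ ℤ.* ⟦ τ ≟ 1# ⟧ ℤ.- 1ℤ

  sum-κ : sum κ ≡ 0ℤ
  sum-κ = trans (∑-sub els (λ τ → qℤ ℤ.* ⟦ τ ≟ 1# ⟧) (λ _ → 1ℤ))
    (trans (cong₂ ℤ._-_ (trans (∑-*ˡ els qℤ (λ τ → ⟦ τ ≟ 1# ⟧)) (cong (qℤ ℤ.*_) (once 1#))) (∑-const els 1ℤ)) (ℤP.+-inverseʳ (qℤ ℤ.* 1ℤ)))

  κ-0 : κ 0# ≡ ℤ.- 1ℤ
  κ-0 = trans (cong (λ w → qℤ ℤ.* w ℤ.- 1ℤ) (⟦⟧-no (0# ≟ 1#) (λ e → 1≢0 (sym e)))) (cong (ℤ._- 1ℤ) (ℤP.*-zeroʳ qℤ))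

  sum-κ-squares : ∀ z → sum (λ a → κ (z + a * a)) ≡ qℤ ℤ.* (roots (1# - z) ℤ.- 1ℤ)
  sum-κ-squares z = trans (∑-sub els (λ a → qℤ ℤ.* ⟦ z + a * a ≟ 1# ⟧) (λ _ → 1ℤ))
    (trans (cong₂ ℤ._-_ (trans (∑-*ˡ els qℤ (λ a → ⟦ z + a * a ≟ 1# ⟧)) (cong (qℤ ℤ.*_) (∑-cong els (λ a → ⟦⟧-cong (z + a * a ≟ 1#) (a * a ≟ 1# - z)
        (λ e → trans (solve 2 (λ z a → a := z :+ a :- z) refl z (a * a)) (cong (_- z) e))
        (λ e → trans (cong (z +_) e) (solve 2 (λ z o → z :+ (o :- z) := o) refl z 1#)))))) (∑-const els 1ℤ))
      (lem qℤ (roots (1# - z))))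
    where
    lem : ∀ q r → q ℤ.* r ℤ.- q ℤ.* 1ℤ ≡ q ℤ.* (r ℤ.- 1ℤ)
    lem = solve-∀

  λ₁ : ℤ
  λ₁ = sum (λ a → κ (0# + a * a))

  λ₁² : λ₁ ℤ.* λ₁ ℤ.≤ qℤ ℤ.* qℤ
  λ₁² = subst (λ w → w ℤ.* w ℤ.≤ qℤ ℤ.* qℤ) (sym (sum-κ-squares 0#)) (≤-from-diff (subst (0ℤ ℤ.≤_) (sym (lem qℤ r))
    (*-nonneg (*-nonneg qℤ≥0 qℤ≥0) (*-nonneg (∑-nonneg els (λ y → ⟦⟧-nonneg (y * y ≟ 1# - 0#))) (diff-nonneg (roots≤2 (1# - 0#)))))))
    where
    r : ℤ
    r = roots (1# - 0#)
    lem : ∀ q r → q ℤ.* q ℤ.- q ℤ.* (r ℤ.- 1ℤ) ℤ.* (q ℤ.* (r ℤ.- 1ℤ)) ≡ q ℤ.* q ℤ.* (r ℤ.* (pos 2 ℤ.- r))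
    lem = solve-∀

  norm²-0 : ∀ t → norm² (replicate t 0#) ≡ 0#
  norm²-0 zero = refl
  norm²-0 (suc t) = trans (cong₂ _+_ (zeroˡ 0#) (norm²-0 t)) (+-identityˡ 0#)

  -- For m = 0 the sphere identity reads ±R^(t + 1) κ at 0, and R² = ±q leaves only a power of q
  -- times `λ₁` or times κ 0 = -1. It bounds how far the unit sphere deviates from its expected
  -- size.
  sphere-size : ∀ t y → let s = ∑ (vecs finite (suc t)) (λ x → κ (sqd x y)) in s ℤ.* s ℤ.≤ pw (suc (suc t))
  sphere-size t y = subst (λ w → w ℤ.* w ℤ.≤ pw (suc (suc t))) (sym eq)
      (subst (ℤ._≤ pw (suc (suc t))) (sym (sign-square (proj₁ S) (Rpow t (R h) 0# 0#))) (cases (parity t)))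
    where
    open ≡-Reasoning
    h : Fun
    h τ ξ = κ τ
    z : TauZero h
    z ξ = sum-κ
    S = sphere-identity t (replicate (suc t) 0#)
    eq : ∑ (vecs finite (suc t)) (λ x → κ (sqd x y)) ≡ proj₁ (proj₁ S) ℤ.* Rpow t (R h) 0# 0#
    eq = begin
      ∑ (vecs finite (suc t)) (λ x → κ (sqd x y)) ≡⟨ ∑-cong (vecs finite (suc t)) (λ x → cong κ (sym (+-identityˡ (sqd x y)))) ⟩
      ∑ (vecs finite (suc t)) (λ x → h (0# + sqd x y) (0# + dot (replicate (suc t) 0#) x)) ≡⟨ proj₂ S z y 0# 0# ⟩
      proj₁ (proj₁ S) ℤ.* Rpow t (O (norm² (replicate (suc t) 0#)) h) 0# ξ ≡⟨ cong (proj₁ (proj₁ S) ℤ.*_) (Rpow-cong t (O-zero (norm²-0 (suc t)) h) 0# ξ) ⟩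
      proj₁ (proj₁ S) ℤ.* Rpow t (R h) 0# ξ ≡⟨ cong (proj₁ (proj₁ S) ℤ.*_) (indep t 0# ξ 0#) ⟩
      proj₁ (proj₁ S) ℤ.* Rpow t (R h) 0# 0# ∎
      where
      ξ : Carrier
      ξ = 0# + dot (replicate (suc t) 0#) y
      indep : ∀ k τ ξ ξ′ → Rpow k (R h) τ ξ ≡ Rpow k (R h) τ ξ′
      indep zero τ ξ ξ′ = refl
      indep (suc k) τ ξ ξ′ = ∑-cong els (λ a → indep k (τ + a * a) ξ ξ′)
    cases : (∃ λ j → t ≡ double j) ⊎ (∃ λ j → t ≡ suc (double j)) → Rpow t (R h) 0# 0# ℤ.* Rpow t (R h) 0# 0# ℤ.≤ pw (suc (suc t))
    cases (inj₁ (j , refl)) = subst₂ ℤ._≤_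
      (sym (trans (cong (λ w → w ℤ.* w) (proj₂ (Rpow-double j) (R-zero z) 0# 0#)) (trans (sign-square (proj₁ (Rpow-double j)) (pw j ℤ.* λ₁)) (lem (pw j) λ₁))))
      (trans (lem′ (pw j) qℤ) (cong (λ w → qℤ ℤ.* (qℤ ℤ.* w)) (sym (pw-double j))))
      (*-monoˡ (sq-nonneg (pw j)) λ₁²)
      where
      lem : ∀ p l → p ℤ.* l ℤ.* (p ℤ.* l) ≡ p ℤ.* p ℤ.* (l ℤ.* l)
      lem = solve-∀
      lem′ : ∀ p q → p ℤ.* p ℤ.* (q ℤ.* q) ≡ q ℤ.* (q ℤ.* (p ℤ.* p))
      lem′ = solve-∀
    cases (inj₂ (j , refl)) = subst₂ ℤ._≤_ (sym value) (trans (lem′ (pw j) qℤ) (cong (λ w → qℤ ℤ.* (qℤ ℤ.* (qℤ ℤ.* w))) (sym (pw-double j))))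
        (*-monoˡ (sq-nonneg (pw j)) (*-monoˡ {qℤ ℤ.* qℤ} (sq-nonneg qℤ) 1≤qℤ))
      where
      lem : ∀ p q → p ℤ.* (q ℤ.* (ℤ.- 1ℤ)) ℤ.* (p ℤ.* (q ℤ.* (ℤ.- 1ℤ))) ≡ p ℤ.* p ℤ.* (q ℤ.* q ℤ.* 1ℤ)
      lem = solve-∀
      lem′ : ∀ p q → p ℤ.* p ℤ.* (q ℤ.* q ℤ.* q) ≡ q ℤ.* (q ℤ.* (q ℤ.* (p ℤ.* p)))
      lem′ = solve-∀
      shuffle : ∀ e p d x → e ℤ.* (p ℤ.* (d ℤ.* x)) ≡ e ℤ.* d ℤ.* (p ℤ.* x)
      shuffle = solve-∀
      ε δ : Sign
      ε = proj₁ (Rpow-double j)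
      δ = proj₁ R²
      value : Rpow (suc (double j)) (R h) 0# 0# ℤ.* Rpow (suc (double j)) (R h) 0# 0# ≡ pw j ℤ.* pw j ℤ.* (qℤ ℤ.* qℤ ℤ.* 1ℤ)
      value = trans (cong (λ w → w ℤ.* w) (begin
        R (Rpow (double j) (R h)) 0# 0# ≡⟨ Rpow-R (double j) (R h) 0# 0# ⟨
        Rpow (double j) (R (R h)) 0# 0# ≡⟨ proj₂ (Rpow-double j) (R-zero (R-zero z)) 0# 0# ⟩
        proj₁ ε ℤ.* (pw j ℤ.* R (R h) 0# 0#) ≡⟨ cong (λ w → proj₁ ε ℤ.* (pw j ℤ.* w)) (trans (proj₂ R² z 0# 0#) (cong (λ w → proj₁ δ ℤ.* (qℤ ℤ.* w)) κ-0)) ⟩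
        proj₁ ε ℤ.* (pw j ℤ.* (proj₁ δ ℤ.* (qℤ ℤ.* (ℤ.- 1ℤ)))) ≡⟨ shuffle (proj₁ ε) (pw j) (proj₁ δ) (qℤ ℤ.* (ℤ.- 1ℤ)) ⟩
        proj₁ ε ℤ.* proj₁ δ ℤ.* (pw j ℤ.* (qℤ ℤ.* (ℤ.- 1ℤ))) ∎))
        (trans (sign-square (ε ·ₛ δ) (pw j ℤ.* (qℤ ℤ.* (ℤ.- 1ℤ)))) (lem (pw j) qℤ))

-- The spectral gap

module KernelBounds (F : OddField) (fermat : ∀ x → OddField._^_ F x (OddField.size F) ≡ x) where
  open OddField F
  open Heat F
  open SphereSums F
  open KloostermanBound F fermat

  energy : (Carrier → ℤ) → ℤ
  energy f = sum (λ ξ → f ξ ℤ.* f ξ)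

  energy≥0 : ∀ f → 0ℤ ℤ.≤ energy f
  energy≥0 f = ∑-nonneg els (λ ξ → sq-nonneg (f ξ))

  apply : Fun → (Carrier → ℤ) → Carrier → ℤ
  apply k f c = sum (λ ζ → f ζ ℤ.* k c ζ)

  Bounded : Fun → ℤ → Set
  Bounded k B = ∀ f → MeanZero f → energy (apply k f) ℤ.≤ B ℤ.* energy f

  sum-reflect : ∀ c f → sum (λ u → f (c - u)) ≡ sum f
  sum-reflect c f = trans (sum-neg (λ u → f (c + u))) (sum-shift c f)

  conv : ∀ (ρ : Carrier → ℤ) f c → sum (λ ζ → f ζ ℤ.* sum (λ u → ρ u ℤ.* ⟦ ζ + u ≟ c ⟧)) ≡ sum (λ u → ρ u ℤ.* f (c - u))
  conv ρ f c = begin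
    sum (λ ζ → f ζ ℤ.* sum (λ u → ρ u ℤ.* ⟦ ζ + u ≟ c ⟧)) ≡⟨ ∑-cong els (λ ζ → sym (∑-*ˡ els (f ζ) (λ u → ρ u ℤ.* ⟦ ζ + u ≟ c ⟧))) ⟩
    sum (λ ζ → sum (λ u → f ζ ℤ.* (ρ u ℤ.* ⟦ ζ + u ≟ c ⟧))) ≡⟨ ∑-swap els els (λ ζ u → f ζ ℤ.* (ρ u ℤ.* ⟦ ζ + u ≟ c ⟧)) ⟩
    sum (λ u → sum (λ ζ → f ζ ℤ.* (ρ u ℤ.* ⟦ ζ + u ≟ c ⟧))) ≡⟨ ∑-cong els (λ u → trans (∑-cong els (λ ζ → trans (lem (f ζ) (ρ u) ⟦ ζ + u ≟ c ⟧)
        (cong (λ w → ρ u ℤ.* (w ℤ.* f ζ)) (⟦⟧-cong (ζ + u ≟ c) (ζ ≟ c - u)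
          (λ e → trans (solve 2 (λ z u → z := z :+ u :- u) refl ζ u) (cong (_- u) e))
          (λ e → trans (cong (_+ u) e) (solve 2 (λ c u → c :- u :+ u := c) refl c u))))))
        (trans (∑-*ˡ els (ρ u) (λ ζ → ⟦ ζ ≟ c - u ⟧ ℤ.* f ζ)) (cong (ρ u ℤ.*_) (∑-δ (c - u) f)))) ⟩
    sum (λ u → ρ u ℤ.* f (c - u)) ∎
    where
    open ≡-Reasoning
    lem : ∀ a b d → a ℤ.* (b ℤ.* d) ≡ b ℤ.* (d ℤ.* a)
    lem = solve-∀

  -- Young's inequality, from Cauchy-Schwarz with the weight ρ at each point.
  young : ∀ (ρ : Carrier → ℤ) → (∀ u → 0ℤ ℤ.≤ ρ u) → ∀ f →
    energy (λ c → sum (λ u → ρ u ℤ.* f (c - u))) ℤ.≤ sum ρ ℤ.* sum ρ ℤ.* energy f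
  young ρ ρ≥0 f = ℤP.≤-trans (∑-mono els pointwise) (ℤP.≤-reflexive total)
    where
    open ≡-Reasoning
    S : ℤ
    S = sum ρ
    pointwise : ∀ c → sum (λ u → ρ u ℤ.* f (c - u)) ℤ.* sum (λ u → ρ u ℤ.* f (c - u)) ℤ.≤ S ℤ.* sum (λ u → ρ u ℤ.* (f (c - u) ℤ.* f (c - u)))
    pointwise c = subst₂ ℤ._≤_ (cong (λ w → w ℤ.* w) (∑-cong els (λ u → cong (ρ u ℤ.*_) (ℤP.*-identityˡ (f (c - u))))))
      (cong (ℤ._* sum (λ u → ρ u ℤ.* (f (c - u) ℤ.* f (c - u)))) (∑-cong els (λ u → ℤP.*-identityʳ (ρ u))))
      (weighted-cauchy-schwarz els ρ (λ _ → 1ℤ) (λ u → f (c - u)) ρ≥0)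
    total : sum (λ c → S ℤ.* sum (λ u → ρ u ℤ.* (f (c - u) ℤ.* f (c - u)))) ≡ S ℤ.* S ℤ.* energy f
    total = begin
      sum (λ c → S ℤ.* sum (λ u → ρ u ℤ.* (f (c - u) ℤ.* f (c - u)))) ≡⟨ ∑-*ˡ els S (λ c → sum (λ u → ρ u ℤ.* (f (c - u) ℤ.* f (c - u)))) ⟩
      S ℤ.* sum (λ c → sum (λ u → ρ u ℤ.* (f (c - u) ℤ.* f (c - u)))) ≡⟨ cong (S ℤ.*_) (trans (∑-swap els els (λ c u → ρ u ℤ.* (f (c - u) ℤ.* f (c - u))))
          (trans (∑-cong els (λ u → trans (∑-*ˡ els (ρ u) (λ c → f (c - u) ℤ.* f (c - u)))
            (cong (ρ u ℤ.*_) (trans (∑-cong els (λ c → cong (λ w → f w ℤ.* f w) (+-comm c (- u)))) (sum-shift (- u) (λ z → f z ℤ.* f z))))))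
            (∑-*ʳ els (energy f) ρ))) ⟩
      S ℤ.* (S ℤ.* energy f) ≡⟨ ℤP.*-assoc S S (energy f) ⟨
      S ℤ.* S ℤ.* energy f ∎

  -- The centred condition of distance one, restricted to the hyperplane on which the linear form is
  -- c.
  δ-fun : Carrier → Fun
  δ-fun c τ ξ = κ τ ℤ.* ⟦ ξ ≟ c ⟧

  δ-fun-zero : ∀ c → TauZero (δ-fun c)
  δ-fun-zero c ξ = trans (∑-*ʳ els ⟦ ξ ≟ c ⟧ κ) (cong (ℤ._* ⟦ ξ ≟ c ⟧) sum-κ)

  energy-cong : ∀ {f g : Carrier → ℤ} → (∀ c → f c ≡ g c) → energy f ≡ energy g
  energy-cong e = ∑-cong els (λ c → cong₂ ℤ._*_ (e c) (e c))

  energy-scale : ∀ a f → energy (λ c → a ℤ.* f c) ≡ a ℤ.* a ℤ.* energy f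
  energy-scale a f = trans (∑-cong els (λ c → lem a (f c))) (∑-*ˡ els (a ℤ.* a) (λ c → f c ℤ.* f c))
    where
    lem : ∀ a x → a ℤ.* x ℤ.* (a ℤ.* x) ≡ a ℤ.* a ℤ.* (x ℤ.* x)
    lem = solve-∀

  diagonal : ∀ a f c → sum (λ ζ → f ζ ℤ.* (a ℤ.* ⟦ ζ ≟ c ⟧)) ≡ a ℤ.* f c
  diagonal a f c = trans (∑-cong els (λ ζ → lem (f ζ) a ⟦ ζ ≟ c ⟧)) (trans (∑-*ˡ els a (λ ζ → ⟦ ζ ≟ c ⟧ ℤ.* f ζ)) (cong (a ℤ.*_) (∑-δ c f)))
    where
    lem : ∀ x a d → x ℤ.* (a ℤ.* d) ≡ a ℤ.* (d ℤ.* x)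
    lem = solve-∀

  -- For n ≠ 0 the constant part of κ acts as zero and leaves q times the convolution with the roots
  -- of u² = n, of which there are at most two. For n = 0 the operator is a scalar.
  odd-bound : ∀ n → Bounded (λ c ζ → O n (δ-fun c) 0# ζ) (pos 9 ℤ.* (qℤ ℤ.* qℤ))
  odd-bound n f mean = cases (n ≟ 0#)
    where
    open ≡-Reasoning
    -- The argument gives 4 q²; 9 is the constant of the other parity, 3² from the Kloosterman
    -- bound.
    weaken : ∀ {a} → 0ℤ ℤ.≤ a → a ℤ.≤ pos 4 ℤ.* (qℤ ℤ.* qℤ) → a ℤ.* energy f ℤ.≤ pos 9 ℤ.* (qℤ ℤ.* qℤ) ℤ.* energy f
    weaken a≥0 le = *-mono a≥0 (energy≥0 f) (ℤP.≤-trans le (*-mono {pos 4} (ℤ.+≤+ z≤n) (sq-nonneg qℤ) (ℤ.+≤+ (ℕP.m≤m+n 4 5)) ℤP.≤-refl)) ℤP.≤-refl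
    cases : Dec (n ≡ 0#) → energy (apply (λ c ζ → O n (δ-fun c) 0# ζ) f) ℤ.≤ pos 9 ℤ.* (qℤ ℤ.* qℤ) ℤ.* energy f
    cases (yes e) = subst (ℤ._≤ pos 9 ℤ.* (qℤ ℤ.* qℤ) ℤ.* energy f)
      (sym (trans (energy-cong value) (energy-scale λ₁ f))) (weaken (sq-nonneg λ₁) (ℤP.≤-trans λ₁² four))
      where
      value : ∀ c → apply (λ c ζ → O n (δ-fun c) 0# ζ) f c ≡ λ₁ ℤ.* f c
      value c = trans (∑-cong els (λ ζ → cong (f ζ ℤ.*_) (trans (O-zero e (δ-fun c) 0# ζ) (∑-*ʳ els ⟦ ζ ≟ c ⟧ (λ a → κ (0# + a * a)))))) (diagonal λ₁ f c)
      four : qℤ ℤ.* qℤ ℤ.≤ pos 4 ℤ.* (qℤ ℤ.* qℤ)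
      four = subst (ℤ._≤ pos 4 ℤ.* (qℤ ℤ.* qℤ)) (ℤP.*-identityˡ _) (*-mono {1ℤ} {pos 4} {qℤ ℤ.* qℤ} {qℤ ℤ.* qℤ} (ℤ.+≤+ z≤n) (sq-nonneg qℤ) (ℤ.+≤+ (s≤s z≤n)) ℤP.≤-refl)
    cases (no p) = ℤP.≤-trans (ℤP.≤-reflexive (trans (energy-cong value) (energy-scale qℤ (λ c → sum (λ u → ρ u ℤ.* f (c - u))))))
      (ℤP.≤-trans (*-monoˡ (sq-nonneg qℤ) (young ρ (λ u → ⟦⟧-nonneg (u * u ≟ n)) f))
        (subst (ℤ._≤ pos 9 ℤ.* (qℤ ℤ.* qℤ) ℤ.* energy f) (ℤP.*-assoc (qℤ ℤ.* qℤ) (sum ρ ℤ.* sum ρ) (energy f))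
          (weaken (*-nonneg (sq-nonneg qℤ) (sq-nonneg (sum ρ))) (ℤP.≤-trans (*-monoˡ (sq-nonneg qℤ) ρ²≤4) (ℤP.≤-reflexive (ℤP.*-comm (qℤ ℤ.* qℤ) (pos 4)))))))
      where
      ρ : Carrier → ℤ
      ρ u = ⟦ u * u ≟ n ⟧
      ρ²≤4 : sum ρ ℤ.* sum ρ ℤ.≤ pos 4
      ρ²≤4 = *-mono (∑-nonneg els (λ u → ⟦⟧-nonneg (u * u ≟ n))) (ℤ.+≤+ z≤n) (roots≤2 n) (roots≤2 n)
      expand : ∀ q r x → (q ℤ.* r ℤ.- 1ℤ) ℤ.* x ≡ q ℤ.* (r ℤ.* x) ℤ.- x
      expand = solve-∀
      equation : ∀ u → ⟦ 0# + u * u * inv n ≟ 1# ⟧ ≡ ρ u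
      equation u = ⟦⟧-cong (0# + u * u * inv n ≟ 1#) (u * u ≟ n)
        (λ e → begin
          u * u ≡⟨ trans (sym (*-identityʳ _)) (cong (u * u *_) (sym (inv-* p))) ⟩
          u * u * (inv n * n) ≡⟨ solve 3 (λ s v n → s :* (v :* n) := (con 0ℤ :+ s :* v) :* n) refl (u * u) (inv n) n ⟩
          (0# + u * u * inv n) * n ≡⟨ trans (cong (_* n) e) (*-identityˡ n) ⟩
          n ∎)
        (λ e → trans (+-identityˡ _) (trans (cong (_* inv n) e) (*-inv p)))
      value : ∀ c → apply (λ c ζ → O n (δ-fun c) 0# ζ) f c ≡ qℤ ℤ.* sum (λ u → ρ u ℤ.* f (c - u))
      value c = begin
        sum (λ ζ → f ζ ℤ.* O n (δ-fun c) 0# ζ) ≡⟨ ∑-cong els (λ ζ → cong (f ζ ℤ.*_) (O-nonzero p (δ-fun c) 0# ζ)) ⟩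
        sum (λ ζ → f ζ ℤ.* sum (λ u → κ (0# + u * u * inv n) ℤ.* ⟦ ζ + u ≟ c ⟧)) ≡⟨ conv (λ u → κ (0# + u * u * inv n)) f c ⟩
        sum (λ u → κ (0# + u * u * inv n) ℤ.* f (c - u)) ≡⟨ ∑-cong els (λ u → trans (cong (λ w → (qℤ ℤ.* w ℤ.- 1ℤ) ℤ.* f (c - u)) (equation u)) (expand qℤ (ρ u) (f (c - u)))) ⟩
        sum (λ u → qℤ ℤ.* (ρ u ℤ.* f (c - u)) ℤ.- f (c - u)) ≡⟨ ∑-sub els (λ u → qℤ ℤ.* (ρ u ℤ.* f (c - u))) (λ u → f (c - u)) ⟩
        sum (λ u → qℤ ℤ.* (ρ u ℤ.* f (c - u))) ℤ.- sum (λ u → f (c - u)) ≡⟨ cong₂ ℤ._-_ (∑-*ˡ els qℤ (λ u → ρ u ℤ.* f (c - u))) (trans (sum-reflect c f) mean) ⟩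
        qℤ ℤ.* sum (λ u → ρ u ℤ.* f (c - u)) ℤ.- 0ℤ ≡⟨ ℤP.+-identityʳ _ ⟩
        qℤ ℤ.* sum (λ u → ρ u ℤ.* f (c - u)) ∎

  roots-scale : ∀ {y} → y ≢ 0# → ∀ x → roots (y * y * x) ≡ roots x
  roots-scale {y} p x = trans (sym (sum-scale p (λ z → ⟦ z * z ≟ y * y * x ⟧))) (∑-cong els (λ z →
    ⟦⟧-cong (y * z * (y * z) ≟ y * y * x) (z * z ≟ x)
      (λ e → *-cancelˡ (*-≢0 p p) (trans (solve 2 (λ y z → y :* y :* (z :* z) := y :* z :* (y :* z)) refl y z) e))
      (λ e → trans (solve 2 (λ y z → y :* z :* (y :* z) := y :* y :* (z :* z)) refl y z) (cong (y * y *_) e))))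

  kloosterman-reflected : ∀ n → n ≢ 0# → ∀ f → MeanZero f →
    energy (λ c → sum (λ u → roots (u * u - n) ℤ.* f (c - u))) ℤ.≤ pos 9 ℤ.* qℤ ℤ.* energy f
  kloosterman-reflected n p f mean = subst (ℤ._≤ pos 9 ℤ.* qℤ ℤ.* energy f)
    (energy-cong (λ c → trans (sym (sum-neg (λ u → roots (u * u - n) ℤ.* f (c + u))))
      (∑-cong els (λ u → cong (λ w → roots (w - n) ℤ.* f (c - u)) (solve 1 (λ u → (:- u) :* (:- u) := u :* u) refl u)))))
    (kloosterman-bound n p f mean)

  -- 1 - u²/n and u² - n differ by the factor -n, whose square class decides the sign.
  kernel-sign : ∀ n → n ≢ 0# → Σ Sign λ ε → ∀ f → MeanZero f → ∀ c →
    sum (λ u → roots (1# - u * u * inv n) ℤ.* f (c - u)) ≡ proj₁ ε ℤ.* sum (λ u → roots (u * u - n) ℤ.* f (c - u))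
  kernel-sign n p with search (λ y → y * y ≟ - n)
  ... | inj₁ (y , e) = +1ₛ , λ f mean c → trans (∑-cong els (λ u → cong (ℤ._* f (c - u)) (trans (sym (roots-scale y≢0 (1# - u * u * inv n))) (cong roots (factor u))))) (sym (ℤP.*-identityˡ _))
    where
    y≢0 : y ≢ 0#
    y≢0 z = Nonzero.neg-≢0 F p (trans (sym e) (trans (cong (_* y) z) (zeroˡ y)))
    factor : ∀ u → y * y * (1# - u * u * inv n) ≡ u * u - n
    factor u = trans (cong (_* (1# - u * u * inv n)) e) (trans (solve 3 (λ n s v → (:- n) :* (con 1ℤ :- s :* v) := s :* (n :* v) :- n) refl n (u * u) (inv n))
      (cong (_- n) (trans (cong (u * u *_) (*-inv p)) (*-identityʳ _))))
  ... | inj₂ ns = -1ₛ , λ f mean c → begin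
      sum (λ u → roots (1# - u * u * inv n) ℤ.* f (c - u)) ≡⟨ ∑-cong els (λ u → trans (cong (ℤ._* f (c - u)) (complement u)) (expand (roots (u * u - n)) (f (c - u)))) ⟩
      sum (λ u → pos 2 ℤ.* f (c - u) ℤ.+ (ℤ.- 1ℤ) ℤ.* (roots (u * u - n) ℤ.* f (c - u))) ≡⟨ ∑-+ els (λ u → pos 2 ℤ.* f (c - u)) (λ u → (ℤ.- 1ℤ) ℤ.* (roots (u * u - n) ℤ.* f (c - u))) ⟩
      sum (λ u → pos 2 ℤ.* f (c - u)) ℤ.+ sum (λ u → (ℤ.- 1ℤ) ℤ.* (roots (u * u - n) ℤ.* f (c - u)))
        ≡⟨ cong₂ ℤ._+_ (trans (∑-*ˡ els (pos 2) (λ u → f (c - u))) (cong (pos 2 ℤ.*_) (trans (sum-reflect c f) mean))) (∑-*ˡ els (ℤ.- 1ℤ) (λ u → roots (u * u - n) ℤ.* f (c - u))) ⟩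
      0ℤ ℤ.+ (ℤ.- 1ℤ) ℤ.* sum (λ u → roots (u * u - n) ℤ.* f (c - u)) ≡⟨ ℤP.+-identityˡ _ ⟩
      (ℤ.- 1ℤ) ℤ.* sum (λ u → roots (u * u - n) ℤ.* f (c - u)) ∎
    where
    open ≡-Reasoning
    expand : ∀ r x → (pos 2 ℤ.- r) ℤ.* x ≡ pos 2 ℤ.* x ℤ.+ (ℤ.- 1ℤ) ℤ.* (r ℤ.* x)
    expand = solve-∀
    -n≢0 : - n ≢ 0#
    -n≢0 = Nonzero.neg-≢0 F p
    scaled : ∀ u → scaled-roots (- n) (u * u - n) ≡ roots (1# - u * u * inv n)
    scaled u = ∑-cong els (λ y → ⟦⟧-cong ((- n) * (y * y) ≟ u * u - n) (y * y ≟ 1# - u * u * inv n)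
      (λ e → *-cancelˡ -n≢0 (trans e (sym factor))) (λ e → trans (cong ((- n) *_) e) factor))
      where
      factor : (- n) * (1# - u * u * inv n) ≡ u * u - n
      factor = trans (solve 3 (λ n s v → (:- n) :* (con 1ℤ :- s :* v) := s :* (n :* v) :- n) refl n (u * u) (inv n))
        (cong (_- n) (trans (cong (u * u *_) (*-inv p)) (*-identityʳ _)))
    complement : ∀ u → roots (1# - u * u * inv n) ≡ pos 2 ℤ.- roots (u * u - n)
    complement u = trans (lem (roots (u * u - n)) (roots (1# - u * u * inv n))) (cong (ℤ._- roots (u * u - n))
      (trans (cong (λ w → roots (u * u - n) ℤ.+ w) (sym (scaled u))) (roots-complement ns (u * u - n))))
      where
      lem : ∀ a b → b ≡ a ℤ.+ b ℤ.- a
      lem = solve-∀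

  -- The additional `R` replaces the condition u² = n by the number of roots of 1 - u²/n. Up to sign
  -- the operator is therefore q times the Kloosterman operator when n ≠ 0, and a scalar when n = 0.
  even-bound : ∀ n → Bounded (λ c ζ → R (O n (δ-fun c)) 0# ζ) (pos 9 ℤ.* (qℤ ℤ.* (qℤ ℤ.* qℤ)))
  even-bound n f mean = cases (n ≟ 0#)
    where
    open ≡-Reasoning
    cases : Dec (n ≡ 0#) → energy (apply (λ c ζ → R (O n (δ-fun c)) 0# ζ) f) ℤ.≤ pos 9 ℤ.* (qℤ ℤ.* (qℤ ℤ.* qℤ)) ℤ.* energy f
    cases (yes e) = subst (ℤ._≤ pos 9 ℤ.* (qℤ ℤ.* (qℤ ℤ.* qℤ)) ℤ.* energy f) (sym (trans (energy-cong value) (energy-scale a f)))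
        (*-mono (sq-nonneg a) (energy≥0 f) (subst (ℤ._≤ pos 9 ℤ.* (qℤ ℤ.* (qℤ ℤ.* qℤ))) (sym a²) small) ℤP.≤-refl)
      where
      ε : Sign
      ε = proj₁ R²
      a : ℤ
      a = proj₁ ε ℤ.* (qℤ ℤ.* (ℤ.- 1ℤ))
      a² : a ℤ.* a ≡ 1ℤ ℤ.* (1ℤ ℤ.* (qℤ ℤ.* qℤ))
      a² = trans (sign-square ε (qℤ ℤ.* (ℤ.- 1ℤ))) (lem qℤ)
        where
        lem : ∀ q → q ℤ.* (ℤ.- 1ℤ) ℤ.* (q ℤ.* (ℤ.- 1ℤ)) ≡ 1ℤ ℤ.* (1ℤ ℤ.* (q ℤ.* q))
        lem = solve-∀
      small : 1ℤ ℤ.* (1ℤ ℤ.* (qℤ ℤ.* qℤ)) ℤ.≤ pos 9 ℤ.* (qℤ ℤ.* (qℤ ℤ.* qℤ))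
      small = *-mono {1ℤ} {pos 9} {1ℤ ℤ.* (qℤ ℤ.* qℤ)} {qℤ ℤ.* (qℤ ℤ.* qℤ)} (ℤ.+≤+ z≤n) (*-nonneg qℤ≥0 (sq-nonneg qℤ)) (ℤ.+≤+ (s≤s z≤n)) (*-mono {1ℤ} {qℤ} {qℤ ℤ.* qℤ} {qℤ ℤ.* qℤ} (ℤ.+≤+ z≤n) (sq-nonneg qℤ) 1≤qℤ ℤP.≤-refl)
      value : ∀ c → apply (λ c ζ → R (O n (δ-fun c)) 0# ζ) f c ≡ a ℤ.* f c
      value c = trans (∑-cong els (λ ζ → cong (f ζ ℤ.*_) (begin
        R (O n (δ-fun c)) 0# ζ ≡⟨ R-cong (O-zero e (δ-fun c)) 0# ζ ⟩
        R (R (δ-fun c)) 0# ζ ≡⟨ proj₂ R² (δ-fun-zero c) 0# ζ ⟩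
        proj₁ ε ℤ.* (qℤ ℤ.* (κ 0# ℤ.* ⟦ ζ ≟ c ⟧)) ≡⟨ cong (λ w → proj₁ ε ℤ.* (qℤ ℤ.* (w ℤ.* ⟦ ζ ≟ c ⟧))) κ-0 ⟩
        proj₁ ε ℤ.* (qℤ ℤ.* ((ℤ.- 1ℤ) ℤ.* ⟦ ζ ≟ c ⟧)) ≡⟨ assoc (proj₁ ε) qℤ (ℤ.- 1ℤ) ⟦ ζ ≟ c ⟧ ⟩
        a ℤ.* ⟦ ζ ≟ c ⟧ ∎))) (diagonal a f c)
        where
        assoc : ∀ e q m d → e ℤ.* (q ℤ.* (m ℤ.* d)) ≡ e ℤ.* (q ℤ.* m) ℤ.* d
        assoc = solve-∀
    cases (no p) = ℤP.≤-trans (ℤP.≤-reflexive (trans (energy-cong value) (trans (energy-scale qℤ _) (cong (qℤ ℤ.* qℤ ℤ.*_) (∑-cong els (λ c → sign-square ε (Kf c)))))))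
        (ℤP.≤-trans (*-monoˡ (sq-nonneg qℤ) (kloosterman-reflected n p f mean)) (ℤP.≤-reflexive (lem qℤ (energy f))))
      where
      ε : Sign
      ε = proj₁ (kernel-sign n p)
      Kf : Carrier → ℤ
      Kf c = sum (λ u → roots (u * u - n) ℤ.* f (c - u))
      lem : ∀ q N → q ℤ.* q ℤ.* (pos 9 ℤ.* q ℤ.* N) ≡ pos 9 ℤ.* (q ℤ.* (q ℤ.* q)) ℤ.* N
      lem = solve-∀
      expand : ∀ q r x → (q ℤ.* (r ℤ.- 1ℤ)) ℤ.* x ≡ q ℤ.* (r ℤ.* x) ℤ.- q ℤ.* x
      expand = solve-∀
      column : ∀ u → sum (λ a → κ (0# + a * a + u * u * inv n)) ≡ qℤ ℤ.* (roots (1# - u * u * inv n) ℤ.- 1ℤ)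
      column u = trans (∑-cong els (λ a → cong κ (solve 2 (λ a z → con 0ℤ :+ a :+ z := z :+ a) refl (a * a) (u * u * inv n)))) (sum-κ-squares (u * u * inv n))
      value : ∀ c → apply (λ c ζ → R (O n (δ-fun c)) 0# ζ) f c ≡ qℤ ℤ.* (proj₁ ε ℤ.* Kf c)
      value c = begin
        sum (λ ζ → f ζ ℤ.* R (O n (δ-fun c)) 0# ζ) ≡⟨ ∑-cong els (λ ζ → cong (f ζ ℤ.*_) (begin
            sum (λ a → O n (δ-fun c) (0# + a * a) ζ) ≡⟨ ∑-cong els (λ a → O-nonzero p (δ-fun c) (0# + a * a) ζ) ⟩
            sum (λ a → sum (λ u → κ (0# + a * a + u * u * inv n) ℤ.* ⟦ ζ + u ≟ c ⟧)) ≡⟨ ∑-swap els els (λ a u → κ (0# + a * a + u * u * inv n) ℤ.* ⟦ ζ + u ≟ c ⟧) ⟩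
            sum (λ u → sum (λ a → κ (0# + a * a + u * u * inv n) ℤ.* ⟦ ζ + u ≟ c ⟧)) ≡⟨ ∑-cong els (λ u → trans (∑-*ʳ els ⟦ ζ + u ≟ c ⟧ (λ a → κ (0# + a * a + u * u * inv n))) (cong (ℤ._* ⟦ ζ + u ≟ c ⟧) (column u))) ⟩
            sum (λ u → ρ u ℤ.* ⟦ ζ + u ≟ c ⟧) ∎)) ⟩
        sum (λ ζ → f ζ ℤ.* sum (λ u → ρ u ℤ.* ⟦ ζ + u ≟ c ⟧)) ≡⟨ conv ρ f c ⟩
        sum (λ u → ρ u ℤ.* f (c - u)) ≡⟨ ∑-cong els (λ u → expand qℤ (roots (1# - u * u * inv n)) (f (c - u))) ⟩
        sum (λ u → qℤ ℤ.* (roots (1# - u * u * inv n) ℤ.* f (c - u)) ℤ.- qℤ ℤ.* f (c - u))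
          ≡⟨ ∑-sub els (λ u → qℤ ℤ.* (roots (1# - u * u * inv n) ℤ.* f (c - u))) (λ u → qℤ ℤ.* f (c - u)) ⟩
        sum (λ u → qℤ ℤ.* (roots (1# - u * u * inv n) ℤ.* f (c - u))) ℤ.- sum (λ u → qℤ ℤ.* f (c - u))
          ≡⟨ cong₂ ℤ._-_ (trans (∑-*ˡ els qℤ (λ u → roots (1# - u * u * inv n) ℤ.* f (c - u))) (cong (qℤ ℤ.*_) (proj₂ (kernel-sign n p) f mean c)))
               (trans (∑-*ˡ els qℤ (λ u → f (c - u))) (trans (cong (qℤ ℤ.*_) (trans (sum-reflect c f) mean)) (ℤP.*-zeroʳ qℤ))) ⟩
        qℤ ℤ.* (proj₁ ε ℤ.* Kf c) ℤ.- 0ℤ ≡⟨ ℤP.+-identityʳ _ ⟩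
        qℤ ℤ.* (proj₁ ε ℤ.* Kf c) ∎
        where
        ρ : Carrier → ℤ
        ρ u = qℤ ℤ.* (roots (1# - u * u * inv n) ℤ.- 1ℤ)

  -- R² = ±q strips off pairs of `R`, so that the parity of t decides between the two preceding
  -- bounds.
  kernel-bound : ∀ t n → Bounded (λ c ζ → Rpow t (O n (δ-fun c)) 0# ζ) (pos 9 ℤ.* pw (suc (suc t)))
  kernel-bound t n f mean = cases (parity t)
    where
    k : Fun
    k c ζ = Rpow t (O n (δ-fun c)) 0# ζ
    rescale : ∀ (s : Sign) p (k′ : Fun) → (∀ c ζ → k c ζ ≡ proj₁ s ℤ.* (p ℤ.* k′ c ζ)) → energy (apply k f) ≡ p ℤ.* p ℤ.* energy (apply k′ f)
    rescale s p k′ e = trans (energy-cong (λ c → trans (∑-cong els (λ ζ → trans (cong (f ζ ℤ.*_) (e c ζ)) (lem (f ζ) (proj₁ s) p (k′ c ζ))))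
        (∑-*ˡ els (proj₁ s ℤ.* p) (λ ζ → f ζ ℤ.* k′ c ζ)))) (trans (energy-scale (proj₁ s ℤ.* p) (apply k′ f)) (cong (ℤ._* energy (apply k′ f)) (sign-square s p)))
      where
      lem : ∀ x s p y → x ℤ.* (s ℤ.* (p ℤ.* y)) ≡ s ℤ.* p ℤ.* (x ℤ.* y)
      lem = solve-∀
    cases : (∃ λ j → t ≡ double j) ⊎ (∃ λ j → t ≡ suc (double j)) → energy (apply k f) ℤ.≤ pos 9 ℤ.* pw (suc (suc t)) ℤ.* energy f
    cases (inj₁ (j , refl)) = subst₂ ℤ._≤_ (sym (rescale (proj₁ (Rpow-double j)) (pw j) (λ c ζ → O n (δ-fun c) 0# ζ)
        (λ c ζ → proj₂ (Rpow-double j) (O-tauzero n (δ-fun-zero c)) 0# ζ)))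
      (trans (lem (pw j) qℤ (energy f)) (cong (λ w → pos 9 ℤ.* (qℤ ℤ.* (qℤ ℤ.* w)) ℤ.* energy f) (sym (pw-double j))))
      (*-monoˡ (sq-nonneg (pw j)) (odd-bound n f mean))
      where
      lem : ∀ p q N → p ℤ.* p ℤ.* (pos 9 ℤ.* (q ℤ.* q) ℤ.* N) ≡ pos 9 ℤ.* (q ℤ.* (q ℤ.* (p ℤ.* p))) ℤ.* N
      lem = solve-∀
    cases (inj₂ (j , refl)) = subst₂ ℤ._≤_ (sym (rescale (proj₁ (Rpow-double j)) (pw j) (λ c ζ → R (O n (δ-fun c)) 0# ζ)
        (λ c ζ → trans (sym (Rpow-R (double j) (O n (δ-fun c)) 0# ζ)) (proj₂ (Rpow-double j) (R-zero (O-tauzero n (δ-fun-zero c))) 0# ζ))))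
      (trans (lem (pw j) qℤ (energy f)) (cong (λ w → pos 9 ℤ.* (qℤ ℤ.* (qℤ ℤ.* (qℤ ℤ.* w))) ℤ.* energy f) (sym (pw-double j))))
      (*-monoˡ (sq-nonneg (pw j)) (even-bound n f mean))
      where
      lem : ∀ p q N → p ℤ.* p ℤ.* (pos 9 ℤ.* (q ℤ.* (q ℤ.* q)) ℤ.* N) ≡ pos 9 ℤ.* (q ℤ.* (q ℤ.* (q ℤ.* (p ℤ.* p)))) ℤ.* N
      lem = solve-∀

-- Radon transform, Parseval's identity and expander mixing

module Hyperplanes (F : OddField) where
  open OddField F
  open SphereSums F

  vecs-count : ∀ n → ∑ (vecs finite n) (λ _ → 1ℤ) ≡ pw n
  vecs-count zero = refl
  vecs-count (suc n) = trans (∑-vecs finite n (λ _ → 1ℤ)) (trans (∑-cong els (λ _ → vecs-count n)) (∑-const els (pw n)))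

  coincidences : ∀ {n} → Vec Carrier n → Vec Carrier n → Carrier → ℤ
  coincidences {n} x y e = ∑ (vecs finite n) (λ m → ⟦ e + dot m x ≟ dot m y ⟧)

  coincidences-same : ∀ {n} (x : Vec Carrier n) → coincidences x x 0# ≡ pw n
  coincidences-same {n} x = trans (∑-cong (vecs finite n) (λ m → ⟦⟧-yes (0# + dot m x ≟ dot m x) (+-identityˡ _))) (vecs-count n)

  -- At a coordinate where x and y differ, the condition can be solved for that entry of m.
  coincidences-diff : ∀ {n} (x y : Vec Carrier n) → x ≢ y → ∀ e → qℤ ℤ.* coincidences x y e ≡ pw n
  coincidences-diff [] [] ne e = contradiction refl ne
  coincidences-diff {suc n} (x₀ ∷ x) (y₀ ∷ y) ne e = cases (x₀ ≟ y₀)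
    where
    open ≡-Reasoning
    unfolded : coincidences (x₀ ∷ x) (y₀ ∷ y) e ≡ sum (λ m₀ → ∑ (vecs finite n) (λ m → ⟦ e + (m₀ * x₀ + dot m x) ≟ m₀ * y₀ + dot m y ⟧))
    unfolded = ∑-vecs finite n (λ m → ⟦ e + dot m (x₀ ∷ x) ≟ dot m (y₀ ∷ y) ⟧)
    cases : Dec (x₀ ≡ y₀) → qℤ ℤ.* coincidences (x₀ ∷ x) (y₀ ∷ y) e ≡ qℤ ℤ.* pw n
    cases (yes refl) = cong (qℤ ℤ.*_) (begin
      coincidences (x₀ ∷ x) (x₀ ∷ y) e ≡⟨ unfolded ⟩
      sum (λ m₀ → ∑ (vecs finite n) (λ m → ⟦ e + (m₀ * x₀ + dot m x) ≟ m₀ * x₀ + dot m y ⟧))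
        ≡⟨ ∑-cong els (λ m₀ → ∑-cong (vecs finite n) (λ m → ⟦⟧-cong (e + (m₀ * x₀ + dot m x) ≟ m₀ * x₀ + dot m y) (e + dot m x ≟ dot m y)
             (λ p → +-cancelˡ (m₀ * x₀) (trans (solve 3 (λ a e d → a :+ (e :+ d) := e :+ (a :+ d)) refl (m₀ * x₀) e (dot m x)) p))
             (λ p → trans (solve 3 (λ a e d → e :+ (a :+ d) := a :+ (e :+ d)) refl (m₀ * x₀) e (dot m x)) (cong (m₀ * x₀ +_) p)))) ⟩
      sum (λ m₀ → coincidences x y e) ≡⟨ ∑-const els (coincidences x y e) ⟩
      qℤ ℤ.* coincidences x y e ≡⟨ coincidences-diff x y (λ p → ne (cong (x₀ ∷_) p)) e ⟩
      pw n ∎)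
    cases (no p) = cong (qℤ ℤ.*_) (begin
      coincidences (x₀ ∷ x) (y₀ ∷ y) e ≡⟨ unfolded ⟩
      sum (λ m₀ → ∑ (vecs finite n) (λ m → ⟦ e + (m₀ * x₀ + dot m x) ≟ m₀ * y₀ + dot m y ⟧))
        ≡⟨ ∑-swap els (vecs finite n) (λ m₀ m → ⟦ e + (m₀ * x₀ + dot m x) ≟ m₀ * y₀ + dot m y ⟧) ⟩
      ∑ (vecs finite n) (λ m → sum (λ m₀ → ⟦ e + (m₀ * x₀ + dot m x) ≟ m₀ * y₀ + dot m y ⟧)) ≡⟨ ∑-cong (vecs finite n) (λ m → trans (∑-cong els (λ m₀ →
          ⟦⟧-cong (e + (m₀ * x₀ + dot m x) ≟ m₀ * y₀ + dot m y) (m₀ ≟ sol m) (λ r → to m m₀ r) (λ r → from m m₀ r))) (once (sol m))) ⟩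
      ∑ (vecs finite n) (λ m → 1ℤ) ≡⟨ vecs-count n ⟩
      pw n ∎)
      where
      δ : Carrier
      δ = x₀ - y₀
      δ≢0 : δ ≢ 0#
      δ≢0 r = p (x-y≡0⇒x≡y r)
      rhs : Vec Carrier n → Carrier
      rhs m = dot m y - dot m x - e
      sol : Vec Carrier n → Carrier
      sol m = inv δ * rhs m
      to : ∀ m m₀ → e + (m₀ * x₀ + dot m x) ≡ m₀ * y₀ + dot m y → m₀ ≡ sol m
      to m m₀ r = *-cancelˡ δ≢0 (trans (begin
          δ * m₀ ≡⟨ solve 5 (λ x y m e d → (x :- y) :* m := (e :+ (m :* x :+ d)) :- m :* y :- d :- e) refl x₀ y₀ m₀ e (dot m x) ⟩
          (e + (m₀ * x₀ + dot m x)) - m₀ * y₀ - dot m x - e ≡⟨ cong (λ w → w - m₀ * y₀ - dot m x - e) r ⟩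
          (m₀ * y₀ + dot m y) - m₀ * y₀ - dot m x - e ≡⟨ cong (λ w → w - dot m x - e) (solve 2 (λ a b → a :+ b :- a := b) refl (m₀ * y₀) (dot m y)) ⟩
          rhs m ∎) (sym (trans (sym (*-assoc δ (inv δ) (rhs m))) (trans (cong (_* rhs m) (*-inv δ≢0)) (*-identityˡ _)))))
      from : ∀ m m₀ → m₀ ≡ sol m → e + (m₀ * x₀ + dot m x) ≡ m₀ * y₀ + dot m y
      from m m₀ r = begin
        e + (m₀ * x₀ + dot m x) ≡⟨ solve 5 (λ x y m e d → e :+ (m :* x :+ d) := m :* y :+ ((x :- y) :* m :+ d :+ e)) refl x₀ y₀ m₀ e (dot m x) ⟩
        m₀ * y₀ + (δ * m₀ + dot m x + e) ≡⟨ cong (λ w → m₀ * y₀ + (w + dot m x + e)) (trans (cong (δ *_) r)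
            (trans (sym (*-assoc δ (inv δ) (rhs m))) (trans (cong (_* rhs m) (*-inv δ≢0)) (*-identityˡ _)))) ⟩
        m₀ * y₀ + (rhs m + dot m x + e) ≡⟨ cong (m₀ * y₀ +_) (solve 3 (λ b d e → b :- d :- e :+ d :+ e := b) refl (dot m y) (dot m x) e) ⟩
        m₀ * y₀ + dot m y ∎

module SpectralGap (F : OddField) (fermat : ∀ x → OddField._^_ F x (OddField.size F) ≡ x) (t : ℕ) where
  open OddField F
  open SphereSums F
  open Heat F using (Fun)
  open KernelBounds F fermat
  open Hyperplanes F

  V : Set
  V = Vec Carrier (suc t)

  finiteV : Finite V
  finiteV = finite-vec finite (suc t)

  private module V = Finite finiteV

  ∑V : (V → ℤ) → ℤ
  ∑V = ∑ V.els

  energyV : (V → ℤ) → ℤ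
  energyV w = ∑V (λ x → w x ℤ.* w x)

  radon : (V → ℤ) → V → Carrier → ℤ
  radon w m c = ∑V (λ x → ⟦ dot m x ≟ c ⟧ ℤ.* w x)

  radon-energy : ∀ w m → energy (radon w m) ≡ ∑V (λ x → ∑V (λ y → (w x ℤ.* w y) ℤ.* ⟦ 0# + dot m x ≟ dot m y ⟧))
  radon-energy w m = begin
    sum (λ c → radon w m c ℤ.* radon w m c) ≡⟨ ∑-cong els (λ c → ∑-product V.els V.els (λ x → ⟦ dot m x ≟ c ⟧ ℤ.* w x) (λ y → ⟦ dot m y ≟ c ⟧ ℤ.* w y)) ⟩
    sum (λ c → ∑V (λ x → ∑V (λ y → ⟦ dot m x ≟ c ⟧ ℤ.* w x ℤ.* (⟦ dot m y ≟ c ⟧ ℤ.* w y)))) ≡⟨ ∑-swap els V.els (λ c x → ∑V (λ y → ⟦ dot m x ≟ c ⟧ ℤ.* w x ℤ.* (⟦ dot m y ≟ c ⟧ ℤ.* w y))) ⟩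
    ∑V (λ x → sum (λ c → ∑V (λ y → ⟦ dot m x ≟ c ⟧ ℤ.* w x ℤ.* (⟦ dot m y ≟ c ⟧ ℤ.* w y)))) ≡⟨ ∑-cong V.els (λ x → ∑-swap els V.els (λ c y → ⟦ dot m x ≟ c ⟧ ℤ.* w x ℤ.* (⟦ dot m y ≟ c ⟧ ℤ.* w y))) ⟩
    ∑V (λ x → ∑V (λ y → sum (λ c → ⟦ dot m x ≟ c ⟧ ℤ.* w x ℤ.* (⟦ dot m y ≟ c ⟧ ℤ.* w y)))) ≡⟨ ∑-cong V.els (λ x → ∑-cong V.els (λ y → pair x y)) ⟩
    ∑V (λ x → ∑V (λ y → (w x ℤ.* w y) ℤ.* ⟦ 0# + dot m x ≟ dot m y ⟧)) ∎
    where
    open ≡-Reasoning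
    lem : ∀ a w b v → a ℤ.* w ℤ.* (b ℤ.* v) ≡ (w ℤ.* v) ℤ.* (a ℤ.* b)
    lem = solve-∀
    pair : ∀ x y → sum (λ c → ⟦ dot m x ≟ c ⟧ ℤ.* w x ℤ.* (⟦ dot m y ≟ c ⟧ ℤ.* w y)) ≡ (w x ℤ.* w y) ℤ.* ⟦ 0# + dot m x ≟ dot m y ⟧
    pair x y = trans (∑-cong els (λ c → lem ⟦ dot m x ≟ c ⟧ (w x) ⟦ dot m y ≟ c ⟧ (w y)))
      (trans (∑-*ˡ els (w x ℤ.* w y) (λ c → ⟦ dot m x ≟ c ⟧ ℤ.* ⟦ dot m y ≟ c ⟧))
        (cong ((w x ℤ.* w y) ℤ.*_) (trans (∑-δ′ (dot m x) (λ c → ⟦ dot m y ≟ c ⟧))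
          (⟦⟧-cong (dot m y ≟ dot m x) (0# + dot m x ≟ dot m y) (λ e → trans (+-identityˡ _) (sym e)) (λ e → sym (trans (sym (+-identityˡ _)) e))))))

  -- After expanding the squares, a pair x, y is weighted by the number of m that take the same
  -- value on both: all of them for x = y, and a proportion 1/q otherwise.
  parseval : ∀ w → qℤ ℤ.* ∑V (λ m → energy (radon w m)) ≡ pw (suc t) ℤ.* (∑V w ℤ.* ∑V w) ℤ.+ (qℤ ℤ.- 1ℤ) ℤ.* pw (suc t) ℤ.* energyV w
  parseval w = begin
    qℤ ℤ.* ∑V (λ m → energy (radon w m)) ≡⟨ cong (qℤ ℤ.*_) (begin
        ∑V (λ m → energy (radon w m)) ≡⟨ ∑-cong V.els (radon-energy w) ⟩
        ∑V (λ m → ∑V (λ x → ∑V (λ y → (w x ℤ.* w y) ℤ.* ⟦ 0# + dot m x ≟ dot m y ⟧))) ≡⟨ ∑-swap V.els V.els (λ m x → ∑V (λ y → (w x ℤ.* w y) ℤ.* ⟦ 0# + dot m x ≟ dot m y ⟧)) ⟩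
        ∑V (λ x → ∑V (λ m → ∑V (λ y → (w x ℤ.* w y) ℤ.* ⟦ 0# + dot m x ≟ dot m y ⟧))) ≡⟨ ∑-cong V.els (λ x → trans (∑-swap V.els V.els (λ m y → (w x ℤ.* w y) ℤ.* ⟦ 0# + dot m x ≟ dot m y ⟧))
            (∑-cong V.els (λ y → ∑-*ˡ V.els (w x ℤ.* w y) (λ m → ⟦ 0# + dot m x ≟ dot m y ⟧)))) ⟩
        ∑V (λ x → ∑V (λ y → (w x ℤ.* w y) ℤ.* coincidences x y 0#)) ∎) ⟩
    qℤ ℤ.* ∑V (λ x → ∑V (λ y → (w x ℤ.* w y) ℤ.* coincidences x y 0#))
      ≡⟨ trans (sym (∑-*ˡ V.els qℤ (λ x → ∑V (λ y → (w x ℤ.* w y) ℤ.* coincidences x y 0#)))) (∑-cong V.els row) ⟩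
    ∑V (λ x → pw (suc t) ℤ.* (w x ℤ.* ∑V w) ℤ.+ (qℤ ℤ.- 1ℤ) ℤ.* pw (suc t) ℤ.* (w x ℤ.* w x))
      ≡⟨ ∑-+ V.els (λ x → pw (suc t) ℤ.* (w x ℤ.* ∑V w)) (λ x → (qℤ ℤ.- 1ℤ) ℤ.* pw (suc t) ℤ.* (w x ℤ.* w x)) ⟩
    ∑V (λ x → pw (suc t) ℤ.* (w x ℤ.* ∑V w)) ℤ.+ ∑V (λ x → (qℤ ℤ.- 1ℤ) ℤ.* pw (suc t) ℤ.* (w x ℤ.* w x))
      ≡⟨ cong₂ ℤ._+_ (trans (∑-*ˡ V.els (pw (suc t)) (λ x → w x ℤ.* ∑V w)) (cong (pw (suc t) ℤ.*_) (∑-*ʳ V.els (∑V w) w)))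
           (∑-*ˡ V.els ((qℤ ℤ.- 1ℤ) ℤ.* pw (suc t)) (λ x → w x ℤ.* w x)) ⟩
    pw (suc t) ℤ.* (∑V w ℤ.* ∑V w) ℤ.+ (qℤ ℤ.- 1ℤ) ℤ.* pw (suc t) ℤ.* energyV w ∎
    where
    open ≡-Reasoning
    P : ℤ
    P = pw (suc t)
    swap-q : ∀ q a b → q ℤ.* (a ℤ.* b) ≡ a ℤ.* (q ℤ.* b)
    swap-q = solve-∀
    same : ∀ x → qℤ ℤ.* coincidences x x 0# ≡ P ℤ.+ (qℤ ℤ.- 1ℤ) ℤ.* P ℤ.* 1ℤ
    same x = trans (cong (qℤ ℤ.*_) (coincidences-same x)) (lem qℤ P)
      where
      lem : ∀ q p → q ℤ.* p ≡ p ℤ.+ (q ℤ.- 1ℤ) ℤ.* p ℤ.* 1ℤ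
      lem = solve-∀
    diff : ∀ x y → x ≢ y → qℤ ℤ.* coincidences x y 0# ≡ P ℤ.+ (qℤ ℤ.- 1ℤ) ℤ.* P ℤ.* 0ℤ
    diff x y ne = trans (coincidences-diff x y ne 0#) (lem qℤ P)
      where
      lem : ∀ q p → p ≡ p ℤ.+ (q ℤ.- 1ℤ) ℤ.* p ℤ.* 0ℤ
      lem = solve-∀
    q-coincidences : ∀ x y → qℤ ℤ.* coincidences x y 0# ≡ P ℤ.+ (qℤ ℤ.- 1ℤ) ℤ.* P ℤ.* ⟦ x V.≟ y ⟧
    q-coincidences x y = cases (x V.≟ y)
      where
      cases : (d : Dec (x ≡ y)) → qℤ ℤ.* coincidences x y 0# ≡ P ℤ.+ (qℤ ℤ.- 1ℤ) ℤ.* P ℤ.* ⟦ d ⟧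
      cases (yes refl) = same x
      cases (no ne) = diff x y ne
    distribute : ∀ a b p r d → a ℤ.* b ℤ.* (p ℤ.+ r ℤ.* p ℤ.* d) ≡ (p ℤ.* a) ℤ.* b ℤ.+ (r ℤ.* p ℤ.* a) ℤ.* (d ℤ.* b)
    distribute = solve-∀
    row : ∀ x → qℤ ℤ.* ∑V (λ y → (w x ℤ.* w y) ℤ.* coincidences x y 0#) ≡ P ℤ.* (w x ℤ.* ∑V w) ℤ.+ (qℤ ℤ.- 1ℤ) ℤ.* P ℤ.* (w x ℤ.* w x)
    row x = begin
      qℤ ℤ.* ∑V (λ y → (w x ℤ.* w y) ℤ.* coincidences x y 0#) ≡⟨ ∑-*ˡ V.els qℤ (λ y → (w x ℤ.* w y) ℤ.* coincidences x y 0#) ⟨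
      ∑V (λ y → qℤ ℤ.* ((w x ℤ.* w y) ℤ.* coincidences x y 0#)) ≡⟨ ∑-cong V.els (λ y → trans (swap-q qℤ (w x ℤ.* w y) (coincidences x y 0#))
          (trans (cong ((w x ℤ.* w y) ℤ.*_) (q-coincidences x y)) (distribute (w x) (w y) P (qℤ ℤ.- 1ℤ) ⟦ x V.≟ y ⟧))) ⟩
      ∑V (λ y → (P ℤ.* w x) ℤ.* w y ℤ.+ ((qℤ ℤ.- 1ℤ) ℤ.* P ℤ.* w x) ℤ.* (⟦ x V.≟ y ⟧ ℤ.* w y))
        ≡⟨ ∑-+ V.els (λ y → (P ℤ.* w x) ℤ.* w y) (λ y → ((qℤ ℤ.- 1ℤ) ℤ.* P ℤ.* w x) ℤ.* (⟦ x V.≟ y ⟧ ℤ.* w y)) ⟩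
      ∑V (λ y → (P ℤ.* w x) ℤ.* w y) ℤ.+ ∑V (λ y → ((qℤ ℤ.- 1ℤ) ℤ.* P ℤ.* w x) ℤ.* (⟦ x V.≟ y ⟧ ℤ.* w y))
        ≡⟨ cong₂ ℤ._+_ (trans (∑-*ˡ V.els (P ℤ.* w x) w) (ℤP.*-assoc P (w x) (∑V w)))
             (trans (∑-*ˡ V.els ((qℤ ℤ.- 1ℤ) ℤ.* P ℤ.* w x) (λ y → ⟦ x V.≟ y ⟧ ℤ.* w y)) (trans (cong (((qℤ ℤ.- 1ℤ) ℤ.* P ℤ.* w x) ℤ.*_) (V.∑-δ′ x w)) (ℤP.*-assoc ((qℤ ℤ.- 1ℤ) ℤ.* P) (w x) (w x)))) ⟩
      P ℤ.* (w x ℤ.* ∑V w) ℤ.+ (qℤ ℤ.- 1ℤ) ℤ.* P ℤ.* (w x ℤ.* w x) ∎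

  sphereConv : (V → ℤ) → V → ℤ
  sphereConv w x = ∑V (λ y → w y ℤ.* κ (sqd x y))

  radon-sum : ∀ w m → sum (radon w m) ≡ ∑V w
  radon-sum w m = trans (∑-swap els V.els (λ c x → ⟦ dot m x ≟ c ⟧ ℤ.* w x)) (∑-cong V.els (λ x → ∑-δ′ (dot m x) (λ _ → w x)))

  -- The Radon transform carries convolution on the space to convolution on F, and the sphere
  -- identity computes the transformed kernel.
  radon-conv : ∀ m → Σ Sign λ ε → ∀ w c → radon (sphereConv w) m c ≡ proj₁ ε ℤ.* apply (λ c ζ → Rpow t (Heat.O F (norm² m) (δ-fun c)) 0# ζ) (radon w m) c
  radon-conv m = ε , λ w c → begin
    ∑V (λ x → ⟦ dot m x ≟ c ⟧ ℤ.* ∑V (λ y → w y ℤ.* κ (sqd x y))) ≡⟨ ∑-cong V.els (λ x → sym (∑-*ˡ V.els ⟦ dot m x ≟ c ⟧ (λ y → w y ℤ.* κ (sqd x y)))) ⟩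
    ∑V (λ x → ∑V (λ y → ⟦ dot m x ≟ c ⟧ ℤ.* (w y ℤ.* κ (sqd x y)))) ≡⟨ ∑-swap V.els V.els (λ x y → ⟦ dot m x ≟ c ⟧ ℤ.* (w y ℤ.* κ (sqd x y))) ⟩
    ∑V (λ y → ∑V (λ x → ⟦ dot m x ≟ c ⟧ ℤ.* (w y ℤ.* κ (sqd x y)))) ≡⟨ ∑-cong V.els (λ y → trans (∑-cong V.els (λ x → trans (lem ⟦ dot m x ≟ c ⟧ (w y) (κ (sqd x y)))
        (cong (w y ℤ.*_) (cong₂ (λ u v → κ u ℤ.* ⟦ v ≟ c ⟧) (sym (+-identityˡ (sqd x y))) (sym (+-identityˡ (dot m x)))))))
        (trans (∑-*ˡ V.els (w y) (λ x → δ-fun c (0# + sqd x y) (0# + dot m x)))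
          (cong (w y ℤ.*_) (trans (proj₂ (sphere-identity t m) (δ-fun-zero c) y 0# 0#) (cong (λ e → proj₁ ε ℤ.* k c e) (+-identityˡ (dot m y))))))) ⟩
    ∑V (λ y → w y ℤ.* (proj₁ ε ℤ.* k c (dot m y))) ≡⟨ ∑-cong V.els (λ y → lem₂ (w y) (proj₁ ε) (k c (dot m y))) ⟩
    ∑V (λ y → proj₁ ε ℤ.* (w y ℤ.* k c (dot m y))) ≡⟨ ∑-*ˡ V.els (proj₁ ε) (λ y → w y ℤ.* k c (dot m y)) ⟩
    proj₁ ε ℤ.* ∑V (λ y → w y ℤ.* k c (dot m y)) ≡⟨ cong (proj₁ ε ℤ.*_) (begin
        ∑V (λ y → w y ℤ.* k c (dot m y)) ≡⟨ ∑-cong V.els (λ y → cong (w y ℤ.*_) (sym (∑-δ′ (dot m y) (k c)))) ⟩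
        ∑V (λ y → w y ℤ.* sum (λ ζ → ⟦ dot m y ≟ ζ ⟧ ℤ.* k c ζ)) ≡⟨ ∑-cong V.els (λ y → trans (sym (∑-*ˡ els (w y) (λ ζ → ⟦ dot m y ≟ ζ ⟧ ℤ.* k c ζ)))
            (∑-cong els (λ ζ → lem₃ (w y) ⟦ dot m y ≟ ζ ⟧ (k c ζ)))) ⟩
        ∑V (λ y → sum (λ ζ → ⟦ dot m y ≟ ζ ⟧ ℤ.* w y ℤ.* k c ζ)) ≡⟨ ∑-swap V.els els (λ y ζ → ⟦ dot m y ≟ ζ ⟧ ℤ.* w y ℤ.* k c ζ) ⟩
        sum (λ ζ → ∑V (λ y → ⟦ dot m y ≟ ζ ⟧ ℤ.* w y ℤ.* k c ζ)) ≡⟨ ∑-cong els (λ ζ → ∑-*ʳ V.els (k c ζ) (λ y → ⟦ dot m y ≟ ζ ⟧ ℤ.* w y)) ⟩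
        sum (λ ζ → radon w m ζ ℤ.* k c ζ) ∎) ⟩
    proj₁ ε ℤ.* apply k (radon w m) c ∎
    where
    open ≡-Reasoning
    ε : Sign
    ε = proj₁ (sphere-identity t m)
    k : Fun
    k c ζ = Rpow t (Heat.O F (norm² m) (δ-fun c)) 0# ζ
    lem : ∀ d w k → d ℤ.* (w ℤ.* k) ≡ w ℤ.* (k ℤ.* d)
    lem = solve-∀
    lem₂ : ∀ w e k → w ℤ.* (e ℤ.* k) ≡ e ℤ.* (w ℤ.* k)
    lem₂ = solve-∀
    lem₃ : ∀ w d k → w ℤ.* (d ℤ.* k) ≡ d ℤ.* w ℤ.* k
    lem₃ = solve-∀

  q-1>0 : 1ℤ ℤ.≤ qℤ ℤ.- 1ℤ
  q-1>0 = ≤-from-diff (subst (0ℤ ℤ.≤_) (lem qℤ) (diff-nonneg {pos 2} {qℤ} (ℤ.+≤+ 1<size)))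
    where
    lem : ∀ q → q ℤ.- pos 2 ≡ q ℤ.- 1ℤ ℤ.- 1ℤ
    lem = solve-∀

  pw>0 : ∀ j → 0ℤ ℤ.< pw j
  pw>0 zero = ℤ.+<+ (s≤s z≤n)
  pw>0 (suc j) = subst (ℤ._< pw (suc j)) (ℤP.*-zeroʳ qℤ) (ℤP.*-monoˡ-<-pos qℤ ⦃ ℤ.positive (ℤP.<-≤-trans (ℤ.+<+ (s≤s z≤n)) 1≤qℤ) ⦄ (pw>0 j))

  spectral-gap : ∀ w → ∑V w ≡ 0ℤ → energyV (sphereConv w) ℤ.≤ pos 9 ℤ.* pw (suc (suc t)) ℤ.* energyV w
  spectral-gap w mean = ℤP.*-cancelˡ-≤-pos (energyV g) (B ℤ.* energyV w) X ⦃ ℤ.positive X>0 ⦄ (ℤP.≤-trans lower (ℤP.≤-trans middle (ℤP.≤-reflexive upper)))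
    where
    g : V → ℤ
    g = sphereConv w
    B X P : ℤ
    P = pw (suc t)
    B = pos 9 ℤ.* pw (suc (suc t))
    X = (qℤ ℤ.- 1ℤ) ℤ.* P
    X>0 : 0ℤ ℤ.< X
    X>0 = subst (ℤ._< X) (ℤP.*-zeroʳ (qℤ ℤ.- 1ℤ)) (ℤP.*-monoˡ-<-pos (qℤ ℤ.- 1ℤ) ⦃ ℤ.positive (ℤP.<-≤-trans (ℤ.+<+ (s≤s z≤n)) q-1>0) ⦄ (pw>0 (suc t)))
    lower : X ℤ.* energyV g ℤ.≤ qℤ ℤ.* ∑V (λ m → energy (radon g m))
    lower = subst (X ℤ.* energyV g ℤ.≤_) (sym (parseval g)) (subst (ℤ._≤ P ℤ.* (∑V g ℤ.* ∑V g) ℤ.+ X ℤ.* energyV g) (ℤP.+-identityˡ _)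
      (ℤP.+-monoˡ-≤ (X ℤ.* energyV g) (*-nonneg (pw≥0 (suc t)) (sq-nonneg (∑V g)))))
    each : ∀ m → energy (radon g m) ℤ.≤ B ℤ.* energy (radon w m)
    each m = subst (ℤ._≤ B ℤ.* energy (radon w m)) (sym (∑-cong els (λ c → trans (cong (λ u → u ℤ.* u) (proj₂ (radon-conv m) w c)) (sign-square (proj₁ (radon-conv m)) _))))
      (kernel-bound t (norm² m) (radon w m) (trans (radon-sum w m) mean))
    middle : qℤ ℤ.* ∑V (λ m → energy (radon g m)) ℤ.≤ qℤ ℤ.* (B ℤ.* ∑V (λ m → energy (radon w m)))
    middle = *-monoˡ qℤ≥0 (subst (∑V (λ m → energy (radon g m)) ℤ.≤_) (∑-*ˡ V.els B (λ m → energy (radon w m))) (∑-mono V.els each))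
    upper : qℤ ℤ.* (B ℤ.* ∑V (λ m → energy (radon w m))) ≡ X ℤ.* (B ℤ.* energyV w)
    upper = trans (lem qℤ B (∑V (λ m → energy (radon w m)))) (trans (cong (B ℤ.*_) (trans (parseval w) (cong (λ s → P ℤ.* (s ℤ.* s) ℤ.+ X ℤ.* energyV w) mean))) (lem₂ B P X (energyV w)))
      where
      lem : ∀ q b s → q ℤ.* (b ℤ.* s) ≡ b ℤ.* (q ℤ.* s)
      lem = solve-∀
      lem₂ : ∀ b p x e → b ℤ.* (p ℤ.* (0ℤ ℤ.* 0ℤ) ℤ.+ x ℤ.* e) ≡ x ℤ.* (b ℤ.* e)
      lem₂ = solve-∀

  adj : V → V → ℤ
  adj x y = ⟦ sqd x y ≟ 1# ⟧

  deg : (V → ℤ) → V → ℤ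
  deg w x = ∑V (λ y → w y ℤ.* adj x y)

  Indicator : (V → ℤ) → Set
  Indicator w = ∀ x → w x ≡ 0ℤ ⊎ w x ≡ 1ℤ

  indicator≥0 : ∀ {w} → Indicator w → ∀ x → 0ℤ ℤ.≤ w x
  indicator≥0 i x with i x
  ... | inj₁ e = ℤP.≤-reflexive (sym e)
  ... | inj₂ e = subst (0ℤ ℤ.≤_) (sym e) (ℤ.+≤+ z≤n)

  indicator≤1 : ∀ {w} → Indicator w → ∀ x → w x ℤ.≤ 1ℤ
  indicator≤1 i x with i x
  ... | inj₁ e = subst (ℤ._≤ 1ℤ) (sym e) (ℤ.+≤+ z≤n)
  ... | inj₂ e = ℤP.≤-reflexive e

  indicator-idem : ∀ {w} → Indicator w → ∀ x → w x ℤ.* w x ≡ w x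
  indicator-idem i x with i x
  ... | inj₁ e = trans (cong (λ v → v ℤ.* v) e) (sym e)
  ... | inj₂ e = trans (cong (λ v → v ℤ.* v) e) (sym e)

  -- Expander mixing, obtained from the spectral gap for N w - |w| with N = |V|.
  mixing : ∀ w → Indicator w → ∑V (λ x → (qℤ ℤ.* deg w x ℤ.- ∑V w) ℤ.* (qℤ ℤ.* deg w x ℤ.- ∑V w)) ℤ.≤ pos 20 ℤ.* pw (suc (suc t)) ℤ.* ∑V w
  mixing w ind = ℤP.*-cancelˡ-≤-pos (energyV g) (pos 20 ℤ.* B ℤ.* W) (N ℤ.* N) ⦃ ℤ.positive N²>0 ⦄ bound
    where
    open ≡-Reasoning
    N W B : ℤ
    N = pw (suc t)
    W = ∑V w
    B = pw (suc (suc t))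
    N≥0 : 0ℤ ℤ.≤ N
    N≥0 = pw≥0 (suc t)
    N>0 : 0ℤ ℤ.< N
    N>0 = pw>0 (suc t)
    N²>0 : 0ℤ ℤ.< N ℤ.* N
    N²>0 = subst (ℤ._< N ℤ.* N) (ℤP.*-zeroʳ N) (ℤP.*-monoˡ-<-pos N ⦃ ℤ.positive N>0 ⦄ N>0)
    B≥0 : 0ℤ ℤ.≤ B
    B≥0 = pw≥0 (suc (suc t))
    W≥0 : 0ℤ ℤ.≤ W
    W≥0 = ∑-nonneg V.els (indicator≥0 ind)
    W≤N : W ℤ.≤ N
    W≤N = subst (W ℤ.≤_) (vecs-count (suc t)) (∑-mono V.els (indicator≤1 ind))
    const-sum : ∀ c → ∑V (λ _ → c) ≡ N ℤ.* c
    const-sum c = trans (∑-cong V.els (λ _ → sym (ℤP.*-identityˡ c))) (trans (∑-*ʳ V.els c (λ _ → 1ℤ)) (cong (ℤ._* c) (vecs-count (suc t))))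
    g w̃ κ̄ : V → ℤ
    g x = qℤ ℤ.* deg w x ℤ.- W
    w̃ x = N ℤ.* w x ℤ.- W
    κ̄ x = ∑V (λ y → κ (sqd x y))
    w̃-mean : ∑V w̃ ≡ 0ℤ
    w̃-mean = trans (∑-sub V.els (λ x → N ℤ.* w x) (λ _ → W)) (trans (cong₂ ℤ._-_ (∑-*ˡ V.els N w) (const-sum W)) (ℤP.+-inverseʳ (N ℤ.* W)))
    conv-g : ∀ x → sphereConv w x ≡ g x
    conv-g x = trans (∑-cong V.els (λ y → lem (w y) qℤ (adj x y))) (trans (∑-sub V.els (λ y → qℤ ℤ.* (w y ℤ.* adj x y)) w) (cong (ℤ._- W) (∑-*ˡ V.els qℤ (λ y → w y ℤ.* adj x y))))
      where
      lem : ∀ w q a → w ℤ.* (q ℤ.* a ℤ.- 1ℤ) ≡ q ℤ.* (w ℤ.* a) ℤ.- w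
      lem = solve-∀
    conv-w̃ : ∀ x → sphereConv w̃ x ≡ N ℤ.* g x ℤ.- W ℤ.* κ̄ x
    conv-w̃ x = trans (∑-cong V.els (λ y → lem N (w y) W (κ (sqd x y)))) (trans (∑-sub V.els (λ y → N ℤ.* (w y ℤ.* κ (sqd x y))) (λ y → W ℤ.* κ (sqd x y)))
      (cong₂ ℤ._-_ (trans (∑-*ˡ V.els N (λ y → w y ℤ.* κ (sqd x y))) (cong (N ℤ.*_) (conv-g x))) (∑-*ˡ V.els W (λ y → κ (sqd x y)))))
      where
      lem : ∀ n w v k → (n ℤ.* w ℤ.- v) ℤ.* k ≡ n ℤ.* (w ℤ.* k) ℤ.- v ℤ.* k
      lem = solve-∀
    energy-w̃ : energyV w̃ ≡ N ℤ.* N ℤ.* W ℤ.- N ℤ.* (W ℤ.* W)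
    energy-w̃ = begin
      ∑V (λ x → w̃ x ℤ.* w̃ x) ≡⟨ ∑-cong V.els (λ x → trans (lem N (w x) W) (cong (λ s → N ℤ.* N ℤ.* s ℤ.+ (W ℤ.* W ℤ.- (pos 2 ℤ.* N ℤ.* W) ℤ.* w x)) (indicator-idem ind x))) ⟩
      ∑V (λ x → N ℤ.* N ℤ.* w x ℤ.+ (W ℤ.* W ℤ.- (pos 2 ℤ.* N ℤ.* W) ℤ.* w x)) ≡⟨ ∑-+ V.els (λ x → N ℤ.* N ℤ.* w x) (λ x → W ℤ.* W ℤ.- (pos 2 ℤ.* N ℤ.* W) ℤ.* w x) ⟩
      ∑V (λ x → N ℤ.* N ℤ.* w x) ℤ.+ ∑V (λ x → W ℤ.* W ℤ.- (pos 2 ℤ.* N ℤ.* W) ℤ.* w x)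
        ≡⟨ cong₂ ℤ._+_ (∑-*ˡ V.els (N ℤ.* N) w) (trans (∑-sub V.els (λ _ → W ℤ.* W) (λ x → (pos 2 ℤ.* N ℤ.* W) ℤ.* w x)) (cong₂ ℤ._-_ (const-sum (W ℤ.* W)) (∑-*ˡ V.els (pos 2 ℤ.* N ℤ.* W) w))) ⟩
      N ℤ.* N ℤ.* W ℤ.+ (N ℤ.* (W ℤ.* W) ℤ.- pos 2 ℤ.* N ℤ.* W ℤ.* W) ≡⟨ lem₂ N W ⟩
      N ℤ.* N ℤ.* W ℤ.- N ℤ.* (W ℤ.* W) ∎
      where
      lem : ∀ n w v → (n ℤ.* w ℤ.- v) ℤ.* (n ℤ.* w ℤ.- v) ≡ n ℤ.* n ℤ.* (w ℤ.* w) ℤ.+ (v ℤ.* v ℤ.- (pos 2 ℤ.* n ℤ.* v) ℤ.* w)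
      lem = solve-∀
      lem₂ : ∀ n v → n ℤ.* n ℤ.* v ℤ.+ (n ℤ.* (v ℤ.* v) ℤ.- pos 2 ℤ.* n ℤ.* v ℤ.* v) ≡ n ℤ.* n ℤ.* v ℤ.- n ℤ.* (v ℤ.* v)
      lem₂ = solve-∀
    κ̄-bound : ∀ x → κ̄ x ℤ.* κ̄ x ℤ.≤ B
    κ̄-bound x = subst (λ s → s ℤ.* s ℤ.≤ B) (∑-cong V.els (λ y → cong κ (sqd-sym y x))) (sphere-size t x)
    -- N g = sphereConv w̃ + W κ̄ and (a + b)² ≤ 2 a² + 2 b². With 9 from the spectral gap, 1 from
    -- the sphere size and W ≤ N this gives 20 = 2 · 9 + 2.
    pointwise : ∀ x → N ℤ.* N ℤ.* (g x ℤ.* g x) ℤ.≤ pos 2 ℤ.* (sphereConv w̃ x ℤ.* sphereConv w̃ x) ℤ.+ pos 2 ℤ.* (W ℤ.* W) ℤ.* B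
    pointwise x = ℤP.≤-trans (≤-from-diff (subst (0ℤ ℤ.≤_) (lem (N ℤ.* g x) (W ℤ.* κ̄ x) (sphereConv w̃ x) (conv-w̃ x)) (sq-nonneg (sphereConv w̃ x ℤ.- W ℤ.* κ̄ x))))
      (subst₂ ℤ._≤_ (cong (ℤ._+_ (pos 2 ℤ.* (sphereConv w̃ x ℤ.* sphereConv w̃ x))) (lem₄ W (κ̄ x))) refl
        (ℤP.+-monoʳ-≤ (pos 2 ℤ.* (sphereConv w̃ x ℤ.* sphereConv w̃ x)) (*-monoˡ (*-nonneg {pos 2} (ℤ.+≤+ z≤n) (sq-nonneg W)) (κ̄-bound x)))) ⟨from⟩ lem₃ N (g x)
      where
      _⟨from⟩_ : ∀ {a b c} → a ℤ.≤ c → b ≡ a → b ℤ.≤ c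
      p ⟨from⟩ e = subst (ℤ._≤ _) (sym e) p
      lem : ∀ a b c → c ≡ a ℤ.- b → (c ℤ.- b) ℤ.* (c ℤ.- b) ≡ pos 2 ℤ.* (c ℤ.* c) ℤ.+ pos 2 ℤ.* (b ℤ.* b) ℤ.- a ℤ.* a
      lem a b c refl = core a b
        where
        core : ∀ a b → (a ℤ.- b ℤ.- b) ℤ.* (a ℤ.- b ℤ.- b) ≡ pos 2 ℤ.* ((a ℤ.- b) ℤ.* (a ℤ.- b)) ℤ.+ pos 2 ℤ.* (b ℤ.* b) ℤ.- a ℤ.* a
        core = solve-∀
      lem₃ : ∀ n g → n ℤ.* n ℤ.* (g ℤ.* g) ≡ n ℤ.* g ℤ.* (n ℤ.* g)
      lem₃ = solve-∀
      lem₄ : ∀ v k → pos 2 ℤ.* (v ℤ.* v) ℤ.* (k ℤ.* k) ≡ pos 2 ℤ.* (v ℤ.* k ℤ.* (v ℤ.* k))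
      lem₄ = solve-∀
    summed : N ℤ.* N ℤ.* energyV g ℤ.≤ pos 2 ℤ.* energyV (sphereConv w̃) ℤ.+ N ℤ.* (pos 2 ℤ.* (W ℤ.* W) ℤ.* B)
    summed = subst₂ ℤ._≤_ (∑-*ˡ V.els (N ℤ.* N) (λ x → g x ℤ.* g x))
      (trans (∑-+ V.els (λ x → pos 2 ℤ.* (sphereConv w̃ x ℤ.* sphereConv w̃ x)) (λ _ → pos 2 ℤ.* (W ℤ.* W) ℤ.* B))
        (cong₂ ℤ._+_ (∑-*ˡ V.els (pos 2) (λ x → sphereConv w̃ x ℤ.* sphereConv w̃ x)) (const-sum (pos 2 ℤ.* (W ℤ.* W) ℤ.* B))))
      (∑-mono V.els pointwise)
    bound : N ℤ.* N ℤ.* energyV g ℤ.≤ N ℤ.* N ℤ.* (pos 20 ℤ.* B ℤ.* W)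
    bound = ℤP.≤-trans summed (ℤP.≤-trans (ℤP.+-monoˡ-≤ (N ℤ.* (pos 2 ℤ.* (W ℤ.* W) ℤ.* B)) (*-monoˡ {pos 2} (ℤ.+≤+ z≤n) (spectral-gap w̃ w̃-mean)))
      (subst (λ e → pos 2 ℤ.* (pos 9 ℤ.* B ℤ.* e) ℤ.+ N ℤ.* (pos 2 ℤ.* (W ℤ.* W) ℤ.* B) ℤ.≤ N ℤ.* N ℤ.* (pos 20 ℤ.* B ℤ.* W)) (sym energy-w̃)
        (≤-from-diff (subst (0ℤ ℤ.≤_) (sym (lem N B W))
          (ℤP.+-mono-≤ {0ℤ} (*-nonneg (*-nonneg (*-nonneg {pos 2} (ℤ.+≤+ z≤n) B≥0) (*-nonneg N≥0 W≥0)) (diff-nonneg W≤N))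
            (*-nonneg (*-nonneg {pos 18} (ℤ.+≤+ z≤n) B≥0) (*-nonneg N≥0 (sq-nonneg W))))))))
      where
      lem : ∀ n b v → n ℤ.* n ℤ.* (pos 20 ℤ.* b ℤ.* v) ℤ.- (pos 2 ℤ.* (pos 9 ℤ.* b ℤ.* (n ℤ.* n ℤ.* v ℤ.- n ℤ.* (v ℤ.* v))) ℤ.+ n ℤ.* (pos 2 ℤ.* (v ℤ.* v) ℤ.* b))
        ≡ pos 2 ℤ.* b ℤ.* (n ℤ.* v) ℤ.* (n ℤ.- v) ℤ.+ pos 18 ℤ.* b ℤ.* (n ℤ.* (v ℤ.* v))
      lem = solve-∀

-- Shattered tuples

finite-Bool : Finite Bool
finite-Bool = record { els = true ∷ false ∷ [] ; _≟_ = BoolP._≟_ ; once = λ { true → refl ; false → refl } }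

1≤⇒0< : ∀ {x} → 1ℤ ℤ.≤ x → 0ℤ ℤ.< x
1≤⇒0< = ℤP.<-≤-trans (ℤ.+<+ (s≤s z≤n))

0<⇒1≤ : ∀ {x} → 0ℤ ℤ.< x → 1ℤ ℤ.≤ x
0<⇒1≤ = ℤP.i<j⇒suc[i]≤j

^-nonneg : ∀ {x} n → 0ℤ ℤ.≤ x → 0ℤ ℤ.≤ x ℤ.^ n
^-nonneg zero p = ℤ.+≤+ z≤n
^-nonneg (suc n) p = *-nonneg p (^-nonneg n p)

^-mono : ∀ {x y} n → 0ℤ ℤ.≤ x → x ℤ.≤ y → x ℤ.^ n ℤ.≤ y ℤ.^ n
^-mono zero p le = ℤP.≤-refl
^-mono (suc n) p le = *-mono p (^-nonneg n (ℤP.≤-trans p le)) le (^-mono n p le)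

^-distrib : ∀ x y n → (x ℤ.* y) ℤ.^ n ≡ x ℤ.^ n ℤ.* y ℤ.^ n
^-distrib x y zero = refl
^-distrib x y (suc n) = trans (cong (x ℤ.* y ℤ.*_) (^-distrib x y n)) (lem x y (x ℤ.^ n) (y ℤ.^ n))
  where
  lem : ∀ x y a b → x ℤ.* y ℤ.* (a ℤ.* b) ≡ x ℤ.* a ℤ.* (y ℤ.* b)
  lem = solve-∀

module Shattering (F : OddField) (fermat : ∀ x → OddField._^_ F x (OddField.size F) ≡ x) (t : ℕ) where
  open OddField F using (Carrier; _≟_; 1#)
  open SphereSums F
  open SpectralGap F fermat t
  private module V = Finite finiteV

  adj-sym : ∀ x y → adj x y ≡ adj y x
  adj-sym x y = cong (λ s → ⟦ s ≟ 1# ⟧) (sqd-sym x y)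

  adj≥0 : ∀ x y → 0ℤ ℤ.≤ adj x y
  adj≥0 x y = ⟦⟧-nonneg (sqd x y ≟ 1#)

  heavy : ℕ → (V → ℤ) → V → ℤ
  heavy d w x = ⟦ ∑V w ℤP.≤? pos d ℤ.* deg w x ⟧

  module _ (d : ℕ) (q≥2d : pos 2 ℤ.* pos d ℤ.≤ qℤ) where

    -- As q ≥ 2d, a heavy point has q deg - W ≥ q W/2d, far from the average. Mixing gives (q W)² H
    -- ≤ 4 d² · 20 q^(t + 2) W, and q² W cancels; for W = 0 there is nothing to prove.
    heavy-count : ∀ w → Indicator w → ∑V w ℤ.* ∑V (heavy d w) ℤ.≤ pos 80 ℤ.* (pos d ℤ.* pos d) ℤ.* pw t
    heavy-count w ind = cases (W ℤP.≤? 0ℤ)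
      where
      W H D : ℤ
      W = ∑V w
      H = ∑V (heavy d w)
      D = pos d
      W≥0 : 0ℤ ℤ.≤ W
      W≥0 = ∑-nonneg V.els (indicator≥0 ind)
      dev : V → ℤ
      dev x = qℤ ℤ.* deg w x ℤ.- W
      pointwise : ∀ x → (qℤ ℤ.* W ℤ.* (qℤ ℤ.* W)) ℤ.* heavy d w x ℤ.≤ pos 4 ℤ.* (D ℤ.* D) ℤ.* (dev x ℤ.* dev x)
      pointwise x = go (W ℤP.≤? D ℤ.* deg w x)
        where
        go : (h : Dec (W ℤ.≤ D ℤ.* deg w x)) → (qℤ ℤ.* W ℤ.* (qℤ ℤ.* W)) ℤ.* ⟦ h ⟧ ℤ.≤ pos 4 ℤ.* (D ℤ.* D) ℤ.* (dev x ℤ.* dev x)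
        go (no _) = subst (ℤ._≤ pos 4 ℤ.* (D ℤ.* D) ℤ.* (dev x ℤ.* dev x)) (sym (ℤP.*-zeroʳ (qℤ ℤ.* W ℤ.* (qℤ ℤ.* W))))
          (*-nonneg (*-nonneg {pos 4} (ℤ.+≤+ z≤n) (sq-nonneg D)) (sq-nonneg (dev x)))
        go (yes h) = subst₂ ℤ._≤_ (sym (ℤP.*-identityʳ (qℤ ℤ.* W ℤ.* (qℤ ℤ.* W)))) (lem D (dev x)) (*-mono qW≥0 (ℤP.≤-trans qW≥0 key) key key)
          where
          qW≥0 : 0ℤ ℤ.≤ qℤ ℤ.* W
          qW≥0 = *-nonneg qℤ≥0 W≥0
          lem : ∀ d x → (pos 2 ℤ.* d ℤ.* x) ℤ.* (pos 2 ℤ.* d ℤ.* x) ≡ pos 4 ℤ.* (d ℤ.* d) ℤ.* (x ℤ.* x)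
          lem = solve-∀
          split : ∀ q d g v → pos 2 ℤ.* d ℤ.* (q ℤ.* g ℤ.- v) ℤ.- q ℤ.* v ≡ pos 2 ℤ.* q ℤ.* (d ℤ.* g ℤ.- v) ℤ.+ (q ℤ.- pos 2 ℤ.* d) ℤ.* v
          split = solve-∀
          key : qℤ ℤ.* W ℤ.≤ pos 2 ℤ.* D ℤ.* dev x
          key = ≤-from-diff (subst (0ℤ ℤ.≤_) (sym (split qℤ D (deg w x) W))
            (ℤP.+-mono-≤ {0ℤ} (*-nonneg (*-nonneg {pos 2} (ℤ.+≤+ z≤n) qℤ≥0) (diff-nonneg h)) (*-nonneg (diff-nonneg q≥2d) W≥0)))
      summed : (qℤ ℤ.* W ℤ.* (qℤ ℤ.* W)) ℤ.* H ℤ.≤ pos 4 ℤ.* (D ℤ.* D) ℤ.* (pos 20 ℤ.* pw (suc (suc t)) ℤ.* W)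
      summed = ℤP.≤-trans (subst₂ ℤ._≤_ (∑-*ˡ V.els (qℤ ℤ.* W ℤ.* (qℤ ℤ.* W)) (heavy d w)) (∑-*ˡ V.els (pos 4 ℤ.* (D ℤ.* D)) (λ x → dev x ℤ.* dev x)) (∑-mono V.els pointwise))
        (*-monoˡ (*-nonneg {pos 4} (ℤ.+≤+ z≤n) (sq-nonneg D)) (mixing w ind))
      rhs≥0 : 0ℤ ℤ.≤ pos 80 ℤ.* (D ℤ.* D) ℤ.* pw t
      rhs≥0 = *-nonneg (*-nonneg {pos 80} (ℤ.+≤+ z≤n) (sq-nonneg D)) (pw≥0 t)
      cases : Dec (W ℤ.≤ 0ℤ) → W ℤ.* H ℤ.≤ pos 80 ℤ.* (D ℤ.* D) ℤ.* pw t
      cases (yes W≤0) = subst (ℤ._≤ pos 80 ℤ.* (D ℤ.* D) ℤ.* pw t) (sym (cong (ℤ._* H) (ℤP.≤-antisym W≤0 W≥0))) rhs≥0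
      cases (no W≰0) = ℤP.*-cancelˡ-≤-pos (W ℤ.* H) (pos 80 ℤ.* (D ℤ.* D) ℤ.* pw t) X ⦃ ℤ.positive X>0 ⦄ (subst₂ ℤ._≤_ (lem₁ qℤ W H) (lem₂ D qℤ (pw t) W) summed)
        where
        X : ℤ
        X = qℤ ℤ.* qℤ ℤ.* W
        X>0 : 0ℤ ℤ.< X
        X>0 = 1≤⇒0< (*-mono {1ℤ} {qℤ ℤ.* qℤ} {1ℤ} {W} (ℤ.+≤+ z≤n) W≥0 (*-mono {1ℤ} {qℤ} {1ℤ} {qℤ} (ℤ.+≤+ z≤n) qℤ≥0 1≤qℤ 1≤qℤ) (0<⇒1≤ (ℤP.≰⇒> W≰0)))
        lem₁ : ∀ q v h → (q ℤ.* v ℤ.* (q ℤ.* v)) ℤ.* h ≡ q ℤ.* q ℤ.* v ℤ.* (v ℤ.* h)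
        lem₁ = solve-∀
        lem₂ : ∀ d q p v → pos 4 ℤ.* (d ℤ.* d) ℤ.* (pos 20 ℤ.* (q ℤ.* (q ℤ.* p)) ℤ.* v) ≡ q ℤ.* q ℤ.* v ℤ.* (pos 80 ℤ.* (d ℤ.* d) ℤ.* p)
        lem₂ = solve-∀

  module _ (u : V → ℤ) (u-ind : Indicator u) where

    n : ℤ
    n = ∑V u

    n≥0 : 0ℤ ℤ.≤ n
    n≥0 = ∑-nonneg V.els (indicator≥0 u-ind)

    common : ∀ {d} → Vec Bool d → Vec V d → V → ℤ
    common [] [] v = 1ℤ
    common (true ∷ S) (x ∷ X) v = adj x v ℤ.* common S X v
    common (false ∷ S) (x ∷ X) v = common S X v

    -- The points of U adjacent to the entries of X that S marks. Unmarked entries impose nothing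
    -- yet, not even non-adjacency.
    nbr : ∀ {d} → Vec Bool d → Vec V d → V → ℤ
    nbr S X v = u v ℤ.* common S X v

    inU : ∀ {d} → Vec V d → ℤ
    inU [] = 1ℤ
    inU (x ∷ X) = u x ℤ.* inU X

    private
      01-* : ∀ {a b} → a ≡ 0ℤ ⊎ a ≡ 1ℤ → b ≡ 0ℤ ⊎ b ≡ 1ℤ → a ℤ.* b ≡ 0ℤ ⊎ a ℤ.* b ≡ 1ℤ
      01-* (inj₁ refl) _ = inj₁ refl
      01-* (inj₂ refl) (inj₁ refl) = inj₁ refl
      01-* (inj₂ refl) (inj₂ refl) = inj₂ refl

      ⟦⟧-01 : {P : Set} (p : Dec P) → ⟦ p ⟧ ≡ 0ℤ ⊎ ⟦ p ⟧ ≡ 1ℤ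
      ⟦⟧-01 (yes _) = inj₂ refl
      ⟦⟧-01 (no _) = inj₁ refl

      01-product : ∀ {a b} → a ≡ 0ℤ ⊎ a ≡ 1ℤ → b ≡ 0ℤ ⊎ b ≡ 1ℤ → a ℤ.* b ≡ 1ℤ → a ≡ 1ℤ × b ≡ 1ℤ
      01-product (inj₁ refl) _ ()
      01-product (inj₂ refl) (inj₁ refl) ()
      01-product (inj₂ refl) (inj₂ refl) _ = refl , refl

    common-01 : ∀ {d} (S : Vec Bool d) X v → common S X v ≡ 0ℤ ⊎ common S X v ≡ 1ℤ
    common-01 [] [] v = inj₂ refl
    common-01 (true ∷ S) (x ∷ X) v = 01-* (⟦⟧-01 (sqd x v ≟ 1#)) (common-01 S X v)
    common-01 (false ∷ S) (x ∷ X) v = common-01 S X v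

    nbr-ind : ∀ {d} (S : Vec Bool d) X → Indicator (nbr S X)
    nbr-ind S X v = 01-* (u-ind v) (common-01 S X v)

    inU-01 : ∀ {d} (X : Vec V d) → inU X ≡ 0ℤ ⊎ inU X ≡ 1ℤ
    inU-01 [] = inj₂ refl
    inU-01 (x ∷ X) = 01-* (u-ind x) (inU-01 X)

    private
      01≥0 : ∀ {a} → a ≡ 0ℤ ⊎ a ≡ 1ℤ → 0ℤ ℤ.≤ a
      01≥0 (inj₁ refl) = ℤP.≤-refl
      01≥0 (inj₂ refl) = ℤ.+≤+ z≤n

      shrink : ∀ {a b} → a ≡ 0ℤ ⊎ a ≡ 1ℤ → 0ℤ ℤ.≤ b → a ℤ.* b ℤ.≤ b
      shrink (inj₁ refl) p = p
      shrink {b = b} (inj₂ refl) p = ℤP.≤-reflexive (ℤP.*-identityˡ b)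

    all : ∀ d → Vec Bool d
    all d = replicate d true

    common-all≤ : ∀ {d} (S : Vec Bool d) X v → common (all d) X v ℤ.≤ common S X v
    common-all≤ [] [] v = ℤP.≤-refl
    common-all≤ (true ∷ S) (x ∷ X) v = *-monoˡ (adj≥0 x v) (common-all≤ S X v)
    common-all≤ {suc d} (false ∷ S) (x ∷ X) v = ℤP.≤-trans (shrink (⟦⟧-01 (sqd x v ≟ 1#)) (01≥0 (common-01 (all d) X v))) (common-all≤ S X v)

    nbr-all≤ : ∀ {d} (S : Vec Bool d) X → ∑V (nbr (all d) X) ℤ.≤ ∑V (nbr S X)
    nbr-all≤ S X = ∑-mono V.els (λ v → *-monoˡ (indicator≥0 u-ind v) (common-all≤ S X v))

    common-true : ∀ {d} (S : Vec Bool d) X v → common S X v ≡ 1ℤ → ∀ i → lookup S i ≡ true → adj (lookup X i) v ≡ 1ℤ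
    common-true (true ∷ S) (x ∷ X) v e i s with 01-product (⟦⟧-01 (sqd x v ≟ 1#)) (common-01 S X v) e
    common-true (true ∷ S) (x ∷ X) v e zero s | a , c = a
    common-true (true ∷ S) (x ∷ X) v e (suc i) s | a , c = common-true S X v c i s
    common-true (false ∷ S) (x ∷ X) v e (suc i) s = common-true S X v e i s

    tuples : ∀ d → List (Vec V d)
    tuples d = vecs finiteV d

    sum-inU : ∀ d → ∑ (tuples d) inU ≡ n ℤ.^ d
    sum-inU zero = refl
    sum-inU (suc d) = trans (∑-vecs finiteV d inU) (trans (∑-cong V.els (λ x → trans (∑-*ˡ (tuples d) (u x) inU) (cong (u x ℤ.*_) (sum-inU d)))) (∑-*ʳ V.els (n ℤ.^ d) u))

    -- The number of stars in U with leaves X, used as the weight with which tuples are averaged.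
    Ω : ∀ {d} → Vec V d → ℤ
    Ω {d} X = inU X ℤ.* ∑V (nbr (all d) X)

    Ω≥0 : ∀ {d} (X : Vec V d) → 0ℤ ℤ.≤ Ω X
    Ω≥0 {d} X = *-nonneg (01≥0 (inU-01 X)) (∑-nonneg V.els (indicator≥0 (nbr-ind (all d) X)))

    -- Seen from its centre, a star is a free choice of d neighbours.
    star : ∀ d v → ∑ (tuples d) (λ X → inU X ℤ.* common (all d) X v) ≡ deg u v ℤ.^ d
    star zero v = refl
    star (suc d) v = trans (∑-vecs finiteV d (λ X → inU X ℤ.* common (all (suc d)) X v))
      (trans (∑-cong V.els (λ x → trans (∑-cong (tuples d) (λ X → lem (u x) (inU X) (adj x v) (common (all d) X v)))
        (trans (∑-*ˡ (tuples d) (u x ℤ.* adj x v) (λ X → inU X ℤ.* common (all d) X v)) (cong₂ (λ a b → u x ℤ.* a ℤ.* b) (adj-sym x v) (star d v)))))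
        (∑-*ʳ V.els (deg u v ℤ.^ d) (λ x → u x ℤ.* adj v x)))
      where
      lem : ∀ a b c e → a ℤ.* b ℤ.* (c ℤ.* e) ≡ a ℤ.* c ℤ.* (b ℤ.* e)
      lem = solve-∀

    sum-Ω : ∀ d → ∑ (tuples d) Ω ≡ ∑V (λ v → u v ℤ.* deg u v ℤ.^ d)
    sum-Ω d = begin
      ∑ (tuples d) (λ X → inU X ℤ.* ∑V (nbr (all d) X)) ≡⟨ ∑-cong (tuples d) (λ X → sym (∑-*ˡ V.els (inU X) (nbr (all d) X))) ⟩
      ∑ (tuples d) (λ X → ∑V (λ v → inU X ℤ.* (u v ℤ.* common (all d) X v))) ≡⟨ ∑-swap (tuples d) V.els (λ X v → inU X ℤ.* (u v ℤ.* common (all d) X v)) ⟩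
      ∑V (λ v → ∑ (tuples d) (λ X → inU X ℤ.* (u v ℤ.* common (all d) X v))) ≡⟨ ∑-cong V.els (λ v → trans (∑-cong (tuples d) (λ X → lem (inU X) (u v) (common (all d) X v)))
          (trans (∑-*ˡ (tuples d) (u v) (λ X → inU X ℤ.* common (all d) X v)) (cong (u v ℤ.*_) (star d v)))) ⟩
      ∑V (λ v → u v ℤ.* deg u v ℤ.^ d) ∎
      where
      open ≡-Reasoning
      lem : ∀ a b c → a ℤ.* (b ℤ.* c) ≡ b ℤ.* (a ℤ.* c)
      lem = solve-∀

    -- Vertices of U with fewer than n / 2q neighbours are rare by mixing.
    sum-Ω-lower : ∀ d → 0ℤ ℤ.< n → pos 160 ℤ.* pw (suc (suc t)) ℤ.≤ n ℤ.* n → n ℤ.* n ℤ.^ d ℤ.≤ pos 2 ℤ.* ((pos 2 ℤ.* qℤ) ℤ.^ d ℤ.* ∑ (tuples d) Ω)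
    sum-Ω-lower d n>0 big = ℤP.≤-trans (subst (n ℤ.* n ℤ.^ d ℤ.≤_) (ℤP.*-assoc (pos 2) G (n ℤ.^ d)) (*-mono n≥0 (^-nonneg d n≥0) n≤2G ℤP.≤-refl))
        (*-monoˡ {pos 2} (ℤ.+≤+ z≤n) (subst₂ ℤ._≤_ (∑-*ʳ V.els (n ℤ.^ d) (λ v → u v ℤ.* ⟦ good? v ⟧))
          (trans (∑-*ˡ V.els ((pos 2 ℤ.* qℤ) ℤ.^ d) (λ v → u v ℤ.* deg u v ℤ.^ d)) (cong ((pos 2 ℤ.* qℤ) ℤ.^ d ℤ.*_) (sym (sum-Ω d)))) (∑-mono V.els each)))
      where
      good? : ∀ v → Dec (n ℤ.≤ pos 2 ℤ.* qℤ ℤ.* deg u v)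
      good? v = n ℤP.≤? pos 2 ℤ.* qℤ ℤ.* deg u v
      G Bd : ℤ
      G = ∑V (λ v → u v ℤ.* ⟦ good? v ⟧)
      Bd = ∑V (λ v → u v ℤ.* (1ℤ ℤ.- ⟦ good? v ⟧))
      dev : V → ℤ
      dev x = qℤ ℤ.* deg u x ℤ.- n
      2q≥0 : 0ℤ ℤ.≤ pos 2 ℤ.* qℤ
      2q≥0 = *-nonneg {pos 2} (ℤ.+≤+ z≤n) qℤ≥0
      deg≥0 : ∀ v → 0ℤ ℤ.≤ deg u v
      deg≥0 v = ∑-nonneg V.els (λ y → *-nonneg (indicator≥0 u-ind y) (adj≥0 v y))
      each : ∀ v → u v ℤ.* ⟦ good? v ⟧ ℤ.* n ℤ.^ d ℤ.≤ (pos 2 ℤ.* qℤ) ℤ.^ d ℤ.* (u v ℤ.* deg u v ℤ.^ d)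
      each v = go (good? v)
        where
        lem : ∀ a b c → a ℤ.* (b ℤ.* c) ≡ b ℤ.* (a ℤ.* c)
        lem = solve-∀
        go : (g : Dec (n ℤ.≤ pos 2 ℤ.* qℤ ℤ.* deg u v)) → u v ℤ.* ⟦ g ⟧ ℤ.* n ℤ.^ d ℤ.≤ (pos 2 ℤ.* qℤ) ℤ.^ d ℤ.* (u v ℤ.* deg u v ℤ.^ d)
        go (yes g) = subst₂ ℤ._≤_ (cong (ℤ._* n ℤ.^ d) (sym (ℤP.*-identityʳ (u v)))) (trans (cong (u v ℤ.*_) (^-distrib (pos 2 ℤ.* qℤ) (deg u v) d)) (lem (u v) ((pos 2 ℤ.* qℤ) ℤ.^ d) (deg u v ℤ.^ d)))
          (*-monoˡ (indicator≥0 u-ind v) (^-mono d n≥0 g))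
        go (no _) = subst (ℤ._≤ (pos 2 ℤ.* qℤ) ℤ.^ d ℤ.* (u v ℤ.* deg u v ℤ.^ d)) (sym (cong (ℤ._* n ℤ.^ d) (ℤP.*-zeroʳ (u v))))
          (*-nonneg (^-nonneg d 2q≥0) (*-nonneg (indicator≥0 u-ind v) (^-nonneg d (deg≥0 v))))
      bad-each : ∀ v → (n ℤ.* n) ℤ.* (u v ℤ.* (1ℤ ℤ.- ⟦ good? v ⟧)) ℤ.≤ pos 4 ℤ.* (dev v ℤ.* dev v)
      bad-each v = go (good? v)
        where
        rhs≥0 : 0ℤ ℤ.≤ pos 4 ℤ.* (dev v ℤ.* dev v)
        rhs≥0 = *-nonneg {pos 4} (ℤ.+≤+ z≤n) (sq-nonneg (dev v))
        go : (g : Dec (n ℤ.≤ pos 2 ℤ.* qℤ ℤ.* deg u v)) → (n ℤ.* n) ℤ.* (u v ℤ.* (1ℤ ℤ.- ⟦ g ⟧)) ℤ.≤ pos 4 ℤ.* (dev v ℤ.* dev v)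
        go (yes _) = subst (ℤ._≤ pos 4 ℤ.* (dev v ℤ.* dev v)) (sym (trans (cong ((n ℤ.* n) ℤ.*_) (ℤP.*-zeroʳ (u v))) (ℤP.*-zeroʳ (n ℤ.* n)))) rhs≥0
        go (no ¬g) = ℤP.≤-trans (subst₂ ℤ._≤_ (cong ((n ℤ.* n) ℤ.*_) (sym (ℤP.*-identityʳ (u v)))) (ℤP.*-identityʳ (n ℤ.* n)) (*-monoˡ (sq-nonneg n) (indicator≤1 u-ind v)))
            (subst (n ℤ.* n ℤ.≤_) (lem (dev v)) (*-mono n≥0 (ℤP.≤-trans n≥0 key) key key))
          where
          lem : ∀ x → (pos 2 ℤ.* (ℤ.- x)) ℤ.* (pos 2 ℤ.* (ℤ.- x)) ≡ pos 4 ℤ.* (x ℤ.* x)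
          lem = solve-∀
          split : ∀ q g n → pos 2 ℤ.* (ℤ.- (q ℤ.* g ℤ.- n)) ℤ.- n ≡ n ℤ.- pos 2 ℤ.* q ℤ.* g
          split = solve-∀
          key : n ℤ.≤ pos 2 ℤ.* (ℤ.- dev v)
          key = ≤-from-diff (subst (0ℤ ℤ.≤_) (sym (split qℤ (deg u v) n)) (diff-nonneg (ℤP.<⇒≤ (ℤP.≰⇒> ¬g))))
      bad-total : (n ℤ.* n) ℤ.* Bd ℤ.≤ pos 4 ℤ.* (pos 20 ℤ.* pw (suc (suc t)) ℤ.* n)
      bad-total = ℤP.≤-trans (subst₂ ℤ._≤_ (∑-*ˡ V.els (n ℤ.* n) (λ v → u v ℤ.* (1ℤ ℤ.- ⟦ good? v ⟧))) (∑-*ˡ V.els (pos 4) (λ v → dev v ℤ.* dev v)) (∑-mono V.els bad-each))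
        (*-monoˡ {pos 4} (ℤ.+≤+ z≤n) (mixing u u-ind))
      G+Bd : G ℤ.+ Bd ≡ n
      G+Bd = trans (sym (∑-+ V.els (λ v → u v ℤ.* ⟦ good? v ⟧) (λ v → u v ℤ.* (1ℤ ℤ.- ⟦ good? v ⟧)))) (∑-cong V.els (λ v → lem (u v) ⟦ good? v ⟧))
        where
        lem : ∀ a g → a ℤ.* g ℤ.+ a ℤ.* (1ℤ ℤ.- g) ≡ a
        lem = solve-∀
      -- A vertex that is not good deviates by at least n/2, so n² Bd ≤ 4 · 20 q^(t + 2) n; the 160
      -- in the hypothesis is twice 80.
      2Bd≤n : pos 2 ℤ.* Bd ℤ.≤ n
      2Bd≤n = ℤP.*-cancelˡ-≤-pos (pos 2 ℤ.* Bd) n (n ℤ.* n) ⦃ ℤ.positive n²>0 ⦄ (ℤP.≤-trans (subst₂ ℤ._≤_ (lem₁ (n ℤ.* n) Bd) (lem₂ (pw (suc (suc t))) n) (*-monoˡ {pos 2} (ℤ.+≤+ z≤n) bad-total))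
          (*-mono (*-nonneg {pos 160} (ℤ.+≤+ z≤n) (pw≥0 (suc (suc t)))) n≥0 big ℤP.≤-refl))
        where
        n²>0 : 0ℤ ℤ.< n ℤ.* n
        n²>0 = 1≤⇒0< (*-mono {1ℤ} {n} {1ℤ} {n} (ℤ.+≤+ z≤n) n≥0 (0<⇒1≤ n>0) (0<⇒1≤ n>0))
        lem₁ : ∀ a b → pos 2 ℤ.* (a ℤ.* b) ≡ a ℤ.* (pos 2 ℤ.* b)
        lem₁ = solve-∀
        lem₂ : ∀ p n → pos 2 ℤ.* (pos 4 ℤ.* (pos 20 ℤ.* p ℤ.* n)) ≡ pos 160 ℤ.* p ℤ.* n
        lem₂ = solve-∀
      n≤2G : n ℤ.≤ pos 2 ℤ.* G
      n≤2G = ≤-from-diff (subst (0ℤ ℤ.≤_) (trans (cong (ℤ._- pos 2 ℤ.* Bd) (sym G+Bd)) (trans (lem G Bd) (cong (λ z → pos 2 ℤ.* G ℤ.- z) G+Bd))) (diff-nonneg 2Bd≤n))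
        where
        lem : ∀ g b → g ℤ.+ b ℤ.- pos 2 ℤ.* b ≡ pos 2 ℤ.* g ℤ.- (g ℤ.+ b)
        lem = solve-∀

    -- Separates x_j from the other points, which stay fixed while x_j varies over the heavy ones.
    sum-insert : ∀ d (j : Fin (suc d)) (G : Vec V (suc d) → ℤ) → ∑ (tuples (suc d)) G ≡ ∑ (tuples d) (λ X → ∑V (λ x → G (insertAt X j x)))
    sum-insert d zero G = trans (∑-vecs finiteV d G) (∑-swap V.els (tuples d) (λ x X → G (x ∷ X)))
    sum-insert (suc d) (suc j) G = trans (∑-vecs finiteV (suc d) G)
      (trans (∑-cong V.els (λ y → sum-insert d j (λ X → G (y ∷ X)))) (sym (∑-vecs finiteV d (λ X → ∑V (λ x → G (insertAt X (suc j) x))))))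

    inU-insert : ∀ {d} (X : Vec V d) j x → inU (insertAt X j x) ≡ u x ℤ.* inU X
    inU-insert X zero x = refl
    inU-insert (y ∷ X) (suc j) x = trans (cong (u y ℤ.*_) (inU-insert X j x)) (lem (u y) (u x) (inU X))
      where
      lem : ∀ a b c → a ℤ.* (b ℤ.* c) ≡ b ℤ.* (a ℤ.* c)
      lem = solve-∀

    common-insert : ∀ {d} (S : Vec Bool (suc d)) j → lookup S j ≡ false → ∀ (X : Vec V d) x v → common S (insertAt X j x) v ≡ common (Vec.removeAt S j) X v
    common-insert (false ∷ S) zero e X x v = refl
    common-insert (true ∷ s ∷ S) (suc j) e (y ∷ X) x v = cong (adj y v ℤ.*_) (common-insert (s ∷ S) j e X x v)
    common-insert (false ∷ s ∷ S) (suc j) e (y ∷ X) x v = common-insert (s ∷ S) j e X x v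

    ∑V-heavy-cong : ∀ d {w w′} → (∀ v → w v ≡ w′ v) → ∀ x → heavy d w x ≡ heavy d w′ x
    ∑V-heavy-cong d {w} {w′} e x = cong₂ (λ a b → ⟦ a ℤP.≤? pos d ℤ.* b ⟧) (∑-cong V.els e) (∑-cong V.els (λ y → cong (ℤ._* adj x y) (e y)))

    module _ (d⁻ : ℕ) (q≥2d : pos 2 ℤ.* pos (suc d⁻) ℤ.≤ qℤ) where
      d : ℕ
      d = suc d⁻

      -- Marks an unmarked x_j adjacent to at least a 1/d part of the points that have the
      -- neighbours S requires. When no pair (S, j) is bad, the tuple is shattered as soon as it has
      -- a centre.
      bad : Vec Bool d → Fin d → Vec V d → ℤ
      bad S j X = ⟦ lookup S j BoolP.≟ false ⟧ ℤ.* heavy d (nbr S X) (lookup X j)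

      bad≥0 : ∀ S j X → 0ℤ ℤ.≤ bad S j X
      bad≥0 S j X = *-nonneg (⟦⟧-nonneg (lookup S j BoolP.≟ false)) (⟦⟧-nonneg (∑V (nbr S X) ℤP.≤? pos d ℤ.* deg (nbr S X) (lookup X j)))

      K : ℤ
      K = pos 80 ℤ.* (pos d ℤ.* pos d) ℤ.* pw t

      K≥0 : 0ℤ ℤ.≤ K
      K≥0 = *-nonneg (*-nonneg {pos 80} (ℤ.+≤+ z≤n) (sq-nonneg (pos d))) (pw≥0 t)

      -- Since S does not mark j, the set `nbr S X` does not depend on x_j, and it contains the
      -- centres counted by Ω. The sum over x_j is thus at most the product bounded in
      -- `heavy-count`; the other points contribute n^(d - 1).
      bad-bound : ∀ S j → ∑ (tuples d) (λ X → Ω X ℤ.* bad S j X) ℤ.≤ K ℤ.* n ℤ.^ d⁻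
      bad-bound S j = go (lookup S j BoolP.≟ false)
        where
        go : (s : Dec (lookup S j ≡ false)) → ∑ (tuples d) (λ X → Ω X ℤ.* (⟦ s ⟧ ℤ.* heavy d (nbr S X) (lookup X j))) ℤ.≤ K ℤ.* n ℤ.^ d⁻
        go (no _) = subst (ℤ._≤ K ℤ.* n ℤ.^ d⁻) (sym (trans (∑-cong (tuples d) (λ X → ℤP.*-zeroʳ (Ω X))) (∑-zero (tuples d)))) (*-nonneg K≥0 (^-nonneg d⁻ n≥0))
        go (yes e) = ℤP.≤-trans (ℤP.≤-reflexive (sum-insert d⁻ j (λ X → Ω X ℤ.* (1ℤ ℤ.* heavy d (nbr S X) (lookup X j)))))
            (ℤP.≤-trans (∑-mono (tuples d⁻) inner) (ℤP.≤-reflexive (trans (∑-*ʳ (tuples d⁻) K inU) (trans (cong (ℤ._* K) (sum-inU d⁻)) (ℤP.*-comm (n ℤ.^ d⁻) K)))))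
          where
          inner : ∀ X → ∑V (λ x → Ω (insertAt X j x) ℤ.* (1ℤ ℤ.* heavy d (nbr S (insertAt X j x)) (lookup (insertAt X j x) j))) ℤ.≤ inU X ℤ.* K
          inner X = ℤP.≤-trans (∑-mono V.els each) (ℤP.≤-trans (ℤP.≤-reflexive (trans (∑-*ˡ V.els (inU X ℤ.* ∑V w) (heavy d w)) (ℤP.*-assoc (inU X) (∑V w) (∑V (heavy d w)))))
              (*-monoˡ (01≥0 (inU-01 X)) (heavy-count d q≥2d w (nbr-ind (Vec.removeAt S j) X))))
            where
            w : V → ℤ
            w = nbr (Vec.removeAt S j) X
            same : ∀ x v → nbr S (insertAt X j x) v ≡ w v
            same x v = cong (u v ℤ.*_) (common-insert S j e X x v)
            each : ∀ x → Ω (insertAt X j x) ℤ.* (1ℤ ℤ.* heavy d (nbr S (insertAt X j x)) (lookup (insertAt X j x) j)) ℤ.≤ inU X ℤ.* ∑V w ℤ.* heavy d w x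
            each x = *-mono (Ω≥0 (insertAt X j x)) (⟦⟧-nonneg (∑V w ℤP.≤? pos d ℤ.* deg w x))
              (*-mono (01≥0 (inU-01 (insertAt X j x))) (∑-nonneg V.els (indicator≥0 (nbr-ind (Vec.removeAt S j) X)))
                (subst (ℤ._≤ inU X) (sym (inU-insert X j x)) (shrink (u-ind x) (01≥0 (inU-01 X))))
                (ℤP.≤-trans (nbr-all≤ S (insertAt X j x)) (ℤP.≤-reflexive (∑-cong V.els (same x)))))
              (ℤP.≤-reflexive (trans (ℤP.*-identityˡ _) (trans (∑V-heavy-cong d (same x) (lookup (insertAt X j x) j)) (cong (heavy d w) (insertAt-lookup X j x)))))

      patterns : List (Vec Bool d)
      patterns = vecs finite-Bool d

      totalBad : Vec V d → ℤ
      totalBad X = ∑ patterns (λ S → ∑ (allFin d) (λ j → bad S j X))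

      -- The number 2^d d of pairs (S, j) in the union bound.
      c : ℤ
      c = pos (length patterns) ℤ.* pos d

      totalBad-bound : ∑ (tuples d) (λ X → Ω X ℤ.* totalBad X) ℤ.≤ c ℤ.* (K ℤ.* n ℤ.^ d⁻)
      totalBad-bound = ℤP.≤-trans (ℤP.≤-reflexive (begin
          ∑ (tuples d) (λ X → Ω X ℤ.* totalBad X) ≡⟨ ∑-cong (tuples d) (λ X → trans (sym (∑-*ˡ patterns (Ω X) (λ S → ∑ (allFin d) (λ j → bad S j X)))) (∑-cong patterns (λ S → sym (∑-*ˡ (allFin d) (Ω X) (λ j → bad S j X))))) ⟩
          ∑ (tuples d) (λ X → ∑ patterns (λ S → ∑ (allFin d) (λ j → Ω X ℤ.* bad S j X))) ≡⟨ ∑-swap (tuples d) patterns (λ X S → ∑ (allFin d) (λ j → Ω X ℤ.* bad S j X)) ⟩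
          ∑ patterns (λ S → ∑ (tuples d) (λ X → ∑ (allFin d) (λ j → Ω X ℤ.* bad S j X))) ≡⟨ ∑-cong patterns (λ S → ∑-swap (tuples d) (allFin d) (λ X j → Ω X ℤ.* bad S j X)) ⟩
          ∑ patterns (λ S → ∑ (allFin d) (λ j → ∑ (tuples d) (λ X → Ω X ℤ.* bad S j X))) ∎))
        (ℤP.≤-trans (∑-mono patterns (λ S → ∑-mono (allFin d) (λ j → bad-bound S j))) (ℤP.≤-reflexive (trans (∑-cong patterns (λ S → trans (∑-const (allFin d) (K ℤ.* n ℤ.^ d⁻)) (cong (λ l → pos l ℤ.* (K ℤ.* n ℤ.^ d⁻)) (length-tabulate {n = d} (λ i → i)))))
          (trans (∑-const patterns (pos d ℤ.* (K ℤ.* n ℤ.^ d⁻))) (sym (ℤP.*-assoc (pos (length patterns)) (pos d) (K ℤ.* n ℤ.^ d⁻)))))))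
        where open ≡-Reasoning

      Large : Set
      Large = pos 2 ℤ.* ((pos 2 ℤ.* qℤ) ℤ.^ d ℤ.* (c ℤ.* K)) ℤ.< n ℤ.* n

      -- What remains of `Large` when the q^d in (2q)^d and the q^t in `K` are collected into q^(d +
      -- t).
      threshold : ℤ
      threshold = pos 2 ℤ.* (pos 2 ℤ.^ d ℤ.* (c ℤ.* (pos 80 ℤ.* (pos d ℤ.* pos d))))

      large-intro : threshold ℤ.* pw (d ℕ.+ t) ℤ.< n ℤ.* n → Large
      large-intro = subst (ℤ._< n ℤ.* n) (trans (cong (threshold ℤ.*_) (pw-+ d))
        (trans (lem (pos 2 ℤ.^ d) (qℤ ℤ.^ d) c (pos 80 ℤ.* (pos d ℤ.* pos d)) (pw t)) (cong (λ a → pos 2 ℤ.* (a ℤ.* (c ℤ.* K))) (sym (^-distrib (pos 2) qℤ d)))))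
        where
        pw-+ : ∀ k → pw (k ℕ.+ t) ≡ qℤ ℤ.^ k ℤ.* pw t
        pw-+ zero = sym (ℤP.*-identityˡ (pw t))
        pw-+ (suc k) = trans (cong (qℤ ℤ.*_) (pw-+ k)) (sym (ℤP.*-assoc qℤ (qℤ ℤ.^ k) (pw t)))
        lem : ∀ a b c k p → pos 2 ℤ.* (a ℤ.* (c ℤ.* k)) ℤ.* (b ℤ.* p) ≡ pos 2 ℤ.* (a ℤ.* b ℤ.* (c ℤ.* (k ℤ.* p)))
        lem = solve-∀

      module _ (n>0 : 0ℤ ℤ.< n) (big : pos 160 ℤ.* pw (suc (suc t)) ℤ.≤ n ℤ.* n) (large : Large) where

        -- Otherwise n · n^d ≤ 2 (2q)^d Σ Ω ≤ 2 (2q)^d c K n^(d - 1), against `Large`.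
        positive-total : 0ℤ ℤ.< ∑ (tuples d) (λ X → Ω X ℤ.* (1ℤ ℤ.- totalBad X))
        positive-total = ℤP.≰⇒> λ le → ℤP.<⇒≱ strict (ℤP.≤-trans (sum-Ω-lower d n>0 big) (chain le))
          where
          A : ℤ
          A = (pos 2 ℤ.* qℤ) ℤ.^ d
          A≥0 : 0ℤ ℤ.≤ A
          A≥0 = ^-nonneg d (*-nonneg {pos 2} (ℤ.+≤+ z≤n) qℤ≥0)
          T Tb : ℤ
          T = ∑ (tuples d) Ω
          Tb = ∑ (tuples d) (λ X → Ω X ℤ.* totalBad X)
          split : ∑ (tuples d) (λ X → Ω X ℤ.* (1ℤ ℤ.- totalBad X)) ≡ T ℤ.- Tb
          split = trans (∑-cong (tuples d) (λ X → lem (Ω X) (totalBad X))) (∑-sub (tuples d) Ω (λ X → Ω X ℤ.* totalBad X))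
            where
            lem : ∀ a b → a ℤ.* (1ℤ ℤ.- b) ≡ a ℤ.- a ℤ.* b
            lem = solve-∀
          chain : ∑ (tuples d) (λ X → Ω X ℤ.* (1ℤ ℤ.- totalBad X)) ℤ.≤ 0ℤ → pos 2 ℤ.* (A ℤ.* T) ℤ.≤ pos 2 ℤ.* (A ℤ.* (c ℤ.* (K ℤ.* n ℤ.^ d⁻)))
          chain le = *-monoˡ {pos 2} (ℤ.+≤+ z≤n) (*-monoˡ A≥0 (ℤP.≤-trans T≤Tb totalBad-bound))
            where
            T≤Tb : T ℤ.≤ Tb
            T≤Tb = ≤-from-diff (subst (0ℤ ℤ.≤_) (trans (cong ℤ.-_ split) (lem T Tb)) (ℤP.neg-mono-≤ le))
              where
              lem : ∀ a b → ℤ.- (a ℤ.- b) ≡ b ℤ.- a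
              lem = solve-∀
          n^>0 : ∀ k → 0ℤ ℤ.< n ℤ.^ k
          n^>0 zero = ℤ.+<+ (s≤s z≤n)
          n^>0 (suc k) = 1≤⇒0< (*-mono {1ℤ} {n} {1ℤ} {n ℤ.^ k} (ℤ.+≤+ z≤n) (ℤP.<⇒≤ (n^>0 k)) (0<⇒1≤ n>0) (0<⇒1≤ (n^>0 k)))
          strict : pos 2 ℤ.* (A ℤ.* (c ℤ.* (K ℤ.* n ℤ.^ d⁻))) ℤ.< n ℤ.* n ℤ.^ d
          strict = subst₂ ℤ._<_ (lem₁ A c K (n ℤ.^ d⁻)) (lem₂ n (n ℤ.^ d⁻)) (ℤP.*-monoʳ-<-pos (n ℤ.^ d⁻) ⦃ ℤ.positive (n^>0 d⁻) ⦄ large)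
            where
            lem₁ : ∀ a c k m → pos 2 ℤ.* (a ℤ.* (c ℤ.* k)) ℤ.* m ≡ pos 2 ℤ.* (a ℤ.* (c ℤ.* (k ℤ.* m)))
            lem₁ = solve-∀
            lem₂ : ∀ n m → n ℤ.* n ℤ.* m ≡ n ℤ.* (n ℤ.* m)
            lem₂ = solve-∀

        record Good (X : Vec V d) : Set where
          field
            members : inU X ≡ 1ℤ
            centre : 1ℤ ℤ.≤ ∑V (nbr (all d) X)
            light : ∀ S j → lookup S j ≡ false → pos d ℤ.* deg (nbr S X) (lookup X j) ℤ.< ∑V (nbr S X)

        private
          -- By integrality a positive weight forces `totalBad` X below 1, and each bad indicator is
          -- at most `totalBad` X. As Ω X is nonzero too, X lies in U and has a centre.
          good-tuple : ∀ X → 0ℤ ℤ.< Ω X ℤ.* (1ℤ ℤ.- totalBad X) → Good X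
          good-tuple X p = record { members = members (inU-01 X) ; centre = 0<⇒1≤ (ℤP.≰⇒> (λ le → Ω≢0 (Ω-small le))) ; light = light }
            where
            Ω≢0 : Ω X ≢ 0ℤ
            Ω≢0 e = ℤP.<-irrefl refl (subst (0ℤ ℤ.<_) (cong (ℤ._* (1ℤ ℤ.- totalBad X)) e) p)
            nbr≥0 : 0ℤ ℤ.≤ ∑V (nbr (all d) X)
            nbr≥0 = ∑-nonneg V.els (indicator≥0 (nbr-ind (all d) X))
            Ω-small : ∑V (nbr (all d) X) ℤ.≤ 0ℤ → Ω X ≡ 0ℤ
            Ω-small le = trans (cong (inU X ℤ.*_) (ℤP.≤-antisym le nbr≥0)) (ℤP.*-zeroʳ (inU X))
            members : inU X ≡ 0ℤ ⊎ inU X ≡ 1ℤ → inU X ≡ 1ℤ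
            members (inj₁ e) = ⊥-elim (Ω≢0 (cong (ℤ._* ∑V (nbr (all d) X)) e))
            members (inj₂ e) = e
            totalBad<1 : totalBad X ℤ.< 1ℤ
            totalBad<1 = ℤP.≰⇒> λ le → ℤP.<⇒≱ p (subst (Ω X ℤ.* (1ℤ ℤ.- totalBad X) ℤ.≤_) (ℤP.*-zeroʳ (Ω X))
              (*-monoˡ (Ω≥0 X) (subst (ℤ._≤ 0ℤ) (lem (totalBad X)) (ℤP.neg-mono-≤ (diff-nonneg le)))))
              where
              lem : ∀ b → ℤ.- (b ℤ.- 1ℤ) ≡ 1ℤ ℤ.- b
              lem = solve-∀
            bad≤ : ∀ S j → bad S j X ℤ.≤ totalBad X
            bad≤ S j = ℤP.≤-trans (∈⇒∑-pos (allFin d) {λ j → bad S j X} (λ j → bad≥0 S j X) (∈-allFin j))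
              (∈⇒∑-pos patterns {λ S → ∑ (allFin d) (λ j → bad S j X)} (λ S → ∑-nonneg (allFin d) (λ j → bad≥0 S j X)) (Finite.∈-els (finite-vec finite-Bool d) S))
            light : ∀ S j → lookup S j ≡ false → pos d ℤ.* deg (nbr S X) (lookup X j) ℤ.< ∑V (nbr S X)
            light S j e = ℤP.≰⇒> λ h → ℤP.<⇒≱ totalBad<1 (subst (ℤ._≤ totalBad X) (cong₂ ℤ._*_ (⟦⟧-yes (lookup S j BoolP.≟ false) e)
              (⟦⟧-yes (∑V (nbr S X) ℤP.≤? pos d ℤ.* deg (nbr S X) (lookup X j)) h)) (bad≤ S j))

        exists-good : ∃ Good
        exists-good = from-witness (∑-witness (tuples d) (λ X → Ω X ℤ.* (1ℤ ℤ.- totalBad X)) positive-total)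
          where
          from-witness : (∃ λ X → X ∈ tuples d × 0ℤ ℤ.< Ω X ℤ.* (1ℤ ℤ.- totalBad X)) → ∃ Good
          from-witness (X , _ , p) = X , good-tuple X p

        module _ {X : Vec V d} (good : Good X) where
          open Good good

          Realises : Vec Bool d → V → Set
          Realises S v = u v ≡ 1ℤ × (∀ i → lookup S i ≡ true → adj (lookup X i) v ≡ 1ℤ) × (∀ i → lookup S i ≡ false → adj (lookup X i) v ≡ 0ℤ)

          private
            Missing : Vec Bool d → V → Set
            Missing S v = ∀ i → lookup S i ≡ false → adj (lookup X i) v ≡ 0ℤ

            missing? : ∀ S v → Dec (Missing S v)
            missing? S v = all? (λ i → (lookup S i BoolP.≟ false) →-dec (adj (lookup X i) v ℤP.≟ 0ℤ))

            candidate? : ∀ S v → Dec (nbr S X v ≡ 1ℤ × Missing S v)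
            candidate? S v with nbr S X v ℤP.≟ 1ℤ | missing? S v
            ... | yes p | yes m = yes (p , m)
            ... | no ¬p | _ = no (λ e → ¬p (proj₁ e))
            ... | yes _ | no ¬m = no (λ e → ¬m (proj₂ e))

            -- A pattern nobody realises would force the light points to cover nbr S X.
            uncovered : ∀ S → (∀ v → ¬ (nbr S X v ≡ 1ℤ × Missing S v)) → ⊥
            uncovered S none = ℤP.<⇒≱ strict contradiction-bound
              where
              w : V → ℤ
              w = nbr S X
              W D : ℤ
              W = ∑V w
              D = pos d
              1≤W : 1ℤ ℤ.≤ W
              1≤W = ℤP.≤-trans centre (nbr-all≤ S X)
              outside : Fin d → ℤ
              outside j = ⟦ lookup S j BoolP.≟ false ⟧
              term : V → Fin d → ℤ
              term v j = outside j ℤ.* (w v ℤ.* adj (lookup X j) v)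
              term≥0 : ∀ v j → 0ℤ ℤ.≤ term v j
              term≥0 v j = *-nonneg (⟦⟧-nonneg (lookup S j BoolP.≟ false)) (*-nonneg (indicator≥0 (nbr-ind S X) v) (adj≥0 (lookup X j) v))
              covered : ∀ v → w v ℤ.≤ ∑ (allFin d) (term v)
              covered v = go (nbr-ind S X v)
                where
                go : w v ≡ 0ℤ ⊎ w v ≡ 1ℤ → w v ℤ.≤ ∑ (allFin d) (term v)
                go (inj₁ e) = subst (ℤ._≤ ∑ (allFin d) (term v)) (sym e) (∑-nonneg (allFin d) (term≥0 v))
                go (inj₂ e) with ¬∀⟶∃¬ d (λ i → lookup S i ≡ false → adj (lookup X i) v ≡ 0ℤ) (λ i → (lookup S i BoolP.≟ false) →-dec (adj (lookup X i) v ℤP.≟ 0ℤ)) (λ m → none v (e , m))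
                ... | j , ¬imp = subst (ℤ._≤ ∑ (allFin d) (term v)) (trans one (sym e)) (∈⇒∑-pos (allFin d) {term v} (term≥0 v) (∈-allFin j))
                  where
                  S-false : lookup S j ≡ false
                  S-false with lookup S j BoolP.≟ false
                  ... | yes p = p
                  ... | no ¬p = ⊥-elim (¬imp (λ p → contradiction p ¬p))
                  adj-one : adj (lookup X j) v ≡ 1ℤ
                  adj-one with ⟦⟧-01 (sqd (lookup X j) v ≟ 1#)
                  ... | inj₁ z = ⊥-elim (¬imp (λ _ → z))
                  ... | inj₂ o = o
                  one : term v j ≡ 1ℤ
                  one = cong₂ ℤ._*_ (⟦⟧-yes (lookup S j BoolP.≟ false) S-false) (cong₂ ℤ._*_ e adj-one)
              W≤ : W ℤ.≤ ∑ (allFin d) (λ j → outside j ℤ.* deg w (lookup X j))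
              W≤ = ℤP.≤-trans (∑-mono V.els covered) (ℤP.≤-reflexive (trans (∑-swap V.els (allFin d) term)
                (∑-cong (allFin d) (λ j → ∑-*ˡ V.els (outside j) (λ v → w v ℤ.* adj (lookup X j) v)))))
              -- A light point loses at least one by strictness. At a marked position the left side
              -- is 0, and W ≥ 1 is needed, which the common centre provides; this also settles the
              -- pattern that marks everything.
              each : ∀ j → D ℤ.* (outside j ℤ.* deg w (lookup X j)) ℤ.≤ W ℤ.- 1ℤ
              each j = go (lookup S j BoolP.≟ false)
                where
                go : (s : Dec (lookup S j ≡ false)) → D ℤ.* (⟦ s ⟧ ℤ.* deg w (lookup X j)) ℤ.≤ W ℤ.- 1ℤ
                go (no _) = subst (ℤ._≤ W ℤ.- 1ℤ) (sym (ℤP.*-zeroʳ D)) (diff-nonneg 1≤W)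
                go (yes s) = subst (ℤ._≤ W ℤ.- 1ℤ) (cong (D ℤ.*_) (sym (ℤP.*-identityˡ _)))
                  (≤-from-diff (subst (0ℤ ℤ.≤_) (lem W (D ℤ.* deg w (lookup X j))) (diff-nonneg (ℤP.i<j⇒suc[i]≤j (light S j s)))))
                  where
                  lem : ∀ a b → a ℤ.- (1ℤ ℤ.+ b) ≡ a ℤ.- 1ℤ ℤ.- b
                  lem = solve-∀
              contradiction-bound : D ℤ.* W ℤ.≤ D ℤ.* (W ℤ.- 1ℤ)
              contradiction-bound = ℤP.≤-trans (*-monoˡ {D} (ℤ.+≤+ z≤n) W≤) (ℤP.≤-trans (ℤP.≤-reflexive (sym (∑-*ˡ (allFin d) D (λ j → outside j ℤ.* deg w (lookup X j)))))
                (ℤP.≤-trans (∑-mono (allFin d) each) (ℤP.≤-reflexive (trans (∑-const (allFin d) (W ℤ.- 1ℤ)) (cong (λ l → pos l ℤ.* (W ℤ.- 1ℤ)) (length-tabulate {n = d} (λ i → i)))))))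
              strict : D ℤ.* (W ℤ.- 1ℤ) ℤ.< D ℤ.* W
              strict = ℤP.*-monoˡ-<-pos D (≤⇒< W)
                where
                ≤⇒< : ∀ a → a ℤ.- 1ℤ ℤ.< a
                ≤⇒< a = subst (a ℤ.- 1ℤ ℤ.<_) (lem a) (ℤP.suc[i]≤j⇒i<j (ℤP.≤-refl {1ℤ ℤ.+ (a ℤ.- 1ℤ)}))
                  where
                  lem : ∀ a → 1ℤ ℤ.+ (a ℤ.- 1ℤ) ≡ a
                  lem = solve-∀

          realise : ∀ S → ∃ (Realises S)
          realise S = cases (V.search (candidate? S))
            where
            found : ∀ v → nbr S X v ≡ 1ℤ → Missing S v → Realises S v
            found v e m = proj₁ uc , (λ i s → common-true S X v (proj₂ uc) i s) , m
              where
              uc = 01-product (u-ind v) (common-01 S X v) e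
            cases : (∃ λ v → nbr S X v ≡ 1ℤ × Missing S v) ⊎ (∀ v → ¬ (nbr S X v ≡ 1ℤ × Missing S v)) → ∃ (Realises S)
            cases (inj₁ (v , e , m)) = v , found v e m
            cases (inj₂ none) = ⊥-elim (uncovered S none)

-- Transfer to enumerated fields and lists of points, and the constants

open import Data.Nat using (_*_; _^_; _≤_; _∸_; _+_)
open FiniteField using (q; OddCharacteristic)

module FromEnumeration {A : Set} {n : ℕ} (enum : Fin n ↔ A) where
  open Inverse enum using (to; from; strictlyInverseˡ; strictlyInverseʳ)

  to-injective : ∀ {i j} → to i ≡ to j → i ≡ j
  to-injective {i} {j} e = trans (sym (strictlyInverseʳ i)) (trans (cong from e) (strictlyInverseʳ j))

  from-injective : ∀ {x y} → from x ≡ from y → x ≡ y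
  from-injective {x} {y} e = trans (sym (strictlyInverseˡ x)) (trans (cong to e) (strictlyInverseˡ y))

  _≟ₑ_ : DecidableEquality A
  x ≟ₑ y = map′ from-injective (cong from) (from x FinP.≟ from y)

  tabulate-once : ∀ {m} (f : Fin m → A) → (∀ {i j} → f i ≡ f j → i ≡ j) → ∀ i → ∑ (List.tabulate f) (λ x → ⟦ x ≟ₑ f i ⟧) ≡ 1ℤ
  tabulate-once {suc m} f inj zero = cong₂ ℤ._+_ (⟦⟧-yes (f zero ≟ₑ f zero) refl) (none f inj)
    where
    none : ∀ {m} (f : Fin (suc m) → A) → (∀ {i j} → f i ≡ f j → i ≡ j) → ∑ (List.tabulate (f ∘ suc)) (λ x → ⟦ x ≟ₑ f zero ⟧) ≡ 0ℤ
    none {m} f inj = go m (f ∘ suc) (λ i e → contradiction (inj e) (λ ()))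
      where
      go : ∀ m (g : Fin m → A) → (∀ i → g i ≢ f zero) → ∑ (List.tabulate g) (λ x → ⟦ x ≟ₑ f zero ⟧) ≡ 0ℤ
      go zero g ne = refl
      go (suc m) g ne = cong₂ ℤ._+_ (⟦⟧-no (g zero ≟ₑ f zero) (ne zero)) (go m (g ∘ suc) (λ i → ne (suc i)))
  tabulate-once {suc m} f inj (suc i) = cong₂ ℤ._+_ (⟦⟧-no (f zero ≟ₑ f (suc i)) (λ e → contradiction (inj e) (λ ())))
    (tabulate-once (f ∘ suc) (λ e → FinP.suc-injective (inj e)) i)

  finite-enum : Finite A
  finite-enum = record
    { els = List.tabulate to
    ; _≟_ = _≟ₑ_
    ; once = λ a → subst (λ b → ∑ (List.tabulate to) (λ x → ⟦ x ≟ₑ b ⟧) ≡ 1ℤ) (strictlyInverseˡ a) (tabulate-once to to-injective (from a)) }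

module FromFiniteField (F : FiniteField) (odd : OddCharacteristic F) where
  open FiniteField F using (enumeration) renaming (q to qF)
  open FromEnumeration enumeration

  field′ : OddField
  field′ = record
    { Carrier = FiniteField.Carrier F ; _+_ = FiniteField._+_ F ; _*_ = FiniteField._*_ F ; -_ = FiniteField.-_ F
    ; 0# = FiniteField.0# F ; 1# = FiniteField.1# F
    ; isCommutativeRing = FiniteField.isCommutativeRing F
    ; 1≢0 = FiniteField.1≢0 F
    ; inverse = FiniteField.inverse F
    ; 2≢0 = odd
    ; finite = finite-enum }

  open OddField field′ renaming (_*_ to _·_; _^_ to _^ᶠ_)
  open Inverse enumeration using (to; from; strictlyInverseˡ; strictlyInverseʳ)
  open Algebra.Properties.CommutativeMonoid.Sum *-commutativeMonoid
    using (sum-permute; sum-cong-≗; ∑-distrib-+) renaming (sum to ∏)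

  size≡q : size ≡ qF
  size≡q = length-tabulate to

  private
    unit : Carrier → Carrier
    unit y with y ≟ 0#
    ... | yes _ = 1#
    ... | no _ = y

    unit≢0 : ∀ y → unit y ≢ 0#
    unit≢0 y with y ≟ 0#
    ... | yes _ = 1≢0
    ... | no p = p

    ∏≢0 : ∀ {n} (f : Fin n → Carrier) → (∀ i → f i ≢ 0#) → ∏ f ≢ 0#
    ∏≢0 {zero} f ne = 1≢0
    ∏≢0 {suc n} f ne = *-≢0 (ne zero) (∏≢0 (f ∘ suc) (ne ∘ suc))

    factor : Carrier → Carrier → Carrier
    factor x y with y ≟ 0#
    ... | yes _ = 1#
    ... | no _ = x

    unit-* : ∀ {x} → x ≢ 0# → ∀ y → unit (x · y) ≡ factor x y · unit y
    unit-* {x} ne y with y ≟ 0#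
    ... | yes refl with x · 0# ≟ 0#
    ...   | yes _ = sym (*-identityˡ 1#)
    ...   | no p = contradiction (zeroʳ x) p
    unit-* {x} ne y | no p with x · y ≟ 0#
    ...   | yes e = contradiction e (*-≢0 ne p)
    ...   | no _ = refl

    -- The zero element contributes the factor 1; the extra x makes up for it, so that the exponent
    -- n - 1 never appears.
    power-except : ∀ x n (i₀ : Fin n) (c : Fin n → Carrier) → c i₀ ≡ 1# → (∀ i → i ≢ i₀ → c i ≡ x) → x · ∏ c ≡ x ^ᶠ n
    power-except x (suc n) zero c e f = cong (x ·_) (trans (cong₂ _·_ e (constant n (c ∘ suc) (λ i → f (suc i) (λ ())))) (*-identityˡ _))
      where
      constant : ∀ n (c : Fin n → Carrier) → (∀ i → c i ≡ x) → ∏ c ≡ x ^ᶠ n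
      constant zero c f = refl
      constant (suc n) c f = cong₂ _·_ (f zero) (constant n (c ∘ suc) (f ∘ suc))
    power-except x (suc n) (suc i₀) c e f = trans (cong (λ w → x · (w · ∏ (c ∘ suc))) (f zero (λ ())))
      (cong (x ·_) (power-except x n i₀ (c ∘ suc) e (λ i ne → f (suc i) (λ p → ne (FinP.suc-injective p)))))

  -- Multiplication by x permutes the nonzero elements, so x^(q-1) does not change their product.
  fermat-nonzero : ∀ {x} → x ≢ 0# → x ^ᶠ qF ≡ x
  fermat-nonzero {x} ne = trans (sym (power-except x qF (from 0#) (λ i → factor x (to i)) at-zero elsewhere)) (trans (cong (x ·_) ∏-factor) (*-identityʳ x))
    where
    open ≡-Reasoning
    at-zero : factor x (to (from 0#)) ≡ 1#
    at-zero with to (from 0#) ≟ 0#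
    ... | yes _ = refl
    ... | no p = contradiction (strictlyInverseˡ 0#) p
    elsewhere : ∀ i → i ≢ from 0# → factor x (to i) ≡ x
    elsewhere i p with to i ≟ 0#
    ... | yes e = contradiction (trans (sym (strictlyInverseʳ i)) (cong from e)) p
    ... | no _ = refl
    undo : ∀ a b → a · b ≡ 1# → ∀ i → from (a · to (from (b · to i))) ≡ i
    undo a b e i = trans (cong from (trans (cong (a ·_) (strictlyInverseˡ _)) (trans (sym (*-assoc a b (to i))) (trans (cong (_· to i) e) (*-identityˡ _))))) (strictlyInverseʳ i)
    π : Permutation qF qF
    π = permutation (λ i → from (x · to i)) (λ i → from (inv x · to i)) (undo x (inv x) (*-inv ne)) (undo (inv x) x (inv-* ne))
    k : Fin qF → Carrier
    k i = unit (to i)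
    ∏-factor : ∏ (λ i → factor x (to i)) ≡ 1#
    ∏-factor = *-cancelˡ (∏≢0 k (λ i → unit≢0 (to i))) (begin
      ∏ k · ∏ (λ i → factor x (to i)) ≡⟨ *-comm _ _ ⟩
      ∏ (λ i → factor x (to i)) · ∏ k ≡⟨ ∑-distrib-+ (λ i → factor x (to i)) k ⟨
      ∏ (λ i → factor x (to i) · k i) ≡⟨ sum-cong-≗ (λ i → trans (cong unit (strictlyInverseˡ (x · to i))) (unit-* ne (to i))) ⟨
      ∏ (λ i → k (π ⟨$⟩ʳ i)) ≡⟨ sum-permute k π ⟨
      ∏ k ≡⟨ *-identityʳ _ ⟨
      ∏ k · 1# ∎)

  fermat : ∀ x → x ^ᶠ size ≡ x
  fermat x = trans (cong (x ^ᶠ_) size≡q) (cases (x ≟ 0#))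
    where
    zero-power : ∀ n → 0 ℕ.< n → 0# ^ᶠ n ≡ 0#
    zero-power (suc n) _ = zeroˡ _
    cases : Dec (x ≡ 0#) → x ^ᶠ qF ≡ x
    cases (yes refl) = zero-power qF (subst (0 ℕ.<_) size≡q (size-positive 0#))
    cases (no ne) = fermat-nonzero ne

module Multiplicity {A : Set} (FA : Finite A) where
  open Finite FA

  -- For a duplicate-free list this is the indicator of a set with total the length, which brings U
  -- into the form of the estimates.
  multiplicity : List A → A → ℤ
  multiplicity U x = ∑ U (λ z → ⟦ z ≟ x ⟧)

  sum-multiplicity : ∀ U → ∑ els (multiplicity U) ≡ pos (length U)
  sum-multiplicity U = trans (∑-swap els U (λ x z → ⟦ z ≟ x ⟧))
    (trans (∑-cong U (λ z → trans (∑-cong els (λ x → ⟦⟧-cong (z ≟ x) (x ≟ z) sym sym)) (once z))) (trans (∑-const U 1ℤ) (ℤP.*-identityʳ _)))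

  multiplicity-01 : ∀ {U} → Unique U → ∀ x → multiplicity U x ≡ 0ℤ ⊎ multiplicity U x ≡ 1ℤ
  multiplicity-01 [] x = inj₁ refl
  multiplicity-01 {z ∷ U} (z∉U ∷ uniq) x with z ≟ x
  ... | yes refl = inj₂ (cong (ℤ._+_ 1ℤ) (absent z∉U))
    where
    absent : ∀ {U} → All (z ≢_) U → multiplicity U z ≡ 0ℤ
    absent [] = refl
    absent {y ∷ _} (p ∷ ps) = cong₂ ℤ._+_ (⟦⟧-no (y ≟ z) (λ e → p (sym e))) (absent ps)
  ... | no _ with multiplicity-01 uniq x
  ...   | inj₁ e = inj₁ (trans (ℤP.+-identityˡ _) e)
  ...   | inj₂ e = inj₂ (trans (ℤP.+-identityˡ _) e)

  multiplicity-∈ : ∀ U x → multiplicity U x ≡ 1ℤ → x ∈ U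
  multiplicity-∈ U x e with ∑-witness U (λ z → ⟦ z ≟ x ⟧) (subst (0ℤ ℤ.<_) (sym e) (ℤ.+<+ (s≤s z≤n)))
  ... | z , z∈ , p with z ≟ x
  ...   | yes refl = z∈
  ...   | no _ = ⊥-elim (ℤP.<-irrefl refl p)

^-cancel-≤ : ∀ k {m n} → m ^ suc k ≤ n ^ suc k → m ≤ n
^-cancel-≤ k {m} {n} le with m ℕ.≤? n
... | yes p = p
... | no ¬p = contradiction le (ℕP.<⇒≱ (ℕP.^-monoˡ-< (suc k) (ℕP.≰⇒> ¬p)))

^-distribʳ-* : ∀ m n k → (m * n) ^ k ≡ m ^ k * n ^ k
^-distribʳ-* m n zero = refl
^-distribʳ-* m n (suc k) = trans (cong (m * n *_) (^-distribʳ-* m n k)) (ℕP.[m*n]*[o*p]≡[m*o]*[n*p] m n (m ^ k) (n ^ k))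

toList≡tabulate : ∀ {A : Set} {d} (X : Vec A d) → toList X ≡ List.tabulate (lookup X)
toList≡tabulate [] = refl
toList≡tabulate (x ∷ X) = cong (x ∷_) (toList≡tabulate X)

module VCDimension (F : FiniteField) (odd : OddCharacteristic F) where
  open FromFiniteField F odd
  open OddField field′ using (size; finite; 1#; _≟_; 0#; size-positive)
  open SphereSums field′

  sqDist≡sqd : ∀ {t} (x y : Point F t) → sqDist F x y ≡ sqd x y
  sqDist≡sqd [] [] = refl
  sqDist≡sqd (x ∷ xs) (y ∷ ys) = cong (FiniteField._+_ F (FiniteField._*_ F (FiniteField._+_ F x (FiniteField.-_ F y)) (FiniteField._+_ F x (FiniteField.-_ F y)))) (sqDist≡sqd xs ys)

  pw≡ : ∀ j → pw j ≡ pos (q F ^ j)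
  pw≡ zero = refl
  pw≡ (suc j) = trans (cong₂ ℤ._*_ (cong pos size≡q) (pw≡ j)) (sym (ℤP.pos-* (q F) (q F ^ j)))

  length≤ : ∀ t (U : List (Point F t)) → Unique U → length U ≤ q F ^ t
  length≤ t U uniq = ℤP.drop‿+≤+ (subst₂ ℤ._≤_ (sum-multiplicity U) (trans (Hyperplanes.vecs-count field′ t) (pw≡ t))
    (∑-mono (vecs finite t) (λ x → ≤1 (multiplicity-01 uniq x))))
    where
    open Multiplicity (finite-vec finite t)
    ≤1 : ∀ {a} → a ≡ 0ℤ ⊎ a ≡ 1ℤ → a ℤ.≤ 1ℤ
    ≤1 (inj₁ refl) = ℤ.+≤+ z≤n
    ≤1 (inj₂ refl) = ℤP.≤-refl

  module _ (t : ℕ) (U : List (Point F (suc t))) (uniq : Unique U) where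
    open Shattering field′ fermat t
    open SpectralGap field′ fermat t using (adj; ∑V; finiteV)
    open Multiplicity finiteV

    u : Point F (suc t) → ℤ
    u = multiplicity U

    u-ind = multiplicity-01 uniq

    n≡ : n u u-ind ≡ pos (length U)
    n≡ = sum-multiplicity U

    vc-dimension : ∀ d⁻ (q≥2d : pos 2 ℤ.* pos (suc d⁻) ℤ.≤ qℤ) → 0ℤ ℤ.< n u u-ind → pos 160 ℤ.* pw (suc (suc t)) ℤ.≤ n u u-ind ℤ.* n u u-ind →
      Large u u-ind d⁻ q≥2d → VCdim≥ F U (suc d⁻)
    vc-dimension d⁻ q≥2d n>0 big large = from-good (exists-good u u-ind d⁻ q≥2d n>0 big large)
      where
      from-good : ∃ (Good u u-ind d⁻ q≥2d n>0 big large) → VCdim≥ F U (suc d⁻)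
      from-good (X , good) = X , subst Unique (sym (toList≡tabulate X)) (tabulate⁺ injective) , members X (Good.members good) , shattered
        where
        members : ∀ {d} (X : Vec (Point F (suc t)) d) → inU u u-ind X ≡ 1ℤ → ∀ i → lookup X i ∈ U
        members (x ∷ X) e i = go (u-ind x) i
          where
          go : u x ≡ 0ℤ ⊎ u x ≡ 1ℤ → ∀ i → lookup (x ∷ X) i ∈ U
          go (inj₁ z) i = ⊥-elim (0≢1 (trans (sym (cong (ℤ._* inU u u-ind X) z)) e))
            where
            0≢1 : 0ℤ ≢ 1ℤ
            0≢1 ()
          go (inj₂ o) zero = multiplicity-∈ U x o
          go (inj₂ o) (suc i) = members X (trans (sym (ℤP.*-identityˡ _)) (trans (cong (ℤ._* inU u u-ind X) (sym o)) e)) i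
        realised : (f : Fin (suc d⁻) → Bool) → ∃ λ v → u v ≡ 1ℤ × (∀ i → f i ≡ true → adj (lookup X i) v ≡ 1ℤ) × (∀ i → f i ≡ false → adj (lookup X i) v ≡ 0ℤ)
        realised f with realise u u-ind d⁻ q≥2d n>0 big large good (tabulate f)
        ... | v , m , a , b = v , m , (λ i e → a i (trans (lookup∘tabulate f i) e)) , (λ i e → b i (trans (lookup∘tabulate f i) e))
        adj-one : ∀ x v → adj x v ≡ 1ℤ → sqDist F x v ≡ 1#
        adj-one x v e with sqd x v ≟ 1#
        ... | yes p = trans (sqDist≡sqd x v) p
        adj-one x v () | no _
        adj-zero : ∀ x v → adj x v ≡ 0ℤ → sqDist F x v ≢ 1#
        adj-zero x v e p with sqd x v ≟ 1#
        adj-zero x v () p | yes _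
        ... | no ¬p = ¬p (trans (sym (sqDist≡sqd x v)) p)
        shattered : ShatteredBy F U X
        shattered f with realised f
        ... | v , m , a , b = v , multiplicity-∈ U v m , λ i → mk⇔ (λ e → adj-one (lookup X i) v (a i e)) (λ e → decide i e (f i) refl)
          where
          decide : ∀ i → sqDist F (lookup X i) v ≡ 1# → ∀ c → f i ≡ c → f i ≡ true
          decide i e true p = p
          decide i e false p = contradiction e (adj-zero (lookup X i) v (b i p))
        -- The averaging allows repeated points. Equal entries are excluded afterwards, because the
        -- pattern that marks i alone is realised.
        injective : ∀ {i j} → lookup X i ≡ lookup X j → i ≡ j
        injective {i} {j} e with i FinP.≟ j
        ... | yes p = p
        ... | no ne with realised (λ k → isYes (k FinP.≟ i))
        ...   | v , m , a , b = ⊥-elim (1≢0ℤ (trans (sym (a i only)) (trans (cong (λ x → adj x v) e) (b j other))))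
          where
          1≢0ℤ : 1ℤ ≢ 0ℤ
          1≢0ℤ ()
          only : isYes (i FinP.≟ i) ≡ true
          only with i FinP.≟ i
          ... | yes _ = refl
          ... | no p = contradiction refl p
          other : isYes (j FinP.≟ i) ≡ false
          other with j FinP.≟ i
          ... | yes p = contradiction (sym p) ne
          ... | no _ = refl

    -- The dimension is suc t, so q^(d + t) is q to the power dimension + d - 1. For d ≥ 2 it
    -- dominates the q^(t + 2) of the mixing estimate, and M exceeds both constants, 160 and
    -- `threshold`.
    vc-dimension-from-size : ∀ d⁻ (q≥2d : pos 2 ℤ.* pos (suc d⁻) ℤ.≤ qℤ) → ∀ M → 160 ℕ.< M → threshold u u-ind d⁻ q≥2d ℤ.< pos M →
      2 ≤ suc d⁻ → M * q F ^ (suc d⁻ + t) ≤ length U ^ 2 → VCdim≥ F U (suc d⁻)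
    vc-dimension-from-size d⁻ q≥2d M 160<M below 2≤d le = vc-dimension d⁻ q≥2d n>0 (ℤP.≤-trans (*-monoˡ {pos 160} (ℤ.+≤+ z≤n) (pw-mono (ℕP.+-monoˡ-≤ t 2≤d))) (ℤP.<⇒≤ (scaled (ℤ.+<+ 160<M))))
        (large-intro u u-ind d⁻ q≥2d (scaled below))
      where
      e : ℕ
      e = suc d⁻ + t
      N : ℤ
      N = n u u-ind
      pw-positive : 0ℤ ℤ.< pw e
      pw-positive = SpectralGap.pw>0 field′ fermat t e
      pw-mono : ∀ {a b} → a ≤ b → pw a ℤ.≤ pw b
      pw-mono {a} {b} a≤b = subst₂ ℤ._≤_ (sym (pw≡ a)) (sym (pw≡ b)) (ℤ.+≤+ (ℕP.^-monoʳ-≤ (q F) ⦃ ℕ.>-nonZero (subst (0 ℕ.<_) size≡q (size-positive 0#)) ⦄ a≤b))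
      n²≥ : pos M ℤ.* pw e ℤ.≤ N ℤ.* N
      n²≥ = subst₂ ℤ._≤_ (trans (ℤP.pos-* M (q F ^ e)) (cong (pos M ℤ.*_) (sym (pw≡ e))))
        (trans (cong (λ k → pos (length U * k)) (ℕP.*-identityʳ (length U))) (trans (ℤP.pos-* (length U) (length U)) (sym (cong₂ ℤ._*_ n≡ n≡))))
        (ℤ.+≤+ le)
      scaled : ∀ {a} → a ℤ.< pos M → a ℤ.* pw e ℤ.< N ℤ.* N
      scaled lt = ℤP.<-≤-trans (ℤP.*-monoʳ-<-pos (pw e) ⦃ ℤ.positive pw-positive ⦄ lt) n²≥
      n>0 : 0ℤ ℤ.< N
      n>0 = ℤP.≰⇒> λ n≤0 → ℤP.<⇒≱ (scaled (ℤ.+<+ (ℕP.≤-<-trans z≤n 160<M))) (ℤP.≤-reflexive (cong (λ w → w ℤ.* w) (ℤP.≤-antisym n≤0 (n≥0 u u-ind))))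

    module _ (C : ℕ) (C≥ : 1000 ≤ C) (q≥6 : 6 ≤ q F) where

      private
        2d≤q : ∀ {d} → d ≤ 3 → pos 2 ℤ.* pos d ℤ.≤ qℤ
        2d≤q {d} d≤3 = subst₂ ℤ._≤_ (ℤP.pos-* 2 d) (cong pos (sym size≡q)) (ℤ.+≤+ (ℕP.≤-trans (ℕP.*-monoʳ-≤ 2 d≤3) q≥6))

        -- 1000² exceeds `threshold`, which is 20480 for d = 2 and 276480 for d = 3.
        million : ∀ k → (C ^ 2) * k ≤ length U ^ 2 → 1000000 * k ≤ length U ^ 2
        million k le = ℕP.≤-trans (ℕP.*-monoˡ-≤ k (ℕP.^-monoˡ-≤ 2 C≥)) le

      vc-dimension-2 : (C ^ 2) * (q F ^ (suc t + 1)) ≤ length U ^ 2 → VCdim≥ F U 2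
      vc-dimension-2 le = vc-dimension-from-size 1 (2d≤q (s≤s (s≤s z≤n))) 1000000 (ℕP.<ᵇ⇒< 160 1000000 _) (ℤ.+<+ (ℕP.<ᵇ⇒< 20480 1000000 _)) ℕP.≤-refl
        (million (q F ^ (2 + t)) (subst (λ k → (C ^ 2) * (q F ^ k) ≤ length U ^ 2) (ℕP.+-comm (suc t) 1) le))

      vc-dimension-3 : (C ^ 2) * (q F ^ (suc t + 2)) ≤ length U ^ 2 → VCdim≥ F U 3
      vc-dimension-3 le = vc-dimension-from-size 2 (2d≤q ℕP.≤-refl) 1000000 (ℕP.<ᵇ⇒< 160 1000000 _) (ℤ.+<+ (ℕP.<ᵇ⇒< 276480 1000000 _)) (s≤s (s≤s z≤n))
        (million (q F ^ (3 + t)) (subst (λ k → (C ^ 2) * (q F ^ k) ≤ length U ^ 2) (ℕP.+-comm (suc t) 2) le))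

-- The factor 6^t rules out q < 6, as |U| ≤ q^t.
constant : ℕ → ℕ
constant t = 1000 * 6 ^ t

constant≥1000 : ∀ t → 1000 ≤ constant t
constant≥1000 t = ℕP.m≤m*n 1000 (6 ^ t) ⦃ ℕP.m^n≢0 6 t ⦄

module _ (F : FiniteField) (odd : OddCharacteristic F) where
  open VCDimension F odd
  open FromFiniteField F odd using (field′; size≡q)

  q-nonZero : ℕ.NonZero (q F)
  q-nonZero = ℕ.>-nonZero (subst (0 ℕ.<_) size≡q (OddField.size-positive field′ (OddField.0# field′)))

  constant≤length : ∀ t e (U : List (Point F t)) → (constant t ^ 2) * (q F ^ e) ≤ length U ^ 2 → constant t ≤ length U
  constant≤length t e U le = ^-cancel-≤ 1 (ℕP.≤-trans (ℕP.m≤m*n (constant t ^ 2) (q F ^ e) ⦃ ℕP.m^n≢0 (q F) e ⦃ q-nonZero ⦄ ⦄) le)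

  q≥6 : ∀ t (U : List (Point F t)) → Unique U → constant t ≤ length U → 6 ≤ q F
  q≥6 t U uniq le with 6 ℕ.≤? q F
  ... | yes p = p
  ... | no ¬p = contradiction (ℕP.≤-trans le (ℕP.≤-trans (length≤ t U uniq) (ℕP.^-monoˡ-≤ t (ℕP.<⇒≤ (ℕP.≰⇒> ¬p)))))
      (ℕP.<⇒≱ (subst (6 ^ t ℕ.<_) (ℕP.*-comm (6 ^ t) 1000) (ℕP.m<m*n (6 ^ t) 1000 ⦃ ℕP.m^n≢0 6 t ⦄ (ℕP.<ᵇ⇒< 1 1000 _))))

  part₁ : ∀ t (U : List (Point F t)) → Unique U → (constant t ^ 2) * (q F ^ (t + 1)) ≤ length U ^ 2 → VCdim≥ F U 2
  -- In dimension 0 there is a single point, so |U| ≤ 1 is incompatible with |U| ≥ 1000.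
  part₁ zero U uniq le = contradiction (ℕP.≤-trans (constant≤length 0 1 U le) (length≤ 0 U uniq)) (λ { (s≤s ()) })
  part₁ (suc t) U uniq le = vc-dimension-2 t U uniq (constant (suc t)) (constant≥1000 (suc t)) (q≥6 (suc t) U uniq (constant≤length (suc t) (suc t + 1) U le)) le

  -- (C² q^(t+2))⁷ ≤ C¹⁴ q^(7t+19)
  part₂ : ∀ t (U : List (Point F t)) → Unique U → (constant t ^ 14) * (q F ^ (7 * t + 19)) ≤ length U ^ 14 → VCdim≥ F U 3
  part₂ t U uniq le = go t U uniq reduced
    where
    reduced : (constant t ^ 2) * (q F ^ (t + 2)) ≤ length U ^ 2
    reduced = ^-cancel-≤ 6 (begin
      (constant t ^ 2 * q F ^ (t + 2)) ^ 7 ≡⟨ ^-distribʳ-* (constant t ^ 2) (q F ^ (t + 2)) 7 ⟩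
      (constant t ^ 2) ^ 7 * (q F ^ (t + 2)) ^ 7 ≡⟨ cong₂ _*_ (ℕP.^-*-assoc (constant t) 2 7) (ℕP.^-*-assoc (q F) (t + 2) 7) ⟩
      constant t ^ 14 * q F ^ ((t + 2) * 7) ≤⟨ ℕP.*-monoʳ-≤ (constant t ^ 14) (ℕP.^-monoʳ-≤ (q F) ⦃ q-nonZero ⦄ exponent) ⟩
      constant t ^ 14 * q F ^ (7 * t + 19) ≤⟨ le ⟩
      length U ^ 14 ≡⟨ ℕP.^-*-assoc (length U) 2 7 ⟨
      (length U ^ 2) ^ 7 ∎)
      where
      open ℕP.≤-Reasoning
      exponent : (t + 2) * 7 ≤ 7 * t + 19
      exponent = subst (_≤ 7 * t + 19) (sym (trans (ℕP.*-comm (t + 2) 7) (ℕP.*-distribˡ-+ 7 t 2))) (ℕP.+-monoʳ-≤ (7 * t) (ℕP.m≤m+n 14 5))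
    go : ∀ t (U : List (Point F t)) → Unique U → (constant t ^ 2) * (q F ^ (t + 2)) ≤ length U ^ 2 → VCdim≥ F U 3
    go zero U uniq le = contradiction (ℕP.≤-trans (constant≤length 0 2 U le) (length≤ 0 U uniq)) (λ { (s≤s ()) })
    go (suc t) U uniq le = vc-dimension-3 t U uniq (constant (suc t)) (constant≥1000 (suc t)) (q≥6 (suc t) U uniq (constant≤length (suc t) (suc t + 2) U le)) le

theorem1p9 : (t : ℕ) → Σ ℕ λ C →
    (F : FiniteField) → OddCharacteristic F →
    (U : List (Point F t)) → Unique U →
    ((C ^ 2) * (q F ^ (t + 1)) ≤ length U ^ 2 → VCdim≥ F U 2)
    × ((C ^ 14) * (q F ^ (7 * t + 19)) ≤ length U ^ 14
    → C * (q F ^ (t ∸ 1)) ≤ length U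
    → VCdim≥ F U 3)
theorem1p9 t = constant t , λ F odd U uniq → part₁ F odd t U uniq , λ le _ → part₂ F odd t U uniq le
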